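{- Let $q\in(0,1]$ and let $F_1$ and $F_2$ be non-bipartite graphs, each of which contains a critical edge, such that $\chi(F_1)+\chi(F_2)\geq 7$. Then there exists $t_0=t_0(F_1,F_2,q)$ such that if $H_1$ is a $t_1$-hairy $F_1$ and $H_2$ is a $t_2$-hairy $F_2$ with $t_1,t_2\geq t_0$ and \[\min\{v(H_1),v(H_2)\}\geq q\cdot\max\{v(H_1),v(H_2)\},\] then $(H_1,H_2)$ is a bonbon pair.
   Context: All graphs are finite and simple; $v(H)=|V(H)|$, $e(H)=|E(H)|$, $k(H)$ is the number of connected components of $H$, $\chi(H)$ is the chromatic number, and $\overline{G}$ is the complement of $G$. An edge $e$ of a graph $F$ is critical if $\chi(F-e)<\chi(F)$ (removing the edge but not its endpoints). For $t\geq 0$, a $t$-hairy $F$ is a graph obtained from $F$ by adding $t$ edges, one at a time, such that each added edge has exactly one endpoint in $V(F)$ (the other endpoint being a new vertex). For graphs $H,G$ with $v(H)\le v(G)$, the injective homomorphism density $t_{\mathrm{inj}}(H,G)$ is the probability that a uniformly random injective map $V(H)\to V(G)$ maps every edge of $H$ to an edge of $G$. A Turán graph with $r$ parts on $n$ vertices is the complete $r$-partite graph whose parts have sizes $\lfloor n/r\rfloor$ or $\lceil n/r\rceil$. A pair $(H_1,H_2)$ of non-empty graphs is a bonbon pair if there exists $n_0$ such that for every $n\ge n_0$, every $n$-vertex graph $G$ minimizing \[(\chi(H_2)-1)^{v(H_1)-k(H_1)}\, t_{\mathrm{inj}}(H_1,G)+(\chi(H_1)-1)^{v(H_2)-k(H_2)}\,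 t_{\mathrm{inj}}(H_2,\overline{G})\] over all $n$-vertex graphs satisfies: either $G$ is a Turán graph with $\chi(H_1)-1$ parts or $\overline{G}$ is a Turán graph with $\chi(H_2)-1$ parts. -}

module Defs where

open import Data.Bool using (Bool; true; false; _∧_; _∨_; not; if_then_else_)
open import Data.Bool.Properties using (∧-comm; ∨-comm)
open import Data.Nat as ℕ using (ℕ; zero; suc; _∸_; _^_; _<ᵇ_; _⊓_; _⊔_)
open import Data.Nat.Properties using ()
open import Data.Fin as Fin using (Fin; toℕ; splitAt)
open import Data.Fin.Properties using () renaming (_≟_ to _≟F_)
open import Data.Integer using (+_)
open import Data.Rational using (ℚ; _/_; 0ℚ; _+_; _*_; _≤_)
open import Data.List using (List; []; _∷_; map; concatMap)
open import Data.List.Relation.Unary.All using ()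
open import Data.Bool.ListAction using (all; any)
open import Data.Product using (Σ; ∃; ∃-syntax; _×_; _,_)
open import Data.Sum using (_⊎_; inj₁; inj₂)
open import Data.Empty using (⊥)
open import Relation.Nullary using (¬_; does; yes; no)
open import Relation.Binary.PropositionalEquality using (_≡_; _≢_; refl; sym; cong; cong₂)

allFin : (n : ℕ) → List (Fin n)
allFin n = Data.List.allFin n

record Graph (n : ℕ) : Set where
  field
    adj    : Fin n → Fin n → Bool
    adjSym : ∀ i j → adj i j ≡ adj j i
    adjIrr : ∀ i → adj i i ≡ false
open Graph public

_==_ : ∀ {n} → Fin n → Fin n → Bool
i == j = does (i ≟F j)

==-sym : ∀ {n} (i j : Fin n) → (i == j) ≡ (j == i)
==-sym i j with i ≟F j | j ≟F i
... | yes _ | yes _ = refl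
... | no _  | no _  = refl
... | yes p | no q  with q (sym p)
... | ()
==-sym i j | no p | yes q with p (sym q)
... | ()

==-refl : ∀ {n} (i : Fin n) → (i == i) ≡ true
==-refl i with i ≟F i
... | yes _ = refl
... | no p with p refl
... | ()

complement : ∀ {n} → Graph n → Graph n
complement G = record
  { adj    = λ i j → not (adj G i j) ∧ not (i == j)
  ; adjSym = λ i j → cong₂ (λ a b → not a ∧ not b) (adjSym G i j) (==-sym i j)
  ; adjIrr = λ i → irr i
  }
  where
  irr : ∀ i → (not (adj G i i) ∧ not (i == i)) ≡ false
  irr i rewrite ==-refl i = ∧-zeroʳ′ (not (adj G i i))
    where
    ∧-zeroʳ′ : ∀ b → (b ∧ false) ≡ false
    ∧-zeroʳ′ true = refl
    ∧-zeroʳ′ false = refl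

deleteEdge : ∀ {n} → Graph n → Fin n → Fin n → Graph n
deleteEdge G u v = record
  { adj    = λ i j → adj G i j ∧ not (isUV i j)
  ; adjSym = λ i j → cong₂ (λ a b → a ∧ not b) (adjSym G i j) (isUV-sym i j)
  ; adjIrr = λ i → cong (λ a → a ∧ not (isUV i i)) (adjIrr G i)
  }
  where
  isUV : _ → _ → Bool
  isUV i j = ((i == u) ∧ (j == v)) ∨ ((i == v) ∧ (j == u))
  isUV-sym : ∀ i j → isUV i j ≡ isUV j i
  isUV-sym i j rewrite ∧-comm (i == u) (j == v) | ∧-comm (i == v) (j == u)
    = ∨-comm ((j == v) ∧ (i == u)) ((j == u) ∧ (i == v))

HasEdge : ∀ {n} → Graph n → Set
HasEdge {n} G = Σ (Fin n) λ i → Σ (Fin n) λ j → adj G i j ≡ true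

ProperColouring : ∀ {n} → Graph n → (c : ℕ) → (Fin n → Fin c) → Set
ProperColouring {n} G c col = ∀ (i j : Fin n) → adj G i j ≡ true → col i ≢ col j

Colourable : ∀ {n} → Graph n → ℕ → Set
Colourable {n} G c = Σ (Fin n → Fin c) λ col → ProperColouring G c col

IsChromatic : ∀ {n} → Graph n → ℕ → Set
IsChromatic G c = Colourable G c × (∀ d → d ℕ.< c → ¬ Colourable G d)

Bipartite : ∀ {n} → Graph n → Set
Bipartite G = Colourable G 2

HasCriticalEdge : ∀ {n} → Graph n → Set
HasCriticalEdge {n} F =
  Σ (Fin n) λ u → Σ (Fin n) λ v → adj F u v ≡ true ×
  Σ ℕ λ c → Σ ℕ λ d → IsChromatic F c × IsChromatic (deleteEdge F u v) d × d ℕ.< c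

countB : ∀ {A : Set} → (A → Bool) → List A → ℕ
countB p []       = 0
countB p (x ∷ xs) = (if p x then 1 else 0) ℕ.+ countB p xs

reach : ∀ {n} → Graph n → ℕ → Fin n → Fin n → Bool
reach G zero    i j = i == j
reach {n} G (suc m) i j = reach G m i j ∨ any (λ k → reach G m i k ∧ adj G k j) (allFin n)

connected : ∀ {n} → Graph n → Fin n → Fin n → Bool
connected {n} G i j = reach G n i j

-- k(G): number of components = number of vertices that are the least vertex of their component
components : ∀ {n} → Graph n → ℕ
components {n} G =
  countB (λ i → not (any (λ j → (toℕ j <ᵇ toℕ i) ∧ connected G i j) (allFin n))) (allFin n)

consF : ∀ {h n} → Fin n → (Fin h → Fin n) → Fin (suc h) → Fin n
consF x f Fin.zero    = x
consF x f (Fin.suc i) = f i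

allMaps : (h n : ℕ) → List (Fin h → Fin n)
allMaps zero    n = (λ ()) ∷ []
allMaps (suc h) n = concatMap (λ f → map (λ x → consF x f) (allFin n)) (allMaps h n)

isInjective : ∀ {h n} → (Fin h → Fin n) → Bool
isInjective {h} f = all (λ i → all (λ j → (i == j) ∨ not (f i == f j)) (allFin h)) (allFin h)

isHom : ∀ {h n} → Graph h → Graph n → (Fin h → Fin n) → Bool
isHom {h} H G f = all (λ i → all (λ j → not (adj H i j) ∨ adj G (f i) (f j)) (allFin h)) (allFin h)

frac : ℕ → ℕ → ℚ
frac x zero    = 0ℚ   -- never used when v(H) ≤ v(G)
frac x (suc d) = (+ x) / suc d

tinj : ∀ {h n} → Graph h → Graph n → ℚ
tinj {h} {n} H G =
  frac (countB (λ f → isInjective f ∧ isHom H G f) (allMaps h n))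
       (countB isInjective (allMaps h n))

ℕtoℚ : ℕ → ℚ
ℕtoℚ m = (+ m) / 1

partSize : ∀ {n r} → (Fin n → Fin r) → Fin r → ℕ
partSize {n} part a = countB (λ i → part i == a) (allFin n)

IsTuran : ∀ {n} → (r : ℕ) → Graph n → Set
IsTuran {n} zero    G = n ≡ 0
IsTuran {n} (suc r) G =
  Σ (Fin n → Fin (suc r)) λ part →
    (∀ i j → adj G i j ≡ true → part i ≢ part j) ×
    (∀ i j → i ≢ j → part i ≢ part j → adj G i j ≡ true) ×
    (∀ a → partSize part a ≡ ℕ._/_ n (suc r) ⊎ partSize part a ≡ ℕ._/_ (n ℕ.+ r) (suc r))

-- the objective, with cH1 = χ(H1), cH2 = χ(H2)
objective : ∀ {h₁ h₂ n} → Graph h₁ → Graph h₂ → ℕ → ℕ → Graph n → ℚ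
objective {h₁} {h₂} H₁ H₂ cH₁ cH₂ G =
  ℕtoℚ ((cH₂ ∸ 1) ^ (h₁ ∸ components H₁)) * tinj H₁ G
  + ℕtoℚ ((cH₁ ∸ 1) ^ (h₂ ∸ components H₂)) * tinj H₂ (complement G)

IsBonbonPair : ∀ {h₁ h₂} → Graph h₁ → Graph h₂ → Set
IsBonbonPair H₁ H₂ =
  HasEdge H₁ × HasEdge H₂ ×
  (∀ c₁ c₂ → IsChromatic H₁ c₁ → IsChromatic H₂ c₂ →
    Σ ℕ λ n₀ → ∀ n → n₀ ℕ.≤ n → ∀ (G : Graph n) →
      (∀ (G′ : Graph n) → objective H₁ H₂ c₁ c₂ G ≤ objective H₁ H₂ c₁ c₂ G′) →
      IsTuran (c₁ ∸ 1) G ⊎ IsTuran (c₂ ∸ 1) (complement G))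

-- t-hairy graphs: vertices Fin (n + t); the first n vertices span F,
-- new vertex n+s is joined exactly to the vertex f s of F.

hairyAdj : ∀ {n t} → Graph n → (Fin t → Fin n) → Fin n ⊎ Fin t → Fin n ⊎ Fin t → Bool
hairyAdj F f (inj₁ x) (inj₁ y) = adj F x y
hairyAdj F f (inj₁ x) (inj₂ s) = f s == x
hairyAdj F f (inj₂ s) (inj₁ x) = f s == x
hairyAdj F f (inj₂ s) (inj₂ s′) = false

hairyAdj-sym : ∀ {n t} (F : Graph n) (f : Fin t → Fin n) a b → hairyAdj F f a b ≡ hairyAdj F f b a
hairyAdj-sym F f (inj₁ x) (inj₁ y) = adjSym F x y
hairyAdj-sym F f (inj₁ x) (inj₂ s) = refl
hairyAdj-sym F f (inj₂ s) (inj₁ x) = refl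
hairyAdj-sym F f (inj₂ s) (inj₂ s′) = refl

hairyAdj-irr : ∀ {n t} (F : Graph n) (f : Fin t → Fin n) a → hairyAdj F f a a ≡ false
hairyAdj-irr F f (inj₁ x) = adjIrr F x
hairyAdj-irr F f (inj₂ s) = refl

hairy : ∀ {n} (F : Graph n) (t : ℕ) → (Fin t → Fin n) → Graph (n ℕ.+ t)
hairy {n} F t f = record
  { adj    = λ i j → hairyAdj F f (splitAt n i) (splitAt n j)
  ; adjSym = λ i j → hairyAdj-sym F f (splitAt n i) (splitAt n j)
  ; adjIrr = λ i → hairyAdj-irr F f (splitAt n i)
  }

{-# OPTIONS --safe #-}

-- Let G minimise the objective, write r₁ = χ(F₁) − 1 and r₂ = χ(F₂) − 1, and recall that the
-- Turán graphs bound the minimum.  A copy of F₁ all of whose vertices have degree at least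
-- (1 + ε)n/r₂ extends to exponentially more copies of H₁ than the minimum allows, so a minimiser
-- with many hairs has few such copies, and likewise for F₂ in the complement; replacing a vertex
-- by clones of the others shows that even a single vertex lies in few of them.  Hence the vertices
-- rich in G span few K_{r₁+1} and those rich in the complement few anticliques of size r₂ + 1.
-- With Ramsey's theorem and Turán densities this leaves almost all vertices rich on one side only,
-- and by stability G or its complement is close to a Turán graph.
--
-- Suppose G is close to the r₁-partite Turán graph.  Every vertex is then typical, as a vertex with
-- many neighbours in every class, or of too large degree in the complement, would carry too many
-- copies.  An edge inside a class would play the critical edge in about (1 + δ)^t copies of H₁,
-- while deleting it creates only about (1 + ε)^t · poly(t) copies of H₂ in the complement, fewer
-- since the orders of H₁ and H₂ are comparable.  So G is r₁-partite and only H₂ in the complement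
-- counts.  The complement contains a disjoint union of r₁ cliques, and moving a vertex from a large
-- clique to a small one strictly loses copies of H₂ because of a pendant edge; so G is Turán.
module Submission where

open import Defs
open import Data.Bool using (Bool; true; false; _∧_; _∨_; not; if_then_else_)
import Data.Bool.Properties as Bool
open import Data.Nat using (ℕ; zero; suc; _+_; _*_; _∸_; _^_; _≤_; _<_; z≤n; s≤s; _⊔_; _⊓_; NonZero; nonZero; >-nonZero; _/_; _<ᵇ_)
open import Data.Nat.Properties renaming (_≟_ to _≟ℕ_)
open import Data.Nat.DivMod using (m*n/n≡m; /-monoˡ-≤; m<n*o⇒m/o<n)
open import Data.Nat.Tactic.RingSolver using (solve-∀)
open import Data.Fin using (Fin; zero; suc; _≟_; _↑ˡ_; _↑ʳ_; splitAt; toℕ; inject≤)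
open import Data.Fin.Properties using (all?; any?; splitAt-↑ˡ; splitAt-↑ʳ; toℕ<n; toℕ-injective; ↑ˡ-injective; toℕ-↑ˡ; toℕ-↑ʳ; inject≤-injective; splitAt⁻¹-↑ˡ) renaming (suc-injective to Fin-suc-injective)
open import Data.List using (List; []; _∷_; map; concatMap; _++_; length; tabulate)
open import Data.List.Properties using (map-tabulate; length-tabulate)
open import Data.Vec using (Vec; []; _∷_; lookup; _[_]≔_)
import Data.Vec as Vec
open import Data.Vec.Properties using (lookup∘update; lookup∘update′; []≔-idempotent; []≔-++-↑ˡ; lookup-++ˡ; lookup-++ʳ; lookup-splitAt; ≡-dec; lookup∘tabulate; lookup-map; map-id; map-∘; map-cong)
open import Data.Product using (Σ; ∃; _×_; _,_; proj₁; proj₂)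
open import Data.Sum using (_⊎_; inj₁; inj₂)
open import Data.Empty using (⊥; ⊥-elim)
open import Function using (_∘_; id)
open import Relation.Nullary using (¬_; Dec; yes; no; does; contradiction)
open import Relation.Nullary.Decidable using (_×-dec_; _→-dec_; ¬?; dec-true; dec-false; decidable-stable)
open import Relation.Binary.PropositionalEquality
open import Data.Bool.ListAction using (all; any)
open import Data.Rational using (ℚ; mkℚ; 0ℚ; 1ℚ; toℚᵘ)
open import Data.Rational.Unnormalised using (mkℚᵘ; *≤*)
import Data.Integer as ℤ
import Data.Integer.Properties as ℤ
import Data.Rational as ℚ
import Data.Rational.Properties as ℚ
import Data.Rational.Unnormalised as ℚᵘ
import Data.Rational.Unnormalised.Properties as ℚᵘ

-- The condition χ(F₁) + χ(F₂) ≥ 7 amounts to 1/r₁ + 1/r₂ < 1. Hence no vertex can be poor on both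
-- sides, and beside a Turán graph with r₁ parts every degree in G exceeds n/r₂ by a constant
-- factor. The order of the constants shapes the proof. Forbidden configurations occur in a
-- proportion 1/c of all maps, with c independent of the number t of hairs, and each hair gains a
-- factor 1 + 1/K. Minimality tolerates only a factor linear in t, since the orders of H₁ and H₂ are
-- comparable; t₀ is where the exponential overtakes it. The bound n₀ comes after the hairs, so that
-- non-injective maps, of relative order 1/n, are negligible and homomorphisms can be counted, for
-- which the hairs are independent. This last device fails when one vertex is moved between two
-- cliques: the change is then of the same order as the non-injective error. There only maps that
-- meet the part of the large clique without counterpart in the small one are compared, which makes
-- the error smaller by a further factor 1/n.

variable
  X Y : Set

-- Indicators

⟦_⟧ : Bool → ℕ
⟦ true ⟧ = 1
⟦ false ⟧ = 0

ι : {P : Set} → Dec P → ℕ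
ι d = ⟦ does d ⟧

ι-yes : {P : Set} (d : Dec P) → P → ι d ≡ 1
ι-yes d p = cong ⟦_⟧ (dec-true d p)

ι-no : {P : Set} (d : Dec P) → ¬ P → ι d ≡ 0
ι-no d p = cong ⟦_⟧ (dec-false d p)

⟦⟧≤1 : ∀ b → ⟦ b ⟧ ≤ 1
⟦⟧≤1 true = ≤-refl
⟦⟧≤1 false = z≤n

ι≤ : {P : Set} (d : Dec P) {k : ℕ} → (P → 1 ≤ k) → ι d ≤ k
ι≤ (yes p) f = f p
ι≤ (no _) f = z≤n

ι*≤ : {P : Set} (d : Dec P) {j k : ℕ} → (P → j ≤ k) → ι d * j ≤ k
ι*≤ (yes p) {j} f = ≤-trans (≤-reflexive (*-identityˡ j)) (f p)
ι*≤ (no _) f = z≤n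

ι-mono : {P Q : Set} (d : Dec P) (d′ : Dec Q) → (P → Q) → ι d ≤ ι d′
ι-mono d d′ f = ι≤ d λ p → ≤-reflexive (sym (ι-yes d′ (f p)))

ι-cong : {P Q : Set} (d : Dec P) (d′ : Dec Q) → (P → Q) → (Q → P) → ι d ≡ ι d′
ι-cong d d′ f g = ≤-antisym (ι-mono d d′ f) (ι-mono d′ d g)

ι-pos : {P : Set} (d : Dec P) → 1 ≤ ι d → P
ι-pos (yes p) _ = p

ι-cases : {P : Set} (d : Dec P) → (P × ι d ≡ 1) ⊎ (¬ P × ι d ≡ 0)
ι-cases (yes p) = inj₁ (p , refl)
ι-cases (no p) = inj₂ (p , refl)

⟦∧⟧ : ∀ a b → ⟦ a ∧ b ⟧ ≡ ⟦ a ⟧ * ⟦ b ⟧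
⟦∧⟧ true b = sym (*-identityˡ ⟦ b ⟧)
⟦∧⟧ false b = refl

⟦⟧+not : ∀ b → ⟦ b ⟧ + ⟦ not b ⟧ ≡ 1
⟦⟧+not true = refl
⟦⟧+not false = refl

-- Finite sums

∑ : List X → (X → ℕ) → ℕ
∑ [] f = 0
∑ (x ∷ xs) f = f x + ∑ xs f

∑-mono : ∀ (xs : List X) {f g : X → ℕ} → (∀ x → f x ≤ g x) → ∑ xs f ≤ ∑ xs g
∑-mono [] h = z≤n
∑-mono (x ∷ xs) h = +-mono-≤ (h x) (∑-mono xs h)

∑-cong : ∀ (xs : List X) {f g : X → ℕ} → (∀ x → f x ≡ g x) → ∑ xs f ≡ ∑ xs g
∑-cong [] h = refl
∑-cong (x ∷ xs) h = cong₂ _+_ (h x) (∑-cong xs h)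

∑-0 : ∀ (xs : List X) → ∑ xs (λ _ → 0) ≡ 0
∑-0 [] = refl
∑-0 (x ∷ xs) = ∑-0 xs

*-left-comm : ∀ a b c → a * (b * c) ≡ b * (a * c)
*-left-comm = solve-∀

+-interchange : ∀ a b c d → (a + b) + (c + d) ≡ (a + c) + (b + d)
+-interchange = solve-∀

∑-+ : ∀ (xs : List X) (f g : X → ℕ) → ∑ xs (λ x → f x + g x) ≡ ∑ xs f + ∑ xs g
∑-+ [] f g = refl
∑-+ (x ∷ xs) f g = trans (cong (f x + g x +_) (∑-+ xs f g)) (+-interchange (f x) (g x) _ _)

∑-*ˡ : ∀ (xs : List X) c (f : X → ℕ) → ∑ xs (λ x → c * f x) ≡ c * ∑ xs f
∑-*ˡ [] c f = sym (*-zeroʳ c)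
∑-*ˡ (x ∷ xs) c f = trans (cong (c * f x +_) (∑-*ˡ xs c f)) (sym (*-distribˡ-+ c (f x) _))

∑-*ʳ : ∀ (xs : List X) c (f : X → ℕ) → ∑ xs (λ x → f x * c) ≡ ∑ xs f * c
∑-*ʳ xs c f = trans (∑-cong xs (λ x → *-comm (f x) c)) (trans (∑-*ˡ xs c f) (*-comm c _))

∑-swap : ∀ (xs : List X) (ys : List Y) (f : X → Y → ℕ) →
  ∑ xs (λ x → ∑ ys (f x)) ≡ ∑ ys (λ y → ∑ xs (λ x → f x y))
∑-swap [] ys f = sym (∑-0 ys)
∑-swap (x ∷ xs) ys f = trans (cong (∑ ys (f x) +_) (∑-swap xs ys f)) (sym (∑-+ ys (f x) _))

∑-const : ∀ (xs : List X) c → ∑ xs (λ _ → c) ≡ length xs * c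
∑-const [] c = refl
∑-const (x ∷ xs) c = cong (c +_) (∑-const xs c)

∑-++ : ∀ (xs ys : List X) (f : X → ℕ) → ∑ (xs ++ ys) f ≡ ∑ xs f + ∑ ys f
∑-++ [] ys f = refl
∑-++ (x ∷ xs) ys f = trans (cong (f x +_) (∑-++ xs ys f)) (sym (+-assoc (f x) _ _))

∑-map : ∀ (xs : List X) (h : X → Y) (f : Y → ℕ) → ∑ (map h xs) f ≡ ∑ xs (f ∘ h)
∑-map [] h f = refl
∑-map (x ∷ xs) h f = cong (f (h x) +_) (∑-map xs h f)

∑-concatMap : ∀ (xs : List X) (h : X → List Y) (f : Y → ℕ) → ∑ (concatMap h xs) f ≡ ∑ xs (λ x → ∑ (h x) f)
∑-concatMap [] h f = refl
∑-concatMap (x ∷ xs) h f = trans (∑-++ (h x) _ f) (cong (∑ (h x) f +_) (∑-concatMap xs h f))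

∑-<-∃ : ∀ (xs : List X) (f g : X → ℕ) → ∑ xs f < ∑ xs g → ∃ λ x → f x < g x
∑-<-∃ (x ∷ xs) f g lt with f x <? g x
... | yes p = x , p
... | no p = ∑-<-∃ xs f g (+-cancelˡ-< (f x) _ _ (<-≤-trans lt (+-monoˡ-≤ _ (≮⇒≥ p))))

-- Sums over Fin n and over vectors

-- Maps from `Fin h` to `Fin n` are kept as vectors: equality of vectors is decidable and pointwise,
-- so that single maps can be isolated inside a sum.
vecs : ∀ h n → List (Vec (Fin n) h)
vecs zero n = [] ∷ []
vecs (suc h) n = concatMap (λ v → map (_∷ v) (allFin n)) (vecs h n)

opaque
  ∑F : ∀ {n} → (Fin n → ℕ) → ℕ
  ∑F {n} f = ∑ (allFin n) f

  ∑V : ∀ {h n} → (Vec (Fin n) h → ℕ) → ℕ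
  ∑V {h} {n} f = ∑ (vecs h n) f

  ∑F-list : ∀ {n} (f : Fin n → ℕ) → ∑F f ≡ ∑ (allFin n) f
  ∑F-list f = refl

  ∑F-zero : (f : Fin 0 → ℕ) → ∑F f ≡ 0
  ∑F-zero f = refl

  ∑F-suc : ∀ {n} (f : Fin (suc n) → ℕ) → ∑F f ≡ f zero + ∑F (f ∘ suc)
  ∑F-suc {n} f = cong (f zero +_) (trans (cong (λ l → ∑ l f) (sym (map-tabulate id suc))) (∑-map (allFin n) suc f))

  ∑F-const : ∀ n c → ∑F {n} (λ _ → c) ≡ n * c
  ∑F-const n c = trans (∑-const (allFin n) c) (cong (_* c) (length-tabulate {n = n} id))

  ∑F-mono : ∀ {n} {f g : Fin n → ℕ} → (∀ x → f x ≤ g x) → ∑F f ≤ ∑F g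
  ∑F-mono {n} = ∑-mono (allFin n)

  ∑F-cong : ∀ {n} {f g : Fin n → ℕ} → (∀ x → f x ≡ g x) → ∑F f ≡ ∑F g
  ∑F-cong {n} = ∑-cong (allFin n)

  ∑F-+ : ∀ {n} (f g : Fin n → ℕ) → ∑F (λ x → f x + g x) ≡ ∑F f + ∑F g
  ∑F-+ {n} = ∑-+ (allFin n)

  ∑F-*ˡ : ∀ {n} c (f : Fin n → ℕ) → ∑F (λ x → c * f x) ≡ c * ∑F f
  ∑F-*ˡ {n} = ∑-*ˡ (allFin n)

  ∑F-*ʳ : ∀ {n} c (f : Fin n → ℕ) → ∑F (λ x → f x * c) ≡ ∑F f * c
  ∑F-*ʳ {n} = ∑-*ʳ (allFin n)

  ∑F-swap : ∀ {n k} (f : Fin n → Fin k → ℕ) → ∑F (λ v → ∑F (f v)) ≡ ∑F (λ x → ∑F (λ v → f v x))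
  ∑F-swap {n} {k} = ∑-swap (allFin n) (allFin k)

  ∑F-<-∃ : ∀ {n} (f g : Fin n → ℕ) → ∑F f < ∑F g → ∃ λ x → f x < g x
  ∑F-<-∃ {n} = ∑-<-∃ (allFin n)

  ∑V-nil : ∀ {n} (f : Vec (Fin n) 0 → ℕ) → ∑V f ≡ f []
  ∑V-nil f = +-identityʳ _

  ∑V-suc : ∀ {h n} (f : Vec (Fin n) (suc h) → ℕ) → ∑V f ≡ ∑V (λ v → ∑F (λ x → f (x ∷ v)))
  ∑V-suc {h} {n} f = trans (∑-concatMap (vecs h n) _ f) (∑-cong (vecs h n) (λ v → ∑-map (allFin n) (_∷ v) f))

  ∑V-mono : ∀ {h n} {f g : Vec (Fin n) h → ℕ} → (∀ x → f x ≤ g x) → ∑V f ≤ ∑V g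
  ∑V-mono {h} {n} = ∑-mono (vecs h n)

  ∑V-cong : ∀ {h n} {f g : Vec (Fin n) h → ℕ} → (∀ x → f x ≡ g x) → ∑V f ≡ ∑V g
  ∑V-cong {h} {n} = ∑-cong (vecs h n)

  ∑V-+ : ∀ {h n} (f g : Vec (Fin n) h → ℕ) → ∑V (λ x → f x + g x) ≡ ∑V f + ∑V g
  ∑V-+ {h} {n} = ∑-+ (vecs h n)

  ∑V-*ˡ : ∀ {h n} c (f : Vec (Fin n) h → ℕ) → ∑V (λ x → c * f x) ≡ c * ∑V f
  ∑V-*ˡ {h} {n} = ∑-*ˡ (vecs h n)

  ∑V-*ʳ : ∀ {h n} c (f : Vec (Fin n) h → ℕ) → ∑V (λ x → f x * c) ≡ ∑V f * c
  ∑V-*ʳ {h} {n} = ∑-*ʳ (vecs h n)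

  ∑VF-swap : ∀ {h n k} (f : Vec (Fin n) h → Fin k → ℕ) → ∑V (λ v → ∑F (f v)) ≡ ∑F (λ x → ∑V (λ v → f v x))
  ∑VF-swap {h} {n} {k} = ∑-swap (vecs h n) (allFin k)

  ∑V-swap : ∀ {h n k l} (f : Vec (Fin n) h → Vec (Fin l) k → ℕ) → ∑V (λ v → ∑V (f v)) ≡ ∑V (λ x → ∑V (λ v → f v x))
  ∑V-swap {h} {n} {k} {l} = ∑-swap (vecs h n) (vecs k l)

  ∑V-<-∃ : ∀ {h n} (f g : Vec (Fin n) h → ℕ) → ∑V f < ∑V g → ∃ λ x → f x < g x
  ∑V-<-∃ {h} {n} = ∑-<-∃ (vecs h n)

∑F-≤const : ∀ {n} c {f : Fin n → ℕ} → (∀ x → f x ≤ c) → ∑F f ≤ n * c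
∑F-≤const {n} c h = ≤-trans (∑F-mono h) (≤-reflexive (∑F-const n c))

∑F-≥ : ∀ {n} (f : Fin n → ℕ) x → f x ≤ ∑F f
∑F-≥ f zero rewrite ∑F-suc f = m≤m+n _ _
∑F-≥ f (suc x) rewrite ∑F-suc f = ≤-trans (∑F-≥ (f ∘ suc) x) (m≤n+m _ (f zero))

∑F-0 : ∀ n → ∑F {n} (λ _ → 0) ≡ 0
∑F-0 n = trans (∑F-const n 0) (*-zeroʳ n)

∑F-δ : ∀ {n} (x : Fin n) (f : Fin n → ℕ) → ∑F (λ y → ι (y ≟ x) * f y) ≡ f x
∑F-δ {suc n} zero f = trans (∑F-suc (λ y → ι (y ≟ zero) * f y))
  (trans (cong₂ _+_ (+-identityʳ _) (∑F-0 n)) (+-identityʳ _))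
∑F-δ {suc n} (suc x) f = trans (∑F-suc (λ y → ι (y ≟ suc x) * f y))
  (trans (∑F-cong (λ y → cong (λ z → z * f (suc y)) (ι-cong (suc y ≟ suc x) (y ≟ x) (λ { refl → refl }) (cong suc)))) (∑F-δ x (f ∘ suc)))

∑V-suc′ : ∀ {h n} (f : Vec (Fin n) (suc h) → ℕ) → ∑V f ≡ ∑F (λ x → ∑V (λ v → f (x ∷ v)))
∑V-suc′ f = trans (∑V-suc f) (∑VF-swap _)

∑V-const : ∀ h n c → ∑V {h} {n} (λ _ → c) ≡ n ^ h * c
∑V-const zero n c = trans (∑V-nil _) (sym (*-identityˡ c))
∑V-const (suc h) n c = trans (∑V-suc {h} {n} (λ _ → c)) (trans (∑V-cong (λ _ → ∑F-const n c))
  (trans (∑V-const h n (n * c)) (lem (n ^ h) n c)))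
  where lem : ∀ p n c → p * (n * c) ≡ n * p * c
        lem = solve-∀

∑V-1 : ∀ h n → ∑V {h} {n} (λ _ → 1) ≡ n ^ h
∑V-1 h n = trans (∑V-const h n 1) (*-identityʳ (n ^ h))

∑V-0 : ∀ h n → ∑V {h} {n} (λ _ → 0) ≡ 0
∑V-0 h n = trans (∑V-const h n 0) (*-zeroʳ (n ^ h))

∑F-1 : ∀ n → ∑F {n} (λ _ → 1) ≡ n
∑F-1 n = trans (∑F-const n 1) (*-identityʳ n)

∑F-ι : ∀ {n} (x : Fin n) → ∑F (λ y → ι (y ≟ x)) ≡ 1
∑F-ι x = trans (∑F-cong (λ y → sym (*-identityʳ (ι (y ≟ x))))) (∑F-δ x (λ _ → 1))

-- Each vector arises exactly n times as `v [ i ]≔ x`, once for every value that the overwritten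
-- coordinate of `v` may have had.
∑V-update : ∀ {h n} (i : Fin h) (f : Vec (Fin n) h → ℕ) →
  ∑V (λ v → ∑F (λ x → f (v [ i ]≔ x))) ≡ n * ∑V f
∑V-update {suc h} {n} zero f =
  trans (∑V-suc (λ v → ∑F (λ x → f (v [ zero ]≔ x))))
  (trans (∑V-cong (λ v → ∑F-const n (∑F (λ x → f (x ∷ v)))))
  (trans (∑V-*ˡ n _) (cong (n *_) (sym (∑V-suc f)))))
∑V-update {suc h} {n} (suc i) f =
  trans (∑V-suc′ (λ v → ∑F (λ x → f (v [ suc i ]≔ x))))
  (trans (∑F-cong (λ y → ∑V-update i (λ v → f (y ∷ v))))
  (trans (∑F-*ˡ n _) (cong (n *_) (sym (∑V-suc′ f)))))

update-lookup-≡ : ∀ {h n} (v : Vec (Fin n) h) i x → lookup v i ≡ x → v [ i ]≔ x ≡ v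
update-lookup-≡ (y ∷ v) zero x refl = refl
update-lookup-≡ (y ∷ v) (suc i) x p = cong (y ∷_) (update-lookup-≡ v i x p)

-- Prescribing a coordinate by overwriting it keeps the sum over all vectors of length h, at the
-- price of the factor n. All rooted counts below are written in this way.
∑V-fix : ∀ {h n} (i : Fin h) (x : Fin n) (f : Vec (Fin n) h → ℕ) →
  ∑V (λ v → f (v [ i ]≔ x)) ≡ n * ∑V (λ v → ι (lookup v i ≟ x) * f v)
∑V-fix {h} {n} i x f =
  trans (∑V-cong (λ v → sym (trans
      (∑F-cong (λ y → lem v y))
      (∑F-δ x (λ y → f (v [ i ]≔ y))))))
    (∑V-update i (λ v → ι (lookup v i ≟ x) * f v))
  where
  lem : ∀ v y → ι (lookup (v [ i ]≔ y) i ≟ x) * f (v [ i ]≔ y) ≡ ι (y ≟ x) * f (v [ i ]≔ y)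
  lem v y rewrite lookup∘update i v y = refl

-- Finite products and splitting of coordinates

∏F : ∀ {n} → (Fin n → ℕ) → ℕ
∏F {zero} f = 1
∏F {suc n} f = f zero * ∏F (f ∘ suc)

∏F-mono : ∀ {n} {f g : Fin n → ℕ} → (∀ x → f x ≤ g x) → ∏F f ≤ ∏F g
∏F-mono {zero} h = ≤-refl
∏F-mono {suc n} h = *-mono-≤ (h zero) (∏F-mono (h ∘ suc))

∏F-cong : ∀ {n} {f g : Fin n → ℕ} → (∀ x → f x ≡ g x) → ∏F f ≡ ∏F g
∏F-cong {zero} h = refl
∏F-cong {suc n} h = cong₂ _*_ (h zero) (∏F-cong (h ∘ suc))

∏F-const : ∀ n c → ∏F {n} (λ _ → c) ≡ c ^ n
∏F-const zero c = refl
∏F-const (suc n) c = cong (c *_) (∏F-const n c)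

∏F-* : ∀ {n} (f g : Fin n → ℕ) → ∏F (λ x → f x * g x) ≡ ∏F f * ∏F g
∏F-* {zero} f g = refl
∏F-* {suc n} f g = trans (cong (f zero * g zero *_) (∏F-* (f ∘ suc) (g ∘ suc))) (lem (f zero) (g zero) _ _)
  where lem : ∀ a b c d → a * b * (c * d) ≡ a * c * (b * d)
        lem = solve-∀

∑V-∏ : ∀ {h n} (f : Fin h → Fin n → ℕ) → ∑V {h} {n} (λ v → ∏F (λ i → f i (lookup v i))) ≡ ∏F (λ i → ∑F (f i))
∑V-∏ {zero} f = ∑V-nil _
∑V-∏ {suc h} {n} f = trans (∑V-suc (λ v → ∏F (λ i → f i (lookup v i))))
  (trans (∑V-cong (λ v → ∑F-*ʳ (∏F (λ i → f (suc i) (lookup v i))) (f zero)))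
  (trans (∑V-*ˡ (∑F (f zero)) _) (cong (∑F (f zero) *_) (∑V-∏ (f ∘ suc)))))

∑V-++ : ∀ {h k n} (f : Vec (Fin n) (h + k) → ℕ) → ∑V f ≡ ∑V {h} {n} (λ u → ∑V {k} {n} (λ v → f (u Vec.++ v)))
∑V-++ {zero} f = sym (∑V-nil _)
∑V-++ {suc h} {k} {n} f = trans (∑V-suc′ f) (trans (∑F-cong (λ x → ∑V-++ {h} {k} (λ v → f (x ∷ v))))
  (sym (∑V-suc′ {h} {n} (λ u → ∑V {k} {n} (λ v → f (u Vec.++ v))))))

ι-all-∏ : ∀ {n} {P : Fin n → Set} (P? : ∀ i → Dec (P i)) → ι (all? P?) ≡ ∏F (λ i → ι (P? i))
ι-all-∏ {zero} P? = refl
ι-all-∏ {suc n} {P} P? = trans (ι-cong (all? P?) (P? zero ×-dec all? (P? ∘ suc))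
    (λ h → h zero , h ∘ suc) (λ { (a , b) zero → a ; (a , b) (suc i) → b i }))
  (trans (⟦∧⟧ (does (P? zero)) _) (cong (ι (P? zero) *_) (ι-all-∏ (P? ∘ suc))))

merge : ∀ {h n} → (Fin h → Bool) → Vec (Fin n) h → Vec (Fin n) h → Vec (Fin n) h
merge b [] [] = []
merge b (x ∷ u) (y ∷ v) = (if b zero then y else x) ∷ merge (b ∘ suc) u v

lookup-merge : ∀ {h n} (b : Fin h → Bool) (u v : Vec (Fin n) h) i →
  lookup (merge b u v) i ≡ (if b i then lookup v i else lookup u i)
lookup-merge b (x ∷ u) (y ∷ v) zero = refl
lookup-merge b (x ∷ u) (y ∷ v) (suc i) = lookup-merge (b ∘ suc) u v i

-- The coordinates that `merge` discards from `u` and `v` are h in number and free.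
∑V-merge : ∀ {h n} (b : Fin h → Bool) (f : Vec (Fin n) h → ℕ) →
  ∑V (λ u → ∑V (λ v → f (merge b u v))) ≡ n ^ h * ∑V f
∑V-merge {zero} b f = trans (∑V-nil _) (trans (∑V-nil _) (sym (trans (+-identityʳ _) (∑V-nil f))))
∑V-merge {suc h} {n} b f = begin
    ∑V (λ u → ∑V (λ v → f (merge b u v)))
  ≡⟨ ∑V-suc′ {h} {n} (λ u → ∑V (λ v → f (merge b u v))) ⟩
    ∑F (λ x → ∑V (λ u → ∑V (λ v → f (merge b (x ∷ u) v))))
  ≡⟨ ∑F-cong (λ x → ∑V-cong (λ u → ∑V-suc′ {h} {n} (λ v → f (merge b (x ∷ u) v)))) ⟩
    ∑F (λ x → ∑V (λ u → ∑F (λ y → ∑V (λ v → f ((if b zero then y else x) ∷ merge (b ∘ suc) u v)))))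
  ≡⟨ ∑F-cong (λ x → ∑VF-swap {h} {n} {n} _) ⟩
    ∑F (λ x → ∑F (λ y → ∑V (λ u → ∑V (λ v → f ((if b zero then y else x) ∷ merge (b ∘ suc) u v)))))
  ≡⟨ ∑F-cong (λ x → ∑F-cong (λ y → ∑V-merge (b ∘ suc) (λ w → f ((if b zero then y else x) ∷ w)))) ⟩
    ∑F (λ x → ∑F (λ y → g (if b zero then y else x)))
  ≡⟨ coord (b zero) ⟩
    n * ∑F g
  ≡⟨ cong (n *_) (∑F-*ˡ (n ^ h) _) ⟩
    n * (n ^ h * ∑F (λ x → ∑V (λ w → f (x ∷ w))))
  ≡⟨ cong (λ z → n * (n ^ h * z)) (sym (∑V-suc′ f)) ⟩
    n * (n ^ h * ∑V f)
  ≡⟨ sym (*-assoc n _ _) ⟩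
    n ^ suc h * ∑V f ∎
  where
  open ≡-Reasoning
  g : Fin n → ℕ
  g x = n ^ h * ∑V (λ w → f (x ∷ w))
  coord : ∀ c → ∑F (λ x → ∑F (λ y → g (if c then y else x))) ≡ n * ∑F g
  coord true = ∑F-const n _
  coord false = trans (∑F-cong (λ x → ∑F-const n (g x))) (∑F-*ˡ n g)

-- Linear arithmetic by certificate: the identity exhibits y − x as (b − a) + s.
linear : ∀ {a b x y} s → a ≤ b → y + a ≡ x + b + s → x ≤ y
linear {a} {b} {x} {y} s a≤b eq = +-cancelʳ-≤ a x y
  (≤-trans (+-monoʳ-≤ x a≤b) (≤-trans (m≤m+n (x + b) s) (≤-reflexive (sym eq))))

^-distrib-* : ∀ m a b → (a * b) ^ m ≡ a ^ m * b ^ m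
^-distrib-* zero a b = refl
^-distrib-* (suc m) a b = trans (cong (a * b *_) (^-distrib-* m a b)) (lem a b _ _)
  where lem : ∀ a b c d → a * b * (c * d) ≡ a * c * (b * d)
        lem = solve-∀

-- Plain forms of *-monoʳ-≤ and *-monoˡ-≤, whose library types hide the products from unification.
mulˡ : ∀ k {a b} → a ≤ b → k * a ≤ k * b
mulˡ k = *-monoʳ-≤ k

mulʳ : ∀ k {a b} → a ≤ b → a * k ≤ b * k
mulʳ k = *-monoˡ-≤ k

-- Markov and Cauchy-Schwarz inequalities

-- The elements with `2 * c * f x < M` contribute less than half of the assumed total, so the
-- others, with values at most M, make up the remaining half.
markov-list : ∀ (xs : List X) (f : X → ℕ) (M c : ℕ) → length xs * M ≤ c * ∑ xs f → (∀ x → f x ≤ M) →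
  length xs * M ≤ 2 * c * (∑ xs (λ x → ι (M ≤? 2 * c * f x)) * M)
markov-list xs f M c h f≤M = linear 0 both (lem L (2 * c * G))
  where
  g : _ → ℕ
  g x = ι (M ≤? 2 * c * f x)
  L = length xs * M
  G = ∑ xs g * M
  pt : ∀ x → 2 * c * f x ≤ 2 * c * (g x * M) + M
  pt x with ι-cases (M ≤? 2 * c * f x)
  ... | inj₁ (p , q) = ≤-trans (mulˡ (2 * c) (≤-trans (f≤M x) (≤-reflexive (sym (trans (cong (_* M) q) (*-identityˡ M)))))) (m≤m+n _ M)
  ... | inj₂ (p , q) = ≤-trans (<⇒≤ (≰⇒> p)) (m≤n+m M _)
  open ≤-Reasoning
  both : L + L ≤ 2 * c * G + L
  both = begin
    L + L ≤⟨ +-mono-≤ h h ⟩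
    c * ∑ xs f + c * ∑ xs f ≡⟨ lem′ c (∑ xs f) ⟩
    2 * c * ∑ xs f ≡⟨ ∑-*ˡ xs (2 * c) f ⟨
    ∑ xs (λ x → 2 * c * f x) ≤⟨ ∑-mono xs pt ⟩
    ∑ xs (λ x → 2 * c * (g x * M) + M) ≡⟨ ∑-+ xs _ _ ⟩
    ∑ xs (λ x → 2 * c * (g x * M)) + ∑ xs (λ _ → M) ≡⟨ cong₂ _+_ (trans (∑-*ˡ xs (2 * c) _) (cong (2 * c *_) (∑-*ʳ xs M g))) (∑-const xs M) ⟩
    2 * c * G + L ∎
    where
    lem′ : ∀ c s → c * s + c * s ≡ 2 * c * s
    lem′ = solve-∀
  lem : ∀ L G → G + (L + L) ≡ L + (G + L) + 0
  lem = solve-∀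

opaque
  unfolding ∑F ∑V
  markovF : ∀ {n} (f : Fin n → ℕ) (M c : ℕ) → 1 ≤ M → n * M ≤ c * ∑F f → (∀ x → f x ≤ M) →
    n ≤ 2 * c * ∑F (λ x → ι (M ≤? 2 * c * f x))
  markovF {n} f (suc M) c _ h f≤M = *-cancelʳ-≤ n _ (suc M) (begin
    n * suc M ≡⟨ cong (_* suc M) len ⟨
    length (allFin n) * suc M ≤⟨ markov-list (allFin n) f (suc M) c (≤-trans (≤-reflexive (cong (_* suc M) len)) h) f≤M ⟩
    2 * c * (∑ (allFin n) g * suc M) ≡⟨ *-assoc (2 * c) (∑ (allFin n) g) (suc M) ⟨
    2 * c * ∑F g * suc M ∎)
    where
    open ≤-Reasoning
    g : Fin n → ℕ
    g x = ι (suc M ≤? 2 * c * f x)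
    len : length (allFin n) ≡ n
    len = length-tabulate {n = n} id

  markovV : ∀ {k n} (f : Vec (Fin n) k → ℕ) (M c : ℕ) → 1 ≤ M → n ^ k * M ≤ c * ∑V f → (∀ x → f x ≤ M) →
    n ^ k ≤ 2 * c * ∑V (λ x → ι (M ≤? 2 * c * f x))
  markovV {k} {n} f (suc M) c _ h f≤M = *-cancelʳ-≤ (n ^ k) _ (suc M) (begin
    n ^ k * suc M ≡⟨ cong (_* suc M) len ⟨
    length (vecs k n) * suc M ≤⟨ markov-list (vecs k n) f (suc M) c (≤-trans (≤-reflexive (cong (_* suc M) len)) h) f≤M ⟩
    2 * c * (∑ (vecs k n) g * suc M) ≡⟨ *-assoc (2 * c) (∑ (vecs k n) g) (suc M) ⟨
    2 * c * ∑V g * suc M ∎)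
    where
    open ≤-Reasoning
    g : Vec (Fin n) k → ℕ
    g x = ι (suc M ≤? 2 * c * f x)
    len : length (vecs k n) ≡ n ^ k
    len = trans (sym (*-identityʳ _)) (trans (sym (∑-const (vecs k n) 1)) (∑V-1 k n))

2ab≤a²+b² : ∀ a b → 2 * (a * b) ≤ a * a + b * b
2ab≤a²+b² a b with ≤-total a b
... | inj₁ a≤b = subst (λ b → 2 * (a * b) ≤ a * a + b * b) (m+[n∸m]≡n a≤b) (linear ((b ∸ a) * (b ∸ a)) z≤n (lem a (b ∸ a)))
  where lem : ∀ a d → (a * a + (a + d) * (a + d)) + 0 ≡ 2 * (a * (a + d)) + 0 + d * d
        lem = solve-∀
... | inj₂ b≤a = subst (λ a → 2 * (a * b) ≤ a * a + b * b) (m+[n∸m]≡n b≤a) (linear ((a ∸ b) * (a ∸ b)) z≤n (lem b (a ∸ b)))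
  where lem : ∀ b d → ((b + d) * (b + d) + b * b) + 0 ≡ 2 * ((b + d) * b) + 0 + d * d
        lem = solve-∀

∑F-*∑F : ∀ {n k} (f : Fin n → ℕ) (g : Fin k → ℕ) → ∑F f * ∑F g ≡ ∑F (λ x → ∑F (λ y → f x * g y))
∑F-*∑F f g = trans (sym (∑F-*ʳ (∑F g) f)) (∑F-cong (λ x → sym (∑F-*ˡ (f x) g)))

-- Weighted form with weights `a`: sum `2ab≤a²+b²` over all pairs x, y with weight `a x * a y`.
cauchy : ∀ {n} (a b : Fin n → ℕ) → ∑F (λ x → a x * b x) * ∑F (λ x → a x * b x) ≤ ∑F a * ∑F (λ x → a x * (b x * b x))
cauchy {n} a b = *-cancelˡ-≤ 2 (begin
  2 * (S * S) ≡⟨ cong (2 *_) (∑F-*∑F ab ab) ⟩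
  2 * ∑F (λ x → ∑F (λ y → ab x * ab y)) ≡⟨ ∑F-*ˡ 2 _ ⟨
  ∑F (λ x → 2 * ∑F (λ y → ab x * ab y)) ≡⟨ ∑F-cong (λ x → sym (∑F-*ˡ 2 _)) ⟩
  ∑F (λ x → ∑F (λ y → 2 * (ab x * ab y))) ≤⟨ ∑F-mono (λ x → ∑F-mono (λ y → pt x y)) ⟩
  ∑F (λ x → ∑F (λ y → a x * abb y + abb x * a y)) ≡⟨ ∑F-cong (λ x → ∑F-+ _ _) ⟩
  ∑F (λ x → ∑F (λ y → a x * abb y) + ∑F (λ y → abb x * a y)) ≡⟨ ∑F-+ _ _ ⟩
  ∑F (λ x → ∑F (λ y → a x * abb y)) + ∑F (λ x → ∑F (λ y → abb x * a y)) ≡⟨ cong₂ _+_ (∑F-*∑F a abb) (∑F-*∑F abb a) ⟨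
  ∑F a * ∑F abb + ∑F abb * ∑F a ≡⟨ lem (∑F a) (∑F abb) ⟩
  2 * (∑F a * ∑F abb) ∎)
  where
  open ≤-Reasoning
  ab abb : Fin n → ℕ
  ab x = a x * b x
  abb x = a x * (b x * b x)
  S = ∑F ab
  lem : ∀ p q → p * q + q * p ≡ 2 * (p * q)
  lem = solve-∀
  lem₁ : ∀ p q x y → 2 * (p * x * (q * y)) ≡ p * q * (2 * (x * y))
  lem₁ = solve-∀
  lem₂ : ∀ p q x y → p * q * (x * x + y * y) ≡ p * (q * (y * y)) + p * (x * x) * q
  lem₂ = solve-∀
  pt : ∀ x y → 2 * (ab x * ab y) ≤ a x * abb y + abb x * a y
  pt x y = ≤-trans (≤-reflexive (lem₁ (a x) (a y) (b x) (b y)))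
    (≤-trans (mulˡ (a x * a y) (2ab≤a²+b² (b x) (b y))) (≤-reflexive (lem₂ (a x) (a y) (b x) (b y))))

-- Ordered cliques of a relation inside a vertex set

Rel : ℕ → Set
Rel n = Fin n → Fin n → Bool

Symm : ∀ {n} → Rel n → Set
Symm e = ∀ x y → e x y ≡ e y x

neg : ∀ {n} → Rel n → Rel n
neg e x y = not (e x y)

card : ∀ {n} → (Fin n → Bool) → ℕ
card S = ∑F (λ x → ⟦ S x ⟧)

card≤n : ∀ {n} (S : Fin n → Bool) → card S ≤ n
card≤n {n} S = ≤-trans (∑F-≤const 1 (λ x → ⟦⟧≤1 (S x))) (≤-reflexive (*-identityʳ n))

nbr : ∀ {n} → Rel n → (Fin n → Bool) → Fin n → Fin n → Bool
nbr e S x y = S y ∧ e x y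

-- The indicator of an ordered clique, computed by shrinking `S` to successive neighbourhoods.
-- Distinctness is not asked for: where `e` has loops, as complements have, vertices may repeat.
cl : ∀ {n k} → Rel n → (Fin n → Bool) → Vec (Fin n) k → ℕ
cl e S [] = 1
cl e S (x ∷ Q) = ⟦ S x ⟧ * cl e (nbr e S x) Q

C : ∀ {n} → Rel n → ℕ → (Fin n → Bool) → ℕ
C e k S = ∑V {k} (cl e S)

C-0 : ∀ {n} (e : Rel n) S → C e 0 S ≡ 1
C-0 e S = ∑V-nil _

C-suc : ∀ {n} (e : Rel n) k S → C e (suc k) S ≡ ∑F (λ x → ⟦ S x ⟧ * C e k (nbr e S x))
C-suc e k S = trans (∑V-suc′ _) (∑F-cong (λ x → ∑V-*ˡ ⟦ S x ⟧ _))

C-1 : ∀ {n} (e : Rel n) S → C e 1 S ≡ card S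
C-1 e S = trans (C-suc e 0 S) (∑F-cong (λ x → trans (cong (⟦ S x ⟧ *_) (C-0 e _)) (*-identityʳ _)))

_⊑_ : ∀ {n} → (Fin n → Bool) → (Fin n → Bool) → Set
S ⊑ S′ = ∀ x → S x ≡ true → S′ x ≡ true

⟦⟧-mono : ∀ {a b} → (a ≡ true → b ≡ true) → ⟦ a ⟧ ≤ ⟦ b ⟧
⟦⟧-mono {true} f rewrite f refl = ≤-refl
⟦⟧-mono {false} f = z≤n

∧-intro : ∀ {a b} → a ≡ true → b ≡ true → a ∧ b ≡ true
∧-intro refl refl = refl

∧-elimˡ : ∀ {a b} → a ∧ b ≡ true → a ≡ true
∧-elimˡ {true} _ = refl

∧-elimʳ : ∀ {a b} → a ∧ b ≡ true → b ≡ true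
∧-elimʳ {true} p = p

cl-mono : ∀ {n k} (e : Rel n) {S S′} (Q : Vec (Fin n) k) → S ⊑ S′ → cl e S Q ≤ cl e S′ Q
cl-mono e [] h = ≤-refl
cl-mono e (x ∷ Q) h = *-mono-≤ (⟦⟧-mono (h x)) (cl-mono e Q (λ y p → ∧-intro (h y (∧-elimˡ p)) (∧-elimʳ p)))

C-mono : ∀ {n} (e : Rel n) k {S S′} → S ⊑ S′ → C e k S ≤ C e k S′
C-mono e k h = ∑V-mono (λ Q → cl-mono e Q h)

cl≤1 : ∀ {n k} (e : Rel n) S (Q : Vec (Fin n) k) → cl e S Q ≤ 1
cl≤1 e S [] = ≤-refl
cl≤1 e S (x ∷ Q) = *-mono-≤ (⟦⟧≤1 (S x)) (cl≤1 e _ Q)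

C≤ : ∀ {n} (e : Rel n) k S → C e k S ≤ n ^ k
C≤ {n} e k S = ≤-trans (∑V-mono (cl≤1 e S)) (≤-reflexive (∑V-1 k n))

nbr-split : ∀ {n} (e : Rel n) S x → card (nbr e S x) + card (nbr (neg e) S x) ≡ card S
nbr-split e S x = trans (sym (∑F-+ _ _)) (∑F-cong (λ y → pt (S y) (e x y)))
  where pt : ∀ s b → ⟦ s ∧ b ⟧ + ⟦ s ∧ not b ⟧ ≡ ⟦ s ⟧
        pt true b = ⟦⟧+not b
        pt false b = refl

-- A counting form of Ramsey's theorem

-- The Erdős-Szekeres recursion with densities. For each x in S at least half of S consists of
-- neighbours or of non-neighbours of x. Cliques of full size in that half would already prove the
-- claim, so the induction hypothesis leaves only many cliques of size one less, to which x can be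
-- added. One of the two kinds occurs at half of the vertices of S.
ramsey-rec : ∀ k l g → ∃ λ c → ∀ {n} (e : Rel n) S → n ≤ g * card S →
  (n ^ k ≤ c * C e k S) ⊎ (n ^ l ≤ c * C (neg e) l S)
ramsey-rec zero l g = 1 , λ e S h → inj₁ (≤-reflexive (sym (trans (+-identityʳ _) (C-0 e S))))
ramsey-rec (suc k) zero g = 1 , λ e S h → inj₂ (≤-reflexive (sym (trans (+-identityʳ _) (C-0 (neg e) S))))
ramsey-rec (suc k) (suc l) g with ramsey-rec k (suc l) (2 * g) | ramsey-rec (suc k) l (2 * g)
... | ca , ha | cb , hb = c , main
  where
  c = (1 + 2 * g) * (ca + cb)
  ca≤ : ca ≤ c
  ca≤ = ≤-trans (m≤m+n ca cb) (m≤m+n (ca + cb) _)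
  cb≤ : cb ≤ c
  cb≤ = ≤-trans (m≤n+m cb ca) (m≤m+n (ca + cb) _)
  main : ∀ {n} (e : Rel n) S → n ≤ g * card S → (n ^ suc k ≤ c * C e (suc k) S) ⊎ (n ^ suc l ≤ c * C (neg e) (suc l) S)
  main {n} e S h with n ^ suc k ≤? c * C e (suc k) S | n ^ suc l ≤? c * C (neg e) (suc l) S
  ... | yes p | _ = inj₁ p
  ... | no _ | yes p = inj₂ p
  ... | no p₁ | no p₂ = fin (≤-total U W)
    where
    d₁ : ∀ x → Dec (n ^ k ≤ ca * C e k (nbr e S x))
    d₁ x = n ^ k ≤? ca * C e k (nbr e S x)
    d₂ : ∀ x → Dec (n ^ l ≤ cb * C (neg e) l (nbr (neg e) S x))
    d₂ x = n ^ l ≤? cb * C (neg e) l (nbr (neg e) S x)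
    nbr⊑ : ∀ {e : Rel n} {x} → nbr e S x ⊑ S
    nbr⊑ y q = ∧-elimˡ q
    half : ∀ a b → n ≤ g * (a + b) → b ≤ a → n ≤ 2 * g * a
    half a b q b≤a = ≤-trans q (≤-trans (mulˡ g (+-monoʳ-≤ a b≤a)) (≤-reflexive (lem g a)))
      where lem : ∀ g a → g * (a + a) ≡ 2 * g * a
            lem = solve-∀
    pt : ∀ x → ⟦ S x ⟧ ≤ ⟦ S x ⟧ * ι (d₁ x) + ⟦ S x ⟧ * ι (d₂ x)
    pt x with S x in eq
    ... | false = z≤n
    ... | true with ≤-total (card (nbr (neg e) S x)) (card (nbr e S x))
    ... | inj₁ q with ha e (nbr e S x) (half _ _ (subst (λ z → n ≤ g * z) (sym (nbr-split e S x)) h) q)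
    ... | inj₁ p = ≤-trans (≤-reflexive (sym (trans (+-identityʳ _) (ι-yes (d₁ x) p)))) (m≤m+n _ _)
    ... | inj₂ p = contradiction (≤-trans p (*-mono-≤ ca≤ (C-mono (neg e) (suc l) (nbr⊑ {e} {x})))) p₂
    pt x | true | inj₂ q with hb e (nbr (neg e) S x) (half _ _ (subst (λ z → n ≤ g * z) (trans (sym (nbr-split e S x)) (+-comm (card (nbr e S x)) _)) h) q)
    ... | inj₁ p = contradiction (≤-trans p (*-mono-≤ cb≤ (C-mono e (suc k) (nbr⊑ {neg e} {x})))) p₁
    ... | inj₂ p = ≤-trans (≤-reflexive (sym (trans (+-identityʳ _) (ι-yes (d₂ x) p)))) (m≤n+m _ (1 * ι (d₁ x)))
    U = ∑F (λ x → ⟦ S x ⟧ * ι (d₁ x))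
    W = ∑F (λ x → ⟦ S x ⟧ * ι (d₂ x))
    n≤ : n ≤ g * (U + W)
    n≤ = ≤-trans h (mulˡ g (≤-trans (∑F-mono pt) (≤-reflexive (∑F-+ _ _))))
    grow : ∀ c′ e′ j (d : ∀ x → Dec (n ^ j ≤ c′ * C e′ j (nbr e′ S x))) →
      n ^ j * ∑F (λ x → ⟦ S x ⟧ * ι (d x)) ≤ c′ * C e′ (suc j) S
    grow c′ e′ j d = begin
      n ^ j * ∑F (λ x → ⟦ S x ⟧ * ι (d x)) ≡⟨ ∑F-*ˡ (n ^ j) _ ⟨
      ∑F (λ x → n ^ j * (⟦ S x ⟧ * ι (d x))) ≤⟨ ∑F-mono (λ x → ≤-trans (≤-reflexive (lem (n ^ j) ⟦ S x ⟧ (ι (d x))))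
           (≤-trans (mulˡ ⟦ S x ⟧ (ι*≤ (d x) id)) (≤-reflexive (*-left-comm ⟦ S x ⟧ c′ _)))) ⟩
      ∑F (λ x → c′ * (⟦ S x ⟧ * C e′ j (nbr e′ S x))) ≡⟨ ∑F-*ˡ c′ _ ⟩
      c′ * ∑F (λ x → ⟦ S x ⟧ * C e′ j (nbr e′ S x)) ≡⟨ cong (c′ *_) (C-suc e′ j S) ⟨
      c′ * C e′ (suc j) S ∎
      where
      open ≤-Reasoning
      lem : ∀ a b c → a * (b * c) ≡ b * (c * a)
      lem = solve-∀
    done : ∀ c′ e′ j U → c′ ≤ ca + cb → n ≤ 2 * g * U → n ^ j * U ≤ c′ * C e′ (suc j) S → n ^ suc j ≤ c * C e′ (suc j) S
    done c′ e′ j U c′≤ q q′ = begin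
      n * n ^ j ≤⟨ mulʳ (n ^ j) q ⟩
      2 * g * U * n ^ j ≡⟨ lem (2 * g) U (n ^ j) ⟩
      2 * g * (n ^ j * U) ≤⟨ mulˡ (2 * g) q′ ⟩
      2 * g * (c′ * C e′ (suc j) S) ≡⟨ *-assoc (2 * g) c′ _ ⟨
      2 * g * c′ * C e′ (suc j) S ≤⟨ mulʳ (C e′ (suc j) S) (*-mono-≤ (n≤1+n (2 * g)) c′≤) ⟩
      c * C e′ (suc j) S ∎
      where
      open ≤-Reasoning
      lem : ∀ a b c → a * b * c ≡ a * (c * b)
      lem = solve-∀
    fin : (U ≤ W) ⊎ (W ≤ U) → (n ^ suc k ≤ c * C e (suc k) S) ⊎ (n ^ suc l ≤ c * C (neg e) (suc l) S)
    fin (inj₁ q) = inj₂ (done cb (neg e) l W (m≤n+m cb ca) (half W U (subst (λ z → n ≤ g * z) (+-comm U W) n≤) q) (grow cb (neg e) l d₂))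
    fin (inj₂ q) = inj₁ (done ca e k U (m≤m+n ca cb) (half U W n≤ q) (grow ca e k d₁))

-- Opaque: unfolding the constant is infeasible.
opaque
  ramsey : ∀ k l g → ∃ λ c → ∀ {n} (e : Rel n) S → n ≤ g * card S →
    (n ^ k ≤ c * C e k S) ⊎ (n ^ l ≤ c * C (neg e) l S)
  ramsey = ramsey-rec

-- Turán density

E : ∀ {n} → Rel n → (Fin n → Bool) → ℕ
E e S = ∑F (λ x → ⟦ S x ⟧ * card (nbr e S x))

C-2 : ∀ {n} (e : Rel n) S → C e 2 S ≡ E e S
C-2 e S = trans (C-suc e 1 S) (∑F-cong (λ x → cong (⟦ S x ⟧ *_) (C-1 e (nbr e S x))))

E≤ : ∀ {n} (e : Rel n) S → E e S ≤ n * n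
E≤ {n} e S = ∑F-≤const n (λ x → ≤-trans (*-mono-≤ (⟦⟧≤1 (S x)) (card≤n (nbr e S x))) (≤-reflexive (*-identityˡ n)))

-- For each edge xy inside S, the degrees of x and y add up to at most their codegree plus the size
-- of S; this is summed over ordered edges.
codegree : ∀ {n} (e : Rel n) S → Symm e →
  2 * ∑F (λ x → ⟦ S x ⟧ * (card (nbr e S x) * card (nbr e S x))) ≤ ∑F (λ x → ⟦ S x ⟧ * E e (nbr e S x)) + card S * E e S
codegree {n} e S e-sym = begin
  2 * D ≡⟨ lem₁ D ⟩
  D + D ≡⟨ cong₂ _+_ eq₁ eq₂ ⟨
  ∑F (λ x → ∑F (λ y → w x y * d x)) + ∑F (λ x → ∑F (λ y → w x y * d y)) ≡⟨ add _ _ ⟨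
  ∑F (λ x → ∑F (λ y → w x y * d x + w x y * d y)) ≤⟨ ∑F-mono (λ x → ∑F-mono (λ y → pt x y)) ⟩
  ∑F (λ x → ∑F (λ y → w x y * card (nbr e (nbr e S x) y) + w x y * card S)) ≡⟨ add _ _ ⟩
  ∑F (λ x → ∑F (λ y → w x y * card (nbr e (nbr e S x) y))) + ∑F (λ x → ∑F (λ y → w x y * card S)) ≡⟨ cong₂ _+_ eq₃ eq₄ ⟩
  ∑F (λ x → ⟦ S x ⟧ * E e (nbr e S x)) + card S * E e S ∎
  where
  open ≤-Reasoning
  d : Fin n → ℕ
  d x = card (nbr e S x)
  D = ∑F (λ x → ⟦ S x ⟧ * (d x * d x))
  w : Fin n → Fin n → ℕ
  w x y = ⟦ S x ⟧ * ⟦ nbr e S x y ⟧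
  lem₁ : ∀ D → 2 * D ≡ D + D
  lem₁ = solve-∀
  add : ∀ (f g : Fin n → Fin n → ℕ) → ∑F (λ x → ∑F (λ y → f x y + g x y)) ≡ ∑F (λ x → ∑F (f x)) + ∑F (λ x → ∑F (g x))
  add f g = trans (∑F-cong (λ x → ∑F-+ (f x) (g x))) (∑F-+ _ _)
  w-sym : ∀ x y → w x y ≡ w y x
  w-sym x y rewrite e-sym x y = aux (S x) (S y) (e y x)
    where aux : ∀ a b c → ⟦ a ⟧ * ⟦ b ∧ c ⟧ ≡ ⟦ b ⟧ * ⟦ a ∧ c ⟧
          aux true true c = refl
          aux true false c = refl
          aux false true c = refl
          aux false false c = refl
  eq₁ : ∑F (λ x → ∑F (λ y → w x y * d x)) ≡ D
  eq₁ = ∑F-cong (λ x → trans (∑F-*ʳ (d x) (w x)) (trans (cong (_* d x) (∑F-*ˡ ⟦ S x ⟧ _)) (*-assoc ⟦ S x ⟧ _ _)))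
  eq₂ : ∑F (λ x → ∑F (λ y → w x y * d y)) ≡ D
  eq₂ = trans (∑F-swap _) (trans (∑F-cong (λ y → ∑F-cong (λ x → cong (_* d y) (w-sym x y)))) eq₁)
  eq₃ : ∑F (λ x → ∑F (λ y → w x y * card (nbr e (nbr e S x) y))) ≡ ∑F (λ x → ⟦ S x ⟧ * E e (nbr e S x))
  eq₃ = ∑F-cong (λ x → trans (∑F-cong (λ y → *-assoc ⟦ S x ⟧ ⟦ nbr e S x y ⟧ (card (nbr e (nbr e S x) y)))) (∑F-*ˡ ⟦ S x ⟧ _))
  eq₄ : ∑F (λ x → ∑F (λ y → w x y * card S)) ≡ card S * E e S
  eq₄ = trans (∑F-cong (λ x → trans (∑F-*ʳ (card S) (w x)) (cong (_* card S) (∑F-*ˡ ⟦ S x ⟧ _)))) (trans (∑F-*ʳ (card S) _) (*-comm _ (card S)))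
  bool : ∀ s a b → ⟦ s ∧ a ⟧ + ⟦ s ∧ b ⟧ ≤ ⟦ (s ∧ a) ∧ b ⟧ + ⟦ s ⟧
  bool true true true = ≤-refl
  bool true true false = ≤-refl
  bool true false true = ≤-refl
  bool true false false = z≤n
  bool false a b = z≤n
  pt : ∀ x y → w x y * d x + w x y * d y ≤ w x y * card (nbr e (nbr e S x) y) + w x y * card S
  pt x y = ≤-trans (≤-reflexive (sym (*-distribˡ-+ (w x y) _ _))) (≤-trans (mulˡ (w x y)
    (≤-trans (≤-reflexive (sym (∑F-+ _ _))) (≤-trans (∑F-mono (λ z → bool (S z) (e x z) (e y z))) (≤-reflexive (∑F-+ _ _)))))
    (≤-reflexive (*-distribˡ-+ (w x y) _ _)))

-- Supersaturation by induction on the clique size. The hypothesis says that the edge density of S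
-- exceeds the Turán value ρ/(ρ+1) by a margin that θ records. Then the neighbourhoods exceed the
-- previous Turán value on average, a positive proportion of them does so by a fixed margin, and x
-- extends each clique in its neighbourhood.
turan-rec : ∀ ρ θ → ∃ λ c → ∀ {n} (e : Rel n) S → Symm e → 1 ≤ n →
  n * n + θ * ρ * (card S * card S) ≤ θ * suc ρ * E e S → n ^ (2 + ρ) ≤ c * C e (2 + ρ) S
turan-rec zero θ = θ , λ {n} e S e-sym n≥1 h → begin
  n ^ 2 ≡⟨ cong (n *_) (*-identityʳ n) ⟩
  n * n ≤⟨ m≤m+n (n * n) _ ⟩
  n * n + θ * 0 * (card S * card S) ≤⟨ h ⟩
  θ * 1 * E e S ≡⟨ cong₂ _*_ (*-identityʳ θ) (sym (C-2 e S)) ⟩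
  θ * C e 2 S ∎
  where open ≤-Reasoning
turan-rec (suc ρ) θ with turan-rec ρ (2 * (suc ρ * (θ * θ * (2 + ρ))))
... | c′ , IH = 2 * c₁ * c′ , main
  where
  c₁ = suc ρ * (θ * θ * (2 + ρ))
  main : ∀ {n} (e : Rel n) S → Symm e → 1 ≤ n → n * n + θ * suc ρ * (card S * card S) ≤ θ * suc (suc ρ) * E e S →
    n ^ (3 + ρ) ≤ 2 * c₁ * c′ * C e (3 + ρ) S
  main {n} e S e-sym n≥1 h = begin
    n * n ^ (2 + ρ) ≤⟨ mulʳ (n ^ (2 + ρ)) many ⟩
    2 * c₁ * ∑F (λ x → ι (good? x)) * n ^ (2 + ρ) ≡⟨ trans (*-assoc (2 * c₁) _ _) (cong (2 * c₁ *_) (sym (∑F-*ʳ (n ^ (2 + ρ)) _))) ⟩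
    2 * c₁ * ∑F (λ x → ι (good? x) * n ^ (2 + ρ)) ≤⟨ mulˡ (2 * c₁) (∑F-mono (λ x → ι*≤ (good? x) (use x))) ⟩
    2 * c₁ * ∑F (λ x → c′ * (⟦ S x ⟧ * C e (2 + ρ) (nbr e S x))) ≡⟨ cong (2 * c₁ *_) (∑F-*ˡ c′ _) ⟩
    2 * c₁ * (c′ * ∑F (λ x → ⟦ S x ⟧ * C e (2 + ρ) (nbr e S x))) ≡⟨ *-assoc (2 * c₁) c′ _ ⟨
    2 * c₁ * c′ * ∑F (λ x → ⟦ S x ⟧ * C e (2 + ρ) (nbr e S x)) ≡⟨ cong (2 * c₁ * c′ *_) (C-suc e (2 + ρ) S) ⟨
    2 * c₁ * c′ * C e (3 + ρ) S ∎
    where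
    open ≤-Reasoning
    s = card S
    d : Fin n → ℕ
    d x = card (nbr e S x)
    -- The scaled excess of the neighbourhood of x over the previous Turán density. Truncation at
    -- zero can only raise it, which is harmless for the lower bound `T≤` on its sum.
    f₀ f : Fin n → ℕ
    f₀ x = suc ρ * E e (nbr e S x) ∸ ρ * (d x * d x)
    f x = ⟦ S x ⟧ * f₀ x
    T = ∑F (λ x → ⟦ S x ⟧ * E e (nbr e S x))
    D = ∑F (λ x → ⟦ S x ⟧ * (d x * d x))
    M = suc ρ * (n * n)
    good? : ∀ x → Dec (M ≤ 2 * c₁ * f x)
    good? x = M ≤? 2 * c₁ * f x
    EE≤sD : E e S * E e S ≤ s * D
    EE≤sD = cauchy (λ x → ⟦ S x ⟧) d
    T≤ : suc ρ * T ≤ ∑F f + ρ * D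
    T≤ = begin
      suc ρ * T ≡⟨ ∑F-*ˡ (suc ρ) _ ⟨
      ∑F (λ x → suc ρ * (⟦ S x ⟧ * E e (nbr e S x))) ≤⟨ ∑F-mono pt ⟩
      ∑F (λ x → f x + ρ * (⟦ S x ⟧ * (d x * d x))) ≡⟨ trans (∑F-+ f _) (cong (∑F f +_) (∑F-*ˡ ρ _)) ⟩
      ∑F f + ρ * D ∎
      where
      pt : ∀ x → suc ρ * (⟦ S x ⟧ * E e (nbr e S x)) ≤ f x + ρ * (⟦ S x ⟧ * (d x * d x))
      pt x = ≤-trans (≤-reflexive (*-left-comm (suc ρ) ⟦ S x ⟧ _)) (≤-trans (mulˡ ⟦ S x ⟧ (m≤m∸n+n′ (suc ρ * E e (nbr e S x)) (ρ * (d x * d x))))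
        (≤-reflexive (trans (*-distribˡ-+ ⟦ S x ⟧ (f₀ x) _) (cong (f x +_) (sym (*-left-comm ρ ⟦ S x ⟧ (d x * d x)))))))
        where
        m≤m∸n+n′ : ∀ m n → m ≤ m ∸ n + n
        m≤m∸n+n′ m n = ≤-trans (m≤n+m∸n m n) (≤-reflexive (+-comm n _))
    -- `codegree` bounds `T` from below by `D`, and Cauchy-Schwarz bounds `D` from below by the
    -- square of the edge count.
    step₁ : (2 + ρ) * (E e S * E e S) ≤ s * ∑F f + suc ρ * (s * s) * E e S
    step₁ = linear 0 (+-mono-≤ (mulˡ s T≤) (+-mono-≤ (mulˡ (suc ρ * s) (codegree e S e-sym)) (mulˡ (2 + ρ) EE≤sD)))
      (l ρ s T D (∑F f) (E e S))
      where
      l : ∀ ρ s T D f E → (s * f + suc ρ * (s * s) * E) + (s * (suc ρ * T) + (suc ρ * s * (2 * D) + (2 + ρ) * (E * E)))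
        ≡ (2 + ρ) * (E * E) + (s * (f + ρ * D) + (suc ρ * s * (T + s * E) + (2 + ρ) * (s * D))) + 0
      l = solve-∀
    step₂ : E e S * (n * n) ≤ θ * (s * ∑F f)
    step₂ = linear 0 (+-mono-≤ (mulˡ (E e S) h) (mulˡ θ step₁)) (l ρ s θ (n * n) (∑F f) (E e S))
      where
      l : ∀ ρ s θ nn f E → θ * (s * f) + (E * (nn + θ * suc ρ * (s * s)) + θ * ((2 + ρ) * (E * E)))
        ≡ E * nn + (E * (θ * suc (suc ρ) * E) + θ * (s * f + suc ρ * (s * s) * E)) + 0
      l = solve-∀
    step₃ : n * n * (n * n) ≤ θ * θ * (2 + ρ) * (n * ∑F f)
    step₃ = begin
      n * n * (n * n) ≤⟨ mulʳ (n * n) (≤-trans (m≤m+n (n * n) _) h) ⟩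
      θ * suc (suc ρ) * E e S * (n * n) ≡⟨ *-assoc (θ * suc (suc ρ)) (E e S) (n * n) ⟩
      θ * suc (suc ρ) * (E e S * (n * n)) ≤⟨ mulˡ (θ * suc (suc ρ)) step₂ ⟩
      θ * suc (suc ρ) * (θ * (s * ∑F f)) ≡⟨ l θ (2 + ρ) (s * ∑F f) ⟩
      θ * θ * (2 + ρ) * (s * ∑F f) ≤⟨ mulˡ (θ * θ * (2 + ρ)) (mulʳ (∑F f) (card≤n S)) ⟩
      θ * θ * (2 + ρ) * (n * ∑F f) ∎
      where
      l : ∀ t r a → t * r * (t * a) ≡ t * t * r * a
      l = solve-∀
    step₄ : n * M ≤ c₁ * ∑F f
    step₄ = begin
      n * M ≡⟨ l n (suc ρ) ⟩
      suc ρ * (n * n * n) ≤⟨ mulˡ (suc ρ) (*-cancelˡ-≤ n ⦃ >-nonZero n≥1 ⦄ (≤-trans (≤-reflexive (l₂ n)) (≤-trans step₃ (≤-reflexive (l₃ n (θ * θ * (2 + ρ)) (∑F f)))))) ⟩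
      suc ρ * (θ * θ * (2 + ρ) * ∑F f) ≡⟨ *-assoc (suc ρ) (θ * θ * (2 + ρ)) (∑F f) ⟨
      c₁ * ∑F f ∎
      where
      l : ∀ n r → n * (r * (n * n)) ≡ r * (n * n * n)
      l = solve-∀
      l₂ : ∀ n → n * (n * n * n) ≡ n * n * (n * n)
      l₂ = solve-∀
      l₃ : ∀ n t f → t * (n * f) ≡ n * (t * f)
      l₃ = solve-∀
    f≤M : ∀ x → f x ≤ M
    f≤M x = ≤-trans (*-mono-≤ (⟦⟧≤1 (S x)) (≤-trans (m∸n≤m (suc ρ * E e (nbr e S x)) (ρ * (d x * d x))) (mulˡ (suc ρ) (E≤ e (nbr e S x))))) (≤-reflexive (*-identityˡ M))
    nn≥1 : 1 ≤ n * n
    nn≥1 = *-mono-≤ n≥1 n≥1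
    many : n ≤ 2 * c₁ * ∑F (λ x → ι (good? x))
    many = markovF f M c₁ (*-mono-≤ (s≤s {n = ρ} z≤n) nn≥1) step₄ f≤M
    use : ∀ x → M ≤ 2 * c₁ * f x → n ^ (2 + ρ) ≤ c′ * (⟦ S x ⟧ * C e (2 + ρ) (nbr e S x))
    use x q with S x
    ... | false = contradiction (≤-trans nn≥1 (≤-trans (m≤m+n (n * n) (ρ * (n * n))) (≤-trans q (≤-reflexive (*-zeroʳ (2 * c₁)))))) λ ()
    ... | true = ≤-trans (IH e (nbr e S x) e-sym n≥1 hyp) (mulˡ c′ (≤-reflexive (sym (*-identityˡ _))))
      where
      nn≤ : n * n ≤ 2 * c₁ * f₀ x
      nn≤ = ≤-trans (m≤m+n (n * n) (ρ * (n * n))) (≤-trans q (mulˡ (2 * c₁) (≤-reflexive (*-identityˡ (f₀ x)))))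
      hyp : n * n + 2 * c₁ * ρ * (d x * d x) ≤ 2 * c₁ * suc ρ * E e (nbr e S x)
      hyp with ≤-total (ρ * (d x * d x)) (suc ρ * E e (nbr e S x))
      ... | inj₁ le = begin
        n * n + 2 * c₁ * ρ * (d x * d x) ≤⟨ +-mono-≤ nn≤ (≤-reflexive (*-assoc (2 * c₁) ρ (d x * d x))) ⟩
        2 * c₁ * f₀ x + 2 * c₁ * (ρ * (d x * d x)) ≡⟨ *-distribˡ-+ (2 * c₁) (f₀ x) (ρ * (d x * d x)) ⟨
        2 * c₁ * (f₀ x + ρ * (d x * d x)) ≡⟨ cong (2 * c₁ *_) (m∸n+n≡m le) ⟩
        2 * c₁ * (suc ρ * E e (nbr e S x)) ≡⟨ *-assoc (2 * c₁) (suc ρ) (E e (nbr e S x)) ⟨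
        2 * c₁ * suc ρ * E e (nbr e S x) ∎
      ... | inj₂ le = contradiction (≤-trans nn≥1 (≤-trans nn≤ (≤-reflexive (trans (cong (2 * c₁ *_) (m≤n⇒m∸n≡0 le)) (*-zeroʳ (2 * c₁)))))) λ ()

opaque
  turan-density : ∀ ρ θ → ∃ λ c → ∀ {n} (e : Rel n) S → Symm e → 1 ≤ n →
    n * n + θ * ρ * (card S * card S) ≤ θ * suc ρ * E e S → n ^ (2 + ρ) ≤ c * C e (2 + ρ) S
  turan-density = turan-rec

-- Blow-ups of cliques

adjAll : ∀ {n k} → Rel n → Fin n → Vec (Fin n) k → ℕ
adjAll e y [] = 1
adjAll e y (x ∷ Q) = ⟦ e y x ⟧ * adjAll e y Q

adjAll≤1 : ∀ {n k} (e : Rel n) y (Q : Vec (Fin n) k) → adjAll e y Q ≤ 1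
adjAll≤1 e y [] = ≤-refl
adjAll≤1 e y (x ∷ Q) = *-mono-≤ (⟦⟧≤1 (e y x)) (adjAll≤1 e y Q)

cl-nbr : ∀ {n k} (e : Rel n) S y (Q : Vec (Fin n) k) → cl e (nbr e S y) Q ≡ cl e S Q * adjAll e y Q
cl-nbr e S y [] = refl
cl-nbr e S y (x ∷ Q) = begin
  ⟦ S x ∧ e y x ⟧ * cl e (nbr e (nbr e S y) x) Q ≡⟨ cong₂ _*_ (⟦∧⟧ (S x) (e y x)) (≤-antisym (cl-mono e Q sw) (cl-mono e Q sw)) ⟩
  ⟦ S x ⟧ * ⟦ e y x ⟧ * cl e (nbr e (nbr e S x) y) Q ≡⟨ cong (⟦ S x ⟧ * ⟦ e y x ⟧ *_) (cl-nbr e (nbr e S x) y Q) ⟩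
  ⟦ S x ⟧ * ⟦ e y x ⟧ * (cl e (nbr e S x) Q * adjAll e y Q) ≡⟨ l ⟦ S x ⟧ ⟦ e y x ⟧ _ _ ⟩
  ⟦ S x ⟧ * cl e (nbr e S x) Q * (⟦ e y x ⟧ * adjAll e y Q) ∎
  where
  open ≡-Reasoning
  l : ∀ a b c d → a * b * (c * d) ≡ a * c * (b * d)
  l = solve-∀
  sw : ∀ {x y} → nbr e (nbr e S y) x ⊑ nbr e (nbr e S x) y
  sw {x} {y} z = b (S z) (e y z) (e x z)
    where b : ∀ s a b → (s ∧ a) ∧ b ≡ true → (s ∧ b) ∧ a ≡ true
          b true true true _ = refl

comm : ∀ {n m} → Rel n → (Fin n → Bool) → Vec (Fin n) m → Fin n → Bool
comm e S [] = S
comm e S (y ∷ ψ) = comm e (nbr e S y) ψ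

comm-elim : ∀ {n m} (e : Rel n) S (ψ : Vec (Fin n) m) z → comm e S ψ z ≡ true → S z ≡ true × (∀ j → e (lookup ψ j) z ≡ true)
comm-elim e S [] z p = p , λ ()
comm-elim e S (y ∷ ψ) z p with comm-elim e (nbr e S y) ψ z p
... | q , h = ∧-elimˡ q , λ { zero → ∧-elimʳ q ; (suc j) → h j }

inS : ∀ {n m} → (Fin n → Bool) → Vec (Fin n) m → ℕ
inS S [] = 1
inS S (y ∷ ψ) = ⟦ S y ⟧ * inS S ψ

inS≤1 : ∀ {n m} S (ψ : Vec (Fin n) m) → inS S ψ ≤ 1
inS≤1 S [] = ≤-refl
inS≤1 S (y ∷ ψ) = *-mono-≤ (⟦⟧≤1 (S y)) (inS≤1 S ψ)

inS-elim : ∀ {n m} S (ψ : Vec (Fin n) m) → 1 ≤ inS S ψ → ∀ j → S (lookup ψ j) ≡ true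
inS-elim S (y ∷ ψ) p j with S y in eq
inS-elim S (y ∷ ψ) p zero | true = eq
inS-elim S (y ∷ ψ) p (suc j) | true = inS-elim S ψ (≤-trans p (≤-reflexive (*-identityˡ _))) j

ext : ∀ {n k} → Rel n → (Fin n → Bool) → Vec (Fin n) k → ℕ
ext e S Q = ∑F (λ y → ⟦ S y ⟧ * adjAll e y Q)

C-ext : ∀ {n} (e : Rel n) k S → C e (suc k) S ≡ ∑V {k} (λ Q → cl e S Q * ext e S Q)
C-ext e k S = begin
  C e (suc k) S ≡⟨ C-suc e k S ⟩
  ∑F (λ x → ⟦ S x ⟧ * ∑V (cl e (nbr e S x))) ≡⟨ ∑F-cong (λ x → ∑V-*ˡ ⟦ S x ⟧ _) ⟨
  ∑F (λ x → ∑V (λ Q → ⟦ S x ⟧ * cl e (nbr e S x) Q)) ≡⟨ ∑VF-swap _ ⟨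
  ∑V (λ Q → ∑F (λ x → ⟦ S x ⟧ * cl e (nbr e S x) Q)) ≡⟨ ∑V-cong (λ Q → trans (∑F-cong (λ x →
      trans (cong (⟦ S x ⟧ *_) (cl-nbr e S x Q)) (*-left-comm ⟦ S x ⟧ (cl e S Q) (adjAll e x Q)))) (∑F-*ˡ (cl e S Q) _)) ⟩
  ∑V (λ Q → cl e S Q * ext e S Q) ∎
  where
  open ≡-Reasoning

-- Q lies in the common neighbourhood of ψ exactly when each entry of ψ is joined to all of Q, and
-- the m entries are chosen independently.
∑-comm : ∀ {n k} (e : Rel n) m S₀ S (Q : Vec (Fin n) k) →
  ∑V {m} (λ ψ → inS S₀ ψ * cl e (comm e S ψ) Q) ≡ cl e S Q * ext e S₀ Q ^ m
∑-comm e zero S₀ S Q = trans (∑V-nil _) (trans (*-identityˡ _) (sym (*-identityʳ _)))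
∑-comm e (suc m) S₀ S Q = begin
  ∑V (λ ψ → inS S₀ ψ * cl e (comm e S ψ) Q) ≡⟨ ∑V-suc′ _ ⟩
  ∑F (λ y → ∑V (λ ψ → ⟦ S₀ y ⟧ * inS S₀ ψ * cl e (comm e (nbr e S y) ψ) Q)) ≡⟨ ∑F-cong (λ y → trans (∑V-cong (λ ψ → *-assoc ⟦ S₀ y ⟧ _ _))
     (trans (∑V-*ˡ ⟦ S₀ y ⟧ _) (trans (cong (⟦ S₀ y ⟧ *_) (trans (∑-comm e m S₀ (nbr e S y) Q) (cong (_* ext e S₀ Q ^ m) (cl-nbr e S y Q))))
       (l ⟦ S₀ y ⟧ (cl e S Q) (adjAll e y Q) (ext e S₀ Q ^ m))))) ⟩
  ∑F (λ y → cl e S Q * ext e S₀ Q ^ m * (⟦ S₀ y ⟧ * adjAll e y Q)) ≡⟨ ∑F-*ˡ (cl e S Q * ext e S₀ Q ^ m) _ ⟩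
  cl e S Q * ext e S₀ Q ^ m * ext e S₀ Q ≡⟨ l₂ (cl e S Q) (ext e S₀ Q) (ext e S₀ Q ^ m) ⟩
  cl e S Q * ext e S₀ Q ^ suc m ∎
  where
  open ≡-Reasoning
  l : ∀ a b c d → a * (b * c * d) ≡ b * d * (a * c)
  l = solve-∀
  l₂ : ∀ a b c → a * c * b ≡ a * (b * c)
  l₂ = solve-∀

module Blowup {m} (F : Graph m) (col : Fin m → ℕ) (proper : ∀ w w′ → adj F w w′ ≡ true → col w ≢ col w′) where

  -- Only the colours below k are constrained, yet all m coordinates are kept: the counts of every
  -- stage are then compared with the same n^m, and two stages combine by `merge`.
  PHom : ∀ {n} → Rel n → ℕ → (Fin n → Bool) → Vec (Fin n) m → Set
  PHom e k S φ = (∀ w → col w < k → S (lookup φ w) ≡ true) ×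
    (∀ w w′ → col w < k → col w′ < k → adj F w w′ ≡ true → e (lookup φ w) (lookup φ w′) ≡ true)

  PHom? : ∀ {n} (e : Rel n) k S (φ : Vec (Fin n) m) → Dec (PHom e k S φ)
  PHom? e k S φ = all? (λ w → (col w <? k) →-dec (S (lookup φ w) Bool.≟ true)) ×-dec
    all? (λ w → all? (λ w′ → (col w <? k) →-dec ((col w′ <? k) →-dec ((adj F w w′ Bool.≟ true) →-dec (e (lookup φ w) (lookup φ w′) Bool.≟ true)))))

  merge-PHom : ∀ {n} (e : Rel n) → Symm e → ∀ k S (φ ψ : Vec (Fin n) m) → 1 ≤ inS S ψ → PHom e k (comm e S ψ) φ →
    PHom e (suc k) S (merge (λ w → does (col w ≟ℕ k)) φ ψ)
  merge-PHom e e-sym k S φ ψ inS≥1 (h₁ , h₂) = g₁ , g₂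
    where
    b : Fin m → Bool
    b w = does (col w ≟ℕ k)
    val : Fin m → _
    val w = lookup (merge b φ ψ) w
    data Cases (w : Fin m) : Set where
      top : col w ≡ k → val w ≡ lookup ψ w → Cases w
      low : col w < k → val w ≡ lookup φ w → Cases w
    cases : ∀ w → col w < suc k → Cases w
    cases w lt with col w ≟ℕ k
    ... | yes p = top p (trans (lookup-merge b φ ψ w) (cong (if_then lookup ψ w else lookup φ w) (dec-true (col w ≟ℕ k) p)))
    ... | no p = low (≤∧≢⇒< (≤-pred lt) p) (trans (lookup-merge b φ ψ w) (cong (if_then lookup ψ w else lookup φ w) (dec-false (col w ≟ℕ k) p)))
    g₁ : ∀ w → col w < suc k → S (val w) ≡ true
    g₁ w lt with cases w lt
    ... | top _ eq = trans (cong S eq) (inS-elim S ψ inS≥1 w)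
    ... | low lt′ eq = trans (cong S eq) (proj₁ (comm-elim e S ψ _ (h₁ w lt′)))
    g₂ : ∀ w w′ → col w < suc k → col w′ < suc k → adj F w w′ ≡ true → e (val w) (val w′) ≡ true
    g₂ w w′ lt lt′ a with cases w lt | cases w′ lt′
    ... | top p eq | top p′ eq′ = contradiction (trans p (sym p′)) (proper w w′ a)
    ... | top p eq | low q eq′ = trans (cong₂ e eq eq′) (proj₂ (comm-elim e S ψ _ (h₁ w′ q)) w)
    ... | low q eq | top p eq′ = trans (cong₂ e eq eq′) (trans (e-sym _ _) (proj₂ (comm-elim e S ψ _ (h₁ w q)) w′))
    ... | low q eq | low q′ eq′ = trans (cong₂ e eq eq′) (h₂ w w′ q q′ a)

  -- Induction on the number of colours. Many (k+1)-cliques mean many k-cliques with linearly many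
  -- extensions, and each of these lies in the common neighbourhood of about n^m tuples ψ. Hence
  -- many ψ have a common neighbourhood rich in k-cliques: ψ places the colour k, and the induction
  -- hypothesis inside the common neighbourhood places the lower colours.
  blowup-rec : ∀ k c → ∃ λ c′ → ∀ {n} (e : Rel n) S → Symm e → 1 ≤ n → n ^ k ≤ c * C e k S →
    n ^ m ≤ c′ * ∑V {m} (λ φ → ι (PHom? e k S φ))
  blowup-rec zero c = 1 , λ {n} e S e-sym n≥1 h → ≤-reflexive (trans (sym (∑V-1 m n))
    (trans (∑V-cong (λ φ → sym (ι-yes (PHom? e 0 S φ) ((λ w ()) , (λ w w′ ()))))) (sym (+-identityʳ _))))
  blowup-rec (suc k) c with blowup-rec k (2 * (2 * c * (2 * c) ^ m))
  ... | c₃ , IH = c₂ * c₃ , main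
    where
    c₁ = 2 * c * (2 * c) ^ m
    c₂ = 2 * c₁
    main : ∀ {n} (e : Rel n) S → Symm e → 1 ≤ n → n ^ suc k ≤ c * C e (suc k) S →
      n ^ m ≤ c₂ * c₃ * ∑V {m} (λ φ → ι (PHom? e (suc k) S φ))
    main {n} e S e-sym n≥1 h = *-cancelˡ-≤ (n ^ m) ⦃ m^n≢0 n m ⦃ >-nonZero n≥1 ⦄ ⦄ (begin
      n ^ m * n ^ m ≤⟨ mulʳ (n ^ m) many ⟩
      c₂ * ∑V (λ ψ → ι (good? ψ)) * n ^ m ≡⟨ trans (*-assoc c₂ _ _) (cong (c₂ *_) (sym (∑V-*ʳ (n ^ m) _))) ⟩
      c₂ * ∑V (λ ψ → ι (good? ψ) * n ^ m) ≤⟨ mulˡ c₂ (∑V-mono (λ ψ → ι*≤ (good? ψ) (use ψ))) ⟩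
      c₂ * ∑V (λ ψ → c₃ * ∑V (λ φ → ι (PHom? e (suc k) S (merge b φ ψ)))) ≡⟨ cong (c₂ *_) (trans (∑V-*ˡ c₃ _)
          (cong (c₃ *_) (trans (∑V-swap _) (∑V-merge b (λ φ → ι (PHom? e (suc k) S φ)))))) ⟩
      c₂ * (c₃ * (n ^ m * R)) ≡⟨ l c₂ c₃ (n ^ m) R ⟩
      n ^ m * (c₂ * c₃ * R) ∎)
      where
      open ≤-Reasoning
      b : Fin m → Bool
      b w = does (col w ≟ℕ k)
      R = ∑V {m} (λ φ → ι (PHom? e (suc k) S φ))
      l : ∀ a b c d → a * (b * (c * d)) ≡ c * (a * b * d)
      l = solve-∀
      f : Vec (Fin n) m → ℕ
      f ψ = inS S ψ * C e k (comm e S ψ)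
      nk≥1 : 1 ≤ n ^ k
      nk≥1 = m^n>0 n ⦃ >-nonZero n≥1 ⦄ k
      good? : ∀ ψ → Dec (n ^ k ≤ c₂ * f ψ)
      good? ψ = n ^ k ≤? c₂ * f ψ
      rich? : ∀ (Q : Vec (Fin n) k) → Dec (n ≤ 2 * c * (cl e S Q * ext e S Q))
      rich? Q = n ≤? 2 * c * (cl e S Q * ext e S Q)
      richQ : n ^ k ≤ 2 * c * ∑V (λ Q → ι (rich? Q))
      richQ = markovV (λ Q → cl e S Q * ext e S Q) n c n≥1
        (≤-trans (≤-reflexive (*-comm (n ^ k) n)) (≤-trans h (≤-reflexive (cong (c *_) (C-ext e k S)))))
        (λ Q → ≤-trans (*-mono-≤ (cl≤1 e S Q) (≤-trans (∑F-≤const 1 (λ y → *-mono-≤ (⟦⟧≤1 (S y)) (adjAll≤1 e y Q))) (≤-reflexive (*-identityʳ n)))) (≤-reflexive (*-identityˡ n)))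
      pow : ∀ a x → a ≤ 1 → n ≤ 2 * c * (a * x) → n ^ m ≤ (2 * c) ^ m * (a * x ^ m)
      pow zero x _ q = contradiction (≤-trans n≥1 (≤-trans q (≤-reflexive (*-zeroʳ (2 * c))))) λ ()
      pow (suc zero) x _ q = ≤-trans (^-monoˡ-≤ m (≤-trans q (≤-reflexive (cong (2 * c *_) (*-identityˡ x)))))
        (≤-reflexive (trans (^-distrib-* m (2 * c) x) (cong ((2 * c) ^ m *_) (sym (*-identityˡ _)))))
      pow (suc (suc a)) x (s≤s ()) q
      total : n ^ m * n ^ k ≤ c₁ * ∑V f
      total = begin
        n ^ m * n ^ k ≤⟨ mulˡ (n ^ m) richQ ⟩
        n ^ m * (2 * c * ∑V (λ Q → ι (rich? Q))) ≡⟨ l₁ (n ^ m) (2 * c) _ ⟩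
        2 * c * (∑V (λ Q → ι (rich? Q)) * n ^ m) ≡⟨ cong (2 * c *_) (∑V-*ʳ (n ^ m) _) ⟨
        2 * c * ∑V (λ Q → ι (rich? Q) * n ^ m) ≤⟨ mulˡ (2 * c) (∑V-mono (λ Q → ι*≤ (rich? Q) (pow (cl e S Q) (ext e S Q) (cl≤1 e S Q)))) ⟩
        2 * c * ∑V (λ Q → (2 * c) ^ m * (cl e S Q * ext e S Q ^ m)) ≡⟨ cong (2 * c *_) (∑V-*ˡ ((2 * c) ^ m) _) ⟩
        2 * c * ((2 * c) ^ m * ∑V (λ Q → cl e S Q * ext e S Q ^ m)) ≡⟨ *-assoc (2 * c) ((2 * c) ^ m) _ ⟨
        c₁ * ∑V (λ Q → cl e S Q * ext e S Q ^ m) ≡⟨ cong (c₁ *_) (∑V-cong (λ Q → sym (∑-comm e m S S Q))) ⟩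
        c₁ * ∑V (λ Q → ∑V (λ ψ → inS S ψ * cl e (comm e S ψ) Q)) ≡⟨ cong (c₁ *_) (trans (∑V-swap _) (∑V-cong (λ ψ → ∑V-*ˡ (inS S ψ) _))) ⟩
        c₁ * ∑V f ∎
        where
        l₁ : ∀ a b c → a * (b * c) ≡ b * (c * a)
        l₁ = solve-∀
      many : n ^ m ≤ c₂ * ∑V (λ ψ → ι (good? ψ))
      many = markovV f (n ^ k) c₁ nk≥1 total
        (λ ψ → ≤-trans (*-mono-≤ (inS≤1 S ψ) (C≤ e k _)) (≤-reflexive (*-identityˡ _)))
      use : ∀ ψ → n ^ k ≤ c₂ * f ψ → n ^ m ≤ c₃ * ∑V (λ φ → ι (PHom? e (suc k) S (merge b φ ψ)))
      use ψ q = ≤-trans (IH e (comm e S ψ) e-sym n≥1 (≤-trans q (mulˡ c₂ (≤-trans (mulʳ _ (inS≤1 S ψ)) (≤-reflexive (*-identityˡ _))))))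
        (mulˡ c₃ (∑V-mono (λ φ → ι-mono (PHom? e k (comm e S ψ) φ) (PHom? e (suc k) S (merge b φ ψ)) (merge-PHom e e-sym k S φ ψ inS≥1))))
        where
        inS≥1 : 1 ≤ inS S ψ
        inS≥1 with inS S ψ
        ... | zero = contradiction (≤-trans nk≥1 (≤-trans q (≤-reflexive (*-zeroʳ c₂)))) λ ()
        ... | suc _ = s≤s z≤n

  opaque
    blowup : ∀ k c → ∃ λ c′ → ∀ {n} (e : Rel n) S → Symm e → 1 ≤ n → n ^ k ≤ c * C e k S →
      n ^ m ≤ c′ * ∑V {m} (λ φ → ι (PHom? e k S φ))
    blowup = blowup-rec

-- Vertices of large degree in a relation or in its complement

deg : ∀ {n} → Rel n → Fin n → ℕ
deg e x = card (e x)

deg-split : ∀ {n} (e : Rel n) x → deg e x + deg (neg e) x ≡ n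
deg-split {n} e x = trans (sym (∑F-+ _ _)) (trans (∑F-cong (λ y → ⟦⟧+not (e x y))) (∑F-1 n))

deg≤n : ∀ {n} (e : Rel n) x → deg e x ≤ n
deg≤n e x = card≤n (e x)

neg-sym : ∀ {n} {e : Rel n} → Symm e → Symm (neg e)
neg-sym s x y = cong not (s x y)

-- Degree at least (1 + 1/K) n / r.
rich : ∀ {n} → Rel n → ℕ → ℕ → Fin n → Bool
rich {n} e K r x = does (suc K * n ≤? K * r * deg e x)

does-true : {P : Set} (d : Dec P) → does d ≡ true → P
does-true (yes p) _ = p

does-false : {P : Set} (d : Dec P) → does d ≡ false → ¬ P
does-false (no p) _ = p

∑∑-+ : ∀ {n k} (f g : Fin n → Fin k → ℕ) → ∑F (λ x → ∑F (λ y → f x y + g x y)) ≡ ∑F (λ x → ∑F (f x)) + ∑F (λ x → ∑F (g x))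
∑∑-+ f g = trans (∑F-cong (λ x → ∑F-+ (f x) (g x))) (∑F-+ _ _)

∑∑-mono : ∀ {n k} {f g : Fin n → Fin k → ℕ} → (∀ x y → f x y ≤ g x y) → ∑F (λ x → ∑F (f x)) ≤ ∑F (λ x → ∑F (g x))
∑∑-mono h = ∑F-mono (λ x → ∑F-mono (h x))

∑∑-cong : ∀ {n k} {f g : Fin n → Fin k → ℕ} → (∀ x y → f x y ≡ g x y) → ∑F (λ x → ∑F (f x)) ≡ ∑F (λ x → ∑F (g x))
∑∑-cong h = ∑F-cong (λ x → ∑F-cong (h x))

E-split : ∀ {n} (e : Rel n) S → E e S + E (neg e) S ≡ card S * card S
E-split e S = trans (sym (∑F-+ _ _)) (trans (∑F-cong (λ x → trans (sym (*-distribˡ-+ ⟦ S x ⟧ _ _)) (cong (⟦ S x ⟧ *_) (nbr-split e S x)))) (∑F-*ʳ (card S) _))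

-- Edges of the complement leaving S are limited by the edges it must have inside S.
cross-bound : ∀ {n} (e : Rel n) (S S′ : Fin n → Bool) L ρ → (∀ y → ⟦ S y ⟧ + ⟦ S′ y ⟧ ≤ 1) →
  (∀ x → S x ≡ true → L * suc ρ * deg (neg e) x ≤ suc L * n) →
  ¬ (n * n + L * ρ * (card S * card S) ≤ L * suc ρ * E e S) →
  L * suc ρ * ∑F (λ x → ⟦ S x ⟧ * card (nbr (neg e) S′ x)) + L * (card S * card S) ≤ n * n + suc L * n * card S
cross-bound {n} e S S′ L ρ disj low few = linear 0 (+-mono-≤ degs (<⇒≤ (≰⇒> few)))
    (subst (λ z → n * n + suc L * n * a + (L * suc ρ * (E (neg e) S + Z) + L * suc ρ * E e S) ≡ L * suc ρ * Z + L * z + (suc L * n * a + (n * n + L * ρ * z)) + 0)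
      (E-split e S) (l L ρ Z (E e S) (E (neg e) S) (n * n) (suc L * n * a)))
  where
  a = card S
  Z = ∑F (λ x → ⟦ S x ⟧ * card (nbr (neg e) S′ x))
  l : ∀ L ρ X E E′ nn p → nn + p + (L * suc ρ * (E′ + X) + L * suc ρ * E) ≡ L * suc ρ * X + L * (E + E′) + (p + (nn + L * ρ * (E + E′))) + 0
  l = solve-∀
  bool : ∀ s s′ b → ⟦ s ⟧ + ⟦ s′ ⟧ ≤ 1 → ⟦ s ∧ b ⟧ + ⟦ s′ ∧ b ⟧ ≤ ⟦ b ⟧
  bool true true b (s≤s ())
  bool true false b _ = ≤-reflexive (+-identityʳ _)
  bool false true b _ = ≤-refl
  bool false false b _ = z≤n
  open ≤-Reasoning
  degs : L * suc ρ * (E (neg e) S + Z) ≤ suc L * n * a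
  degs = begin
    L * suc ρ * (E (neg e) S + Z) ≡⟨ cong (L * suc ρ *_) (∑F-+ _ _) ⟨
    L * suc ρ * ∑F (λ x → ⟦ S x ⟧ * card (nbr (neg e) S x) + ⟦ S x ⟧ * card (nbr (neg e) S′ x)) ≡⟨ ∑F-*ˡ (L * suc ρ) _ ⟨
    ∑F (λ x → L * suc ρ * (⟦ S x ⟧ * card (nbr (neg e) S x) + ⟦ S x ⟧ * card (nbr (neg e) S′ x))) ≤⟨ ∑F-mono pt ⟩
    ∑F (λ x → suc L * n * ⟦ S x ⟧) ≡⟨ ∑F-*ˡ (suc L * n) _ ⟩
    suc L * n * a ∎
    where
    l₁ : ∀ k s a b → k * (s * a + s * b) ≡ s * (k * (a + b))
    l₁ = solve-∀
    pt : ∀ x → L * suc ρ * (⟦ S x ⟧ * card (nbr (neg e) S x) + ⟦ S x ⟧ * card (nbr (neg e) S′ x)) ≤ suc L * n * ⟦ S x ⟧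
    pt x with S x in eq
    ... | false = ≤-reflexive (trans (*-zeroʳ (L * suc ρ)) (sym (*-zeroʳ (suc L * n))))
    ... | true = ≤-trans (≤-reflexive (trans (l₁ (L * suc ρ) 1 (card (nbr (neg e) S x)) (card (nbr (neg e) S′ x))) (*-identityˡ _)))
      (≤-trans (mulˡ (L * suc ρ) (≤-trans (≤-reflexive (sym (∑F-+ _ _))) (∑F-mono (λ y → bool (S y) (S′ y) (not (e x y)) (disj y)))))
      (≤-trans (low x eq) (≤-reflexive (sym (*-identityʳ (suc L * n))))))

module Dichotomy (ρ ρ′ : ℕ) (r+r′<rr′ : suc (suc ρ + suc ρ′) ≤ suc ρ * suc ρ′) (lam : ℕ) (lam≥2 : 2 ≤ lam) where
  r r′ L : ℕ
  r = suc ρ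
  r′ = suc ρ′
  -- Chosen for `conclude`: there 12 (r + r′) n / L bounds the smaller of `A°` and `B°`, and n / L
  -- bounds `AB`; together they must stay below n / lam.
  L = lam * (12 * (r + r′) + 1)

  lam≤L : lam ≤ L
  lam≤L = ≤-trans (≤-reflexive (sym (*-identityʳ lam))) (mulˡ lam (m≤n+m 1 (12 * (r + r′))))

  r+r′≤L : r + r′ ≤ L
  r+r′≤L = ≤-trans (≤-trans (m≤m+n (r + r′) _) (m≤m+n (12 * (r + r′)) 1)) (≤-trans (≤-reflexive (sym (*-identityˡ (12 * (r + r′) + 1)))) (mulʳ (12 * (r + r′) + 1) (≤-trans (s≤s z≤n) lam≥2)))

  const : ℕ
  const = proj₁ (ramsey (suc r) (suc r′) L) + (proj₁ (turan-density ρ L) + proj₁ (turan-density ρ′ L))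

  module _ {n} (e : Rel n) (e-sym : Symm e) (n≥1 : 1 ≤ n) where
    A B A° B° : Fin n → Bool
    A = rich e L r′
    B = rich (neg e) L r
    A° x = not (B x)
    B° x = not (A x)

    A°-low : ∀ x → A° x ≡ true → L * r * deg (neg e) x < suc L * n
    A°-low x p = ≰⇒> (does-false (suc L * n ≤? L * r * deg (neg e) x) (Bool.not-injective p))

    B°-low : ∀ x → B° x ≡ true → L * r′ * deg e x < suc L * n
    B°-low x p = ≰⇒> (does-false (suc L * n ≤? L * r′ * deg e x) (Bool.not-injective p))

    -- A vertex poor on both sides would have n < (1 + 1/L)(1/r + 1/r′) n. By `r+r′<rr′` the second
    -- factor is at most (r + r′)/(r + r′ + 1), and L ≥ r + r′ brings the product down to 1.
    cover : ∀ x → A° x ≡ true → B° x ≡ true → ⊥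
    cover x p q = <⇒≱ both (linear 0 (+-mono-≤ (mulʳ (L * n) r+r′<rr′) (mulʳ n r+r′≤L))
        (subst (λ z → r′ * (L * r * d₂) + r * (L * r′ * d₁) + (suc (r + r′) * (L * z) + (r + r′) * z) ≡ (r + r′) * (suc L * z) + (r * r′ * (L * z) + L * z) + 0)
          (deg-split e x) (l L r r′ d₁ d₂)))
      where
      d₁ = deg e x
      d₂ = deg (neg e) x
      l : ∀ L r r′ d₁ d₂ → r′ * (L * r * d₂) + r * (L * r′ * d₁) + (suc (r + r′) * (L * (d₁ + d₂)) + (r + r′) * (d₁ + d₂))
        ≡ (r + r′) * (suc L * (d₁ + d₂)) + (r * r′ * (L * (d₁ + d₂)) + L * (d₁ + d₂)) + 0
      l = solve-∀
      l₂ : ∀ r r′ s → r′ * s + r * s ≡ (r + r′) * s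
      l₂ = solve-∀
      both : r′ * (L * r * d₂) + r * (L * r′ * d₁) < (r + r′) * (suc L * n)
      both = <-≤-trans (+-mono-<-≤ (*-monoʳ-< r′ (A°-low x p)) (mulˡ r (<⇒≤ (B°-low x q)))) (≤-reflexive (l₂ r r′ (suc L * n)))

    A°⊑A : A° ⊑ A
    A°⊑A x p with A x in eq
    ... | true = refl
    ... | false = ⊥-elim (cover x p (cong not eq))

    B°⊑B : B° ⊑ B
    B°⊑B x p with B x in eq
    ... | true = refl
    ... | false = ⊥-elim (cover x (cong not eq) p)

    -- By Ramsey's theorem `AB` is small, so `A°` and `B°` almost partition the vertices, say with
    -- sizes a and b. Few cliques in `A°` force about a²/r ordered non-edges inside it by the Turán
    -- density; since its vertices have at most about n/r non-neighbours, only about ab/r non-edges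
    -- lead to `B°`. Likewise only about ab/r′ edges run between the two. As 1/r + 1/r′ < 1, this
    -- cannot account for all ab pairs unless ab is small.
    dichotomy : ¬ (n ^ suc r ≤ const * C e (suc r) A) → ¬ (n ^ suc r′ ≤ const * C (neg e) (suc r′) B) →
      (lam * card B ≤ n) ⊎ (lam * card A ≤ n)
    dichotomy fewA fewB = fin (≤-total b a)
      where
      open ≤-Reasoning
      AB : Fin n → Bool
      AB x = A x ∧ B x
      a = card A°
      b = card B°
      c = card AB
      c₁ = proj₁ (ramsey (suc r) (suc r′) L)
      c₂ = proj₁ (turan-density ρ L)
      c₃ = proj₁ (turan-density ρ′ L)
      fewA-gen : ∀ {S k} → k ≤ const → S ⊑ A → ¬ (n ^ suc r ≤ k * C e (suc r) S)
      fewA-gen k≤ S⊑ h = fewA (≤-trans h (*-mono-≤ k≤ (C-mono e (suc r) S⊑)))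
      fewB-gen : ∀ {S k} → k ≤ const → S ⊑ B → ¬ (n ^ suc r′ ≤ k * C (neg e) (suc r′) S)
      fewB-gen k≤ S⊑ h = fewB (≤-trans h (*-mono-≤ k≤ (C-mono (neg e) (suc r′) S⊑)))
      Lc≤n : L * c ≤ n
      Lc≤n with n ≤? L * c
      ... | no q = <⇒≤ (≰⇒> q)
      ... | yes q with proj₂ (ramsey (suc r) (suc r′) L) e AB q
      ... | inj₁ h = ⊥-elim (fewA-gen (m≤m+n c₁ _) (λ x → ∧-elimˡ) h)
      ... | inj₂ h = ⊥-elim (fewB-gen (m≤m+n c₁ _) (λ x p → ∧-elimʳ {A x} p) h)
      part3 : ∀ x → (⟦ A° x ⟧ + ⟦ B° x ⟧) + ⟦ AB x ⟧ ≡ 1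
      part3 x with A x in eqA | B x in eqB
      ... | true | true = refl
      ... | true | false = refl
      ... | false | true = refl
      ... | false | false = ⊥-elim (cover x (cong not eqB) (cong not eqA))
      n≡ : a + b + c ≡ n
      n≡ = trans (cong (_+ c) (sym (∑F-+ _ _))) (trans (sym (∑F-+ _ _)) (trans (∑F-cong part3) (∑F-1 n)))
      disj : ∀ y → ⟦ A° y ⟧ + ⟦ B° y ⟧ ≤ 1
      disj y = ≤-trans (m≤m+n _ _) (≤-reflexive (part3 y))
      -- `X₂` counts the non-edges between `A°` and `B°` and `X₁`, through a double negation, the
      -- edges; together they are all pairs.
      X₂ = ∑F (λ x → ⟦ A° x ⟧ * card (nbr (neg e) B° x))
      X₁ = ∑F (λ x → ⟦ B° x ⟧ * card (nbr (neg (neg e)) A° x))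
      b₂ : L * r * X₂ + L * (a * a) ≤ n * n + suc L * n * a
      b₂ = cross-bound e A° B° L ρ disj (λ x p → <⇒≤ (A°-low x p))
        (λ h → fewA-gen (≤-trans (m≤m+n c₂ c₃) (m≤n+m _ c₁)) A°⊑A (proj₂ (turan-density ρ L) e A° e-sym n≥1 h))
      b₁ : L * r′ * X₁ + L * (b * b) ≤ n * n + suc L * n * b
      b₁ = cross-bound (neg e) B° A° L ρ′ (λ y → ≤-trans (≤-reflexive (+-comm ⟦ B° y ⟧ _)) (disj y))
        (λ x p → ≤-trans (mulˡ (L * r′) (≤-reflexive (∑F-cong (λ y → cong ⟦_⟧ (Bool.not-involutive (e x y)))))) (<⇒≤ (B°-low x p)))
        (λ h → fewB-gen (≤-trans (m≤n+m c₃ c₂) (m≤n+m _ c₁)) B°⊑B (proj₂ (turan-density ρ′ L) (neg e) B° (neg-sym e-sym) n≥1 h))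
      X-sum : X₁ + X₂ ≡ a * b
      X-sum = begin-equality
        X₁ + X₂ ≡⟨ cong₂ _+_ (∑F-cong (λ x → sym (∑F-*ˡ ⟦ B° x ⟧ _))) (∑F-cong (λ x → sym (∑F-*ˡ ⟦ A° x ⟧ _))) ⟩
        ∑F (λ y → ∑F (λ x → ⟦ B° y ⟧ * ⟦ A° x ∧ not (not (e y x)) ⟧)) + ∑F (λ x → ∑F (λ y → ⟦ A° x ⟧ * ⟦ B° y ∧ not (e x y) ⟧)) ≡⟨ cong (_+ ∑F (λ x → ∑F (λ y → ⟦ A° x ⟧ * ⟦ B° y ∧ not (e x y) ⟧))) (∑F-swap _) ⟩
        ∑F (λ x → ∑F (λ y → ⟦ B° y ⟧ * ⟦ A° x ∧ not (not (e y x)) ⟧)) + ∑F (λ x → ∑F (λ y → ⟦ A° x ⟧ * ⟦ B° y ∧ not (e x y) ⟧)) ≡⟨ ∑∑-+ _ _ ⟨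
        ∑F (λ x → ∑F (λ y → ⟦ B° y ⟧ * ⟦ A° x ∧ not (not (e y x)) ⟧ + ⟦ A° x ⟧ * ⟦ B° y ∧ not (e x y) ⟧)) ≡⟨ ∑∑-cong (λ x y → trans (cong (λ z → ⟦ B° y ⟧ * ⟦ A° x ∧ not (not z) ⟧ + ⟦ A° x ⟧ * ⟦ B° y ∧ not (e x y) ⟧) (e-sym y x)) (bool (A° x) (B° y) (e x y))) ⟩
        ∑F (λ x → ∑F (λ y → ⟦ A° x ⟧ * ⟦ B° y ⟧)) ≡⟨ ∑F-*∑F _ _ ⟨
        a * b ∎
        where
        bool : ∀ s s′ b → ⟦ s′ ⟧ * ⟦ s ∧ not (not b) ⟧ + ⟦ s ⟧ * ⟦ s′ ∧ not b ⟧ ≡ ⟦ s ⟧ * ⟦ s′ ⟧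
        bool true true true = refl
        bool true true false = refl
        bool true false true = refl
        bool true false false = refl
        bool false true true = refl
        bool false true false = refl
        bool false false true = refl
        bool false false false = refl
      tidy : ∀ a b X r → a + b + c ≡ n → a ≤ n → L * r * X + L * (a * a) ≤ n * n + suc L * n * a → L * r * X ≤ L * (a * b) + 3 * (n * n)
      tidy a b X r n≡′ a≤n h = linear 0 (+-mono-≤ (≤-trans h (≤-reflexive expand)) (+-mono-≤ (≤-trans (mulʳ a Lc≤n) na≤nn) na≤nn)) (l₁ (L * r * X) (L * (a * a)) (L * (a * b)) (L * c * a) (n * a) (n * n))
        where
        na≤nn : n * a ≤ n * n
        na≤nn = mulˡ n a≤n
        l₁ : ∀ x p q w y z → q + 3 * z + ((x + p) + (w + y)) ≡ x + ((z + (y + (p + q + w))) + (z + z)) + 0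
        l₁ = solve-∀
        l₂ : ∀ L a b c → L * (a * (a + b + c)) ≡ L * (a * a) + L * (a * b) + L * c * a
        l₂ = solve-∀
        l₃ : ∀ n L a → n * n + suc L * n * a ≡ n * n + (n * a + L * (a * n))
        l₃ = solve-∀
        expand : n * n + suc L * n * a ≡ n * n + (n * a + (L * (a * a) + L * (a * b) + L * c * a))
        expand = trans (l₃ n L a) (cong (λ z → n * n + (n * a + z)) (trans (cong (λ z → L * (a * z)) (sym n≡′)) (l₂ L a b c)))
      B₂ : L * r * X₂ ≤ L * (a * b) + 3 * (n * n)
      B₂ = tidy a b X₂ r n≡ (card≤n A°) b₂
      B₁ : L * r′ * X₁ ≤ L * (b * a) + 3 * (n * n)
      B₁ = tidy b a X₁ r′ (trans (cong (_+ c) (+-comm b a)) n≡) (card≤n B°) b₁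
      -- r′ times the first bound plus r times the second gives rr′ab ≤ (r + r′)ab up to the error;
      -- the surplus of rr′ over r + r′ leaves one copy of ab.
      Lab≤ : L * (a * b) ≤ 3 * (r + r′) * (n * n)
      Lab≤ = linear 0 (+-mono-≤ (mulˡ r′ B₂) (+-mono-≤ (mulˡ r B₁) (mulʳ (L * (a * b)) r+r′<rr′)))
        (subst (λ z → 3 * (r + r′) * (n * n) + (r′ * (L * r * X₂) + (r * (L * r′ * X₁) + suc (r + r′) * (L * (a * b)))) ≡
                      L * (a * b) + (r′ * (L * (a * b) + 3 * (n * n)) + (r * (L * (b * a) + 3 * (n * n)) + r * r′ * (L * z))) + 0) X-sum
          (l L r r′ X₁ X₂ a b (n * n)))
        where
        l : ∀ L r r′ X₁ X₂ a b nn → 3 * (r + r′) * nn + (r′ * (L * r * X₂) + (r * (L * r′ * X₁) + suc (r + r′) * (L * (a * b)))) ≡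
          L * (a * b) + (r′ * (L * (a * b) + 3 * nn) + (r * (L * (b * a) + 3 * nn) + r * r′ * (L * (X₁ + X₂)))) + 0
        l = solve-∀
      2c≤n : 2 * c ≤ n
      2c≤n = ≤-trans (mulʳ c (≤-trans lam≥2 lam≤L)) Lc≤n
      quarter : ∀ a b → a + b + c ≡ n → b ≤ a → n ≤ 4 * a
      quarter a b eq b≤a = linear 0 (+-mono-≤ 2c≤n (mulˡ 2 b≤a)) (subst (λ z → 4 * a + (2 * c + 2 * b) ≡ z + (z + 2 * a) + 0) eq (l a b c))
        where l : ∀ a b c → 4 * a + (2 * c + 2 * b) ≡ (a + b + c) + ((a + b + c) + 2 * a) + 0
              l = solve-∀
      conclude : ∀ a b → n ≤ 4 * a → L * (a * b) ≤ 3 * (r + r′) * (n * n) → lam * (b + c) ≤ n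
      conclude a b q h = *-cancelˡ-≤ (12 * (r + r′) + 1) ⦃ >-nonZero (m≤n+m 1 (12 * (r + r′))) ⦄ (begin
        (12 * (r + r′) + 1) * (lam * (b + c)) ≡⟨ l₁ (12 * (r + r′) + 1) lam b c ⟩
        L * b + L * c ≤⟨ +-mono-≤ Lb≤ Lc≤n ⟩
        12 * (r + r′) * n + n ≡⟨ l₂ (12 * (r + r′)) n ⟩
        (12 * (r + r′) + 1) * n ∎)
        where
        l₁ : ∀ k m b c → k * (m * (b + c)) ≡ m * k * b + m * k * c
        l₁ = solve-∀
        l₂ : ∀ k n → k * n + n ≡ (k + 1) * n
        l₂ = solve-∀
        l₄ : ∀ n L b → n * (L * b) ≡ L * b * n
        l₄ = solve-∀
        l₅ : ∀ L a b → L * b * (4 * a) ≡ 4 * (L * (a * b))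
        l₅ = solve-∀
        l₆ : ∀ k n → 4 * (3 * k * (n * n)) ≡ n * (12 * k * n)
        l₆ = solve-∀
        Lb≤ : L * b ≤ 12 * (r + r′) * n
        Lb≤ = *-cancelˡ-≤ n ⦃ >-nonZero n≥1 ⦄ (begin
          n * (L * b) ≡⟨ l₄ n L b ⟩
          L * b * n ≤⟨ mulˡ (L * b) q ⟩
          L * b * (4 * a) ≡⟨ l₅ L a b ⟩
          4 * (L * (a * b)) ≤⟨ mulˡ 4 h ⟩
          4 * (3 * (r + r′) * (n * n)) ≡⟨ l₆ (r + r′) n ⟩
          n * (12 * (r + r′) * n) ∎)
      cardB : card B ≤ b + c
      cardB = ≤-trans (∑F-mono pt) (≤-reflexive (∑F-+ _ _))
        where pt : ∀ x → ⟦ B x ⟧ ≤ ⟦ B° x ⟧ + ⟦ AB x ⟧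
              pt x with A x | B x
              ... | true | true = ≤-refl
              ... | true | false = z≤n
              ... | false | true = ≤-refl
              ... | false | false = z≤n
      cardA : card A ≤ a + c
      cardA = ≤-trans (∑F-mono pt) (≤-reflexive (∑F-+ _ _))
        where pt : ∀ x → ⟦ A x ⟧ ≤ ⟦ A° x ⟧ + ⟦ AB x ⟧
              pt x with A x | B x
              ... | true | true = ≤-refl
              ... | true | false = ≤-refl
              ... | false | true = z≤n
              ... | false | false = z≤n
      fin : (b ≤ a) ⊎ (a ≤ b) → (lam * card B ≤ n) ⊎ (lam * card A ≤ n)
      fin (inj₁ b≤a) = inj₁ (≤-trans (mulˡ lam cardB) (conclude a b (quarter a b n≡ b≤a) Lab≤))
      fin (inj₂ a≤b) = inj₂ (≤-trans (mulˡ lam cardA) (conclude b a (quarter b a (trans (cong (_+ c) (+-comm b a)) n≡) a≤b)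
        (≤-trans (≤-reflexive (cong (L *_) (*-comm b a))) Lab≤)))

-- Stability

cl-intro : ∀ {n k} (e : Rel n) S (Q : Vec (Fin n) k) → (∀ i → S (lookup Q i) ≡ true) →
  (∀ i j → i ≢ j → e (lookup Q i) (lookup Q j) ≡ true) → 1 ≤ cl e S Q
cl-intro e S [] h₁ h₂ = ≤-refl
cl-intro e S (x ∷ Q) h₁ h₂ = *-mono-≤ (≤-reflexive (cong ⟦_⟧ (sym (h₁ zero))))
  (cl-intro e (nbr e S x) Q (λ i → ∧-intro (h₁ (suc i)) (h₂ zero (suc i) λ ())) (λ i j i≢j → h₂ (suc i) (suc j) (i≢j ∘ Fin-suc-injective)))

1≤⟦⟧ : ∀ {b} → 1 ≤ ⟦ b ⟧ → b ≡ true
1≤⟦⟧ {true} _ = refl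

1≤*ˡ : ∀ {a b} → 1 ≤ a * b → 1 ≤ a
1≤*ˡ {suc a} _ = s≤s z≤n

1≤*ʳ : ∀ {a b} → 1 ≤ a * b → 1 ≤ b
1≤*ʳ {a} {b} h = 1≤*ˡ {b} {a} (≤-trans h (≤-reflexive (*-comm a b)))

cl-elim-∈ : ∀ {n k} (e : Rel n) S (Q : Vec (Fin n) k) → 1 ≤ cl e S Q → ∀ i → S (lookup Q i) ≡ true
cl-elim-∈ e S (x ∷ Q) h zero = 1≤⟦⟧ (1≤*ˡ h)
cl-elim-∈ e S (x ∷ Q) h (suc i) = ∧-elimˡ (cl-elim-∈ e (nbr e S x) Q (1≤*ʳ {⟦ S x ⟧} h) i)

cl-elim-adj : ∀ {n k} (e : Rel n) → Symm e → ∀ S (Q : Vec (Fin n) k) → 1 ≤ cl e S Q → ∀ i j → i ≢ j → e (lookup Q i) (lookup Q j) ≡ true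
cl-elim-adj e s S (x ∷ Q) h zero zero p = contradiction refl p
cl-elim-adj e s S (x ∷ Q) h zero (suc j) p = ∧-elimʳ {S (lookup Q j)} (cl-elim-∈ e (nbr e S x) Q (1≤*ʳ {⟦ S x ⟧} h) j)
cl-elim-adj e s S (x ∷ Q) h (suc i) zero p = trans (s _ _) (cl-elim-adj e s S (x ∷ Q) h zero (suc i) λ ())
cl-elim-adj e s S (x ∷ Q) h (suc i) (suc j) p = cl-elim-adj e s (nbr e S x) Q (1≤*ʳ {⟦ S x ⟧} h) i j (p ∘ cong suc)

adjAll-intro : ∀ {n k} (e : Rel n) y (Q : Vec (Fin n) k) → (∀ i → e y (lookup Q i) ≡ true) → 1 ≤ adjAll e y Q
adjAll-intro e y [] h = ≤-refl
adjAll-intro e y (x ∷ Q) h = *-mono-≤ (≤-reflexive (cong ⟦_⟧ (sym (h zero)))) (adjAll-intro e y Q (h ∘ suc))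

∑F-≥₂ : ∀ {n} (f : Fin n → ℕ) x y → x ≢ y → f x + f y ≤ ∑F f
∑F-≥₂ f zero zero p = contradiction refl p
∑F-≥₂ f zero (suc y) p rewrite ∑F-suc f = +-monoʳ-≤ (f zero) (∑F-≥ (f ∘ suc) y)
∑F-≥₂ f (suc x) zero p rewrite ∑F-suc f = ≤-trans (≤-reflexive (+-comm (f (suc x)) _)) (+-monoʳ-≤ (f zero) (∑F-≥ (f ∘ suc) x))
∑F-≥₂ f (suc x) (suc y) p rewrite ∑F-suc f = ≤-trans (∑F-≥₂ (f ∘ suc) x y (p ∘ cong suc)) (m≤n+m _ (f zero))

psize : ∀ {n r} → (Fin n → Fin r) → Fin r → ℕ
psize part i = ∑F (λ x → ι (part x ≟ i))

badPair : ∀ {n r} → Rel n → (Fin n → Fin r) → Fin n → Fin n → Bool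
badPair e part x y = if does (part x ≟ part y) then e x y else not (e x y)

record NearTuran {n} (e : Rel n) (r δ : ℕ) : Set where
  field
    part : Fin n → Fin r
    bad≤ : δ * ∑F (λ x → ∑F (λ y → ⟦ badPair e part x y ⟧)) ≤ n * n
    size≤ : ∀ i → δ * (r * psize part i) ≤ suc δ * n

psize-total : ∀ {n r} (part : Fin n → Fin r) → ∑F (psize part) ≡ n
psize-total {n} {r} part = trans (∑F-swap _) (trans (∑F-cong (λ x → trans (∑F-cong (λ i → trans (ι-cong (part x ≟ i) (i ≟ part x) sym sym) (sym (*-identityʳ _)))) (∑F-δ (part x) (λ _ → 1)))) (∑F-1 n))

psize-squares : ∀ {n r} (part : Fin n → Fin r) → ∑F (λ x → ∑F (λ y → ι (part x ≟ part y))) ≡ ∑F (λ i → psize part i * psize part i)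
psize-squares {n} {r} part = sym (begin
  ∑F (λ i → psize part i * psize part i) ≡⟨ ∑F-cong (λ i → ∑F-*∑F _ _) ⟩
  ∑F (λ i → ∑F (λ x → ∑F (λ y → ι (part x ≟ i) * ι (part y ≟ i)))) ≡⟨ ∑F-swap _ ⟩
  ∑F (λ x → ∑F (λ i → ∑F (λ y → ι (part x ≟ i) * ι (part y ≟ i)))) ≡⟨ ∑F-cong (λ x → ∑F-cong (λ i → trans (∑F-*ˡ (ι (part x ≟ i)) _) (cong (_* ∑F (λ y → ι (part y ≟ i))) (ι-cong (part x ≟ i) (i ≟ part x) sym sym)))) ⟩
  ∑F (λ x → ∑F (λ i → ι (i ≟ part x) * ∑F (λ y → ι (part y ≟ i)))) ≡⟨ ∑F-cong (λ x → ∑F-δ (part x) _) ⟩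
  ∑F (λ x → ∑F (λ y → ι (part y ≟ part x))) ≡⟨ ∑∑-cong (λ x y → ι-cong (part y ≟ part x) (part x ≟ part y) sym sym) ⟩
  ∑F (λ x → ∑F (λ y → ι (part x ≟ part y))) ∎)
  where open ≡-Reasoning

n²≤r∑p² : ∀ {n r} (part : Fin n → Fin r) → n * n ≤ r * ∑F (λ i → psize part i * psize part i)
n²≤r∑p² {n} {r} part = begin
  n * n ≡⟨ cong₂ _*_ (eq) (eq) ⟨
  ∑F (λ i → 1 * psize part i) * ∑F (λ i → 1 * psize part i) ≤⟨ cauchy (λ _ → 1) (psize part) ⟩
  ∑F {r} (λ _ → 1) * ∑F (λ i → 1 * (psize part i * psize part i)) ≡⟨ cong₂ _*_ (∑F-1 r) (∑F-cong (λ i → *-identityˡ _)) ⟩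
  r * ∑F (λ i → psize part i * psize part i) ∎
  where
  open ≤-Reasoning
  eq : ∑F (λ i → 1 * psize part i) ≡ n
  eq = trans (∑F-cong (λ i → *-identityˡ _)) (psize-total part)

module Stability (ρ δ lam : ℕ) (lam≥3 : 3 ≤ lam) (lam≥8r : 8 * (2 + ρ) ≤ lam)
  (lam≥24δ : 24 * δ ≤ lam) (lam≥rδ : (1 + 5 * (2 + ρ)) * δ ≤ lam) where
  r κ gcl const : ℕ
  r = 2 + ρ
  κ = lam
  gcl = proj₁ (turan-density ρ (4 * (2 + ρ)))
  const = gcl * (κ * suc r)

  module _ {n} (e : Rel n) (e-sym : Symm e) (n≥1 : 1 ≤ n) (A B : Fin n → Bool)
    (B-small : lam * card B ≤ n) (nB⊑A : (not ∘ B) ⊑ A)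
    (nB-low : ∀ x → not (B x) ≡ true → lam * r * deg (neg e) x ≤ suc lam * n)
    (few : ¬ (n ^ suc r ≤ const * C e (suc r) A)) where
    open ≤-Reasoning

    A° : Fin n → Bool
    A° = not ∘ B
    a = card A°
    β = card B

    a+β : a + β ≡ n
    a+β = trans (sym (∑F-+ _ _)) (trans (∑F-cong (λ x → trans (+-comm ⟦ not (B x) ⟧ _) (⟦⟧+not (B x)))) (∑F-1 n))

    E₂≤ : lam * r * E (neg e) A° ≤ suc lam * n * a
    E₂≤ = begin
      lam * r * E (neg e) A° ≡⟨ ∑F-*ˡ (lam * r) _ ⟨
      ∑F (λ x → lam * r * (⟦ A° x ⟧ * card (nbr (neg e) A° x))) ≤⟨ ∑F-mono pt ⟩
      ∑F (λ x → suc lam * n * ⟦ A° x ⟧) ≡⟨ ∑F-*ˡ (suc lam * n) _ ⟩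
      suc lam * n * a ∎
      where
      pt : ∀ x → lam * r * (⟦ A° x ⟧ * card (nbr (neg e) A° x)) ≤ suc lam * n * ⟦ A° x ⟧
      pt x with A° x in eq
      ... | false = ≤-reflexive (trans (*-zeroʳ (lam * r)) (sym (*-zeroʳ (suc lam * n))))
      ... | true = ≤-trans (mulˡ (lam * r) (≤-trans (≤-reflexive (*-identityˡ _)) (∑F-mono (λ y → ⟦⟧-mono (λ p → ∧-elimʳ {A° y} p)))))
        (≤-trans (nB-low x eq) (≤-reflexive (sym (*-identityʳ (suc lam * n)))))

    -- `A°` is almost everything and its vertices have at most about n/r non-neighbours, so its edge
    -- density is about 1 - 1/r. This is above the Turán value (r-2)/(r-1) for r-cliques, and θ = 4r
    -- leaves room for the errors.
    cliques : n ^ r ≤ gcl * C e r A°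
    cliques = proj₂ (turan-density ρ (4 * r)) e A° e-sym n≥1 hyp
      where
      h₁ : lam * n ≤ lam * a + n
      h₁ = linear 0 B-small (subst (λ z → lam * a + z + lam * β ≡ lam * z + z + 0) a+β (l lam a β))
        where l : ∀ m a b → m * a + (a + b) + m * b ≡ m * (a + b) + (a + b) + 0
              l = solve-∀
      h₂ : 8 * r * a ≤ lam * a
      h₂ = mulʳ a lam≥8r
      h₃ : 3 * n ≤ lam * n
      h₃ = mulʳ n lam≥3
      mid : lam * n + 8 * r * a ≤ 4 * lam * a + 4 * a
      mid = linear (lam * n + 4 * a) (+-mono-≤ h₂ (+-mono-≤ (mulˡ 3 h₁) h₃)) (l lam n a (8 * r * a))
        where l : ∀ m n a q → (4 * m * a + 4 * a) + (q + (3 * (m * n) + 3 * n)) ≡ m * n + q + (m * a + (3 * (m * a + n) + m * n)) + (m * n + 4 * a)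
              l = solve-∀
      tgt : lam * (n * n) + 4 * suc ρ * (suc lam * n * a) ≤ 4 * r * lam * (a * a)
      tgt = linear 0 (+-mono-≤ (mulˡ (4 * r * a) h₁) (mulˡ n mid)) (l lam n a ρ)
        where l : ∀ m n a ρ → 4 * (2 + ρ) * m * (a * a) + (4 * (2 + ρ) * a * (m * n) + n * (m * n + 8 * (2 + ρ) * a))
                ≡ m * (n * n) + 4 * suc ρ * (suc m * n * a) + (4 * (2 + ρ) * a * (m * a + n) + n * (4 * m * a + 4 * a)) + 0
              l = solve-∀
      hyp : n * n + 4 * r * ρ * (a * a) ≤ 4 * r * suc ρ * E e A°
      hyp = *-cancelˡ-≤ lam ⦃ >-nonZero (≤-trans (s≤s z≤n) lam≥3) ⦄ (linear 0 (+-mono-≤ tgt (mulˡ (4 * suc ρ) E₂≤))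
        (subst (λ z → lam * (4 * r * suc ρ * E e A°) + ((lam * (n * n) + 4 * suc ρ * (suc lam * n * a)) + 4 * suc ρ * (lam * r * E (neg e) A°))
            ≡ lam * (n * n + 4 * r * ρ * z) + (4 * r * lam * z + 4 * suc ρ * (suc lam * n * a)) + 0) (E-split e A°) (l lam (n * n) (suc lam * n * a) ρ (E e A°) (E (neg e) A°))))
        where l : ∀ m nn p ρ E E′ → m * (4 * (2 + ρ) * suc ρ * E) + ((m * nn + 4 * suc ρ * p) + 4 * suc ρ * (m * (2 + ρ) * E′))
                ≡ m * (nn + 4 * (2 + ρ) * ρ * (E + E′)) + (4 * (2 + ρ) * m * (E + E′) + 4 * suc ρ * p) + 0
              l = solve-∀

    joins : Vec (Fin n) r → Fin r → Fin n → Set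
    joins Q i y = ∀ j → j ≢ i → e y (lookup Q j) ≡ true

    joins? : ∀ Q i y → Dec (joins Q i y)
    joins? Q i y = all? (λ j → ¬? (j ≟ i) →-dec (e y (lookup Q j) Bool.≟ true))

    -- Both y and z may replace the i-th member of Q, so both belong to the class that this member
    -- represents: yz is an edge inside a class.
    Face : Vec (Fin n) r → Fin r → Fin n → Fin n → Set
    Face Q i y z = (A y ≡ true × A z ≡ true) × (e y z ≡ true × (joins Q i y × joins Q i z))

    face? : ∀ Q i y z → Dec (Face Q i y z)
    face? Q i y z = ((A y Bool.≟ true) ×-dec (A z Bool.≟ true)) ×-dec ((e y z Bool.≟ true) ×-dec (joins? Q i y ×-dec joins? Q i z))

    face : Vec (Fin n) r → Fin r → ℕ
    face Q i = ∑F (λ y → ∑F (λ z → ι (face? Q i y z)))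

    -- The factor n brings the number of extensions of Q to the scale n² of the number of faces.
    -- Both are to be small for the same Q.
    wt : Vec (Fin n) r → ℕ
    wt Q = n * ext e A Q + ∑F (face Q)

    -- Putting y in place of the i-th member of Q gives an r-clique that z extends; the factor n
    -- accounts for the forgotten member.
    face-sum : ∀ i → ∑V (λ Q → cl e A° Q * face Q i) ≤ n * C e (suc r) A
    face-sum i = begin
      ∑V (λ Q → cl e A° Q * face Q i) ≤⟨ ∑V-mono (λ Q → ≤-trans (≤-reflexive (trans (sym (∑F-*ˡ (cl e A° Q) _)) (∑F-cong (λ y → sym (∑F-*ˡ (cl e A° Q) _))))) (∑F-mono (λ y → ≤-trans (∑F-mono (pt Q y)) (≤-reflexive (∑F-*ˡ (cl e A (Q [ i ]≔ y)) _))))) ⟩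
      ∑V (λ Q → ∑F (λ y → cl e A (Q [ i ]≔ y) * ext e A (Q [ i ]≔ y))) ≡⟨ ∑V-update i (λ Q → cl e A Q * ext e A Q) ⟩
      n * ∑V {r} (λ Q → cl e A Q * ext e A Q) ≡⟨ cong (n *_) (C-ext e r A) ⟨
      n * C e (suc r) A ∎
      where
      pt : ∀ Q y z → cl e A° Q * ι (face? Q i y z) ≤ cl e A (Q [ i ]≔ y) * (⟦ A z ⟧ * adjAll e z (Q [ i ]≔ y))
      pt Q y z with ι-cases (face? Q i y z)
      ... | inj₂ (_ , eq) = ≤-trans (≤-reflexive (trans (cong (cl e A° Q *_) eq) (*-zeroʳ (cl e A° Q)))) z≤n
      ... | inj₁ (((Ay , Az) , (eyz , (jy , jz))) , eq) = ≤-trans (≤-reflexive (trans (cong (cl e A° Q *_) eq) (*-identityʳ (cl e A° Q)))) (aux (1 ≤? cl e A° Q))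
        where
        aux : Dec (1 ≤ cl e A° Q) → cl e A° Q ≤ cl e A (Q [ i ]≔ y) * (⟦ A z ⟧ * adjAll e z (Q [ i ]≔ y))
        aux (no q) = ≤-trans (≤-pred (≰⇒> q)) z≤n
        aux (yes q) = ≤-trans (cl≤1 e A° Q) (*-mono-≤ (cl-intro e A (Q [ i ]≔ y) g₁ g₂) (*-mono-≤ (≤-reflexive (cong ⟦_⟧ (sym Az))) (adjAll-intro e z (Q [ i ]≔ y) g₃)))
          where
          at : ∀ j → (j ≡ i × lookup (Q [ i ]≔ y) j ≡ y) ⊎ (j ≢ i × lookup (Q [ i ]≔ y) j ≡ lookup Q j)
          at j with j ≟ i
          ... | yes refl = inj₁ (refl , lookup∘update i Q y)
          ... | no p = inj₂ (p , lookup∘update′ p Q y)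
          g₁ : ∀ j → A (lookup (Q [ i ]≔ y) j) ≡ true
          g₁ j with at j
          ... | inj₁ (_ , p) = trans (cong A p) Ay
          ... | inj₂ (_ , p) = trans (cong A p) (nB⊑A _ (cl-elim-∈ e A° Q q j))
          g₂ : ∀ j k → j ≢ k → e (lookup (Q [ i ]≔ y) j) (lookup (Q [ i ]≔ y) k) ≡ true
          g₂ j k j≢k with at j | at k
          ... | inj₁ (p , _) | inj₁ (p′ , _) = contradiction (trans p (sym p′)) j≢k
          ... | inj₁ (_ , p) | inj₂ (k≢i , p′) = trans (cong₂ e p p′) (jy k k≢i)
          ... | inj₂ (j≢i , p) | inj₁ (_ , p′) = trans (cong₂ e p p′) (trans (e-sym _ _) (jy j j≢i))
          ... | inj₂ (_ , p) | inj₂ (_ , p′) = trans (cong₂ e p p′) (cl-elim-adj e e-sym A° Q q j k j≢k)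
          g₃ : ∀ j → e z (lookup (Q [ i ]≔ y) j) ≡ true
          g₃ j with at j
          ... | inj₁ (_ , p) = trans (cong (e z) p) (trans (e-sym z y) eyz)
          ... | inj₂ (j≢i , p) = trans (cong (e z) p) (jz j j≢i)

    wt-sum : ∑V (λ Q → cl e A° Q * wt Q) ≤ suc r * (n * C e (suc r) A)
    wt-sum = begin
      ∑V (λ Q → cl e A° Q * wt Q) ≡⟨ ∑V-cong (λ Q → trans (*-distribˡ-+ (cl e A° Q) (n * ext e A Q) _) (cong₂ _+_ (l (cl e A° Q) n _) (sym (∑F-*ˡ (cl e A° Q) _)))) ⟩
      ∑V (λ Q → n * (cl e A° Q * ext e A Q) + ∑F (λ i → cl e A° Q * face Q i)) ≡⟨ trans (∑V-+ _ _) (cong₂ _+_ (∑V-*ˡ n _) (∑VF-swap _)) ⟩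
      n * ∑V (λ Q → cl e A° Q * ext e A Q) + ∑F (λ i → ∑V (λ Q → cl e A° Q * face Q i)) ≤⟨ +-mono-≤ (mulˡ n (≤-trans (∑V-mono (λ Q → mulʳ (ext e A Q) (cl-mono e Q nB⊑A))) (≤-reflexive (sym (C-ext e r A))))) (∑F-≤const _ face-sum) ⟩
      n * C e (suc r) A + r * (n * C e (suc r) A) ∎
      where l : ∀ a b c → a * (b * c) ≡ b * (a * c)
            l = solve-∀

    wt-lt : ∑V (λ Q → κ * (cl e A° Q * wt Q)) < ∑V (λ Q → n * n * cl e A° Q)
    wt-lt = *-cancelˡ-< gcl (∑V (λ Q → κ * (cl e A° Q * wt Q))) (∑V (λ Q → n * n * cl e A° Q)) (begin-strict
        gcl * ∑V (λ Q → κ * (cl e A° Q * wt Q)) ≡⟨ cong (gcl *_) (∑V-*ˡ κ (λ Q → cl e A° Q * wt Q)) ⟩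
        gcl * (κ * ∑V (λ Q → cl e A° Q * wt Q)) ≤⟨ mulˡ gcl (mulˡ κ wt-sum) ⟩
        gcl * (κ * (suc r * (n * C e (suc r) A))) ≡⟨ l gcl κ (suc r) n (C e (suc r) A) ⟩
        n * (const * C e (suc r) A) <⟨ *-monoʳ-< n ⦃ >-nonZero n≥1 ⦄ (≰⇒> few) ⟩
        n * (n * n ^ r) ≤⟨ mulˡ n (mulˡ n cliques) ⟩
        n * (n * (gcl * C e r A°)) ≡⟨ l₂ n gcl (C e r A°) ⟩
        gcl * (n * n * C e r A°) ≡⟨ cong (gcl *_) (∑V-*ˡ (n * n) (cl e A°)) ⟨
        gcl * ∑V (λ Q → n * n * cl e A° Q) ∎)
      where
      l : ∀ a b c d f → a * (b * (c * (d * f))) ≡ d * (a * (b * c) * f)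
      l = solve-∀
      l₂ : ∀ n g c → n * (n * (g * c)) ≡ g * (n * n * c)
      l₂ = solve-∀

    pick : ∃ λ Q → 1 ≤ cl e A° Q × κ * wt Q ≤ n * n
    pick = proj₁ found , cases (cl e A° (proj₁ found)) (cl≤1 e A° (proj₁ found)) (proj₂ found)
      where
      found : ∃ λ Q → κ * (cl e A° Q * wt Q) < n * n * cl e A° Q
      found = ∑V-<-∃ (λ Q → κ * (cl e A° Q * wt Q)) (λ Q → n * n * cl e A° Q) wt-lt
      cases : ∀ {w} c → c ≤ 1 → κ * (c * w) < n * n * c → 1 ≤ c × κ * w ≤ n * n
      cases zero _ q = contradiction (≤-trans q (≤-reflexive (*-zeroʳ (n * n)))) λ ()
      cases {w} (suc zero) _ q = ≤-refl , <⇒≤ (≤-<-trans (mulˡ κ (≤-reflexive (sym (*-identityˡ w)))) (<-≤-trans q (≤-reflexive (*-identityʳ (n * n)))))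
      cases (suc (suc c)) (s≤s ()) q

    -- One clique Q of small weight organises all vertices. Its members together have little more
    -- than n non-neighbours, while few vertices are joined to all of Q; so nearly every vertex
    -- misses exactly one member of Q, and this member names its class. An edge inside a class is a
    -- face of Q, and a class consists of non-neighbours of one vertex up to exceptions, which
    -- bounds its size.
    near : NearTuran e r δ
    near = fromQ (proj₁ pick) (proj₁ (proj₂ pick)) (proj₂ (proj₂ pick))
      where
      fromQ : ∀ Q → 1 ≤ cl e A° Q → κ * wt Q ≤ n * n → NearTuran e r δ
      fromQ Q clQ wtQ = record { part = part ; bad≤ = bad≤ ; size≤ = size≤ }
        where
        miss : Fin n → Fin r → ℕ
        miss y i = ⟦ not (e y (lookup Q i)) ⟧
        #miss : Fin n → ℕ
        #miss y = ∑F (miss y)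
        part-of : ∀ y → Dec (∃ λ i → e y (lookup Q i) ≡ false) → Fin r
        part-of y (yes (i , _)) = i
        -- A default: a vertex that misses no member of Q is not `Reg` and is counted by `exc`.
        part-of y (no _) = zero
        missed? : ∀ y → Dec (∃ λ i → e y (lookup Q i) ≡ false)
        missed? y = any? (λ i → e y (lookup Q i) Bool.≟ false)
        part : Fin n → Fin r
        part y = part-of y (missed? y)
        Reg : Fin n → Set
        Reg y = A y ≡ true × #miss y ≡ 1
        reg? : ∀ y → Dec (Reg y)
        reg? y = (A y Bool.≟ true) ×-dec (#miss y ≟ℕ 1)
        exc : Fin n → ℕ
        exc y = ι (¬? (reg? y))
        xn = ∑F exc
        d₂ : Fin r → ℕ
        d₂ i = deg (neg e) (lookup Q i)
        part-missed : ∀ y → Reg y → e y (lookup Q (part y)) ≡ false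
        part-missed y (_ , m≡1) with missed? y
        ... | yes (i , p) = p
        ... | no q = contradiction (trans (sym m≡1) (trans (∑F-cong (λ i → cong (⟦_⟧ ∘ not) (Bool.¬-not (λ p → q (i , p))))) (∑F-0 r))) λ ()
        part-joins : ∀ y → Reg y → joins Q (part y) y
        part-joins y R j j≢ with e y (lookup Q j) in eq
        ... | true = refl
        ... | false = contradiction (≤-trans (≤-trans (≤-reflexive (cong₂ _+_ (sym (cong (⟦_⟧ ∘ not) eq)) (sym (cong (⟦_⟧ ∘ not) (part-missed y R))))) (∑F-≥₂ (miss y) j (part y) j≢)) (≤-reflexive (proj₂ R))) λ { (s≤s ()) }
        sum-miss : lam * ∑F #miss ≤ suc lam * n
        sum-miss = *-cancelˡ-≤ r (begin
          r * (lam * ∑F #miss) ≡⟨ l r lam (∑F #miss) ⟩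
          lam * r * ∑F #miss ≡⟨ cong (lam * r *_) (trans (∑F-swap _) (∑F-cong (λ i → ∑F-cong (λ y → cong (⟦_⟧ ∘ not) (e-sym y (lookup Q i)))))) ⟩
          lam * r * ∑F d₂ ≡⟨ ∑F-*ˡ (lam * r) d₂ ⟨
          ∑F (λ i → lam * r * d₂ i) ≤⟨ ∑F-≤const (suc lam * n) (λ i → nB-low _ (cl-elim-∈ e A° Q clQ i)) ⟩
          r * (suc lam * n) ∎)
          where l : ∀ a b c → a * (b * c) ≡ b * a * c
                l = solve-∀
        lam-ext : lam * ext e A Q ≤ n
        lam-ext = *-cancelˡ-≤ n ⦃ >-nonZero n≥1 ⦄ (≤-trans (≤-reflexive (l n lam _)) (≤-trans (mulˡ κ (m≤m+n (n * ext e A Q) _)) wtQ))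
          where l : ∀ a b c → a * (b * c) ≡ b * (a * c)
                l = solve-∀
        lam-face : lam * ∑F (face Q) ≤ n * n
        lam-face = ≤-trans (mulˡ κ (m≤n+m _ (n * ext e A Q))) wtQ
        -- A vertex with two misses pays for itself. One without misses lies in `B` or is an
        -- extension of Q inside `A`, whence the coefficients 2.
        exc-pt : ∀ y → 1 + exc y ≤ #miss y + (2 * ⟦ B y ⟧ + 2 * (⟦ A y ⟧ * adjAll e y Q))
        exc-pt y with ι-cases (¬? (reg? y))
        ... | inj₂ (q , eq) = ≤-trans (≤-reflexive (trans (cong suc eq) (sym (proj₂ (decidable-stable (reg? y) q))))) (m≤m+n _ _)
        ... | inj₁ (q , eq) = ≤-trans (≤-reflexive (cong suc eq)) (aux (A y Bool.≟ true))
          where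
          aux : Dec (A y ≡ true) → 2 ≤ #miss y + (2 * ⟦ B y ⟧ + 2 * (⟦ A y ⟧ * adjAll e y Q))
          aux (no p) = ≤-trans (≤-trans (≤-reflexive (cong (λ b → 2 * ⟦ b ⟧) (sym (By (B y) refl)))) (m≤m+n (2 * ⟦ B y ⟧) _)) (m≤n+m _ (#miss y))
            where By : ∀ b → B y ≡ b → B y ≡ true
                  By true q = q
                  By false q = contradiction (nB⊑A y (cong not q)) p
          aux (yes p) = by (#miss y) refl
            where
            rest = 2 * ⟦ B y ⟧ + 2 * (⟦ A y ⟧ * adjAll e y Q)
            hit : #miss y ≡ 0 → ∀ i b → e y (lookup Q i) ≡ b → e y (lookup Q i) ≡ true
            hit m≡ i true q = q
            hit m≡ i false q = contradiction (≤-trans (≤-reflexive (cong (⟦_⟧ ∘ not) (sym q))) (≤-trans (∑F-≥ (miss y) i) (≤-reflexive m≡))) λ ()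
            by : ∀ k → #miss y ≡ k → 2 ≤ #miss y + rest
            by zero m≡ = ≤-trans (mulˡ 2 (*-mono-≤ (≤-reflexive (cong ⟦_⟧ (sym p))) (adjAll-intro e y Q (λ i → hit m≡ i (e y (lookup Q i)) refl)))) (≤-trans (m≤n+m _ (2 * ⟦ B y ⟧)) (m≤n+m rest (#miss y)))
            by (suc zero) m≡ = contradiction (p , m≡) q
            by (suc (suc k)) m≡ = ≤-trans (s≤s (s≤s z≤n)) (≤-trans (≤-reflexive (sym m≡)) (m≤m+n (#miss y) rest))
        exc≤ : lam * xn ≤ 5 * n
        exc≤ = linear 0 (+-mono-≤ (mulˡ lam sum) (+-mono-≤ sum-miss (+-mono-≤ (mulˡ 2 B-small) (mulˡ 2 lam-ext)))) (l lam n xn (∑F #miss) β (ext e A Q))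
          where
          sum : n + xn ≤ ∑F #miss + (2 * β + 2 * ext e A Q)
          sum = begin
            n + xn ≡⟨ trans (∑F-+ _ _) (cong (_+ xn) (∑F-1 n)) ⟨
            ∑F (λ y → 1 + exc y) ≤⟨ ∑F-mono exc-pt ⟩
            ∑F (λ y → #miss y + (2 * ⟦ B y ⟧ + 2 * (⟦ A y ⟧ * adjAll e y Q))) ≡⟨ trans (∑F-+ _ _) (cong (∑F #miss +_) (trans (∑F-+ _ _) (cong₂ _+_ (∑F-*ˡ 2 _) (∑F-*ˡ 2 _)))) ⟩
            ∑F #miss + (2 * β + 2 * ext e A Q) ∎
          l : ∀ m n xn M β E → 5 * n + (m * (n + xn) + (m * M + (2 * (m * β) + 2 * (m * E)))) ≡ m * xn + (m * (M + (2 * β + 2 * E)) + (suc m * n + (2 * n + 2 * n))) + 0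
          l = solve-∀
        same diff : Fin n → Fin n → ℕ
        same y z = ι (part y ≟ part z)
        diff y z = ι (¬? (part y ≟ part z))
        bad₁ bad₂ same₂ D₂ : ℕ
        bad₁ = ∑F (λ y → ∑F (λ z → same y z * ⟦ e y z ⟧))
        same₂ = ∑F (λ y → ∑F (λ z → same y z * ⟦ not (e y z) ⟧))
        bad₂ = ∑F (λ y → ∑F (λ z → diff y z * ⟦ not (e y z) ⟧))
        D₂ = ∑F (λ y → deg (neg e) y)
        same+diff : ∀ y z → same y z + diff y z ≡ 1
        same+diff y z = ⟦⟧+not (does (part y ≟ part z))
        bad-split : ∑F (λ y → ∑F (λ z → ⟦ badPair e part y z ⟧)) ≡ bad₁ + bad₂
        bad-split = trans (∑∑-cong (λ y z → b (does (part y ≟ part z)) (e y z))) (∑∑-+ _ _)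
          where b : ∀ s c → ⟦ if s then c else not c ⟧ ≡ ⟦ s ⟧ * ⟦ c ⟧ + ⟦ not s ⟧ * ⟦ not c ⟧
                b true true = refl
                b true false = refl
                b false true = refl
                b false false = refl
        D₂-split : bad₂ + same₂ ≡ D₂
        D₂-split = trans (sym (∑∑-+ _ _)) (∑∑-cong (λ y z → trans (sym (*-distribʳ-+ ⟦ not (e y z) ⟧ (diff y z) (same y z))) (trans (cong (_* ⟦ not (e y z) ⟧) (trans (+-comm (diff y z) _) (same+diff y z))) (*-identityˡ _))))
        SS = ∑F (λ i → psize part i * psize part i)
        SS-split : bad₁ + same₂ ≡ SS
        SS-split = trans (sym (∑∑-+ _ _)) (trans (∑∑-cong (λ y z → trans (sym (*-distribˡ-+ (same y z) ⟦ e y z ⟧ _)) (trans (cong (same y z *_) (⟦⟧+not (e y z))) (*-identityʳ _)))) (psize-squares part))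
        D₂≤ : lam * r * D₂ ≤ suc lam * (n * n) + r * (n * n)
        D₂≤ = begin
          lam * r * D₂ ≡⟨ ∑F-*ˡ (lam * r) _ ⟨
          ∑F (λ y → lam * r * deg (neg e) y) ≤⟨ ∑F-mono (λ y → pt y) ⟩
          ∑F (λ y → suc lam * n + lam * r * n * ⟦ B y ⟧) ≡⟨ trans (∑F-+ _ _) (cong₂ _+_ (∑F-const n (suc lam * n)) (∑F-*ˡ (lam * r * n) _)) ⟩
          n * (suc lam * n) + lam * r * n * β ≡⟨ l n (suc lam) lam r β ⟩
          suc lam * (n * n) + r * n * (lam * β) ≤⟨ +-monoʳ-≤ (suc lam * (n * n)) (mulˡ (r * n) B-small) ⟩
          suc lam * (n * n) + r * n * n ≡⟨ cong (suc lam * (n * n) +_) (*-assoc r n n) ⟩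
          suc lam * (n * n) + r * (n * n) ∎
          where
          l : ∀ n m′ m r β → n * (m′ * n) + m * r * n * β ≡ m′ * (n * n) + r * n * (m * β)
          l = solve-∀
          pt : ∀ y → lam * r * deg (neg e) y ≤ suc lam * n + lam * r * n * ⟦ B y ⟧
          pt y with B y in eq
          ... | false = ≤-trans (nB-low y (cong not eq)) (m≤m+n _ _)
          ... | true = ≤-trans (mulˡ (lam * r) (deg≤n (neg e) y)) (≤-trans (≤-reflexive (sym (*-identityʳ (lam * r * n)))) (m≤n+m _ (suc lam * n)))
        bad₁≤ : lam * bad₁ ≤ 11 * (n * n)
        bad₁≤ = begin
          lam * bad₁ ≤⟨ mulˡ lam (∑∑-mono pt) ⟩
          lam * ∑F (λ y → ∑F (λ z → ∑F (λ i → ι (face? Q i y z)) + (exc y + exc z))) ≡⟨ cong (lam *_) (trans (∑∑-+ _ _) (cong₂ _+_ eq₁ (trans (∑∑-+ _ _) (cong₂ _+_ eq₂ (∑F-const n xn))))) ⟩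
          lam * (∑F (face Q) + (n * xn + n * xn)) ≡⟨ l lam (∑F (face Q)) n xn ⟩
          lam * ∑F (face Q) + 2 * (n * (lam * xn)) ≤⟨ +-mono-≤ lam-face (mulˡ 2 (mulˡ n exc≤)) ⟩
          n * n + 2 * (n * (5 * n)) ≡⟨ l₂ n ⟩
          11 * (n * n) ∎
          where
          l : ∀ m f n xn → m * (f + (n * xn + n * xn)) ≡ m * f + 2 * (n * (m * xn))
          l = solve-∀
          l₂ : ∀ n → n * n + 2 * (n * (5 * n)) ≡ 11 * (n * n)
          l₂ = solve-∀
          eq₁ : ∑F (λ y → ∑F (λ z → ∑F (λ i → ι (face? Q i y z)))) ≡ ∑F (face Q)
          eq₁ = trans (∑F-cong (λ y → ∑F-swap _)) (∑F-swap _)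
          eq₂ : ∑F (λ y → ∑F {n} (λ z → exc y)) ≡ n * xn
          eq₂ = trans (∑F-cong (λ y → ∑F-const n (exc y))) (∑F-*ˡ n exc)
          pt : ∀ y z → same y z * ⟦ e y z ⟧ ≤ ∑F (λ i → ι (face? Q i y z)) + (exc y + exc z)
          pt y z with ι-cases (¬? (reg? y)) | ι-cases (¬? (reg? z))
          ... | inj₁ (_ , p) | _ = ≤-trans (*-mono-≤ (⟦⟧≤1 (does (part y ≟ part z))) (⟦⟧≤1 (e y z))) (≤-trans (≤-reflexive (sym p)) (≤-trans (m≤m+n (exc y) (exc z)) (m≤n+m (exc y + exc z) (∑F (λ i → ι (face? Q i y z))))))
          ... | inj₂ _ | inj₁ (_ , p) = ≤-trans (*-mono-≤ (⟦⟧≤1 (does (part y ≟ part z))) (⟦⟧≤1 (e y z))) (≤-trans (≤-reflexive (sym p)) (≤-trans (m≤n+m (exc z) (exc y)) (m≤n+m (exc y + exc z) (∑F (λ i → ι (face? Q i y z))))))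
          ... | inj₂ (ny , _) | inj₂ (nz , _) = ι*≤ (part y ≟ part z) λ p → ≤-trans (⟦⟧≤ (e y z) λ q →
              ≤-trans (≤-reflexive (sym (ι-yes (face? Q (part y) y z) ((proj₁ ry , proj₁ rz) , (q , (part-joins y ry , subst (λ i → joins Q i z) (sym p) (part-joins z rz)))))))
                (∑F-≥ (λ i → ι (face? Q i y z)) (part y))) (m≤m+n _ _)
            where
            ry = decidable-stable (reg? y) ny
            rz = decidable-stable (reg? z) nz
            ⟦⟧≤ : ∀ b {k} → (b ≡ true → 1 ≤ k) → ⟦ b ⟧ ≤ k
            ⟦⟧≤ true f = f refl
            ⟦⟧≤ false f = z≤n
        -- The classes contain at least n²/r ordered pairs, nearly all of them non-edges, and there
        -- are only about n²/r ordered non-edges altogether. Few are left between classes.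
        bad₂≤ : lam * r * bad₂ ≤ suc r * (n * n) + lam * r * bad₁
        bad₂≤ = linear 0 (+-mono-≤ D₂≤ (mulˡ lam (n²≤r∑p² part)))
          (subst (λ z → suc r * (n * n) + lam * r * bad₁ + (lam * r * z + lam * (n * n)) ≡ lam * r * bad₂ + ((suc lam * (n * n) + r * (n * n)) + lam * (r * SS)) + 0) D₂-split
          (subst (λ z → suc r * (n * n) + lam * r * bad₁ + (lam * r * (bad₂ + same₂) + lam * (n * n)) ≡ lam * r * bad₂ + ((suc lam * (n * n) + r * (n * n)) + lam * (r * z)) + 0) SS-split
          (l lam r (n * n) bad₁ bad₂ same₂)))
          where l : ∀ m r nn b₁ b₂ s → suc r * nn + m * r * b₁ + (m * r * (b₂ + s) + m * nn) ≡ m * r * b₂ + ((suc m * nn + r * nn) + m * (r * (b₁ + s))) + 0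
                l = solve-∀
        lam-bad : lam * (bad₁ + bad₂) ≤ 24 * (n * n)
        lam-bad = *-cancelˡ-≤ r (linear (n * n + ρ * (n * n)) (+-mono-≤ bad₂≤ (mulˡ (2 * r) bad₁≤)) (l lam ρ (n * n) bad₁ bad₂))
          where l : ∀ m ρ nn b₁ b₂ → (2 + ρ) * (24 * nn) + (m * (2 + ρ) * b₂ + 2 * (2 + ρ) * (m * b₁)) ≡ (2 + ρ) * (m * (b₁ + b₂)) + ((3 + ρ) * nn + m * (2 + ρ) * b₁ + 2 * (2 + ρ) * (11 * nn)) + (nn + ρ * nn)
                l = solve-∀
        bad≤ : δ * ∑F (λ x → ∑F (λ y → ⟦ badPair e part x y ⟧)) ≤ n * n
        bad≤ = *-cancelˡ-≤ 24 (begin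
          24 * (δ * ∑F (λ x → ∑F (λ y → ⟦ badPair e part x y ⟧))) ≡⟨ *-assoc 24 δ _ ⟨
          24 * δ * ∑F (λ x → ∑F (λ y → ⟦ badPair e part x y ⟧)) ≤⟨ *-mono-≤ lam≥24δ (≤-reflexive bad-split) ⟩
          lam * (bad₁ + bad₂) ≤⟨ lam-bad ⟩
          24 * (n * n) ∎)
        size≤ : ∀ i → δ * (r * psize part i) ≤ suc δ * n
        size≤ i = *-cancelˡ-≤ lam ⦃ >-nonZero (≤-trans (s≤s z≤n) lam≥3) ⦄ (begin
          lam * (δ * (r * psize part i)) ≡⟨ l lam δ r (psize part i) ⟩
          δ * (lam * r * psize part i) ≤⟨ mulˡ δ (mulˡ (lam * r) p≤) ⟩
          δ * (lam * r * (d₂ i + xn)) ≡⟨ cong (δ *_) (l₂ lam r (d₂ i) xn) ⟩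
          δ * (lam * r * d₂ i + r * (lam * xn)) ≤⟨ mulˡ δ (+-mono-≤ (nB-low _ (cl-elim-∈ e A° Q clQ i)) (mulˡ r exc≤)) ⟩
          δ * (suc lam * n + r * (5 * n)) ≡⟨ l₃ δ r n lam ⟩
          lam * (δ * n) + (1 + 5 * r) * δ * n ≤⟨ +-monoʳ-≤ (lam * (δ * n)) (mulʳ n lam≥rδ) ⟩
          lam * (δ * n) + lam * n ≡⟨ l₄ lam δ n ⟩
          lam * (suc δ * n) ∎)
          where
          l : ∀ k d r p → k * (d * (r * p)) ≡ d * (k * r * p)
          l = solve-∀
          l₂ : ∀ m r d x → m * r * (d + x) ≡ m * r * d + r * (m * x)
          l₂ = solve-∀
          l₃ : ∀ d r n m → d * (suc m * n + r * (5 * n)) ≡ m * (d * n) + (1 + 5 * r) * d * n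
          l₃ = solve-∀
          l₄ : ∀ m d n → m * (d * n) + m * n ≡ m * (suc d * n)
          l₄ = solve-∀
          p≤ : psize part i ≤ d₂ i + xn
          p≤ = ≤-trans (∑F-mono pt) (≤-reflexive (∑F-+ _ _))
            where
            pt : ∀ y → ι (part y ≟ i) ≤ ⟦ not (e (lookup Q i) y) ⟧ + exc y
            pt y with ι-cases (¬? (reg? y))
            ... | inj₁ (_ , p) = ≤-trans (⟦⟧≤1 _) (≤-trans (≤-reflexive (sym p)) (m≤n+m (exc y) _))
            ... | inj₂ (ny , _) = ι≤ (part y ≟ i) λ p → ≤-trans (≤-reflexive (sym (cong (⟦_⟧ ∘ not) (trans (e-sym (lookup Q i) y) (trans (cong (λ j → e y (lookup Q j)) (sym p)) (part-missed y (decidable-stable (reg? y) ny))))))) (m≤m+n _ _)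

-- Counting homomorphisms

Hom : ∀ {h n} → Graph h → Rel n → Vec (Fin n) h → Set
Hom H e φ = ∀ i j → adj H i j ≡ true → e (lookup φ i) (lookup φ j) ≡ true

Inj : ∀ {h n} → Vec (Fin n) h → Set
Inj φ = ∀ i j → i ≢ j → lookup φ i ≢ lookup φ j

opaque
  Hom? : ∀ {h n} (H : Graph h) (e : Rel n) φ → Dec (Hom H e φ)
  Hom? H e φ = all? (λ i → all? (λ j → (adj H i j Bool.≟ true) →-dec (e (lookup φ i) (lookup φ j) Bool.≟ true)))

  Inj? : ∀ {h n} (φ : Vec (Fin n) h) → Dec (Inj φ)
  Inj? φ = all? (λ i → all? (λ j → ¬? (i ≟ j) →-dec ¬? (lookup φ i ≟ lookup φ j)))

InjHom? : ∀ {h n} (H : Graph h) (e : Rel n) φ → Dec (Inj φ × Hom H e φ)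
InjHom? H e φ = Inj? φ ×-dec Hom? H e φ

#inj : ℕ → ℕ → ℕ
#inj h n = ∑V {h} {n} (λ φ → ι (Inj? φ))

#hom #injhom : ∀ {h n} → Graph h → Rel n → ℕ
#hom H e = ∑V (λ φ → ι (Hom? H e φ))
#injhom H e = ∑V (λ φ → ι (InjHom? H e φ))

#inj≤ : ∀ h n → #inj h n ≤ n ^ h
#inj≤ h n = ≤-trans (∑V-mono (λ φ → ⟦⟧≤1 (does (Inj? φ)))) (≤-reflexive (∑V-1 h n))

ι-×≤ : {P Q : Set} (p : Dec P) (q : Dec Q) → ι (p ×-dec q) ≤ ι q
ι-×≤ p q = ι-mono (p ×-dec q) q proj₂

#injhom≤#hom : ∀ {h n} (H : Graph h) (e : Rel n) → #injhom H e ≤ #hom H e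
#injhom≤#hom H e = ∑V-mono (λ φ → ι-×≤ (Inj? φ) (Hom? H e φ))

-- Coordinate j is independent of the target `a φ` and hits it for one value in n.
collision : ∀ {h n} (a : Vec (Fin n) h → Fin n) j → (∀ φ z → a (φ [ j ]≔ z) ≡ a φ) →
  n * ∑V (λ φ → ι (lookup φ j ≟ a φ)) ≡ n ^ h
collision {h} {n} a j indep = begin
  n * ∑V (λ φ → ι (lookup φ j ≟ a φ)) ≡⟨ ∑V-update j (λ φ → ι (lookup φ j ≟ a φ)) ⟨
  ∑V (λ φ → ∑F (λ z → ι (lookup (φ [ j ]≔ z) j ≟ a (φ [ j ]≔ z)))) ≡⟨ ∑V-cong (λ φ → trans (∑F-cong (λ z → trans (cong₂ (λ p q → ι (p ≟ q)) (lookup∘update j φ z) (indep φ z)) (sym (*-identityʳ _)))) (∑F-δ (a φ) (λ _ → 1))) ⟩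
  ∑V {h} {n} (λ φ → 1) ≡⟨ ∑V-1 h n ⟩
  n ^ h ∎
  where open ≡-Reasoning

-- Substitutions that pin the coordinates in `D` at distinct values and leave the others alone. The
-- instances pin nothing, one vertex, or the two ends of an edge.
record Fixing {h n} (D : Fin h → Bool) (g : Vec (Fin n) h → Vec (Fin n) h) : Set where
  field
    free : ∀ φ i → D i ≡ false → lookup (g φ) i ≡ lookup φ i
    fixed : ∀ φ φ′ i → D i ≡ true → lookup (g φ) i ≡ lookup (g φ′) i
    distinct : ∀ φ i j → D i ≡ true → D j ≡ true → i ≢ j → lookup (g φ) i ≢ lookup (g φ) j

-- Union bound over pairs of coordinates: two pinned coordinates never agree, and in any other pair
-- a free coordinate meets the other value with probability 1/n.
noninj-bound : ∀ {h n} D (g : Vec (Fin n) h → Vec (Fin n) h) → Fixing D g →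
  n * ∑V (λ φ → ι (¬? (Inj? (g φ)))) ≤ h * h * n ^ h
noninj-bound {h} {n} D g fx = begin
  n * ∑V (λ φ → ι (¬? (Inj? (g φ)))) ≤⟨ mulˡ n (∑V-mono pt) ⟩
  n * ∑V (λ φ → ∑F (λ i → ∑F (λ j → ι (coll? φ i j)))) ≡⟨ cong (n *_) (trans (∑VF-swap _) (∑F-cong (λ i → ∑VF-swap _))) ⟩
  n * ∑F (λ i → ∑F (λ j → ∑V (λ φ → ι (coll? φ i j)))) ≡⟨ trans (sym (∑F-*ˡ n _)) (∑F-cong (λ i → sym (∑F-*ˡ n _))) ⟩
  ∑F (λ i → ∑F (λ j → n * ∑V (λ φ → ι (coll? φ i j)))) ≤⟨ ∑F-≤const (h * n ^ h) (λ i → ∑F-≤const (n ^ h) (λ j → each i j)) ⟩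
  h * (h * n ^ h) ≡⟨ *-assoc h h _ ⟨
  h * h * n ^ h ∎
  where
  open ≤-Reasoning
  open Fixing fx
  coll? : ∀ φ i j → Dec (i ≢ j × lookup (g φ) j ≡ lookup (g φ) i)
  coll? φ i j = ¬? (i ≟ j) ×-dec (lookup (g φ) j ≟ lookup (g φ) i)
  pt : ∀ φ → ι (¬? (Inj? (g φ))) ≤ ∑F (λ i → ∑F (λ j → ι (coll? φ i j)))
  pt φ = ι≤ (¬? (Inj? (g φ))) aux
    where
    S = ∑F (λ i → ∑F (λ j → ι (coll? φ i j)))
    aux : ¬ Inj (g φ) → 1 ≤ S
    aux ni with 1 ≤? S
    ... | yes p = p
    ... | no p = contradiction (λ i j i≢j q → p (≤-trans (≤-reflexive (sym (ι-yes (coll? φ i j) (i≢j , sym q))))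
        (≤-trans (∑F-≥ (λ j → ι (coll? φ i j)) j) (∑F-≥ (λ i → ∑F (λ j → ι (coll? φ i j))) i)))) ni
  zero-sum : ∀ i j → (∀ φ → ¬ (i ≢ j × lookup (g φ) j ≡ lookup (g φ) i)) → n * ∑V (λ φ → ι (coll? φ i j)) ≤ n ^ h
  zero-sum i j nc = ≤-trans (≤-reflexive (trans (cong (n *_) (trans (∑V-cong (λ φ → ι-no (coll? φ i j) (nc φ))) (∑V-0 h n))) (*-zeroʳ n))) z≤n
  via : ∀ i j → i ≢ j → D j ≡ false → n * ∑V (λ φ → ι (lookup (g φ) j ≟ lookup (g φ) i)) ≤ n ^ h
  via i j i≢j Dj = ≤-reflexive (trans (cong (n *_) (∑V-cong (λ φ → cong (λ z → ι (z ≟ lookup (g φ) i)) (free φ j Dj)))) (collision (λ φ → lookup (g φ) i) j indep))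
    where
    indep : ∀ φ z → lookup (g (φ [ j ]≔ z)) i ≡ lookup (g φ) i
    indep φ z with D i in Di
    ... | true = fixed _ _ i Di
    ... | false = trans (free _ i Di) (trans (lookup∘update′ i≢j φ z) (sym (free φ i Di)))
  each : ∀ i j → n * ∑V (λ φ → ι (coll? φ i j)) ≤ n ^ h
  each i j = go (i ≟ j) (D i) refl (D j) refl
    where
    go : Dec (i ≡ j) → ∀ bi → D i ≡ bi → ∀ bj → D j ≡ bj → n * ∑V (λ φ → ι (coll? φ i j)) ≤ n ^ h
    go (yes p) _ _ _ _ = zero-sum i j (λ φ q → proj₁ q p)
    go (no i≢j) _ _ false Dj = ≤-trans (mulˡ n (∑V-mono (λ φ → ι-mono (coll? φ i j) (lookup (g φ) j ≟ lookup (g φ) i) proj₂))) (via i j i≢j Dj)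
    go (no i≢j) true Di true Dj = zero-sum i j (λ φ q → distinct φ i j Di Dj i≢j (sym (proj₂ q)))
    go (no i≢j) false Di true Dj = ≤-trans (mulˡ n (∑V-mono (λ φ → ι-mono (coll? φ i j) (lookup (g φ) i ≟ lookup (g φ) j) (sym ∘ proj₂)))) (via j i (i≢j ∘ sym) Di)

fixing-id : ∀ {h n} → Fixing {h} {n} (λ _ → false) id
fixing-id = record { free = λ _ _ _ → refl ; fixed = λ _ _ _ () ; distinct = λ _ _ _ () }

fixing-1 : ∀ {h n} (v : Fin h) (x : Fin n) → Fixing (λ i → does (i ≟ v)) (λ φ → φ [ v ]≔ x)
fixing-1 v x = record
  { free = λ φ i p → lookup∘update′ (does-false (i ≟ v) p) φ x
  ; fixed = λ φ φ′ i p → trans (at φ i p) (sym (at φ′ i p))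
  ; distinct = λ φ i j p q i≢j → contradiction (trans (does-true (i ≟ v) p) (sym (does-true (j ≟ v) q))) i≢j }
  where
  at : ∀ φ i → does (i ≟ v) ≡ true → lookup (φ [ v ]≔ x) i ≡ x
  at φ i p = trans (cong (lookup (φ [ v ]≔ x)) (does-true (i ≟ v) p)) (lookup∘update v φ x)

-- Homomorphisms versus injective homomorphisms, along a substitution
hom≤injhom+ : ∀ {h n} (H : Graph h) (e : Rel n) D g → Fixing D g →
  n * ∑V (λ φ → ι (Hom? H e (g φ))) ≤ n * ∑V (λ φ → ι (InjHom? H e (g φ))) + h * h * n ^ h
hom≤injhom+ {h} {n} H e D g fx = begin
  n * ∑V (λ φ → ι (Hom? H e (g φ))) ≤⟨ mulˡ n (≤-trans (∑V-mono pt) (≤-reflexive (∑V-+ _ _))) ⟩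
  n * (∑V (λ φ → ι (InjHom? H e (g φ))) + ∑V (λ φ → ι (¬? (Inj? (g φ))))) ≡⟨ *-distribˡ-+ n _ _ ⟩
  n * ∑V (λ φ → ι (InjHom? H e (g φ))) + n * ∑V (λ φ → ι (¬? (Inj? (g φ)))) ≤⟨ +-monoʳ-≤ (n * ∑V (λ φ → ι (InjHom? H e (g φ)))) (noninj-bound D g fx) ⟩
  n * ∑V (λ φ → ι (InjHom? H e (g φ))) + h * h * n ^ h ∎
  where
  open ≤-Reasoning
  pt : ∀ φ → ι (Hom? H e (g φ)) ≤ ι (InjHom? H e (g φ)) + ι (¬? (Inj? (g φ)))
  pt φ = ι≤ (Hom? H e (g φ)) λ p → aux p (Inj? (g φ))
    where
    aux : Hom H e (g φ) → Dec (Inj (g φ)) → 1 ≤ ι (InjHom? H e (g φ)) + ι (¬? (Inj? (g φ)))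
    aux p (yes q) = ≤-trans (≤-reflexive (sym (ι-yes (InjHom? H e (g φ)) (q , p)))) (m≤m+n _ _)
    aux p (no q) = ≤-trans (≤-reflexive (sym (ι-yes (¬? (Inj? (g φ))) q))) (m≤n+m _ (ι (InjHom? H e (g φ))))

#inj-large : ∀ h n → 2 * (h * h) ≤ n → 1 ≤ n → n ^ h ≤ 2 * #inj h n
#inj-large h n n≥ n≥1 = *-cancelˡ-≤ n ⦃ >-nonZero n≥1 ⦄ (linear 0 (+-mono-≤ (mulʳ (n ^ h) n≥) (mulˡ 2 (noninj-bound (λ _ → false) id (fixing-id {h} {n}))))
    (subst (λ z → n * (2 * #inj h n) + (2 * (h * h) * n ^ h + 2 * (n * bad)) ≡ n * n ^ h + (n * z + 2 * (h * h * n ^ h)) + 0) tot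
      (subst (λ z → n * (2 * #inj h n) + (2 * (h * h) * n ^ h + 2 * (n * bad)) ≡ n * z + (n * (#inj h n + bad) + 2 * (h * h * n ^ h)) + 0) tot (l n (#inj h n) bad (h * h) (n ^ h)))))
  where
  bad = ∑V {h} {n} (λ φ → ι (¬? (Inj? φ)))
  tot : #inj h n + bad ≡ n ^ h
  tot = trans (sym (∑V-+ _ _)) (trans (∑V-cong (λ φ → ⟦⟧+not (does (Inj? φ)))) (∑V-1 h n))
  l : ∀ n i b hh q → n * (2 * i) + (2 * hh * q + 2 * (n * b)) ≡ n * (i + b) + (n * (i + b) + 2 * (hh * q)) + 0
  l = solve-∀

-- Homomorphisms of hairy graphs

⟦⟧≡ι : ∀ b → ⟦ b ⟧ ≡ ι (b Bool.≟ true)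
⟦⟧≡ι true = refl
⟦⟧≡ι false = refl

module _ {m t n} (F : Graph m) (f : Fin t → Fin m) (e : Rel n) where
  hairy-hom⇒ : ∀ (u : Vec (Fin n) m) (w : Vec (Fin n) t) → Hom (hairy F t f) e (u Vec.++ w) →
    Hom F e u × (∀ s → e (lookup u (f s)) (lookup w s) ≡ true)
  hairy-hom⇒ u w h = (λ i j p → trans (sym (cong₂ e (lookup-++ˡ u w i) (lookup-++ˡ u w j))) (h (i ↑ˡ t) (j ↑ˡ t) (trans (cong₂ (hairyAdj F f) (splitAt-↑ˡ m i t) (splitAt-↑ˡ m j t)) p))) ,
    λ s → trans (sym (cong₂ e (lookup-++ˡ u w (f s)) (lookup-++ʳ u w s))) (h (f s ↑ˡ t) (m ↑ʳ s) (trans (cong₂ (hairyAdj F f) (splitAt-↑ˡ m (f s) t) (splitAt-↑ʳ m t s)) (==-refl (f s))))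

  hairy-hom⇐ : Symm e → ∀ (u : Vec (Fin n) m) (w : Vec (Fin n) t) →
    Hom F e u → (∀ s → e (lookup u (f s)) (lookup w s) ≡ true) → Hom (hairy F t f) e (u Vec.++ w)
  hairy-hom⇐ e-sym u w h₁ h₂ i j p with splitAt m i | splitAt m j | lookup-splitAt m u w i | lookup-splitAt m u w j
  ... | inj₁ a | inj₁ b | q₁ | q₂ = trans (cong₂ e q₁ q₂) (h₁ a b p)
  ... | inj₁ a | inj₂ s | q₁ | q₂ = trans (cong₂ e q₁ q₂) (trans (cong (λ z → e (lookup u z) (lookup w s)) (sym (does-true (f s ≟ a) p))) (h₂ s))
  ... | inj₂ s | inj₁ a | q₁ | q₂ = trans (cong₂ e q₁ q₂) (trans (e-sym _ _) (trans (cong (λ z → e (lookup u z) (lookup w s)) (sym (does-true (f s ≟ a) p))) (h₂ s)))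

  hairs : Vec (Fin n) m → ℕ
  hairs u = ∏F (λ s → deg e (lookup u (f s)))

  -- Once the core is placed, the hairs choose neighbours of their stems independently.
  hair-sum : Symm e → ∀ u → ∑V (λ w → ι (Hom? (hairy F t f) e (u Vec.++ w))) ≡ ι (Hom? F e u) * hairs u
  hair-sum e-sym u = trans (∑V-cong split) (trans (∑V-*ˡ (ι (Hom? F e u)) _) (cong (ι (Hom? F e u) *_) (trans (∑V-cong (λ w → trans (ι-all-∏ (att? w)) (∏F-cong (λ s → sym (⟦⟧≡ι (e (lookup u (f s)) (lookup w s))))))) (∑V-∏ (λ s y → ⟦ e (lookup u (f s)) y ⟧)))))
    where
    att? : ∀ w s → Dec (e (lookup u (f s)) (lookup w s) ≡ true)
    att? w s = e (lookup u (f s)) (lookup w s) Bool.≟ true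
    split : ∀ w → ι (Hom? (hairy F t f) e (u Vec.++ w)) ≡ ι (Hom? F e u) * ι (all? (att? w))
    split w = trans (ι-cong (Hom? (hairy F t f) e (u Vec.++ w)) (Hom? F e u ×-dec all? (att? w)) (hairy-hom⇒ u w) (λ { (a , b) → hairy-hom⇐ e-sym u w a b })) (⟦∧⟧ (does (Hom? F e u)) (does (all? (att? w))))

  rooted-sum : Symm e → ∀ u₀ x → ∑V (λ φ → ι (Hom? (hairy F t f) e (φ [ u₀ ↑ˡ t ]≔ x))) ≡
    ∑V (λ u → ι (Hom? F e (u [ u₀ ]≔ x)) * hairs (u [ u₀ ]≔ x))
  rooted-sum e-sym u₀ x = trans (∑V-++ {m} {t} _) (∑V-cong (λ u → trans (∑V-cong (λ w → cong (λ z → ι (Hom? (hairy F t f) e z)) ([]≔-++-↑ˡ u w u₀))) (hair-sum e-sym (u [ u₀ ]≔ x))))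

  hom-sum : Symm e → #hom (hairy F t f) e ≡ ∑V (λ u → ι (Hom? F e u) * hairs u)
  hom-sum e-sym = trans (∑V-++ {m} {t} _) (∑V-cong (hair-sum e-sym))

-- Growth estimates

bernoulli : ∀ K t → K ^ t * (K + t) ≤ K * suc K ^ t
bernoulli K zero = ≤-reflexive (l K)
  where l : ∀ K → 1 * (K + 0) ≡ K * 1
        l = solve-∀
bernoulli K (suc t) = begin
  K * K ^ t * (K + suc t) ≤⟨ linear (K ^ t * t) z≤n (l₁ K (K ^ t) t) ⟩
  suc K * (K ^ t * (K + t)) ≤⟨ mulˡ (suc K) (bernoulli K t) ⟩
  suc K * (K * suc K ^ t) ≡⟨ *-left-comm (suc K) K (suc K ^ t) ⟩
  K * (suc K * suc K ^ t) ∎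
  where
  open ≤-Reasoning
  l₁ : ∀ K p t → suc K * (p * (K + t)) + 0 ≡ K * p * (K + suc t) + 0 + p * t
  l₁ = solve-∀

-- The linear terms of (t + 1)² are paid for by `bernoulli`. Quadratic growth is what `exp>linear`
-- needs in order to beat a linear factor.
bernoulli² : ∀ K t → 1 ≤ K → K ^ t * (t * t) ≤ 2 * (K * K) * suc K ^ t
bernoulli² K zero K≥1 = z≤n
bernoulli² K (suc t) K≥1 = linear (K * K ^ t) (+-mono-≤ (mulˡ K (bernoulli² K t K≥1)) (+-mono-≤ (mulˡ (2 * K) (bernoulli K t)) (mulˡ (2 * K * K ^ t) K≥1)))
  (l K (K ^ t) t (suc K ^ t))
  where
  l : ∀ K p t s → 2 * (K * K) * (suc K * s) + (K * (p * (t * t)) + (2 * K * (p * (K + t)) + 2 * K * p * 1))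
    ≡ K * p * (suc t * suc t) + (K * (2 * (K * K) * s) + (2 * K * (K * s) + 2 * K * p * K)) + K * p
  l = solve-∀

opaque
  exp>linear : ∀ K b d → 1 ≤ K → ∃ λ t₀ → ∀ t → t₀ ≤ t → K ^ t * (b + d * t) < suc K ^ t
  exp>linear K b d K≥1 = t₀ , main
    where
    t₀ : ℕ
    -- Beyond this value t² exceeds 2K²(b + d)t, and `bernoulli²` converts t² into the power.
    t₀ = suc (2 * (K * K) * (b + d))
    main : ∀ t → t₀ ≤ t → K ^ t * (b + d * t) < suc K ^ t
    main t t≥ = *-cancelˡ-< (2 * (K * K)) (K ^ t * (b + d * t)) (suc K ^ t) (begin-strict
      2 * (K * K) * (K ^ t * (b + d * t)) ≡⟨ *-left-comm (2 * (K * K)) (K ^ t) (b + d * t) ⟩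
      K ^ t * (2 * (K * K) * (b + d * t)) ≤⟨ mulˡ (K ^ t) (mulˡ (2 * (K * K)) (+-monoˡ-≤ (d * t) (≤-trans (≤-reflexive (sym (*-identityʳ b))) (mulˡ b t≥1)))) ⟩
      K ^ t * (2 * (K * K) * (b * t + d * t)) ≡⟨ cong (K ^ t *_) (l₂ (2 * (K * K)) b d t) ⟩
      K ^ t * (2 * (K * K) * (b + d) * t) <⟨ *-monoʳ-< (K ^ t) ⦃ m^n≢0 K t ⦃ >-nonZero K≥1 ⦄ ⦄ (*-monoˡ-< t ⦃ >-nonZero t≥1 ⦄ t≥) ⟩
      K ^ t * (t * t) ≤⟨ bernoulli² K t K≥1 ⟩
      2 * (K * K) * suc K ^ t ∎)
      where
      open ≤-Reasoning
      t≥1 : 1 ≤ t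
      t≥1 = ≤-trans (s≤s z≤n) t≥
      l₂ : ∀ a b c d → a * (b * d + c * d) ≡ a * (b + c) * d
      l₂ = solve-∀

-- As long as 2jr ≤ n, the higher terms of the binomial expansion are covered by doubling the linear
-- one.
bernoulli-upper : ∀ n r j → 2 * (j * r) ≤ n → (n + r) ^ j * n ≤ n ^ j * (n + 2 * (j * r))
bernoulli-upper n r zero _ = ≤-reflexive (cong (1 *_) (sym (+-identityʳ n)))
bernoulli-upper n r (suc j) q = ≤-trans (≤-reflexive (l₁ ((n + r) ^ j) n r)) (≤-trans (mulˡ (n + r) (bernoulli-upper n r j q′)) (linear 0 (mulˡ (n ^ j) (mulˡ r q′)) (l₂ (n ^ j) n r j)))
  where
  q′ : 2 * (j * r) ≤ n
  q′ = ≤-trans (mulˡ 2 (m≤n+m (j * r) r)) q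
  l₁ : ∀ q n r → (n + r) * q * n ≡ (n + r) * (q * n)
  l₁ = solve-∀
  l₂ : ∀ p n r j → n * p * (n + 2 * (suc j * r)) + p * (r * (2 * (j * r))) ≡ (n + r) * (p * (n + 2 * (j * r))) + p * (r * n) + 0
  l₂ = solve-∀

near-power : ∀ n r t → 1 ≤ n → 2 * (t * r) ≤ n → (n + r) ^ t ≤ 2 * n ^ t
near-power n r t n≥1 h = *-cancelʳ-≤ _ _ n ⦃ >-nonZero n≥1 ⦄ (≤-trans (bernoulli-upper n r t h)
  (≤-trans (mulˡ (n ^ t) (+-monoʳ-≤ n h)) (≤-reflexive (l (n ^ t) n))))
  where
  l : ∀ p n → p * (n + n) ≡ 2 * p * n
  l = solve-∀

-- The objective with denominators cleared

-- Competitors may have loops, which complements bring about. The objectives to which this is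
-- applied count injective homomorphisms of loopless graphs and do not see the diagonal.
Minimal : ∀ {n} → (Rel n → ℕ) → Rel n → Set
Minimal obj e = ∀ e′ → Symm e′ → obj e ≤ obj e′

objective′ : ∀ {h₁ h₂ n} → Graph h₁ → Graph h₂ → ℕ → ℕ → Rel n → ℕ
objective′ {h₁} {h₂} {n} H₁ H₂ α β e = α * #inj h₂ n * #injhom H₁ e + β * #inj h₁ n * #injhom H₂ (neg e)

#injhom-cong : ∀ {h n} (H : Graph h) {e e′ : Rel n} → (∀ x y → e x y ≡ e′ x y) → #injhom H e ≡ #injhom H e′
#injhom-cong H {e} {e′} eq = ∑V-cong (λ φ → ι-cong (InjHom? H e φ) (InjHom? H e′ φ)
  (λ { (a , b) → a , λ i j p → trans (sym (eq _ _)) (b i j p) }) (λ { (a , b) → a , λ i j p → trans (eq _ _) (b i j p) }))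

-- Replacing the vertex x by a copy of y

module Clone {n} (x : Fin n) where
  σ : Fin n → Fin n → Fin n
  σ y p = if does (p ≟ x) then y else p

  σ-x : ∀ y → σ y x ≡ y
  σ-x y = cong (if_then y else x) (dec-true (x ≟ x) refl)

  σ-≢ : ∀ y {p} → p ≢ x → σ y p ≡ p
  σ-≢ y {p} p≢x = cong (if_then y else p) (dec-false (p ≟ x) p≢x)

  cloned : Rel n → Fin n → Rel n
  cloned e y p q = e (σ y p) (σ y q)

  avoid? : ∀ {h} (φ : Vec (Fin n) h) → Dec (∀ v → lookup φ v ≢ x)
  avoid? φ = all? (λ v → ¬? (lookup φ v ≟ x))

  module _ {h} (H : Graph h) (e : Rel n) where
    avoiding hitting : ℕ
    avoiding = ∑V (λ φ → ι (InjHom? H e φ ×-dec avoid? φ))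
    hitting = ∑V (λ φ → ι (InjHom? H e φ ×-dec ¬? (avoid? φ)))

    avoiding+hitting : avoiding + hitting ≡ #injhom H e
    avoiding+hitting = trans (sym (∑V-+ _ _)) (∑V-cong (λ φ → b (does (InjHom? H e φ)) (does (avoid? φ))))
      where b : ∀ p q → ⟦ p ∧ q ⟧ + ⟦ p ∧ not q ⟧ ≡ ⟦ p ⟧
            b true q = ⟦⟧+not q
            b false q = refl

    hit-sum : 1 ≤ n → ∀ v → ∑F (λ y → ∑V (λ φ → ι (lookup φ v ≟ x) * ι (Hom? H e (φ [ v ]≔ y)))) ≡ #hom H e
    hit-sum n≥1 v = *-cancelˡ-≡ _ _ n ⦃ >-nonZero n≥1 ⦄ (begin
      n * ∑F (λ y → ∑V (λ φ → ι (lookup φ v ≟ x) * ι (Hom? H e (φ [ v ]≔ y)))) ≡⟨ ∑F-*ˡ n _ ⟨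
      ∑F (λ y → n * ∑V (λ φ → ι (lookup φ v ≟ x) * ι (Hom? H e (φ [ v ]≔ y)))) ≡⟨ ∑F-cong (λ y → ∑V-fix v x (λ φ → ι (Hom? H e (φ [ v ]≔ y)))) ⟨
      ∑F (λ y → ∑V (λ φ → ι (Hom? H e ((φ [ v ]≔ x) [ v ]≔ y)))) ≡⟨ ∑F-cong (λ y → ∑V-cong (λ φ → cong (λ z → ι (Hom? H e z)) ([]≔-idempotent φ v))) ⟩
      ∑F (λ y → ∑V (λ φ → ι (Hom? H e (φ [ v ]≔ y)))) ≡⟨ ∑VF-swap _ ⟨
      ∑V (λ φ → ∑F (λ y → ι (Hom? H e (φ [ v ]≔ y)))) ≡⟨ ∑V-update v (λ φ → ι (Hom? H e φ)) ⟩
      n * #hom H e ∎)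
      where open ≡-Reasoning

    -- A copy in the cloned relation uses x at one vertex v at most, and sending v to y instead
    -- gives a homomorphism into `e`. The copy may already use y, so injectivity can be lost: hence
    -- `Hom?` in the second summand.
    clone-pt : ∀ y φ → ι (InjHom? H (cloned e y) φ) ≤ ι (InjHom? H e φ ×-dec avoid? φ) + ∑F (λ v → ι (lookup φ v ≟ x) * ι (Hom? H e (φ [ v ]≔ y)))
    clone-pt y φ = ι≤ (InjHom? H (cloned e y) φ) λ { (inj , hom) → go inj hom (any? (λ v → lookup φ v ≟ x)) }
      where
      rhs = ∑F (λ v → ι (lookup φ v ≟ x) * ι (Hom? H e (φ [ v ]≔ y)))
      go : Inj φ → Hom H (cloned e y) φ → Dec (∃ λ v → lookup φ v ≡ x) → 1 ≤ ι (InjHom? H e φ ×-dec avoid? φ) + rhs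
      go inj hom (no q) = ≤-trans (≤-reflexive (sym (ι-yes (InjHom? H e φ ×-dec avoid? φ) ((inj , hom′) , λ v p → q (v , p))))) (m≤m+n _ rhs)
        where
        hom′ : Hom H e φ
        hom′ i j p = trans (sym (cong₂ e (σ-≢ y (λ r → q (i , r))) (σ-≢ y (λ r → q (j , r))))) (hom i j p)
      go inj hom (yes (v , p)) = ≤-trans (≤-trans (≤-reflexive (sym (cong₂ _*_ (ι-yes (lookup φ v ≟ x) p) (ι-yes (Hom? H e (φ [ v ]≔ y)) hom′))))
          (∑F-≥ (λ v → ι (lookup φ v ≟ x) * ι (Hom? H e (φ [ v ]≔ y))) v)) (m≤n+m rhs _)
        where
        val : ∀ i → lookup (φ [ v ]≔ y) i ≡ σ y (lookup φ i)
        val i with i ≟ v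
        ... | yes refl = trans (lookup∘update v φ y) (sym (trans (cong (σ y) p) (σ-x y)))
        ... | no i≢v = trans (lookup∘update′ i≢v φ y) (sym (σ-≢ y (λ r → inj i v i≢v (trans r (sym p)))))
        hom′ : Hom H e (φ [ v ]≔ y)
        hom′ i j r = trans (cong₂ e (val i) (val j)) (hom i j r)

    clone-sum : 1 ≤ n → ∑F (λ y → #injhom H (cloned e y)) ≤ n * avoiding + h * #hom H e
    clone-sum n≥1 = begin
      ∑F (λ y → #injhom H (cloned e y)) ≤⟨ ∑F-mono (λ y → ≤-trans (∑V-mono (clone-pt y)) (≤-reflexive (trans (∑V-+ _ _) (cong (avoiding +_) (∑VF-swap _))))) ⟩
      ∑F (λ y → avoiding + ∑F (λ v → ∑V (λ φ → ι (lookup φ v ≟ x) * ι (Hom? H e (φ [ v ]≔ y))))) ≡⟨ trans (∑F-+ _ _) (cong₂ _+_ (∑F-const n avoiding) (∑F-swap _)) ⟩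
      n * avoiding + ∑F (λ v → ∑F (λ y → ∑V (λ φ → ι (lookup φ v ≟ x) * ι (Hom? H e (φ [ v ]≔ y))))) ≡⟨ cong (n * avoiding +_) (trans (∑F-cong (hit-sum n≥1)) (∑F-const h (#hom H e))) ⟩
      n * avoiding + h * #hom H e ∎
      where open ≤-Reasoning

    rooted≤hitting : ∀ v → ∑V (λ φ → ι (InjHom? H e (φ [ v ]≔ x))) ≤ n * hitting
    rooted≤hitting v = ≤-trans (≤-reflexive (∑V-fix v x (λ φ → ι (InjHom? H e φ)))) (mulˡ n (∑V-mono (λ φ → ι*≤ (lookup φ v ≟ x) λ p →
      ι-mono (InjHom? H e φ) (InjHom? H e φ ×-dec ¬? (avoid? φ)) (λ q → q , λ av → av v p))))

-- In a minimiser every vertex carries about the same number of weighted copies; the bound is the average over all clones.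
module _ {h₁ h₂ n} (H₁ : Graph h₁) (H₂ : Graph h₂) (α β : ℕ) (e : Rel n) (e-sym : Symm e)
  (min : Minimal (objective′ H₁ H₂ α β) e) (n≥1 : 1 ≤ n) where

  clone-bound : ∀ h → h₁ ≤ h → h₂ ≤ h → ∀ x v →
    α * #inj h₂ n * (n * ∑V (λ φ → ι (Hom? H₁ e (φ [ v ]≔ x)))) ≤
    h * (n * objective′ H₁ H₂ α β e) + suc h * (α * #inj h₂ n * (h₁ * h₁ * n ^ h₁) + β * #inj h₁ n * (h₂ * h₂ * n ^ h₂))
  clone-bound h h₁≤h h₂≤h x v = linear 0 (+-mono-≤ step₂ (+-mono-≤ (mulˡ A rooted) z≤n))
      (l A B n h R Hi₁ I₁ I₂ (h₁ * h₁ * n ^ h₁) (h₂ * h₂ * n ^ h₂))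
    where
    open Clone x
    open ≤-Reasoning
    A = α * #inj h₂ n
    B = β * #inj h₁ n
    I₁ = #injhom H₁ e
    I₂ = #injhom H₂ (neg e)
    Av₁ = avoiding H₁ e
    Av₂ = avoiding H₂ (neg e)
    Hi₁ = hitting H₁ e
    Hi₂ = hitting H₂ (neg e)
    Ho₁ = #hom H₁ e
    Ho₂ = #hom H₂ (neg e)
    R = ∑V (λ φ → ι (Hom? H₁ e (φ [ v ]≔ x)))
    -- The clones of all y are competitors at once; summing over y replaces the vertex x by an
    -- average vertex.
    average : n * (A * I₁ + B * I₂) ≤ A * (n * Av₁ + h₁ * Ho₁) + B * (n * Av₂ + h₂ * Ho₂)
    average = begin
      n * (A * I₁ + B * I₂) ≡⟨ ∑F-const n _ ⟨
      ∑F {n} (λ y → A * I₁ + B * I₂) ≤⟨ ∑F-mono (λ y → min (cloned e y) (λ p q → e-sym (σ y p) (σ y q))) ⟩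
      ∑F (λ y → A * #injhom H₁ (cloned e y) + B * #injhom H₂ (cloned (neg e) y)) ≡⟨ trans (∑F-+ _ _) (cong₂ _+_ (∑F-*ˡ A _) (∑F-*ˡ B _)) ⟩
      A * ∑F (λ y → #injhom H₁ (cloned e y)) + B * ∑F (λ y → #injhom H₂ (cloned (neg e) y)) ≤⟨ +-mono-≤ (mulˡ A (clone-sum H₁ e n≥1)) (mulˡ B (clone-sum H₂ (neg e) n≥1)) ⟩
      A * (n * Av₁ + h₁ * Ho₁) + B * (n * Av₂ + h₂ * Ho₂) ∎
    -- Copies that avoid x occur on both sides and cancel. The copies of H₂ through x are dropped,
    -- being on the smaller side.
    step₁ : A * (n * Hi₁) ≤ A * (h * Ho₁) + B * (h * Ho₂)
    step₁ = ≤-trans (linear (B * (n * Hi₂)) average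
      (subst (λ z → A * (h₁ * Ho₁) + B * (h₂ * Ho₂) + n * (A * z + B * I₂) ≡ A * (n * Hi₁) + (A * (n * Av₁ + h₁ * Ho₁) + B * (n * Av₂ + h₂ * Ho₂)) + B * (n * Hi₂)) (avoiding+hitting H₁ e)
        (subst (λ z → A * (h₁ * Ho₁) + B * (h₂ * Ho₂) + n * (A * (Av₁ + Hi₁) + B * z) ≡ A * (n * Hi₁) + (A * (n * Av₁ + h₁ * Ho₁) + B * (n * Av₂ + h₂ * Ho₂)) + B * (n * Hi₂)) (avoiding+hitting H₂ (neg e))
          (l₁ A B n Av₁ Hi₁ Av₂ Hi₂ (h₁ * Ho₁) (h₂ * Ho₂)))))
      (+-mono-≤ (mulˡ A (mulʳ Ho₁ h₁≤h)) (mulˡ B (mulʳ Ho₂ h₂≤h)))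
      where
      l₁ : ∀ A B n a b c d p q → A * p + B * q + n * (A * (a + b) + B * (c + d)) ≡ A * (n * b) + (A * (n * a + p) + B * (n * c + q)) + B * (n * d)
      l₁ = solve-∀
    step₂ : n * (A * (n * Hi₁)) ≤ A * (h * (n * I₁ + h₁ * h₁ * n ^ h₁)) + B * (h * (n * I₂ + h₂ * h₂ * n ^ h₂))
    step₂ = begin
      n * (A * (n * Hi₁)) ≤⟨ mulˡ n step₁ ⟩
      n * (A * (h * Ho₁) + B * (h * Ho₂)) ≡⟨ l₂ A B n h Ho₁ Ho₂ ⟩
      A * (h * (n * Ho₁)) + B * (h * (n * Ho₂)) ≤⟨ +-mono-≤ (mulˡ A (mulˡ h (hom≤injhom+ H₁ e (λ _ → false) id fixing-id))) (mulˡ B (mulˡ h (hom≤injhom+ H₂ (neg e) (λ _ → false) id fixing-id))) ⟩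
      A * (h * (n * I₁ + h₁ * h₁ * n ^ h₁)) + B * (h * (n * I₂ + h₂ * h₂ * n ^ h₂)) ∎
      where
      l₂ : ∀ A B n h p q → n * (A * (h * p) + B * (h * q)) ≡ A * (h * (n * p)) + B * (h * (n * q))
      l₂ = solve-∀
    rooted : n * R ≤ n * (n * Hi₁) + h₁ * h₁ * n ^ h₁
    rooted = ≤-trans (hom≤injhom+ H₁ e _ _ (fixing-1 v x)) (+-monoˡ-≤ (h₁ * h₁ * n ^ h₁) (mulˡ n (rooted≤hitting H₁ e v)))
    l : ∀ A B n h R H I J p q → h * (n * (A * I + B * J)) + suc h * (A * p + B * q) + (n * (A * (n * H)) + (A * (n * R) + 0))
      ≡ A * (n * R) + ((A * (h * (n * I + p)) + B * (h * (n * J + q))) + (A * (n * (n * H) + p) + B * q)) + 0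
    l = solve-∀

  -- The point is that the bound is linear in h, hence in the number of hairs; the lower-order terms
  -- of `clone-bound` disappear in the assumption that n is large in terms of the hairs.
  vertex-bound : ∀ h c → h₁ ≤ h → h₂ ≤ h → objective′ H₁ H₂ α β e ≤ c * (n ^ h₁ * n ^ h₂) → 2 * (h₂ * h₂) ≤ n →
    suc h * (α * (h₁ * h₁) + β * (h₂ * h₂)) ≤ n →
    ∀ x v → α * ∑V (λ φ → ι (Hom? H₁ e (φ [ v ]≔ x))) ≤ 2 * (h * c + 1) * n ^ h₁
  vertex-bound h c h₁≤h h₂≤h obj≤ n≥ n≥′ x v = *-cancelˡ-≤ (n * N₂) ⦃ m*n≢0 n N₂ ⦃ >-nonZero n≥1 ⦄ ⦃ m^n≢0 n h₂ ⦃ >-nonZero n≥1 ⦄ ⦄ ⦄ (begin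
    n * N₂ * (α * R) ≡⟨ l₁ n N₂ α R ⟩
    N₂ * (α * (n * R)) ≤⟨ mulʳ (α * (n * R)) (#inj-large h₂ n n≥ n≥1) ⟩
    2 * P₂ * (α * (n * R)) ≡⟨ l₂ P₂ α (n * R) ⟩
    2 * (α * P₂ * (n * R)) ≤⟨ mulˡ 2 (clone-bound h h₁≤h h₂≤h x v) ⟩
    2 * (h * (n * objective′ H₁ H₂ α β e) + suc h * (α * P₂ * (h₁ * h₁ * N₁) + β * P₁ * (h₂ * h₂ * N₂))) ≤⟨ mulˡ 2 (+-mono-≤ (mulˡ h (mulˡ n obj≤)) (mulˡ (suc h) (+-mono-≤ (mulʳ (h₁ * h₁ * N₁) (mulˡ α (#inj≤ h₂ n))) (mulʳ (h₂ * h₂ * N₂) (mulˡ β (#inj≤ h₁ n)))))) ⟩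
    2 * (h * (n * (c * (N₁ * N₂))) + suc h * (α * N₂ * (h₁ * h₁ * N₁) + β * N₁ * (h₂ * h₂ * N₂))) ≡⟨ l₃ h n c N₁ N₂ α β (h₁ * h₁) (h₂ * h₂) ⟩
    2 * (h * c * n + suc h * (α * (h₁ * h₁) + β * (h₂ * h₂))) * (N₁ * N₂) ≤⟨ mulʳ (N₁ * N₂) (mulˡ 2 (+-monoʳ-≤ (h * c * n) n≥′)) ⟩
    2 * (h * c * n + n) * (N₁ * N₂) ≡⟨ l₄ (h * c) n N₁ N₂ ⟩
    n * N₂ * (2 * (h * c + 1) * N₁) ∎)
    where
    open ≤-Reasoning
    N₁ = n ^ h₁
    N₂ = n ^ h₂
    P₁ = #inj h₁ n
    P₂ = #inj h₂ n
    R = ∑V (λ φ → ι (Hom? H₁ e (φ [ v ]≔ x)))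
    l₁ : ∀ n N α R → n * N * (α * R) ≡ N * (α * (n * R))
    l₁ = solve-∀
    l₂ : ∀ P α R → 2 * P * (α * R) ≡ 2 * (α * P * R)
    l₂ = solve-∀
    l₃ : ∀ h n c N M α β p q → 2 * (h * (n * (c * (N * M))) + suc h * (α * M * (p * N) + β * N * (q * M))) ≡ 2 * (h * c * n + suc h * (α * p + β * q)) * (N * M)
    l₃ = solve-∀
    l₄ : ∀ hc n N M → 2 * (hc * n + n) * (N * M) ≡ n * M * (2 * (hc + 1) * N)
    l₄ = solve-∀

-- Balanced complete multipartite relations

sameRel multi : ∀ {n r} → (Fin n → Fin r) → Rel n
sameRel part x y = does (part x ≟ part y)
multi part = neg (sameRel part)

sameRel-sym : ∀ {n r} (part : Fin n → Fin r) → Symm (sameRel part)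
sameRel-sym part x y = ==-sym (part x) (part y)

min-part : ∀ {n r} (part : Fin n → Fin r) → 1 ≤ r → ∃ λ i → r * psize part i ≤ n
min-part {n} {r} part r≥1 = proj₁ found , ≤-pred (proj₂ found)
  where
  lt : ∑F (λ i → r * psize part i) < ∑F {r} (λ _ → suc n)
  lt = subst₂ _<_ (sym (trans (∑F-*ˡ r _) (cong (r *_) (psize-total part)))) (sym (∑F-const r (suc n))) (*-monoʳ-< r ⦃ >-nonZero r≥1 ⦄ (n<1+n n))
  found = ∑F-<-∃ (λ i → r * psize part i) (λ _ → suc n) lt

-- Greedy: each new vertex joins a class of at most average size, so no class ever exceeds the
-- average by more than one.
balanced : ∀ n r → 1 ≤ r → ∃ λ (part : Fin n → Fin r) → ∀ i → r * psize part i ≤ n + r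
balanced zero r r≥1 = (λ ()) , λ i → ≤-trans (≤-reflexive (trans (cong (r *_) (∑F-zero _)) (*-zeroʳ r))) z≤n
balanced (suc n) r r≥1 with balanced n r r≥1
... | part , bal = part′ , bal′
  where
  i₀ = proj₁ (min-part part r≥1)
  part′ : Fin (suc n) → Fin r
  part′ zero = i₀
  part′ (suc x) = part x
  bal′ : ∀ i → r * psize part′ i ≤ suc n + r
  bal′ i = ≤-trans (≤-reflexive (cong (r *_) (∑F-suc (λ x → ι (part′ x ≟ i))))) (go (i₀ ≟ i))
    where
    go : Dec (i₀ ≡ i) → r * (ι (i₀ ≟ i) + psize part i) ≤ suc n + r
    go (yes p) = ≤-trans (≤-reflexive (trans (cong (λ z → r * (z + psize part i)) (ι-yes (i₀ ≟ i) p)) (*-distribˡ-+ r 1 (psize part i))))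
      (≤-trans (+-mono-≤ (≤-reflexive (*-identityʳ r)) (≤-trans (subst (λ j → r * psize part j ≤ n) p (proj₂ (min-part part r≥1))) (n≤1+n n))) (≤-reflexive (+-comm r (suc n))))
    go (no p) = ≤-trans (≤-reflexive (cong (λ z → r * (z + psize part i)) (ι-no (i₀ ≟ i) p))) (≤-trans (bal i) (n≤1+n (n + r)))

hom-multi⇒colourable : ∀ {h n r} (H : Graph h) (part : Fin n → Fin r) (e : Rel n) → (∀ x y → e x y ≡ true → part x ≢ part y) →
  ∀ φ → Hom H e φ → Colourable H r
hom-multi⇒colourable H part e proper φ hom = (λ i → part (lookup φ i)) , λ i j p → proper _ _ (hom i j p)

multi-proper : ∀ {n r} (part : Fin n → Fin r) x y → multi part x y ≡ true → part x ≢ part y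
multi-proper part x y p = does-false (part x ≟ part y) (Bool.not-injective p)

no-hom : ∀ {h n r} (H : Graph h) (part : Fin n → Fin r) (e : Rel n) → (∀ x y → e x y ≡ true → part x ≢ part y) →
  ¬ Colourable H r → #injhom H e ≡ 0
no-hom {h} {n} H part e proper nc = trans (∑V-cong (λ φ → ι-no (InjHom? H e φ) (λ p → nc (hom-multi⇒colourable H part e proper φ (proj₂ p))))) (∑V-0 h n)

hairy-uncolourable : ∀ {m t c} (F : Graph m) (f : Fin t → Fin m) → ¬ Colourable F c → ¬ Colourable (hairy F t f) c
hairy-uncolourable {m} {t} F f nc (col , proper) = nc ((λ i → col (i ↑ˡ t)) , λ i j p → proper _ _ (trans (cong₂ (hairyAdj F f) (splitAt-↑ˡ m i t) (splitAt-↑ˡ m j t)) p))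

-- The competitor is a balanced complete r-partite relation, which has no copy of H₁. In its
-- complement each hair of H₂ has at most n/r + 1 choices, which cancels the weight `r ^ a₂` up to
-- `r ^ m₂`; the rounding of all t₂ hairs together costs the factor 2. The resulting constant does
-- not depend on the hairs.
upper-bound : ∀ {m₁ m₂ t₁ t₂ n} (F₁ : Graph m₁) (F₂ : Graph m₂) (f₁ : Fin t₁ → Fin m₁) (f₂ : Fin t₂ → Fin m₂) r α a₂ →
  1 ≤ r → 1 ≤ n → ¬ Colourable F₁ r → a₂ ≤ m₂ + t₂ → 2 * (t₂ * r) ≤ n → ∀ e →
  Minimal (objective′ {n = n} (hairy F₁ t₁ f₁) (hairy F₂ t₂ f₂) α (r ^ a₂)) e →
  objective′ (hairy F₁ t₁ f₁) (hairy F₂ t₂ f₂) α (r ^ a₂) e ≤ 2 * r ^ m₂ * (n ^ (m₁ + t₁) * n ^ (m₂ + t₂))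
upper-bound {m₁} {m₂} {t₁} {t₂} {n} F₁ F₂ f₁ f₂ r α a₂ r≥1 n≥1 nc a₂≤ n≥ e min = begin
  objective′ H₁ H₂ α (r ^ a₂) e ≤⟨ min (multi part) (neg-sym (sameRel-sym part)) ⟩
  α * #inj h₂ n * #injhom H₁ (multi part) + r ^ a₂ * #inj h₁ n * #injhom H₂ (neg (multi part)) ≡⟨ cong₂ _+_ (trans (cong (α * #inj h₂ n *_) (no-hom H₁ part (multi part) (multi-proper part) (hairy-uncolourable F₁ f₁ nc))) (*-zeroʳ (α * #inj h₂ n))) (cong (r ^ a₂ * #inj h₁ n *_) (#injhom-cong H₂ (λ x y → Bool.not-involutive (sameRel part x y)))) ⟩
  r ^ a₂ * #inj h₁ n * #injhom H₂ (sameRel part) ≤⟨ *-mono-≤ (*-mono-≤ (^-monoʳ-≤ r ⦃ >-nonZero r≥1 ⦄ a₂≤) (#inj≤ h₁ n)) (#injhom≤#hom H₂ (sameRel part)) ⟩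
  r ^ (m₂ + t₂) * n ^ h₁ * #hom H₂ (sameRel part) ≡⟨ cong₂ (λ p q → p * n ^ h₁ * q) (^-distribˡ-+-* r m₂ t₂) (hom-sum F₂ f₂ (sameRel part) (sameRel-sym part)) ⟩
  r ^ m₂ * r ^ t₂ * n ^ h₁ * ∑V (λ u → ι (Hom? F₂ (sameRel part) u) * hairs F₂ f₂ (sameRel part) u) ≡⟨ l₁ (r ^ m₂) (r ^ t₂) (n ^ h₁) _ ⟩
  r ^ m₂ * n ^ h₁ * (r ^ t₂ * ∑V (λ u → ι (Hom? F₂ (sameRel part) u) * hairs F₂ f₂ (sameRel part) u)) ≤⟨ mulˡ (r ^ m₂ * n ^ h₁) homs ⟩
  r ^ m₂ * n ^ h₁ * (n ^ m₂ * (2 * n ^ t₂)) ≡⟨ l₂ (r ^ m₂) (n ^ h₁) (n ^ m₂) (n ^ t₂) ⟩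
  2 * r ^ m₂ * (n ^ h₁ * (n ^ m₂ * n ^ t₂)) ≡⟨ cong (λ z → 2 * r ^ m₂ * (n ^ h₁ * z)) (^-distribˡ-+-* n m₂ t₂) ⟨
  2 * r ^ m₂ * (n ^ h₁ * n ^ h₂) ∎
  where
  open ≤-Reasoning
  h₁ = m₁ + t₁
  h₂ = m₂ + t₂
  H₁ = hairy F₁ t₁ f₁
  H₂ = hairy F₂ t₂ f₂
  part : Fin n → Fin r
  part = proj₁ (balanced n r r≥1)
  l₁ : ∀ a b c d → a * b * c * d ≡ a * c * (b * d)
  l₁ = solve-∀
  l₂ : ∀ a b c d → a * b * (c * (2 * d)) ≡ 2 * a * (b * (c * d))
  l₂ = solve-∀
  deg≤ : ∀ x → r * deg (sameRel part) x ≤ n + r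
  deg≤ x = ≤-trans (≤-reflexive (cong (r *_) (∑F-cong (λ y → ι-cong (part x ≟ part y) (part y ≟ part x) sym sym)))) (proj₂ (balanced n r r≥1) (part x))
  hairs≤ : ∀ u → r ^ t₂ * hairs F₂ f₂ (sameRel part) u ≤ 2 * n ^ t₂
  hairs≤ u = begin
    r ^ t₂ * hairs F₂ f₂ (sameRel part) u ≡⟨ trans (cong (_* hairs F₂ f₂ (sameRel part) u) (sym (∏F-const t₂ r))) (sym (∏F-* (λ _ → r) (λ s → deg (sameRel part) (lookup u (f₂ s))))) ⟩
    ∏F (λ s → r * deg (sameRel part) (lookup u (f₂ s))) ≤⟨ ∏F-mono (λ s → deg≤ (lookup u (f₂ s))) ⟩
    ∏F {t₂} (λ _ → n + r) ≡⟨ ∏F-const t₂ (n + r) ⟩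
    (n + r) ^ t₂ ≤⟨ near-power n r t₂ n≥1 n≥ ⟩
    2 * n ^ t₂ ∎
  homs : r ^ t₂ * ∑V (λ u → ι (Hom? F₂ (sameRel part) u) * hairs F₂ f₂ (sameRel part) u) ≤ n ^ m₂ * (2 * n ^ t₂)
  homs = begin
    r ^ t₂ * ∑V (λ u → ι (Hom? F₂ (sameRel part) u) * hairs F₂ f₂ (sameRel part) u) ≤⟨ mulˡ (r ^ t₂) (∑V-mono (λ u → ι*≤ (Hom? F₂ (sameRel part) u) (λ _ → ≤-refl))) ⟩
    r ^ t₂ * ∑V (λ u → hairs F₂ f₂ (sameRel part) u) ≡⟨ ∑V-*ˡ (r ^ t₂) _ ⟨
    ∑V (λ u → r ^ t₂ * hairs F₂ f₂ (sameRel part) u) ≤⟨ ∑V-mono hairs≤ ⟩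
    ∑V {m₂} {n} (λ _ → 2 * n ^ t₂) ≡⟨ ∑V-const m₂ n (2 * n ^ t₂) ⟩
    n ^ m₂ * (2 * n ^ t₂) ∎

-- The parameters attached to a pair of hairy graphs; a₁, a₂ are the exponents in the objective.
record Pair {m₁ m₂} (F₁ : Graph m₁) (F₂ : Graph m₂) : Set where
  field
    t₁ t₂ : ℕ
    f₁ : Fin t₁ → Fin m₁
    f₂ : Fin t₂ → Fin m₂
    a₁ a₂ : ℕ
    t₁≤a₁ : t₁ ≤ a₁
    a₁≤ : a₁ ≤ m₁ + t₁
    t₂≤a₂ : t₂ ≤ a₂
    a₂≤ : a₂ ≤ m₂ + t₂

module _ {m₁ m₂} {F₁ : Graph m₁} {F₂ : Graph m₂} (r₁ r₂ : ℕ) (p : Pair F₁ F₂) where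
  open Pair p
  pairObj : ∀ {n} → Rel n → ℕ
  pairObj = objective′ (hairy F₁ t₁ f₁) (hairy F₂ t₂ f₂) (r₂ ^ a₁) (r₁ ^ a₂)

swapPair : ∀ {m₁ m₂} {F₁ : Graph m₁} {F₂ : Graph m₂} → Pair F₁ F₂ → Pair F₂ F₁
swapPair p = record { t₁ = t₂ ; t₂ = t₁ ; f₁ = f₂ ; f₂ = f₁ ; a₁ = a₂ ; a₂ = a₁ ; t₁≤a₁ = t₂≤a₂ ; a₁≤ = a₂≤ ; t₂≤a₂ = t₁≤a₁ ; a₂≤ = a₁≤ }
  where open Pair p

swapMinimal : ∀ {m₁ m₂ n} {F₁ : Graph m₁} {F₂ : Graph m₂} r₁ r₂ (p : Pair F₁ F₂) (e : Rel n) →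
  Minimal (pairObj r₁ r₂ p) e → Minimal (pairObj r₂ r₁ (swapPair p)) (neg e)
swapMinimal {n = n} {F₁} {F₂} r₁ r₂ p e min e′ e′-sym = ≤-trans (≤-reflexive (trans (+-comm (B * #injhom H₂ (neg e)) _) (cong (λ z → A * z + B * #injhom H₂ (neg e)) (#injhom-cong H₁ (λ x y → Bool.not-involutive (e x y))))))
  (≤-trans (min (neg e′) (neg-sym e′-sym)) (≤-reflexive (trans (+-comm (A * #injhom H₁ (neg e′)) _) (cong (λ z → B * z + A * #injhom H₁ (neg e′)) (#injhom-cong H₂ (λ x y → Bool.not-involutive (e′ x y)))))))
  where
  open Pair p
  H₁ = hairy F₁ t₁ f₁
  H₂ = hairy F₂ t₂ f₂
  A = r₂ ^ a₁ * #inj _ n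
  B = r₁ ^ a₂ * #inj _ n

-- Copies of the core with surplus at the hairs

Good : ∀ {m t n} (F : Graph m) (f : Fin t → Fin m) (e : Rel n) (r K : ℕ) → Vec (Fin n) m → Set
Good {t = t} {n} F f e r K u = Hom F e u × (suc K * n) ^ t ≤ (K * r) ^ t * hairs F f e u

Good? : ∀ {m t n} (F : Graph m) (f : Fin t → Fin m) (e : Rel n) r K u → Dec (Good F f e r K u)
Good? {t = t} {n} F f e r K u = Hom? F e u ×-dec ((suc K * n) ^ t ≤? (K * r) ^ t * hairs F f e u)

-- A good copy extends by hairs in at least ((1 + 1/K) n / r₂)^t₁ ways. If a proportion 1/c of the
-- maps rooted at x were good, the weighted number of copies rooted at x would be at least (1 +
-- 1/K)^t₁ n^h₁ / c, against a bound from `vertex-bound` that is linear in t₁. Here c is fixed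
-- before the hairs, so enough hairs give a contradiction.
few-good : ∀ {m₁ m₂} (F₁ : Graph m₁) (F₂ : Graph m₂) r₁ r₂ Q → 1 ≤ r₁ → 1 ≤ r₂ → ¬ Colourable F₁ r₁ → ∀ c K → 1 ≤ K →
  ∃ λ t₀ → ∀ (p : Pair F₁ F₂) → t₀ ≤ Pair.t₁ p → m₂ + Pair.t₂ p ≤ Q * (m₁ + Pair.t₁ p) →
  ∃ λ n₀ → ∀ n → n₀ ≤ n → ∀ (e : Rel n) → Symm e → Minimal (pairObj r₁ r₂ p) e →
  ∀ u₀ x → ¬ (n ^ m₁ ≤ c * ∑V (λ u → ι (Good? F₁ (Pair.f₁ p) e r₂ K (u [ u₀ ]≔ x))))
few-good {m₁} {m₂} F₁ F₂ r₁ r₂ Q r₁≥1 r₂≥1 nc c K K≥1 = proj₁ growth , main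
  where
  cc b d : ℕ
  cc = 2 * r₁ ^ m₂
  -- `b + d * t₁` is 2c(h * cc + 1) for h = (Q + 1)(m₁ + t₁), a common bound for the orders of both
  -- graphs.
  b = 2 * c * (suc Q * m₁ * cc + 1)
  d = 2 * c * (suc Q * cc)
  growth = exp>linear K b d K≥1
  main : ∀ (p : Pair F₁ F₂) → proj₁ growth ≤ Pair.t₁ p → m₂ + Pair.t₂ p ≤ Q * (m₁ + Pair.t₁ p) → _
  main p t≥ h₂≤ = n₀ , bound
    where
    open Pair p
    h₁ h₂ h α β n₀ : ℕ
    h₁ = m₁ + t₁
    h₂ = m₂ + t₂
    h = suc Q * h₁
    α = r₂ ^ a₁
    β = r₁ ^ a₂
    n₀ = 1 + (2 * (t₂ * r₁) + (2 * (h₂ * h₂) + suc h * (α * (h₁ * h₁) + β * (h₂ * h₂))))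
    bound : ∀ n → n₀ ≤ n → ∀ (e : Rel n) → Symm e → Minimal (pairObj r₁ r₂ p) e →
      ∀ u₀ x → ¬ (n ^ m₁ ≤ c * ∑V (λ u → ι (Good? F₁ f₁ e r₂ K (u [ u₀ ]≔ x))))
    bound n n≥ e e-sym min u₀ x many = <⇒≱ (proj₂ growth t₁ t≥) (*-cancelʳ-≤ _ _ (n ^ h₁) ⦃ m^n≢0 n h₁ ⦃ >-nonZero n≥1 ⦄ ⦄ (begin
      suc K ^ t₁ * n ^ h₁ ≡⟨ cong (suc K ^ t₁ *_) (^-distribˡ-+-* n m₁ t₁) ⟩
      suc K ^ t₁ * (n ^ m₁ * n ^ t₁) ≡⟨ trans (*-left-comm (suc K ^ t₁) (n ^ m₁) (n ^ t₁)) (cong (n ^ m₁ *_) (sym (^-distrib-* t₁ (suc K) n))) ⟩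
      n ^ m₁ * (suc K * n) ^ t₁ ≤⟨ mulʳ ((suc K * n) ^ t₁) many ⟩
      c * ∑V (λ u → ι (good? u)) * (suc K * n) ^ t₁ ≡⟨ trans (*-assoc c _ _) (cong (c *_) (sym (∑V-*ʳ ((suc K * n) ^ t₁) _))) ⟩
      c * ∑V (λ u → ι (good? u) * (suc K * n) ^ t₁) ≤⟨ mulˡ c (∑V-mono pt) ⟩
      c * ∑V (λ u → (K * r₂) ^ t₁ * (ι (Hom? F₁ e (u [ u₀ ]≔ x)) * hairs F₁ f₁ e (u [ u₀ ]≔ x))) ≡⟨ cong (c *_) (trans (∑V-*ˡ ((K * r₂) ^ t₁) _) (cong ((K * r₂) ^ t₁ *_) (sym (rooted-sum F₁ f₁ e e-sym u₀ x)))) ⟩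
      c * ((K * r₂) ^ t₁ * R) ≡⟨ cong (λ z → c * (z * R)) (^-distrib-* t₁ K r₂) ⟩
      c * (K ^ t₁ * r₂ ^ t₁ * R) ≤⟨ mulˡ c (mulʳ R (mulˡ (K ^ t₁) (^-monoʳ-≤ r₂ ⦃ >-nonZero r₂≥1 ⦄ t₁≤a₁))) ⟩
      c * (K ^ t₁ * α * R) ≡⟨ l₂ c (K ^ t₁) α R ⟩
      c * K ^ t₁ * (α * R) ≤⟨ mulˡ (c * K ^ t₁) vb ⟩
      c * K ^ t₁ * (2 * (h * cc + 1) * n ^ h₁) ≡⟨ l₃ c (K ^ t₁) (suc Q) m₁ t₁ cc (n ^ h₁) ⟩
      K ^ t₁ * (b + d * t₁) * n ^ h₁ ∎))
      where
      open ≤-Reasoning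
      n≥1 : 1 ≤ n
      n≥1 = ≤-trans (m≤m+n 1 _) n≥
      n≥₂ : 2 * (t₂ * r₁) ≤ n
      n≥₂ = ≤-trans (≤-trans (m≤m+n (2 * (t₂ * r₁)) _) (m≤n+m _ 1)) n≥
      n≥₃ : 2 * (h₂ * h₂) ≤ n
      n≥₃ = ≤-trans (≤-trans (m≤m+n (2 * (h₂ * h₂)) _) (≤-trans (m≤n+m _ (2 * (t₂ * r₁))) (m≤n+m _ 1))) n≥
      n≥₄ : suc h * (α * (h₁ * h₁) + β * (h₂ * h₂)) ≤ n
      n≥₄ = ≤-trans (≤-trans (m≤n+m _ (2 * (h₂ * h₂))) (≤-trans (m≤n+m _ (2 * (t₂ * r₁))) (m≤n+m _ 1))) n≥
      good? : ∀ u → Dec (Good F₁ f₁ e r₂ K (u [ u₀ ]≔ x))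
      good? u = Good? F₁ f₁ e r₂ K (u [ u₀ ]≔ x)
      R = ∑V (λ φ → ι (Hom? (hairy F₁ t₁ f₁) e (φ [ u₀ ↑ˡ t₁ ]≔ x)))
      vb : α * R ≤ 2 * (h * cc + 1) * n ^ h₁
      vb = vertex-bound (hairy F₁ t₁ f₁) (hairy F₂ t₂ f₂) α β e e-sym min n≥1 h cc (m≤m+n h₁ _) (≤-trans h₂≤ (m≤n+m (Q * h₁) h₁))
        (upper-bound F₁ F₂ f₁ f₂ r₁ α a₂ r₁≥1 n≥1 nc a₂≤ n≥₂ e min) n≥₃ n≥₄ x (u₀ ↑ˡ t₁)
      pt : ∀ u → ι (good? u) * (suc K * n) ^ t₁ ≤ (K * r₂) ^ t₁ * (ι (Hom? F₁ e (u [ u₀ ]≔ x)) * hairs F₁ f₁ e (u [ u₀ ]≔ x))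
      pt u = ι*≤ (good? u) λ { (hom , q) → ≤-trans q (mulˡ ((K * r₂) ^ t₁) (≤-reflexive (sym (trans (cong (_* hairs F₁ f₁ e (u [ u₀ ]≔ x)) (ι-yes (Hom? F₁ e (u [ u₀ ]≔ x)) hom)) (*-identityˡ _))))) }
      l₂ : ∀ a b c d → a * (b * c * d) ≡ a * b * (c * d)
      l₂ = solve-∀
      l₃ : ∀ c k q m t cc N → c * k * (2 * (q * (m + t) * cc + 1) * N) ≡ k * (2 * c * (q * m * cc + 1) + 2 * c * (q * cc) * t) * N
      l₃ = solve-∀

-- Properties of all large minimisers, once there are enough hairs

Pred : ∀ {m₁ m₂} → Graph m₁ → Graph m₂ → Set₁
Pred F₁ F₂ = Pair F₁ F₂ → ∀ {n} → Rel n → Set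

record Comparable {m₁ m₂} {F₁ : Graph m₁} {F₂ : Graph m₂} (Q : ℕ) (p : Pair F₁ F₂) : Set where
  constructor comparable
  field
    v₂≤ : m₂ + Pair.t₂ p ≤ Q * (m₁ + Pair.t₁ p)
    v₁≤ : m₁ + Pair.t₁ p ≤ Q * (m₂ + Pair.t₂ p)

-- The threshold t₀ is chosen before the hairs and n₀ after them. So the constants that enter t₀ are
-- uniform in the hairs, while errors of relative order 1/n may depend on the hairs in any way.
Ev : ∀ {m₁ m₂} (F₁ : Graph m₁) (F₂ : Graph m₂) (r₁ r₂ Q : ℕ) → Pred F₁ F₂ → Set
Ev F₁ F₂ r₁ r₂ Q P = ∃ λ t₀ → ∀ (p : Pair F₁ F₂) → t₀ ≤ Pair.t₁ p → t₀ ≤ Pair.t₂ p → Comparable Q p →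
  ∃ λ n₀ → ∀ n → n₀ ≤ n → ∀ (e : Rel n) → Symm e → Minimal (pairObj r₁ r₂ p) e → P p e

module _ {m₁ m₂} {F₁ : Graph m₁} {F₂ : Graph m₂} {r₁ r₂ Q : ℕ} where
  ev-× : {P R : Pred F₁ F₂} → Ev F₁ F₂ r₁ r₂ Q P → Ev F₁ F₂ r₁ r₂ Q R → Ev F₁ F₂ r₁ r₂ Q (λ p e → P p e × R p e)
  ev-× (t , f) (t′ , g) = t ⊔ t′ , λ p h₁ h₂ c →
    let (n₀ , F) = f p (m⊔n≤o⇒m≤o t t′ h₁) (m⊔n≤o⇒m≤o t t′ h₂) c
        (n₀′ , G) = g p (m⊔n≤o⇒n≤o t t′ h₁) (m⊔n≤o⇒n≤o t t′ h₂) c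
    in n₀ ⊔ n₀′ , λ n h e s m → F n (m⊔n≤o⇒m≤o n₀ n₀′ h) e s m , G n (m⊔n≤o⇒n≤o n₀ n₀′ h) e s m

  ev-map : {P R : Pred F₁ F₂} (t₀ : ℕ) → (∀ p → t₀ ≤ Pair.t₁ p → t₀ ≤ Pair.t₂ p → Comparable Q p → ∃ λ n₀ → ∀ {n} (e : Rel n) → n₀ ≤ n → 1 ≤ n → Symm e → Minimal (pairObj r₁ r₂ p) e → P p e → R p e) →
    Ev F₁ F₂ r₁ r₂ Q P → Ev F₁ F₂ r₁ r₂ Q R
  ev-map t₀ g (t , f) = t₀ ⊔ t , λ p h₁ h₂ c →
    let (n₀ , F) = f p (m⊔n≤o⇒n≤o t₀ t h₁) (m⊔n≤o⇒n≤o t₀ t h₂) c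
        (n₀′ , G) = g p (m⊔n≤o⇒m≤o t₀ t h₁) (m⊔n≤o⇒m≤o t₀ t h₂) c
    in suc (n₀ ⊔ n₀′) , λ n h e s m → G e (m⊔n≤o⇒n≤o n₀ n₀′ (<⇒≤ h)) (≤-trans (s≤s z≤n) h) s m (F n (m⊔n≤o⇒m≤o n₀ n₀′ (<⇒≤ h)) e s m)

  ev-map′ : {P R : Pred F₁ F₂} → (∀ p {n} (e : Rel n) → 1 ≤ n → Symm e → P p e → R p e) → Ev F₁ F₂ r₁ r₂ Q P → Ev F₁ F₂ r₁ r₂ Q R
  ev-map′ {P} {R} g = ev-map {P} {R} 0 (λ p _ _ _ → 0 , λ e _ n≥1 s _ → g p e n≥1 s)

  ev-swap : {P : Pred F₂ F₁} → Ev F₂ F₁ r₂ r₁ Q P → Ev F₁ F₂ r₁ r₂ Q (λ p e → P (swapPair p) (neg e))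
  ev-swap (t , f) = t , λ p h₁ h₂ (comparable c₁ c₂) →
    let (n₀ , F) = f (swapPair p) h₂ h₁ (comparable c₂ c₁)
    in n₀ , λ n h e s m → F n h (neg e) (neg-sym s) (swapMinimal r₁ r₂ p e m)

FewGood : ∀ {m₁ m₂} {F₁ : Graph m₁} {F₂ : Graph m₂} → ℕ → ℕ → ℕ → Pred F₁ F₂
FewGood {m₁} {F₁ = F₁} r₂ c K p {n} e = ∀ u₀ x → ¬ (n ^ m₁ ≤ c * ∑V (λ u → ι (Good? F₁ (Pair.f₁ p) e r₂ K (u [ u₀ ]≔ x))))

-- Graphs with a critical edge

record Critical {m} (F : Graph m) (ρ : ℕ) : Set where
  field
    u v : Fin m
    edge : adj F u v ≡ true
    col : Fin m → Fin (2 + ρ)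
    col-proper : ∀ i j → adj F i j ≡ true → ¬ (i ≡ u × j ≡ v) → ¬ (i ≡ v × j ≡ u) → col i ≢ col j
    uncolourable : ¬ Colourable F (2 + ρ)

  u≢v : u ≢ v
  u≢v p = contradiction (trans (sym edge) (trans (cong (adj F u) (sym p)) (adjIrr F u))) λ ()

  -- A new colour at u repairs the only edge that `col` may leave monochromatic; this is the proper
  -- colouring of all of F along which cliques are blown up.
  col⁺ : Fin m → ℕ
  col⁺ i = if does (i ≟ u) then 2 + ρ else toℕ (col i)

  col⁺-u : ∀ i → i ≡ u → col⁺ i ≡ 2 + ρ
  col⁺-u i p = cong (if_then 2 + ρ else toℕ (col i)) (dec-true (i ≟ u) p)

  col⁺-≢u : ∀ i → i ≢ u → col⁺ i ≡ toℕ (col i)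
  col⁺-≢u i p = cong (if_then 2 + ρ else toℕ (col i)) (dec-false (i ≟ u) p)

  col⁺< : ∀ i → col⁺ i < 3 + ρ
  col⁺< i with i ≟ u
  ... | yes p = n<1+n (2 + ρ)
  ... | no p = m<n⇒m<1+n (toℕ<n (col i))

  col⁺-proper : ∀ i j → adj F i j ≡ true → col⁺ i ≢ col⁺ j
  col⁺-proper i j a eq = go (i ≟ u) (j ≟ u)
    where
    go : Dec (i ≡ u) → Dec (j ≡ u) → ⊥
    go (yes p) (yes q) = contradiction (trans (sym a) (trans (cong₂ (adj F) p q) (adjIrr F u))) λ ()
    go (yes p) (no q) = <-irrefl (trans (sym (col⁺-≢u j q)) (trans (sym eq) (col⁺-u i p))) (toℕ<n (col j))
    go (no p) (yes q) = <-irrefl (trans (sym (col⁺-≢u i p)) (trans eq (col⁺-u j q))) (toℕ<n (col i))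
    go (no p) (no q) = col-proper i j a (λ { (x , _) → p x }) (λ { (_ , y) → q y }) (toℕ-injective (trans (sym (col⁺-≢u i p)) (trans eq (col⁺-≢u j q))))

-- Few cliques among rich vertices

module Coarse {m₁ m₂} (F₁ : Graph m₁) (F₂ : Graph m₂) (ρ₁ ρ₂ Q : ℕ) (cr₁ : Critical F₁ ρ₁) where
  r₁ r₂ : ℕ
  r₁ = 2 + ρ₁
  r₂ = 2 + ρ₂
  open Critical cr₁

  few-good-ev : ∀ c K → 1 ≤ K → Ev F₁ F₂ r₁ r₂ Q (λ p e → FewGood r₂ c K p e)
  few-good-ev c K K≥1 = let (t₀ , f) = few-good F₁ F₂ r₁ r₂ Q (s≤s z≤n) (s≤s z≤n) uncolourable c K K≥1
    in t₀ , λ p h₁ h₂ (comparable c₁ c₂) → f p h₁ c₁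

  FewCliques : ℕ → ℕ → Pred F₁ F₂
  FewCliques g L p {n} e = ¬ (n ^ suc r₁ ≤ g * C e (suc r₁) (rich e L r₂))

  -- Blown up along `col⁺`, many cliques among rich vertices yield many copies of F₁ that use rich
  -- vertices only. There every hair has a surplus, so these copies are good, and averaging over the
  -- image of u finds a vertex that roots too many of them.
  few-cliques : ∀ g L → 1 ≤ L → Ev F₁ F₂ r₁ r₂ Q (FewCliques g L)
  few-cliques g L L≥1 = ev-map′ {P = λ p e → FewGood r₂ c′ L p e} {R = FewCliques g L} main (few-good-ev c′ L L≥1)
    where
    open Blowup F₁ col⁺ col⁺-proper
    c′ = proj₁ (blowup (suc r₁) g)
    main : ∀ p {n} (e : Rel n) → 1 ≤ n → Symm e → FewGood r₂ c′ L p e → FewCliques g L p e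
    main p {n} e n≥1 e-sym few many = <⇒≱ (≤-<-trans lower upper) ≤-refl
      where
      open ≤-Reasoning
      open Pair p
      A = rich e L r₂
      homs : n ^ m₁ ≤ c′ * ∑V (λ φ → ι (PHom? e (suc r₁) A φ))
      homs = proj₂ (blowup (suc r₁) g) e A e-sym n≥1 many
      good : ∀ φ → PHom e (suc r₁) A φ → Good F₁ f₁ e r₂ L φ
      good φ (inA , hom) = (λ i j a → hom i j (col⁺< i) (col⁺< j) a) , (begin
        (suc L * n) ^ t₁ ≡⟨ ∏F-const t₁ (suc L * n) ⟨
        ∏F {t₁} (λ _ → suc L * n) ≤⟨ ∏F-mono (λ s → does-true (suc L * n ≤? L * r₂ * deg e (lookup φ (f₁ s))) (inA (f₁ s) (col⁺< (f₁ s)))) ⟩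
        ∏F (λ s → L * r₂ * deg e (lookup φ (f₁ s))) ≡⟨ ∏F-* (λ _ → L * r₂) (λ s → deg e (lookup φ (f₁ s))) ⟩
        ∏F {t₁} (λ _ → L * r₂) * hairs F₁ f₁ e φ ≡⟨ cong (_* hairs F₁ f₁ e φ) (∏F-const t₁ (L * r₂)) ⟩
        (L * r₂) ^ t₁ * hairs F₁ f₁ e φ ∎)
      S : Fin n → ℕ
      S x = ∑V (λ φ → ι (Good? F₁ f₁ e r₂ L (φ [ u ]≔ x)))
      lower : n * n ^ m₁ ≤ c′ * ∑F S
      lower = begin
        n * n ^ m₁ ≤⟨ mulˡ n (≤-trans homs (mulˡ c′ (∑V-mono (λ φ → ι-mono (PHom? e (suc r₁) A φ) (Good? F₁ f₁ e r₂ L φ) (good φ))))) ⟩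
        n * (c′ * ∑V (λ φ → ι (Good? F₁ f₁ e r₂ L φ))) ≡⟨ *-left-comm n c′ _ ⟩
        c′ * (n * ∑V (λ φ → ι (Good? F₁ f₁ e r₂ L φ))) ≡⟨ cong (c′ *_) (trans (sym (∑V-update u (λ φ → ι (Good? F₁ f₁ e r₂ L φ)))) (∑VF-swap _)) ⟩
        c′ * ∑F S ∎
      upper : c′ * ∑F S < n * n ^ m₁
      upper = begin-strict
        c′ * ∑F S ≡⟨ ∑F-*ˡ c′ S ⟨
        ∑F (λ x → c′ * S x) <⟨ m<m+n (∑F (λ x → c′ * S x)) n≥1 ⟩
        ∑F (λ x → c′ * S x) + n ≡⟨ cong (∑F (λ x → c′ * S x) +_) (∑F-1 n) ⟨
        ∑F (λ x → c′ * S x) + ∑F {n} (λ _ → 1) ≡⟨ ∑F-+ _ _ ⟨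
        ∑F (λ x → c′ * S x + 1) ≤⟨ ∑F-≤const (n ^ m₁) (λ x → ≤-trans (≤-reflexive (+-comm (c′ * S x) 1)) (≰⇒> (few u x))) ⟩
        n * n ^ m₁ ∎

relax-low : ∀ lam L r d n → 1 ≤ L → lam ≤ L → L * r * d ≤ suc L * n → lam * r * d ≤ suc lam * n
relax-low lam L r d n L≥1 lam≤L h = *-cancelˡ-≤ L ⦃ >-nonZero L≥1 ⦄ (linear 0 (+-mono-≤ (mulˡ lam h) (mulʳ n lam≤L)) (l lam L r d n))
  where l : ∀ m L r d n → L * (suc m * n) + (m * (L * r * d) + m * n) ≡ L * (m * r * d) + (m * (suc L * n) + L * n) + 0
        l = solve-∀

-- Large minimisers are close to a Turán relation on one side

coarse : ∀ {m₁ m₂} (F₁ : Graph m₁) (F₂ : Graph m₂) ρ₁ ρ₂ Q → Critical F₁ ρ₁ → Critical F₂ ρ₂ →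
  suc (2 + ρ₁ + (2 + ρ₂)) ≤ (2 + ρ₁) * (2 + ρ₂) → ∀ δ →
  Ev F₁ F₂ (2 + ρ₁) (2 + ρ₂) Q (λ p e → NearTuran e (2 + ρ₁) δ ⊎ NearTuran (neg e) (2 + ρ₂) δ)
coarse F₁ F₂ ρ₁ ρ₂ Q cr₁ cr₂ rr δ = ev-map′ {P = P} {R = R} main
    (ev-× {P = C₁.FewCliques g L} {R = λ p e → C₂.FewCliques g L (swapPair p) (neg e)} (C₁.few-cliques g L L≥1) (ev-swap {P = C₂.FewCliques g L} (C₂.few-cliques g L L≥1)))
  where
  module C₁ = Coarse F₁ F₂ ρ₁ ρ₂ Q cr₁
  module C₂ = Coarse F₂ F₁ ρ₂ ρ₁ Q cr₂
  s₁ s₂ s₃ lam g L : ℕ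
  s₁ = 8 * (2 + ρ₁) + (1 + 5 * (2 + ρ₁)) * δ
  s₂ = 8 * (2 + ρ₂) + (1 + 5 * (2 + ρ₂)) * δ
  -- The sum dominates every lower bound on `lam` asked for by `Dichotomy` and by `Stability` on
  -- either side.
  lam = 3 + (24 * δ + (s₁ + s₂))
  lam≥3 : 3 ≤ lam
  lam≥3 = m≤m+n 3 _
  lam≥24 : 24 * δ ≤ lam
  lam≥24 = ≤-trans (m≤m+n (24 * δ) (s₁ + s₂)) (m≤n+m _ 3)
  s₁≤ : s₁ ≤ lam
  s₁≤ = ≤-trans (m≤m+n s₁ s₂) (≤-trans (m≤n+m (s₁ + s₂) (24 * δ)) (m≤n+m _ 3))
  s₂≤ : s₂ ≤ lam
  s₂≤ = ≤-trans (m≤n+m s₂ s₁) (≤-trans (m≤n+m (s₁ + s₂) (24 * δ)) (m≤n+m _ 3))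
  module D = Dichotomy (suc ρ₁) (suc ρ₂) rr lam (≤-trans (s≤s (s≤s z≤n)) lam≥3)
  module S₁ = Stability ρ₁ δ lam lam≥3 (≤-trans (m≤m+n (8 * (2 + ρ₁)) _) s₁≤) lam≥24 (≤-trans (m≤n+m _ (8 * (2 + ρ₁))) s₁≤)
  module S₂ = Stability ρ₂ δ lam lam≥3 (≤-trans (m≤m+n (8 * (2 + ρ₂)) _) s₂≤) lam≥24 (≤-trans (m≤n+m _ (8 * (2 + ρ₂))) s₂≤)
  s₃ = S₁.const + S₂.const
  g = D.const + s₃
  L = D.L
  L≥1 : 1 ≤ L
  L≥1 = ≤-trans (≤-trans (s≤s z≤n) lam≥3) D.lam≤L
  P R : Pred F₁ F₂
  P p e = C₁.FewCliques g L p e × C₂.FewCliques g L (swapPair p) (neg e)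
  R p e = NearTuran e (2 + ρ₁) δ ⊎ NearTuran (neg e) (2 + ρ₂) δ
  main : ∀ p {n} (e : Rel n) → 1 ≤ n → Symm e → P p e → R p e
  main p {n} e n≥1 e-sym (fewA , fewB) = finish (D.dichotomy e e-sym n≥1 (λ h → fewA (≤-trans h (mulʳ _ D≤g))) (λ h → fewB (≤-trans h (mulʳ _ D≤g))))
    where
    D≤g : D.const ≤ g
    D≤g = m≤m+n D.const s₃
    finish : (lam * card (rich (neg e) L (2 + ρ₁)) ≤ n) ⊎ (lam * card (rich e L (2 + ρ₂)) ≤ n) → R p e
    finish (inj₁ q) = inj₁ (S₁.near e e-sym n≥1 (rich e L (2 + ρ₂)) (rich (neg e) L (2 + ρ₁)) q (D.A°⊑A e e-sym n≥1)
      (λ x o → relax-low lam L (2 + ρ₁) (deg (neg e) x) n L≥1 D.lam≤L (<⇒≤ (D.A°-low e e-sym n≥1 x o)))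
      (λ h → fewA (≤-trans h (mulʳ _ (≤-trans (m≤m+n S₁.const S₂.const) (m≤n+m s₃ D.const))))))
    finish (inj₂ q) = inj₂ (S₂.near (neg e) (neg-sym e-sym) n≥1 (rich (neg e) L (2 + ρ₁)) (rich e L (2 + ρ₂)) q (D.B°⊑B e e-sym n≥1)
      (λ x o → relax-low lam L (2 + ρ₂) (deg (neg (neg e)) x) n L≥1 D.lam≤L
        (≤-trans (mulˡ (L * (2 + ρ₂)) (≤-reflexive (∑F-cong (λ y → cong ⟦_⟧ (Bool.not-involutive (e x y)))))) (<⇒≤ (D.B°-low e e-sym n≥1 x o))))
      (λ h → fewB (≤-trans h (mulʳ _ (≤-trans (m≤n+m S₂.const S₁.const) (m≤n+m s₃ D.const))))))

-- Maps avoiding a sparse set of bad pairs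

pair-sum : ∀ {m n} (k : Fin n → Fin n → ℕ) (w w′ : Fin m) → w ≢ w′ →
  n * (n * ∑V (λ φ → k (lookup φ w) (lookup φ w′))) ≡ n ^ m * ∑F (λ x → ∑F (λ y → k x y))
pair-sum {m} {n} k w w′ w≢w′ = begin
  n * (n * ∑V (λ φ → k (lookup φ w) (lookup φ w′))) ≡⟨ cong (n *_) (∑V-update w′ (λ φ → k (lookup φ w) (lookup φ w′))) ⟨
  n * ∑V (λ φ → ∑F (λ y → k (lookup (φ [ w′ ]≔ y) w) (lookup (φ [ w′ ]≔ y) w′))) ≡⟨ cong (n *_) (∑V-cong (λ φ → ∑F-cong (λ y → cong₂ k (lookup∘update′ w≢w′ φ y) (lookup∘update w′ φ y)))) ⟩
  n * ∑V (λ φ → ∑F (λ y → k (lookup φ w) y)) ≡⟨ ∑V-update w (λ φ → ∑F (λ y → k (lookup φ w) y)) ⟨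
  ∑V (λ φ → ∑F (λ x → ∑F (λ y → k (lookup (φ [ w ]≔ x) w) y))) ≡⟨ ∑V-cong (λ φ → ∑F-cong (λ x → ∑F-cong (λ y → cong (λ z → k z y) (lookup∘update w φ x)))) ⟩
  ∑V {m} {n} (λ φ → ∑F (λ x → ∑F (λ y → k x y))) ≡⟨ ∑V-const m n _ ⟩
  n ^ m * ∑F (λ x → ∑F (λ y → k x y)) ∎
  where open ≡-Reasoning

Scattered : ∀ {m n} → (Fin m → Fin n → Bool) → (Fin n → Fin n → Bool) → Vec (Fin n) m → Set
Scattered S bad φ = (∀ w → S w (lookup φ w) ≡ true) × (∀ w w′ → w ≢ w′ → bad (lookup φ w) (lookup φ w′) ≡ false)

Scattered? : ∀ {m n} (S : Fin m → Fin n → Bool) (bad : Fin n → Fin n → Bool) φ → Dec (Scattered S bad φ)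
Scattered? S bad φ = all? (λ w → S w (lookup φ w) Bool.≟ true) ×-dec
  all? (λ w → all? (λ w′ → ¬? (w ≟ w′) →-dec (bad (lookup φ w) (lookup φ w′) Bool.≟ false)))

-- Union bound. At least a proportion η^-m of the maps sends each w into `S w`. A given pair of
-- vertices lands on a bad pair with probability Bad/n², and the sparsity assumption lets all m²
-- pairs together spoil at most half of that proportion.
scattered-many : ∀ {m n} (S : Fin m → Fin n → Bool) (bad : Fin n → Fin n → Bool) η → 1 ≤ n → (∀ w → n ≤ η * card (S w)) →
  2 * (m * m * η ^ m) * ∑F (λ x → ∑F (λ y → ⟦ bad x y ⟧)) ≤ n * n →
  n ^ m ≤ 2 * η ^ m * ∑V (λ φ → ι (Scattered? S bad φ))
scattered-many {m} {n} S bad η n≥1 big sparse = *-cancelˡ-≤ (n * n) ⦃ m*n≢0 n n ⦃ >-nonZero n≥1 ⦄ ⦃ >-nonZero n≥1 ⦄ ⦄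
    (linear 0 (+-mono-≤ (mulˡ (2 * (n * n)) all-in) (+-mono-≤ (mulˡ (2 * η ^ m) pairs) (mulʳ (n ^ m) sparse))) (l (n * n) (n ^ m) (η ^ m) G X₀ (m * m) Bad))
  where
  open ≤-Reasoning
  Bad G X₀ : ℕ
  Bad = ∑F (λ x → ∑F (λ y → ⟦ bad x y ⟧))
  G = ∑V (λ φ → ι (Scattered? S bad φ))
  in? : ∀ φ → Dec (∀ w → S w (lookup φ w) ≡ true)
  in? φ = all? (λ w → S w (lookup φ w) Bool.≟ true)
  X₀ = ∑V (λ φ → ι (in? φ))
  X₀≡ : X₀ ≡ ∏F (λ w → card (S w))
  X₀≡ = trans (∑V-cong (λ φ → trans (ι-all-∏ (λ w → S w (lookup φ w) Bool.≟ true)) (∏F-cong (λ w → sym (⟦⟧≡ι (S w (lookup φ w))))))) (∑V-∏ (λ w x → ⟦ S w x ⟧))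
  all-in : n ^ m ≤ η ^ m * X₀
  all-in = begin
    n ^ m ≡⟨ ∏F-const m n ⟨
    ∏F {m} (λ _ → n) ≤⟨ ∏F-mono big ⟩
    ∏F (λ w → η * card (S w)) ≡⟨ ∏F-* (λ _ → η) (λ w → card (S w)) ⟩
    ∏F {m} (λ _ → η) * ∏F (λ w → card (S w)) ≡⟨ cong₂ _*_ (∏F-const m η) (sym X₀≡) ⟩
    η ^ m * X₀ ∎
  clash? : ∀ φ w w′ → Dec (w ≢ w′ × bad (lookup φ w) (lookup φ w′) ≡ true)
  clash? φ w w′ = ¬? (w ≟ w′) ×-dec (bad (lookup φ w) (lookup φ w′) Bool.≟ true)
  pt : ∀ φ → ι (in? φ) ≤ ι (Scattered? S bad φ) + ∑F (λ w → ∑F (λ w′ → ι (clash? φ w w′)))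
  pt φ = ι≤ (in? φ) aux
    where
    Y₀ = ∑F (λ w → ∑F (λ w′ → ι (clash? φ w w′)))
    aux : (∀ w → S w (lookup φ w) ≡ true) → 1 ≤ ι (Scattered? S bad φ) + Y₀
    aux h with 1 ≤? Y₀
    ... | yes q = ≤-trans q (m≤n+m Y₀ (ι (Scattered? S bad φ)))
    ... | no q = ≤-trans (≤-reflexive (sym (ι-yes (Scattered? S bad φ) (h , λ w w′ w≢ → Bool.¬-not (λ b → q (≤-trans (≤-reflexive (sym (ι-yes (clash? φ w w′) (w≢ , b)))) (≤-trans (∑F-≥ (λ w′ → ι (clash? φ w w′)) w′) (∑F-≥ (λ w → ∑F (λ w′ → ι (clash? φ w w′))) w)))))))) (m≤m+n _ Y₀)
  each : ∀ w w′ → n * n * ∑V (λ φ → ι (clash? φ w w′)) ≤ n ^ m * Bad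
  each w w′ = go (w ≟ w′)
    where
    go : Dec (w ≡ w′) → n * n * ∑V (λ φ → ι (clash? φ w w′)) ≤ n ^ m * Bad
    go (yes q) = ≤-trans (≤-reflexive (trans (cong (n * n *_) (trans (∑V-cong (λ φ → ι-no (clash? φ w w′) (λ z → proj₁ z q))) (∑V-0 m n))) (*-zeroʳ (n * n)))) z≤n
    go (no q) = ≤-trans (mulˡ (n * n) (∑V-mono (λ φ → ≤-trans (ι-mono (clash? φ w w′) (bad (lookup φ w) (lookup φ w′) Bool.≟ true) proj₂) (≤-reflexive (sym (⟦⟧≡ι (bad (lookup φ w) (lookup φ w′))))))))
      (≤-reflexive (trans (*-assoc n n _) (pair-sum (λ x y → ⟦ bad x y ⟧) w w′ q)))
  pairs : n * n * X₀ ≤ n * n * G + m * m * (n ^ m * Bad)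
  pairs = begin
    n * n * X₀ ≤⟨ mulˡ (n * n) (≤-trans (∑V-mono pt) (≤-reflexive (trans (∑V-+ _ _) (cong (G +_) (trans (∑VF-swap _) (∑F-cong (λ w → ∑VF-swap _))))))) ⟩
    n * n * (G + ∑F (λ w → ∑F (λ w′ → ∑V (λ φ → ι (clash? φ w w′))))) ≡⟨ trans (*-distribˡ-+ (n * n) G _) (cong (n * n * G +_) (trans (sym (∑F-*ˡ (n * n) _)) (∑F-cong (λ w → sym (∑F-*ˡ (n * n) _))))) ⟩
    n * n * G + ∑F (λ w → ∑F (λ w′ → n * n * ∑V (λ φ → ι (clash? φ w w′)))) ≤⟨ +-monoʳ-≤ (n * n * G) (∑F-≤const (m * (n ^ m * Bad)) (λ w → ∑F-≤const (n ^ m * Bad) (each w))) ⟩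
    n * n * G + m * (m * (n ^ m * Bad)) ≡⟨ cong (n * n * G +_) (sym (*-assoc m m _)) ⟩
    n * n * G + m * m * (n ^ m * Bad) ∎
  l : ∀ nn N η G X mm B → nn * (2 * η * G) + (2 * nn * N + (2 * η * (nn * X) + 2 * (mm * η) * B * N)) ≡ nn * N + (2 * nn * (η * X) + (2 * η * (nn * G + mm * (N * B)) + nn * N)) + 0
  l = solve-∀

-- Typical vertices of a nearly Turán relation

module Local {n} (e : Rel n) (e-sym : Symm e) (n≥1 : 1 ≤ n) (ρ δ τ : ℕ) (τ≥1 : 1 ≤ τ) (ττ≤δ : τ * τ ≤ δ) (nt : NearTuran e (2 + ρ) δ) where
  open NearTuran nt public
  open ≤-Reasoning

  r : ℕ
  r = 2 + ρ

  bad : Fin n → Fin n → Bool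
  bad = badPair e part

  bd : Fin n → ℕ
  bd x = ∑F (λ y → ⟦ bad x y ⟧)

  bad-same : ∀ x y → part x ≡ part y → bad x y ≡ e x y
  bad-same x y p = cong (if_then e x y else not (e x y)) (dec-true (part x ≟ part y) p)

  bad-diff : ∀ x y → part x ≢ part y → bad x y ≡ not (e x y)
  bad-diff x y p = cong (if_then e x y else not (e x y)) (dec-false (part x ≟ part y) p)

  same⇒neg : ∀ x y → part x ≡ part y → bad x y ≡ false → neg e x y ≡ true
  same⇒neg x y p q = cong not (trans (sym (bad-same x y p)) q)

  diff⇒e : ∀ x y → part x ≢ part y → bad x y ≡ false → e x y ≡ true
  diff⇒e x y p q = Bool.not-injective (trans (sym (bad-diff x y p)) q)

  typ? : ∀ x → Dec (τ * bd x ≤ n)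
  typ? x = τ * bd x ≤? n

  typ : Fin n → Bool
  typ x = does (typ? x)

  atypical : ℕ
  atypical = ∑F (λ x → ι (¬? (typ? x)))

  -- Markov's inequality with τ² ≤ δ: more than n/τ vertices of bad degree above n/τ would produce
  -- more than n²/δ bad pairs.
  few-atypical : τ * atypical ≤ n
  few-atypical = *-cancelˡ-≤ n ⦃ >-nonZero n≥1 ⦄ (begin
    n * (τ * atypical) ≡⟨ l n τ atypical ⟩
    τ * (n * atypical) ≡⟨ cong (τ *_) (∑F-*ˡ n _) ⟨
    τ * ∑F (λ x → n * ι (¬? (typ? x))) ≤⟨ mulˡ τ (∑F-mono (λ x → ≤-trans (≤-reflexive (*-comm n _)) (ι*≤ (¬? (typ? x)) (λ q → <⇒≤ (≰⇒> q))))) ⟩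
    τ * ∑F (λ x → τ * bd x) ≡⟨ trans (cong (τ *_) (∑F-*ˡ τ bd)) (sym (*-assoc τ τ _)) ⟩
    τ * τ * ∑F bd ≤⟨ mulʳ (∑F bd) ττ≤δ ⟩
    δ * ∑F bd ≤⟨ bad≤ ⟩
    n * n ∎)
    where l : ∀ a b c → a * (b * c) ≡ b * (a * c)
          l = solve-∀

  restrict : ∀ (S : Fin n → Bool) → card S ≤ card (λ y → S y ∧ typ y) + atypical
  restrict S = ≤-trans (∑F-mono (λ y → b (S y) (typ y))) (≤-reflexive (∑F-+ _ _))
    where b : ∀ s t → ⟦ s ⟧ ≤ ⟦ s ∧ t ⟧ + ⟦ not t ⟧
          b true true = ≤-refl
          b true false = ≤-refl
          b false t = z≤n

  psz : Fin r → ℕ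
  psz = psize part

  psz-upper : ∀ i → τ * r * psz i ≤ suc τ * n
  psz-upper i = relax-low τ δ r (psz i) n (≤-trans τ≥1 τ≤δ) τ≤δ (≤-trans (≤-reflexive (*-assoc δ r (psz i))) (size≤ i))
    where τ≤δ : τ ≤ δ
          τ≤δ = ≤-trans (≤-trans (≤-reflexive (sym (*-identityˡ τ))) (mulʳ τ τ≥1)) ττ≤δ

  -- Measured against (1 + 1/τ) n / r, the deficits of all classes add up to only n/τ because the
  -- sizes add up to n. A single deficit is at most their sum.
  psz-lower : ∀ i → suc τ * n ≤ τ * r * psz i + r * n
  psz-lower i = ≤-trans (≤-reflexive (sym (m+[n∸m]≡n (psz-upper i)))) (+-monoʳ-≤ (τ * r * psz i) (≤-trans (∑F-≥ g i) g-sum))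
    where
    g : Fin r → ℕ
    g j = suc τ * n ∸ τ * r * psz j
    g-sum : ∑F g ≤ r * n
    g-sum = +-cancelˡ-≤ (τ * r * n) _ _ (≤-reflexive (begin-equality
      τ * r * n + ∑F g ≡⟨ cong (λ z → τ * r * z + ∑F g) (psize-total part) ⟨
      τ * r * ∑F psz + ∑F g ≡⟨ cong (_+ ∑F g) (∑F-*ˡ (τ * r) psz) ⟨
      ∑F (λ j → τ * r * psz j) + ∑F g ≡⟨ ∑F-+ _ _ ⟨
      ∑F (λ j → τ * r * psz j + g j) ≡⟨ ∑F-cong (λ j → m+[n∸m]≡n (psz-upper j)) ⟩
      ∑F {r} (λ j → suc τ * n) ≡⟨ ∑F-const r (suc τ * n) ⟩
      r * (suc τ * n) ≡⟨ l r τ n ⟩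
      τ * r * n + r * n ∎))
      where l : ∀ r τ n → r * (suc τ * n) ≡ τ * r * n + r * n
            l = solve-∀

  psz≤deg₂ : ∀ x → psz (part x) ≤ deg (neg e) x + bd x
  psz≤deg₂ x = ≤-trans (∑F-mono (λ y → ι≤ (part y ≟ part x) (λ q → ≤-trans (≤-reflexive (b (e x y))) (+-monoʳ-≤ ⟦ not (e x y) ⟧ (≤-reflexive (cong ⟦_⟧ (sym (bad-same x y (sym q))))))))) (≤-reflexive (∑F-+ _ _))
    where b : ∀ c → 1 ≡ ⟦ not c ⟧ + ⟦ c ⟧
          b true = refl
          b false = refl

  typ-deg₂-lower : ∀ x → typ x ≡ true → τ * n ≤ τ * r * deg (neg e) x + 2 * (r * n)
  typ-deg₂-lower x q = linear n (+-mono-≤ (psz-lower (part x)) (+-mono-≤ (mulˡ (τ * r) (psz≤deg₂ x)) (mulˡ r (does-true (typ? x) q))))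
    (l τ r n (psz (part x)) (deg (neg e) x) (bd x))
    where l : ∀ τ r n p d b → τ * r * d + 2 * (r * n) + (suc τ * n + (τ * r * p + r * (τ * b))) ≡ τ * n + ((τ * r * p + r * n) + (τ * r * (d + b) + r * n)) + n
          l = solve-∀

  nbrIn : Rel n → Fin n → Fin r → Fin n → Bool
  nbrIn e′ x i y = does (part y ≟ i) ∧ e′ x y

  nbrIn-split : ∀ x i → card (nbrIn e x i) + card (nbrIn (neg e) x i) ≡ psz i
  nbrIn-split x i = nbr-split e (λ y → does (part y ≟ i)) x

  nbrIn-total : ∀ e′ x → ∑F (λ i → card (nbrIn e′ x i)) ≡ deg e′ x
  nbrIn-total e′ x = trans (∑F-swap _) (∑F-cong (λ y → trans (∑F-cong (λ i → trans (⟦∧⟧ (does (part y ≟ i)) (e′ x y)) (cong (_* ⟦ e′ x y ⟧) (ι-cong (part y ≟ i) (i ≟ part y) sym sym)))) (∑F-δ (part y) (λ _ → ⟦ e′ x y ⟧))))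

-- Degrees in the complement

^-pos : ∀ a k → 1 ≤ a → 1 ≤ a ^ k
^-pos a k a≥1 = m^n>0 a ⦃ >-nonZero a≥1 ⦄ k

module HairArith (p m r : ℕ) (p≥1 : 1 ≤ p) (m≥1 : 1 ≤ m) (r≥1 : 1 ≤ r) where
  open ≤-Reasoning
  x₀ y₀ b σ τ : ℕ
  -- With these values `bernoulli-upper` bounds (1 + 1/b)^(m+1) and (1 + 2r/σ)^m by 1 + 1/(3p) each,
  -- and (1 + 1/(3p))² ≤ 1 + 1/p.
  x₀ = 2 * (suc m * 1)
  y₀ = 2 * (m * (2 * r))
  b = 3 * p * x₀
  σ = 3 * p * y₀
  τ = σ + 2 * r

  x₀≥1 : 1 ≤ x₀
  x₀≥1 = *-mono-≤ {1} {2} (s≤s z≤n) (*-mono-≤ {1} {suc m} (s≤s z≤n) (≤-refl {1}))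
  y₀≥1 : 1 ≤ y₀
  y₀≥1 = *-mono-≤ {1} {2} (s≤s z≤n) (*-mono-≤ m≥1 (*-mono-≤ {1} {2} (s≤s z≤n) r≥1))
  3p≥1 : 1 ≤ 3 * p
  3p≥1 = *-mono-≤ {1} {3} (s≤s z≤n) p≥1
  b≥1 : 1 ≤ b
  b≥1 = *-mono-≤ 3p≥1 x₀≥1
  σ≥1 : 1 ≤ σ
  σ≥1 = *-mono-≤ 3p≥1 y₀≥1
  x₀≤b : x₀ ≤ b
  x₀≤b = ≤-trans (≤-reflexive (sym (*-identityˡ x₀))) (mulʳ x₀ 3p≥1)
  y₀≤σ : y₀ ≤ σ
  y₀≤σ = ≤-trans (≤-reflexive (sym (*-identityˡ y₀))) (mulʳ y₀ 3p≥1)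
  τ≥1 : 1 ≤ τ
  τ≥1 = ≤-trans σ≥1 (m≤m+n σ (2 * r))

  base : suc b ^ suc m * τ ^ m * p ≤ b ^ suc m * σ ^ m * suc p
  base = *-cancelˡ-≤ (b * σ) ⦃ >-nonZero (*-mono-≤ b≥1 σ≥1) ⦄ (begin
    b * σ * (suc b ^ suc m * τ ^ m * p) ≡⟨ cong (λ z → b * σ * (z ^ suc m * τ ^ m * p)) (+-comm 1 b) ⟩
    b * σ * ((b + 1) ^ suc m * τ ^ m * p) ≡⟨ l₁ b σ ((b + 1) ^ suc m) (τ ^ m) p ⟩
    ((b + 1) ^ suc m * b) * (τ ^ m * σ) * p ≤⟨ mulʳ p (*-mono-≤ (bernoulli-upper b 1 (suc m) x₀≤b) (bernoulli-upper σ (2 * r) m y₀≤σ)) ⟩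
    (b ^ suc m * (b + x₀)) * (σ ^ m * (σ + y₀)) * p ≡⟨ l₂ (b ^ suc m) (σ ^ m) p x₀ y₀ ⟩
    b ^ suc m * σ ^ m * (x₀ * y₀ * ((3 * p + 1) * (3 * p + 1) * p)) ≤⟨ mulˡ (b ^ suc m * σ ^ m) (mulˡ (x₀ * y₀) cubic) ⟩
    b ^ suc m * σ ^ m * (x₀ * y₀ * (9 * (p * p) * suc p)) ≡⟨ l₃ (b ^ suc m) (σ ^ m) p x₀ y₀ ⟩
    b * σ * (b ^ suc m * σ ^ m * suc p) ∎)
    where
    l₁ : ∀ b s u t p → b * s * (u * t * p) ≡ (u * b) * (t * s) * p
    l₁ = solve-∀
    l₂ : ∀ u v p x y → (u * (3 * p * x + x)) * (v * (3 * p * y + y)) * p ≡ u * v * (x * y * ((3 * p + 1) * (3 * p + 1) * p))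
    l₂ = solve-∀
    l₃ : ∀ u v p x y → u * v * (x * y * (9 * (p * p) * suc p)) ≡ 3 * p * x * (3 * p * y) * (u * v * suc p)
    l₃ = solve-∀
    cubic : (3 * p + 1) * (3 * p + 1) * p ≤ 9 * (p * p) * suc p
    cubic = linear (2 * (p * p)) (mulʳ p p≥1) (l p)
      where l : ∀ p → 9 * (p * p) * suc p + 1 * p ≡ (3 * p + 1) * (3 * p + 1) * p + p * p + 2 * (p * p)
            l = solve-∀

  -- Of k + j hairs, k gain a factor 1 + 1/p and j lose a factor σ/τ. In the worst case m hairs lose
  -- for each one that gains; this is `base`, which still leaves a gain of 1 + 1/b per hair. The
  -- exponent `i` pads j up to mk.
  hair-arith : ∀ k j → j ≤ m * k → suc b ^ (k + j) * (p ^ k * τ ^ j) ≤ b ^ (k + j) * (suc p ^ k * σ ^ j)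
  hair-arith k j j≤ = *-cancelʳ-≤ _ _ ((suc b * τ) ^ i) ⦃ >-nonZero (^-pos (suc b * τ) i (*-mono-≤ {1} {suc b} (s≤s z≤n) τ≥1)) ⦄ (begin
    suc b ^ (k + j) * (p ^ k * τ ^ j) * (suc b * τ) ^ i ≡⟨ regroup (suc b) τ p ⟩
    (suc b ^ suc m * τ ^ m * p) ^ k ≤⟨ ^-monoˡ-≤ k base ⟩
    (b ^ suc m * σ ^ m * suc p) ^ k ≡⟨ regroup b σ (suc p) ⟨
    b ^ (k + j) * (suc p ^ k * σ ^ j) * (b * σ) ^ i ≤⟨ mulˡ (b ^ (k + j) * (suc p ^ k * σ ^ j)) (^-monoˡ-≤ i (*-mono-≤ (n≤1+n b) (m≤m+n σ (2 * r)))) ⟩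
    b ^ (k + j) * (suc p ^ k * σ ^ j) * (suc b * τ) ^ i ∎)
    where
    i = m * k ∸ j
    j+i : j + i ≡ m * k
    j+i = m+[n∸m]≡n j≤
    l : ∀ a b c d f → a * (b * c) * (d * f) ≡ a * d * (c * f) * b
    l = solve-∀
    regroup : ∀ u v w → u ^ (k + j) * (w ^ k * v ^ j) * (u * v) ^ i ≡ (u ^ suc m * v ^ m * w) ^ k
    regroup u v w = begin-equality
      u ^ (k + j) * (w ^ k * v ^ j) * (u * v) ^ i ≡⟨ cong (u ^ (k + j) * (w ^ k * v ^ j) *_) (^-distrib-* i u v) ⟩
      u ^ (k + j) * (w ^ k * v ^ j) * (u ^ i * v ^ i) ≡⟨ l (u ^ (k + j)) (w ^ k) (v ^ j) (u ^ i) (v ^ i) ⟩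
      u ^ (k + j) * u ^ i * (v ^ j * v ^ i) * w ^ k ≡⟨ cong₂ (λ y z → y * z * w ^ k) (trans (sym (^-distribˡ-+-* u (k + j) i)) (trans (cong (u ^_) (trans (+-assoc k j i) (cong (k +_) j+i))) (sym (^-*-assoc u (suc m) k)))) (trans (sym (^-distribˡ-+-* v j i)) (trans (cong (v ^_) j+i) (sym (^-*-assoc v m k)))) ⟩
      (u ^ suc m) ^ k * (v ^ m) ^ k * w ^ k ≡⟨ trans (cong (_* w ^ k) (sym (^-distrib-* k (u ^ suc m) (v ^ m)))) (sym (^-distrib-* k (u ^ suc m * v ^ m) w)) ⟩
      (u ^ suc m * v ^ m * w) ^ k ∎

∏F-if : ∀ {t} (c : Fin t → Bool) x y → ∏F (λ s → if c s then x else y) ≡ x ^ ∑F (λ s → ⟦ c s ⟧) * y ^ ∑F (λ s → ⟦ not (c s) ⟧)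
∏F-if {zero} c x y = sym (cong₂ (λ a b → x ^ a * y ^ b) (∑F-zero _) (∑F-zero _))
∏F-if {suc t} c x y = trans (cong ((if c zero then x else y) *_) (∏F-if (c ∘ suc) x y)) (trans (go (c zero)) (sym (cong₂ (λ a b → x ^ a * y ^ b) (∑F-suc (λ s → ⟦ c s ⟧)) (∑F-suc (λ s → ⟦ not (c s) ⟧)))))
  where
  a b : ℕ
  a = ∑F (λ s → ⟦ c (suc s) ⟧)
  b = ∑F (λ s → ⟦ not (c (suc s)) ⟧)
  go : ∀ z → (if z then x else y) * (x ^ a * y ^ b) ≡ x ^ (⟦ z ⟧ + a) * y ^ (⟦ not z ⟧ + b)
  go true = sym (*-assoc x _ _)
  go false = *-left-comm y (x ^ a) (y ^ b)

max-val : ∀ {m} (g : Fin m → ℕ) → 1 ≤ m → ∃ λ i → ∑F g ≤ m * g i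
max-val {m} g m≥1 = proj₁ found , ≤-pred (≤-trans (proj₂ found) (≤-reflexive (+-comm (m * g (proj₁ found)) 1)))
  where
  open ≤-Reasoning
  lt : ∑F {m} (λ _ → ∑F g) < ∑F (λ i → m * g i + 1)
  lt = begin-strict
    ∑F {m} (λ _ → ∑F g) ≡⟨ ∑F-const m (∑F g) ⟩
    m * ∑F g <⟨ m<m+n (m * ∑F g) m≥1 ⟩
    m * ∑F g + m ≡⟨ cong₂ _+_ (∑F-*ˡ m g) (∑F-1 m) ⟨
    ∑F (λ i → m * g i) + ∑F {m} (λ _ → 1) ≡⟨ ∑F-+ _ _ ⟨
    ∑F (λ i → m * g i + 1) ∎
  found = ∑F-<-∃ (λ _ → ∑F g) (λ i → m * g i + 1) lt

-- The most hairy vertex of F is sent to the vertex of large degree.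
module _ (p m r : ℕ) (p≥1 : 1 ≤ p) (m≥1 : 1 ≤ m) (r≥1 : 1 ≤ r) where
  open HairArith p m r p≥1 m≥1 r≥1

  hairy-product : ∀ {t n} (f : Fin t → Fin m) u₀ (d : Fin t → ℕ) → t ≤ m * psize f u₀ →
    (∀ s → f s ≡ u₀ → suc p * n ≤ p * r * d s) → (∀ s → f s ≢ u₀ → σ * n ≤ τ * (r * d s)) →
    (suc b * n) ^ t ≤ (b * r) ^ t * ∏F d
  hairy-product {t} {n} f u₀ d hairy₀ at off = *-cancelˡ-≤ (p ^ k * τ ^ j) ⦃ >-nonZero (*-mono-≤ (^-pos p k p≥1) (^-pos τ j τ≥1)) ⦄ (begin
    p ^ k * τ ^ j * (suc b * n) ^ t ≡⟨ trans (cong (p ^ k * τ ^ j *_) (^-distrib-* t (suc b) n)) (l₁ (p ^ k * τ ^ j) (suc b ^ t) (n ^ t)) ⟩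
    suc b ^ t * (p ^ k * τ ^ j) * n ^ t ≡⟨ cong (λ z → suc b ^ z * (p ^ k * τ ^ j) * n ^ t) t≡ ⟨
    suc b ^ (k + j) * (p ^ k * τ ^ j) * n ^ t ≤⟨ mulʳ (n ^ t) (hair-arith k j j≤) ⟩
    b ^ (k + j) * (suc p ^ k * σ ^ j) * n ^ t ≡⟨ trans (cong (λ z → b ^ z * (suc p ^ k * σ ^ j) * n ^ t) t≡) (*-assoc (b ^ t) _ _) ⟩
    b ^ t * (suc p ^ k * σ ^ j * n ^ t) ≤⟨ mulˡ (b ^ t) prods ⟩
    b ^ t * (p ^ k * τ ^ j * (r ^ t * ∏F d)) ≡⟨ trans (l₂ (b ^ t) (p ^ k * τ ^ j) (r ^ t) (∏F d)) (cong (λ z → p ^ k * τ ^ j * (z * ∏F d)) (sym (^-distrib-* t b r))) ⟩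
    p ^ k * τ ^ j * ((b * r) ^ t * ∏F d) ∎)
    where
    open ≤-Reasoning
    c : Fin t → Bool
    c s = does (f s ≟ u₀)
    k j : ℕ
    k = ∑F (λ s → ⟦ c s ⟧)
    j = ∑F (λ s → ⟦ not (c s) ⟧)
    t≡ : k + j ≡ t
    t≡ = trans (sym (∑F-+ _ _)) (trans (∑F-cong (λ s → ⟦⟧+not (c s))) (∑F-1 t))
    j≤ : j ≤ m * k
    j≤ = ≤-trans (≤-trans (m≤n+m j k) (≤-reflexive t≡)) hairy₀
    l₁ : ∀ a b c → a * (b * c) ≡ b * a * c
    l₁ = solve-∀
    l₂ : ∀ a b c d → a * (b * (c * d)) ≡ b * (a * c * d)
    l₂ = solve-∀
    pt : ∀ s → (if c s then suc p else σ) * n ≤ (if c s then p else τ) * (r * d s)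
    pt s with f s ≟ u₀
    ... | yes q = ≤-trans (at s q) (≤-reflexive (*-assoc p r (d s)))
    ... | no q = off s q
    prods : suc p ^ k * σ ^ j * n ^ t ≤ p ^ k * τ ^ j * (r ^ t * ∏F d)
    prods = begin
      suc p ^ k * σ ^ j * n ^ t ≡⟨ cong₂ _*_ (∏F-if c (suc p) σ) (∏F-const t n) ⟨
      ∏F (λ s → if c s then suc p else σ) * ∏F {t} (λ _ → n) ≡⟨ ∏F-* (λ s → if c s then suc p else σ) (λ _ → n) ⟨
      ∏F (λ s → (if c s then suc p else σ) * n) ≤⟨ ∏F-mono pt ⟩
      ∏F (λ s → (if c s then p else τ) * (r * d s)) ≡⟨ trans (∏F-* (λ s → if c s then p else τ) (λ s → r * d s)) (cong₂ _*_ (∏F-if c p τ) (trans (∏F-* (λ _ → r) d) (cong (_* ∏F d) (∏F-const t r)))) ⟩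
      p ^ k * τ ^ j * (r ^ t * ∏F d) ∎

-- The extreme case is r₁ = 3, r₂ = 2, where (1 - 13/(12 r₁)) r₂ is 23/18. The constant 10/9 lies
-- below this and still exceeds (21/20)(19/18), as the comparison of growth rates in
-- `deletion-growth` requires.
deg-arith : ∀ ρ₁ ρ₂ d₁ d₂ n → suc (2 + ρ₁ + (2 + ρ₂)) ≤ (2 + ρ₁) * (2 + ρ₂) → d₁ + d₂ ≡ n →
  12 * (2 + ρ₁) * d₂ ≤ 13 * n → 10 * n ≤ 9 * (2 + ρ₂) * d₁
deg-arith ρ₁ ρ₂ d₁ d₂ n rr refl h = *-cancelˡ-≤ (4 * (2 + ρ₁)) (linear ((8 + 10 * ρ₁ + 11 * ρ₂ + 14 * (ρ₁ * ρ₂)) * (d₁ + d₂)) (+-mono-≤ (mulˡ (22 * (d₁ + d₂)) rr) (mulˡ (3 * (2 + ρ₂)) h)) (l ρ₁ ρ₂ d₁ d₂))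
  where
  l : ∀ a b d f → 4 * (2 + a) * (9 * (2 + b) * d) + (22 * (d + f) * suc (2 + a + (2 + b)) + 3 * (2 + b) * (12 * (2 + a) * f))
    ≡ 4 * (2 + a) * (10 * (d + f)) + (22 * (d + f) * ((2 + a) * (2 + b)) + 3 * (2 + b) * (13 * (d + f))) + (8 + 10 * a + 11 * b + 14 * (a * b)) * (d + f)
  l = solve-∀

-- Every vertex of a minimiser near a Turán relation is typical

module Claims {m₁ m₂} (F₁ : Graph m₁) (F₂ : Graph m₂) (ρ₁ ρ₂ K₁ τ δ : ℕ) (cr : Critical F₁ ρ₁)
  (m₂≥1 : 1 ≤ m₂) (K₁≥1 : 1 ≤ K₁) (K₁≥12 : 12 ≤ K₁) (K₁≥32 : 32 ≤ K₁)
  (rr : suc (2 + ρ₁ + (2 + ρ₂)) ≤ (2 + ρ₁) * (2 + ρ₂))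
  (τ≥1 : 1 ≤ τ) (τ≥hair : HairArith.τ K₁ m₂ (2 + ρ₁) K₁≥1 m₂≥1 (s≤s z≤n) ≤ τ)
  (τ≥rr : 2 * ((2 + ρ₁) * (2 + ρ₁)) ≤ τ) (τ≥64r : 2 * (32 * (2 + ρ₁)) ≤ τ)
  (ττ≤δ : τ * τ ≤ δ)
  (δ≥₁ : 2 * (m₂ * m₂ * (2 * ((2 + ρ₁) * (2 + ρ₁))) ^ m₂) ≤ δ)
  (δ≥₂ : 2 * (m₁ * m₁ * (2 * (32 * (2 + ρ₁))) ^ m₁) ≤ δ)
  (δ≥₃ : 2 * (m₁ * m₁ * (4 * (2 + ρ₁)) ^ m₁) ≤ δ)
  {n} (e : Rel n) (e-sym : Symm e) (n≥1 : 1 ≤ n) (nt : NearTuran e (2 + ρ₁) δ) where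

  open Local e e-sym n≥1 ρ₁ δ τ τ≥1 ττ≤δ nt
  open Critical cr
  open ≤-Reasoning

  r₂ : ℕ
  r₂ = 2 + ρ₂

  module HA = HairArith K₁ m₂ r K₁≥1 m₂≥1 (s≤s z≤n)

  sparse : ∀ {q} → q ≤ δ → q * ∑F (λ x → ∑F (λ y → ⟦ bad x y ⟧)) ≤ n * n
  sparse q≤ = ≤-trans (mulʳ (∑F (λ x → ∑F (λ y → ⟦ bad x y ⟧))) q≤) bad≤

  typ-part : ∀ η (S : Fin n → Bool) → n ≤ η * card S → 2 * η ≤ τ → n ≤ 2 * η * card (λ y → S y ∧ typ y)
  typ-part η S big 2η≤τ = linear 0 (+-mono-≤ (mulˡ 2 big) (+-mono-≤ (mulˡ (2 * η) (restrict S)) (≤-trans (mulʳ atypical 2η≤τ) few-atypical)))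
    (l η n (card S) (card (λ y → S y ∧ typ y)) atypical)
    where l : ∀ η n s t a → 2 * η * t + (2 * n + (2 * η * s + 2 * η * a)) ≡ n + (2 * (η * s) + (2 * η * (t + a) + n)) + 0
          l = solve-∀

  upd : ∀ {m} (φ : Vec (Fin n) m) u₀ x w → (w ≡ u₀ × lookup (φ [ u₀ ]≔ x) w ≡ x) ⊎ (w ≢ u₀ × lookup (φ [ u₀ ]≔ x) w ≡ lookup φ w)
  upd φ u₀ x w with w ≟ u₀
  ... | yes refl = inj₁ (refl , lookup∘update u₀ φ x)
  ... | no q = inj₂ (q , lookup∘update′ q φ x)

  -- Otherwise some class contains at least n/r² non-neighbours of x. The complement is nearly
  -- complete inside a class, so the vertices of F₂ fit there, except that the one with most hairs
  -- is sent to x. By `hairy-product` the surplus at x outweighs the small loss at typical vertices,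
  -- so there are too many good copies of F₂ in the complement.
  deg₂-bound : ∀ {t₂} (f₂ : Fin t₂ → Fin m₂) →
    (∀ u₀ x → ¬ (n ^ m₂ ≤ 2 * (2 * (r * r)) ^ m₂ * ∑V (λ u → ι (Good? F₂ f₂ (neg e) r HA.b (u [ u₀ ]≔ x))))) →
    ∀ x → K₁ * r * deg (neg e) x ≤ suc K₁ * n
  deg₂-bound {t₂} f₂ few x with suc K₁ * n ≤? K₁ * r * deg (neg e) x
  ... | no q = <⇒≤ (≰⇒> q)
  ... | yes q = ⊥-elim (few u₀ x (≤-trans (scattered-many {m₂} (λ _ → S) bad (2 * (r * r)) n≥1 (λ _ → S-big) (sparse δ≥₁))
      (mulˡ (2 * (2 * (r * r)) ^ m₂) (∑V-mono (λ φ → ι-mono (Scattered? (λ _ → S) bad φ) (Good? F₂ f₂ (neg e) r HA.b (φ [ u₀ ]≔ x)) (good φ))))))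
    where
    u₀ = proj₁ (max-val (psize f₂) m₂≥1)
    i = proj₁ (max-val (λ i → card (nbrIn (neg e) x i)) (s≤s {n = suc ρ₁} z≤n))
    S : Fin n → Bool
    S y = nbrIn (neg e) x i y ∧ typ y
    n≤rd : n ≤ r * deg (neg e) x
    n≤rd = *-cancelˡ-≤ K₁ ⦃ >-nonZero K₁≥1 ⦄ (≤-trans (m≤n+m (K₁ * n) n) (≤-trans q (≤-reflexive (*-assoc K₁ r (deg (neg e) x)))))
    S-big : n ≤ 2 * (r * r) * card S
    S-big = typ-part (r * r) (nbrIn (neg e) x i) (≤-trans n≤rd (≤-trans (mulˡ r (≤-trans (≤-reflexive (sym (nbrIn-total (neg e) x))) (proj₂ (max-val (λ i → card (nbrIn (neg e) x i)) (s≤s {n = suc ρ₁} z≤n))))) (≤-reflexive (sym (*-assoc r r (card (nbrIn (neg e) x i))))))) τ≥rr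
    relax : ∀ d → τ * n ≤ τ * r * d + 2 * (r * n) → HA.σ * n ≤ HA.τ * (r * d)
    relax d h = *-cancelˡ-≤ τ ⦃ >-nonZero τ≥1 ⦄ (linear 0 (+-mono-≤ (mulˡ HA.τ h) (mulʳ (2 * (r * n)) τ≥hair)) (l HA.σ τ r n d))
      where l : ∀ σ τ r n d → τ * ((σ + 2 * r) * (r * d)) + ((σ + 2 * r) * (τ * n) + (σ + 2 * r) * (2 * (r * n))) ≡ τ * (σ * n) + ((σ + 2 * r) * (τ * r * d + 2 * (r * n)) + τ * (2 * (r * n))) + 0
            l = solve-∀
    good : ∀ φ → Scattered (λ _ → S) bad φ → Good F₂ f₂ (neg e) r HA.b (φ [ u₀ ]≔ x)
    good φ (inS′ , ok) = hom , hairy-product K₁ m₂ r K₁≥1 m₂≥1 (s≤s z≤n) f₂ u₀ (λ s → deg (neg e) (lookup (φ [ u₀ ]≔ x) (f₂ s)))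
        (≤-trans (≤-reflexive (sym (psize-total f₂))) (proj₂ (max-val (psize f₂) m₂≥1))) at off
      where
      S-part : ∀ w → part (lookup φ w) ≡ i
      S-part w = does-true (part (lookup φ w) ≟ i) (∧-elimˡ {does (part (lookup φ w) ≟ i)} (∧-elimˡ {nbrIn (neg e) x i (lookup φ w)} (inS′ w)))
      S-nbr : ∀ w → neg e x (lookup φ w) ≡ true
      S-nbr w = ∧-elimʳ {does (part (lookup φ w) ≟ i)} (∧-elimˡ {nbrIn (neg e) x i (lookup φ w)} (inS′ w))
      S-typ : ∀ w → typ (lookup φ w) ≡ true
      S-typ w = ∧-elimʳ {nbrIn (neg e) x i (lookup φ w)} (inS′ w)
      hom : Hom F₂ (neg e) (φ [ u₀ ]≔ x)
      hom w w′ a with upd φ u₀ x w | upd φ u₀ x w′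
      ... | inj₁ (p , _) | inj₁ (p′ , _) = contradiction (trans (sym a) (trans (cong₂ (adj F₂) p p′) (adjIrr F₂ u₀))) λ ()
      ... | inj₁ (_ , p) | inj₂ (_ , p′) = trans (cong₂ (neg e) p p′) (S-nbr w′)
      ... | inj₂ (_ , p) | inj₁ (_ , p′) = trans (cong₂ (neg e) p p′) (trans (neg-sym e-sym (lookup φ w) x) (S-nbr w))
      ... | inj₂ (_ , p) | inj₂ (_ , p′) = trans (cong₂ (neg e) p p′) (same⇒neg _ _ (trans (S-part w) (sym (S-part w′))) (ok w w′ (λ { refl → contradiction (trans (sym a) (adjIrr F₂ w)) λ () })))
      at : ∀ s → f₂ s ≡ u₀ → suc K₁ * n ≤ K₁ * r * deg (neg e) (lookup (φ [ u₀ ]≔ x) (f₂ s))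
      at s p = ≤-trans q (mulˡ (K₁ * r) (≤-reflexive (cong (deg (neg e)) (sym (trans (cong (lookup (φ [ u₀ ]≔ x)) p) (lookup∘update u₀ φ x))))))
      off : ∀ s → f₂ s ≢ u₀ → HA.σ * n ≤ HA.τ * (r * deg (neg e) (lookup (φ [ u₀ ]≔ x) (f₂ s)))
      off s p = relax _ (≤-trans (typ-deg₂-lower (lookup φ (f₂ s)) (S-typ (f₂ s))) (+-monoˡ-≤ (2 * (r * n)) (mulˡ (τ * r) (≤-reflexive (cong (deg (neg e)) (sym (lookup∘update′ p φ x)))))))

  module _ (deg₂≤ : ∀ x → K₁ * r * deg (neg e) x ≤ suc K₁ * n) where

    deg₁≥ : ∀ x → 10 * n ≤ 9 * r₂ * deg e x
    deg₁≥ x = deg-arith ρ₁ ρ₂ (deg e x) (deg (neg e) x) n rr (deg-split e x) (relax-low 12 K₁ r (deg (neg e) x) n K₁≥1 K₁≥12 (deg₂≤ x))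

    good-hairs : ∀ {t₁} (f₁ : Fin t₁ → Fin m₁) u → (10 * n) ^ t₁ ≤ (9 * r₂) ^ t₁ * hairs F₁ f₁ e u
    good-hairs {t₁} f₁ u = begin
      (10 * n) ^ t₁ ≡⟨ ∏F-const t₁ (10 * n) ⟨
      ∏F {t₁} (λ _ → 10 * n) ≤⟨ ∏F-mono (λ s → deg₁≥ (lookup u (f₁ s))) ⟩
      ∏F (λ s → 9 * r₂ * deg e (lookup u (f₁ s))) ≡⟨ trans (∏F-* (λ _ → 9 * r₂) (λ s → deg e (lookup u (f₁ s)))) (cong (_* hairs F₁ f₁ e u) (∏F-const t₁ (9 * r₂))) ⟩
      (9 * r₂) ^ t₁ * hairs F₁ f₁ e u ∎

    -- If x had many neighbours in every class, it could play u: the other vertices are properly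
    -- coloured by `col`, which distributes them over the classes. All degrees are at least (10/9) n
    -- / r₂, so each of these copies is good with K = 9.
    home : ∀ {t₁} (f₁ : Fin t₁ → Fin m₁) →
      (∀ u₀ x → ¬ (n ^ m₁ ≤ 2 * (2 * (32 * r)) ^ m₁ * ∑V (λ φ → ι (Good? F₁ f₁ e r₂ 9 (φ [ u₀ ]≔ x))))) →
      ∀ x → ∃ λ i → 32 * r * card (nbrIn e x i) < n
    home f₁ few x with any? (λ i → 32 * r * card (nbrIn e x i) <? n)
    ... | yes q = q
    ... | no q = ⊥-elim (few u x (≤-trans (scattered-many S bad (2 * (32 * r)) n≥1 S-big (sparse δ≥₂))
        (mulˡ (2 * (2 * (32 * r)) ^ m₁) (∑V-mono (λ φ → ι-mono (Scattered? S bad φ) (Good? F₁ f₁ e r₂ 9 (φ [ u ]≔ x)) (good φ))))))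
      where
      S : Fin m₁ → Fin n → Bool
      S w y = nbrIn e x (col w) y ∧ typ y
      S-big : ∀ w → n ≤ 2 * (32 * r) * card (S w)
      S-big w = typ-part (32 * r) (nbrIn e x (col w)) (≮⇒≥ (λ lt → q (col w , lt))) τ≥64r
      good : ∀ φ → Scattered S bad φ → Good F₁ f₁ e r₂ 9 (φ [ u ]≔ x)
      good φ (inS′ , ok) = hom , good-hairs f₁ (φ [ u ]≔ x)
        where
        S-part : ∀ w → part (lookup φ w) ≡ col w
        S-part w = does-true (part (lookup φ w) ≟ col w) (∧-elimˡ {does (part (lookup φ w) ≟ col w)} (∧-elimˡ {nbrIn e x (col w) (lookup φ w)} (inS′ w)))
        S-nbr : ∀ w → e x (lookup φ w) ≡ true
        S-nbr w = ∧-elimʳ {does (part (lookup φ w) ≟ col w)} (∧-elimˡ {nbrIn e x (col w) (lookup φ w)} (inS′ w))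
        hom : Hom F₁ e (φ [ u ]≔ x)
        hom w w′ a with upd φ u x w | upd φ u x w′
        ... | inj₁ (p , _) | inj₁ (p′ , _) = contradiction (trans (sym a) (trans (cong₂ (adj F₁) p p′) (adjIrr F₁ u))) λ ()
        ... | inj₁ (_ , p) | inj₂ (_ , p′) = trans (cong₂ e p p′) (S-nbr w′)
        ... | inj₂ (_ , p) | inj₁ (_ , p′) = trans (cong₂ e p p′) (trans (e-sym (lookup φ w) x) (S-nbr w))
        ... | inj₂ (w≢ , p) | inj₂ (w′≢ , p′) = trans (cong₂ e p p′) (diff⇒e _ _ (λ eq → col-proper w w′ a (w≢ ∘ proj₁) (w′≢ ∘ proj₂) (trans (sym (S-part w)) (trans eq (S-part w′)))) (ok w w′ (λ { refl → contradiction (trans (sym a) (adjIrr F₁ w)) λ () })))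

    -- Were the two colours different, `col` would be a proper colouring of F₁ itself.
    col-u≡col-v : col u ≡ col v
    col-u≡col-v with col u ≟ col v
    ... | yes q = q
    ... | no q = ⊥-elim (uncolourable (col , λ i j a → go i j a))
      where
      go : ∀ i j → adj F₁ i j ≡ true → col i ≢ col j
      go i j a eq = col-proper i j a (λ { (refl , refl) → q eq }) (λ { (refl , refl) → q (sym eq) }) eq

    -- An edge xy inside a class spans many copies of F₁ in which it plays the critical edge.
    module Inside (x y : Fin n) (i : Fin r) (hx : 32 * r * card (nbrIn e x i) < n) (hy : 32 * r * card (nbrIn e y i) < n) (exy : e x y ≡ true) where

      psz≥ : ∀ j → 31 * n ≤ 32 * r * psz j
      psz≥ j = *-cancelˡ-≤ τ ⦃ >-nonZero τ≥1 ⦄ (linear (32 * n) (+-mono-≤ (mulˡ 32 (psz-lower j)) (mulʳ n (≤-trans (m≤m+n (32 * r) _) τ≥64r))) (l τ r n (psz j)))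
        where l : ∀ τ r n p → τ * (32 * r * p) + (32 * (suc τ * n) + 32 * r * n) ≡ τ * (31 * n) + (32 * (τ * r * p + r * n) + τ * n) + 32 * n
              l = solve-∀

      -- Class i has size close to n/r and z misses almost all of it. This uses up nearly all of the
      -- at most (33/32) n / r non-neighbours of z.
      cross : ∀ z → 32 * r * card (nbrIn e z i) < n → ∀ j → j ≢ i → 32 * r * card (nbrIn (neg e) z j) ≤ 3 * n
      cross z hz j j≢i = linear 0 (+-mono-≤ (psz≥ i) (+-mono-≤ (<⇒≤ hz) (+-mono-≤ (relax-low 32 K₁ r (deg (neg e) z) n K₁≥1 K₁≥32 (deg₂≤ z)) (mulˡ (32 * r) two))))
        (subst (λ q → 3 * n + (31 * n + (32 * r * card (nbrIn e z i) + (32 * r * deg (neg e) z + 32 * r * (card (nbrIn (neg e) z j) + card (nbrIn (neg e) z i))))) ≡ 32 * r * card (nbrIn (neg e) z j) + (32 * r * q + (n + (33 * n + 32 * r * deg (neg e) z))) + 0)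
          (nbrIn-split z i) (l n (32 * r) (card (nbrIn e z i)) (deg (neg e) z) (card (nbrIn (neg e) z j)) (card (nbrIn (neg e) z i))))
        where
        two : card (nbrIn (neg e) z j) + card (nbrIn (neg e) z i) ≤ deg (neg e) z
        two = ≤-trans (∑F-≥₂ (λ j → card (nbrIn (neg e) z j)) j i j≢i) (≤-reflexive (nbrIn-total (neg e) z))
        l : ∀ n R a D c b → 3 * n + (31 * n + (R * a + (R * D + R * (c + b)))) ≡ R * c + (R * (a + b) + (n + (33 * n + R * D))) + 0
        l = solve-∀

      c₀ : Fin r
      c₀ = col u

      -- The transposition of `c₀` and `i`: the common colour of u and v goes to the class in which
      -- x and y have few neighbours.
      π : Fin r → Fin r
      π c = if does (c ≟ c₀) then i else (if does (c ≟ i) then c₀ else c)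

      π-c₀ : ∀ {c} → c ≡ c₀ → π c ≡ i
      π-c₀ {c} p = cong (if_then i else (if does (c ≟ i) then c₀ else c)) (dec-true (c ≟ c₀) p)

      π-i : ∀ {c} → c ≢ c₀ → c ≡ i → π c ≡ c₀
      π-i {c} p q = trans (cong (if_then i else (if does (c ≟ i) then c₀ else c)) (dec-false (c ≟ c₀) p)) (cong (if_then c₀ else c) (dec-true (c ≟ i) q))

      π-else : ∀ {c} → c ≢ c₀ → c ≢ i → π c ≡ c
      π-else {c} p q = trans (cong (if_then i else (if does (c ≟ i) then c₀ else c)) (dec-false (c ≟ c₀) p)) (cong (if_then c₀ else c) (dec-false (c ≟ i) q))

      π≢i : ∀ {c} → c ≢ c₀ → π c ≢ i
      π≢i {c} p eq = go (c ≟ i)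
        where
        go : Dec (c ≡ i) → ⊥
        go (yes q) = p (trans q (trans (sym eq) (π-i p q)))
        go (no q) = q (trans (sym (π-else p q)) eq)

      π-inj : ∀ c d → π c ≡ π d → c ≡ d
      π-inj c d eq = go (c ≟ c₀) (d ≟ c₀) (c ≟ i) (d ≟ i)
        where
        go : Dec (c ≡ c₀) → Dec (d ≡ c₀) → Dec (c ≡ i) → Dec (d ≡ i) → c ≡ d
        go (yes p) (yes q) _ _ = trans p (sym q)
        go (yes p) (no q) _ _ = contradiction (trans (sym eq) (π-c₀ p)) (π≢i q)
        go (no p) (yes q) _ _ = contradiction (trans eq (π-c₀ q)) (π≢i p)
        go (no p) (no q) (yes p′) (yes q′) = trans p′ (sym q′)
        go (no p) (no q) (yes p′) (no q′) = contradiction (trans (sym (π-else q q′)) (trans (sym eq) (π-i p p′))) q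
        go (no p) (no q) (no p′) (yes q′) = contradiction (trans (sym (π-else p p′)) (trans eq (π-i q q′))) p
        go (no p) (no q) (no p′) (no q′) = trans (sym (π-else p p′)) (trans eq (π-else q q′))

      -- Vertices coloured like u and v are joined to neither of them, apart from the edge uv
      -- itself, so their images need not be neighbours of x and y.
      S : Fin m₁ → Fin n → Bool
      S w z = does (part z ≟ π (col w)) ∧ (typ z ∧ (does (col w ≟ c₀) ∨ (e x z ∧ e y z)))

      atyp≤ : 32 * r * atypical ≤ n
      atyp≤ = ≤-trans (mulʳ atypical (≤-trans (m≤m+n (32 * r) _) τ≥64r)) few-atypical

      S-big : ∀ w → n ≤ 4 * r * card (S w)
      S-big w = go (col w ≟ c₀)
        where
        finish : 24 * n ≤ 32 * r * card (S w) → n ≤ 4 * r * card (S w)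
        finish h = *-cancelˡ-≤ 8 (≤-trans (*-monoˡ-≤ n {8} {24} (m≤m+n 8 16)) (≤-trans h (≤-reflexive (l r (card (S w))))))
          where l : ∀ r s → 32 * r * s ≡ 8 * (4 * r * s)
                l = solve-∀
        j = π (col w)
        go : Dec (col w ≡ c₀) → n ≤ 4 * r * card (S w)
        go (yes p) = finish (linear (6 * n) (+-mono-≤ (psz≥ j) (+-mono-≤ (mulˡ (32 * r) sum) atyp≤)) (l n (32 * r) (psz j) (card (S w)) atypical))
          where
          l : ∀ n R p s a → R * s + (31 * n + (R * p + R * a)) ≡ 24 * n + (R * p + (R * (s + a) + n)) + 6 * n
          l = solve-∀
          bool : ∀ s t c d → c ≡ true → ⟦ s ⟧ ≤ ⟦ s ∧ (t ∧ (c ∨ d)) ⟧ + ⟦ not t ⟧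
          bool true true .true d refl = ≤-refl
          bool true false .true d refl = ≤-refl
          bool false t .true d refl = z≤n
          sum : psz j ≤ card (S w) + atypical
          sum = ≤-trans (∑F-mono (λ z → bool (does (part z ≟ j)) (typ z) (does (col w ≟ c₀)) (e x z ∧ e y z) (dec-true (col w ≟ c₀) p))) (≤-reflexive (∑F-+ _ _))
        go (no p) = finish (linear 0 (+-mono-≤ (psz≥ j) (+-mono-≤ (mulˡ (32 * r) sum) (+-mono-≤ atyp≤ (+-mono-≤ (cross x hx j (π≢i p)) (cross y hy j (π≢i p))))))
            (l n (32 * r) (psz j) (card (S w)) atypical (card (nbrIn (neg e) x j)) (card (nbrIn (neg e) y j))))
          where
          l : ∀ n R p s a b c → R * s + (31 * n + (R * p + (R * a + (R * b + R * c)))) ≡ 24 * n + (R * p + (R * (s + (a + (b + c))) + (n + (3 * n + 3 * n)))) + 0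
          l = solve-∀
          bool : ∀ s t c d d′ → ⟦ s ⟧ ≤ ⟦ s ∧ (t ∧ (c ∨ (d ∧ d′))) ⟧ + (⟦ not t ⟧ + (⟦ s ∧ not d ⟧ + ⟦ s ∧ not d′ ⟧))
          bool true true true d d′ = s≤s z≤n
          bool true true false true true = ≤-refl
          bool true true false true false = ≤-refl
          bool true true false false d′ = s≤s z≤n
          bool true false c d d′ = s≤s z≤n
          bool false t c d d′ = z≤n
          sum : psz j ≤ card (S w) + (atypical + (card (nbrIn (neg e) x j) + card (nbrIn (neg e) y j)))
          sum = ≤-trans (∑F-mono (λ z → bool (does (part z ≟ j)) (typ z) (does (col w ≟ c₀)) (e x z) (e y z)))
            (≤-reflexive (trans (∑F-+ _ _) (cong (card (S w) +_) (trans (∑F-+ _ _) (cong (atypical +_) (∑F-+ _ _))))))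

      at : ∀ φ w → (w ≡ u × lookup ((φ [ u ]≔ x) [ v ]≔ y) w ≡ x) ⊎ ((w ≡ v × lookup ((φ [ u ]≔ x) [ v ]≔ y) w ≡ y) ⊎ ((w ≢ u × w ≢ v) × lookup ((φ [ u ]≔ x) [ v ]≔ y) w ≡ lookup φ w))
      at φ w with upd (φ [ u ]≔ x) v y w
      ... | inj₁ q = inj₂ (inj₁ q)
      ... | inj₂ (w≢v , q) with upd φ u x w
      ... | inj₁ (p , q′) = inj₁ (p , trans q q′)
      ... | inj₂ (w≢u , q′) = inj₂ (inj₂ ((w≢u , w≢v) , trans q q′))

      good : ∀ φ → Scattered S bad φ → Hom F₁ e ((φ [ u ]≔ x) [ v ]≔ y)
      good φ (inS′ , ok) = hom
        where
        S-part : ∀ w → part (lookup φ w) ≡ π (col w)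
        S-part w = does-true (part (lookup φ w) ≟ π (col w)) (∧-elimˡ (inS′ w))
        S-nbr : ∀ w → col w ≢ c₀ → (e x (lookup φ w) ∧ e y (lookup φ w)) ≡ true
        S-nbr w q = trans (cong (_∨ (e x (lookup φ w) ∧ e y (lookup φ w))) (sym (dec-false (col w ≟ c₀) q))) (∧-elimʳ {typ (lookup φ w)} (∧-elimʳ {does (part (lookup φ w) ≟ π (col w))} (inS′ w)))
        F-sym : ∀ {a b} → adj F₁ a b ≡ true → adj F₁ b a ≡ true
        F-sym p = trans (adjSym F₁ _ _) p
        to-u : ∀ w → w ≢ u → w ≢ v → adj F₁ u w ≡ true → e x (lookup φ w) ≡ true
        to-u w w≢u w≢v a = ∧-elimˡ (S-nbr w (λ q → col-proper u w a (w≢v ∘ proj₂) (w≢u ∘ proj₂) (sym q)))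
        to-v : ∀ w → w ≢ u → w ≢ v → adj F₁ v w ≡ true → e y (lookup φ w) ≡ true
        to-v w w≢u w≢v a = ∧-elimʳ {e x (lookup φ w)} (S-nbr w (λ q → col-proper v w a (w≢v ∘ proj₂) (w≢u ∘ proj₂) (trans (sym col-u≡col-v) (sym q))))
        loop : ∀ {a b c} → adj F₁ a b ≡ true → a ≡ c → b ≡ c → ⊥
        loop {c = c} p refl refl = contradiction (trans (sym p) (adjIrr F₁ c)) λ ()
        hom : Hom F₁ e ((φ [ u ]≔ x) [ v ]≔ y)
        hom w w′ a with at φ w | at φ w′
        ... | inj₁ (p , _) | inj₁ (p′ , _) = ⊥-elim (loop a p p′)
        ... | inj₁ (_ , q) | inj₂ (inj₁ (_ , q′)) = trans (cong₂ e q q′) exy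
        ... | inj₁ (p , q) | inj₂ (inj₂ ((w′≢u , w′≢v) , q′)) = trans (cong₂ e q q′) (to-u w′ w′≢u w′≢v (trans (cong (λ z → adj F₁ z w′) (sym p)) a))
        ... | inj₂ (inj₁ (_ , q)) | inj₁ (_ , q′) = trans (cong₂ e q q′) (trans (e-sym y x) exy)
        ... | inj₂ (inj₁ (p , _)) | inj₂ (inj₁ (p′ , _)) = ⊥-elim (loop a p p′)
        ... | inj₂ (inj₁ (p , q)) | inj₂ (inj₂ ((w′≢u , w′≢v) , q′)) = trans (cong₂ e q q′) (to-v w′ w′≢u w′≢v (trans (cong (λ z → adj F₁ z w′) (sym p)) a))
        ... | inj₂ (inj₂ ((w≢u , w≢v) , q)) | inj₁ (p′ , q′) = trans (cong₂ e q q′) (trans (e-sym _ x) (to-u w w≢u w≢v (trans (cong (λ z → adj F₁ z w) (sym p′)) (F-sym a))))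
        ... | inj₂ (inj₂ ((w≢u , w≢v) , q)) | inj₂ (inj₁ (p′ , q′)) = trans (cong₂ e q q′) (trans (e-sym _ y) (to-v w w≢u w≢v (trans (cong (λ z → adj F₁ z w) (sym p′)) (F-sym a))))
        ... | inj₂ (inj₂ ((w≢u , w≢v) , q)) | inj₂ (inj₂ ((w′≢u , w′≢v) , q′)) = trans (cong₂ e q q′)
            (diff⇒e _ _ (λ eq → col-proper w w′ a (w≢u ∘ proj₁) (w≢v ∘ proj₁) (π-inj _ _ (trans (sym (S-part w)) (trans eq (S-part w′))))) (ok w w′ (λ p → loop a p refl)))

      many-copies : n ^ m₁ ≤ 2 * (4 * r) ^ m₁ * ∑V (λ φ → ι (Hom? F₁ e ((φ [ u ]≔ x) [ v ]≔ y)))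
      many-copies = ≤-trans (scattered-many S bad (4 * r) n≥1 S-big (sparse δ≥₃))
        (mulˡ (2 * (4 * r) ^ m₁) (∑V-mono (λ φ → ι-mono (Scattered? S bad φ) (Hom? F₁ e ((φ [ u ]≔ x) [ v ]≔ y)) (good φ))))

-- Deleting one edge

fixing-2 : ∀ {h n} (u v : Fin h) (x y : Fin n) → u ≢ v → x ≢ y → Fixing (λ i → does (i ≟ u) ∨ does (i ≟ v)) (λ φ → (φ [ u ]≔ x) [ v ]≔ y)
fixing-2 u v x y u≢v x≢y = record { free = free ; fixed = fixed ; distinct = distinct }
  where
  g : Vec _ _ → Vec _ _
  g φ = (φ [ u ]≔ x) [ v ]≔ y
  g-u : ∀ φ → lookup (g φ) u ≡ x
  g-u φ = trans (lookup∘update′ u≢v (φ [ u ]≔ x) y) (lookup∘update u φ x)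
  g-v : ∀ φ → lookup (g φ) v ≡ y
  g-v φ = lookup∘update v (φ [ u ]≔ x) y
  free : ∀ φ i → does (i ≟ u) ∨ does (i ≟ v) ≡ false → lookup (g φ) i ≡ lookup φ i
  free φ i p = trans (lookup∘update′ (does-false (i ≟ v) (∨-elimʳ (does (i ≟ u)) p)) (φ [ u ]≔ x) y) (lookup∘update′ (does-false (i ≟ u) (∨-elimˡ p)) φ x)
    where
    ∨-elimˡ : ∀ {a b} → a ∨ b ≡ false → a ≡ false
    ∨-elimˡ {false} _ = refl
    ∨-elimʳ : ∀ a {b} → a ∨ b ≡ false → b ≡ false
    ∨-elimʳ false q = q
  which : ∀ i → does (i ≟ u) ∨ does (i ≟ v) ≡ true → (i ≡ u) ⊎ (i ≡ v)
  which i p with i ≟ u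
  ... | yes q = inj₁ q
  ... | no _ = inj₂ (does-true (i ≟ v) p)
  fixed : ∀ φ φ′ i → does (i ≟ u) ∨ does (i ≟ v) ≡ true → lookup (g φ) i ≡ lookup (g φ′) i
  fixed φ φ′ i p with which i p
  ... | inj₁ refl = trans (g-u φ) (sym (g-u φ′))
  ... | inj₂ refl = trans (g-v φ) (sym (g-v φ′))
  distinct : ∀ φ i j → does (i ≟ u) ∨ does (i ≟ v) ≡ true → does (j ≟ u) ∨ does (j ≟ v) ≡ true → i ≢ j → lookup (g φ) i ≢ lookup (g φ) j
  distinct φ i j p q i≢j eq with which i p | which j q
  ... | inj₁ refl | inj₁ refl = i≢j refl
  ... | inj₁ refl | inj₂ refl = x≢y (trans (sym (g-u φ)) (trans eq (g-v φ)))
  ... | inj₂ refl | inj₁ refl = x≢y (trans (sym (g-u φ)) (trans (sym eq) (g-v φ)))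
  ... | inj₂ refl | inj₂ refl = i≢j refl

∑V-fix₂ : ∀ {h n} (u v : Fin h) (x y : Fin n) → u ≢ v → (k : Vec (Fin n) h → ℕ) →
  ∑V (λ φ → k ((φ [ u ]≔ x) [ v ]≔ y)) ≡ n * (n * ∑V (λ φ → ι (lookup φ v ≟ y) * (ι (lookup φ u ≟ x) * k φ)))
∑V-fix₂ {h} {n} u v x y u≢v k = begin
  ∑V (λ φ → k ((φ [ u ]≔ x) [ v ]≔ y)) ≡⟨ ∑V-fix u x (λ φ → k (φ [ v ]≔ y)) ⟩
  n * ∑V (λ φ → ι (lookup φ u ≟ x) * k (φ [ v ]≔ y)) ≡⟨ cong (n *_) (∑V-cong (λ φ → cong (λ z → ι (z ≟ x) * k (φ [ v ]≔ y)) (sym (lookup∘update′ u≢v φ y)))) ⟩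
  n * ∑V (λ φ → ι (lookup (φ [ v ]≔ y) u ≟ x) * k (φ [ v ]≔ y)) ≡⟨ cong (n *_) (∑V-fix v y (λ φ → ι (lookup φ u ≟ x) * k φ)) ⟩
  n * (n * ∑V (λ φ → ι (lookup φ v ≟ y) * (ι (lookup φ u ≟ x) * k φ))) ∎
  where open ≡-Reasoning

-- Serves a product of degrees in which one hair is forced to a single vertex and therefore
-- contributes 1 in place of a degree.
∏F-special : ∀ {t} (f : Fin t → ℕ) s a c M → (∀ s′ → s′ ≢ s → f s′ ≤ M) → a * f s ≤ c * M → a * ∏F f ≤ c * M ^ t
∏F-special {suc t} f zero a c M rest h = begin
  a * (f zero * ∏F (f ∘ suc)) ≡⟨ *-assoc a (f zero) _ ⟨
  a * f zero * ∏F (f ∘ suc) ≤⟨ *-mono-≤ h (∏F-mono (λ s → rest (suc s) λ ())) ⟩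
  c * M * ∏F {t} (λ _ → M) ≡⟨ trans (cong (c * M *_) (∏F-const t M)) (*-assoc c M _) ⟩
  c * M ^ suc t ∎
  where open ≤-Reasoning
∏F-special {suc t} f (suc s) a c M rest h = begin
  a * (f zero * ∏F (f ∘ suc)) ≡⟨ *-left-comm a (f zero) _ ⟩
  f zero * (a * ∏F (f ∘ suc)) ≤⟨ *-mono-≤ (rest zero λ ()) (∏F-special (f ∘ suc) s a c M (λ s′ q → rest (suc s′) (q ∘ Fin-suc-injective)) h) ⟩
  M * (c * M ^ t) ≡⟨ *-left-comm M c _ ⟩
  c * M ^ suc t ∎
  where
  open ≤-Reasoning

∏F-pos : ∀ {t} (f : Fin t → ℕ) → (∀ s → 1 ≤ f s) → 1 ≤ ∏F f
∏F-pos {t} f h = ≤-trans (≤-reflexive (sym (trans (∏F-const t 1) (^-zeroˡ t)))) (∏F-mono h)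

module Deletion {n} (e : Rel n) (e-sym : Symm e) (x y : Fin n) (x≢y : x ≢ y) (exy : e x y ≡ true) where

  isxy : Fin n → Fin n → Bool
  isxy p q = (does (p ≟ x) ∧ does (q ≟ y)) ∨ (does (p ≟ y) ∧ does (q ≟ x))

  e′ : Rel n
  e′ p q = e p q ∧ not (isxy p q)

  isxy-sym : ∀ p q → isxy p q ≡ isxy q p
  isxy-sym p q = trans (Bool.∨-comm (does (p ≟ x) ∧ does (q ≟ y)) _) (cong₂ _∨_ (Bool.∧-comm (does (p ≟ y)) _) (Bool.∧-comm (does (p ≟ x)) _))

  e′-sym : Symm e′
  e′-sym p q = cong₂ (λ a b → a ∧ not b) (e-sym p q) (isxy-sym p q)

  e′xy : e′ x y ≡ false
  e′xy = trans (cong (λ b → e x y ∧ not b) (cong₂ (λ a b → (a ∧ b) ∨ (does (x ≟ y) ∧ does (y ≟ x))) (dec-true (x ≟ x) refl) (dec-true (y ≟ y) refl))) (Bool.∧-zeroʳ (e x y))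

  new-pair : ∀ p q → neg e′ p q ≡ true → neg e p q ≢ true → (p ≡ x × q ≡ y) ⊎ (p ≡ y × q ≡ x)
  new-pair p q h h′ = go (p ≟ x) (q ≟ y) (p ≟ y) (q ≟ x)
    where
    t : isxy p q ≡ true
    t with e p q | isxy p q
    ... | true | true = refl
    ... | true | false = h
    ... | false | _ = contradiction refl h′
    go : Dec (p ≡ x) → Dec (q ≡ y) → Dec (p ≡ y) → Dec (q ≡ x) → (p ≡ x × q ≡ y) ⊎ (p ≡ y × q ≡ x)
    go (yes a) (yes b) _ _ = inj₁ (a , b)
    go _ _ (yes c) (yes d) = inj₂ (c , d)
    go (no a) _ (no c) _ = contradiction (trans (sym t) (cong₂ (λ s t → (s ∧ does (q ≟ y)) ∨ (t ∧ does (q ≟ x))) (dec-false (p ≟ x) a) (dec-false (p ≟ y) c))) λ ()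
    go (no a) _ _ (no d) = contradiction (trans (sym t) (trans (cong₂ (λ s t → (s ∧ does (q ≟ y)) ∨ (does (p ≟ y) ∧ t)) (dec-false (p ≟ x) a) (dec-false (q ≟ x) d)) (Bool.∧-zeroʳ (does (p ≟ y))))) λ ()
    go _ (no b) (no c) _ = contradiction (trans (sym t) (trans (cong₂ (λ s t → (does (p ≟ x) ∧ s) ∨ (t ∧ does (q ≟ x))) (dec-false (q ≟ y) b) (dec-false (p ≟ y) c)) (trans (Bool.∨-identityʳ _) (Bool.∧-zeroʳ (does (p ≟ x)))))) λ ()
    go _ (no b) _ (no d) = contradiction (trans (sym t) (trans (cong₂ (λ s t → (does (p ≟ x) ∧ s) ∨ (does (p ≟ y) ∧ t)) (dec-false (q ≟ y) b) (dec-false (q ≟ x) d)) (cong₂ _∨_ (Bool.∧-zeroʳ (does (p ≟ x))) (Bool.∧-zeroʳ (does (p ≟ y)))))) λ ()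

  deg′ : ∀ z → deg (neg e′) z ≤ deg (neg e) z + 1
  deg′ z = ≤-trans (∑F-mono (λ q → pt q)) (≤-trans (≤-reflexive (∑F-+ _ _)) (+-monoʳ-≤ (deg (neg e) z) (≤-reflexive (∑F-ι other))))
    where
    other : Fin n
    other = if does (z ≟ x) then y else x
    pt : ∀ q → ⟦ neg e′ z q ⟧ ≤ ⟦ neg e z q ⟧ + ι (q ≟ other)
    pt q with neg e z q Bool.≟ true
    ... | yes h = ≤-trans (⟦⟧≤1 (neg e′ z q)) (≤-trans (≤-reflexive (cong ⟦_⟧ (sym h))) (m≤m+n _ _))
    ... | no h with neg e′ z q in eq
    ... | false = z≤n
    ... | true = ≤-trans (≤-reflexive (sym (ι-yes (q ≟ other) (go (new-pair z q eq h))))) (m≤n+m _ ⟦ neg e z q ⟧)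
      where
      go : (z ≡ x × q ≡ y) ⊎ (z ≡ y × q ≡ x) → q ≡ other
      go (inj₁ (a , b)) = trans b (sym (cong (if_then y else x) (dec-true (z ≟ x) a)))
      go (inj₂ (a , b)) = trans b (sym (cong (if_then y else x) (dec-false (z ≟ x) (λ c → x≢y (trans (sym c) a)))))

  -- Copies that put uv on xy do not survive the deletion. One orientation suffices for a lower
  -- bound; the factor n² stems from prescribing two coordinates.
  lost : ∀ {h} (H : Graph h) u v → u ≢ v → adj H u v ≡ true →
    n * n * #injhom H e′ + ∑V (λ φ → ι (InjHom? H e ((φ [ u ]≔ x) [ v ]≔ y))) ≤ n * n * #injhom H e
  lost {h} H u v u≢v a = begin
    n * n * #injhom H e′ + ∑V (λ φ → ι (InjHom? H e ((φ [ u ]≔ x) [ v ]≔ y))) ≡⟨ cong (n * n * #injhom H e′ +_) (trans (∑V-fix₂ u v x y u≢v (λ φ → ι (InjHom? H e φ))) (sym (*-assoc n n _))) ⟩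
    n * n * #injhom H e′ + n * n * ∑V (λ φ → ι (lookup φ v ≟ y) * (ι (lookup φ u ≟ x) * ι (InjHom? H e φ))) ≡⟨ trans (cong (n * n *_) (∑V-+ _ _)) (*-distribˡ-+ (n * n) (#injhom H e′) _) ⟨
    n * n * ∑V (λ φ → ι (InjHom? H e′ φ) + ι (lookup φ v ≟ y) * (ι (lookup φ u ≟ x) * ι (InjHom? H e φ))) ≤⟨ mulˡ (n * n) (∑V-mono pt) ⟩
    n * n * #injhom H e ∎
    where
    open ≤-Reasoning
    pt : ∀ φ → ι (InjHom? H e′ φ) + ι (lookup φ v ≟ y) * (ι (lookup φ u ≟ x) * ι (InjHom? H e φ)) ≤ ι (InjHom? H e φ)
    pt φ = go (ι-cases (InjHom? H e′ φ))
      where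
      rest≤ : ι (lookup φ v ≟ y) * (ι (lookup φ u ≟ x) * ι (InjHom? H e φ)) ≤ ι (InjHom? H e φ)
      rest≤ = ι*≤ (lookup φ v ≟ y) (λ _ → ι*≤ (lookup φ u ≟ x) (λ _ → ≤-refl))
      go : ((Inj φ × Hom H e′ φ) × ι (InjHom? H e′ φ) ≡ 1) ⊎ (¬ (Inj φ × Hom H e′ φ) × ι (InjHom? H e′ φ) ≡ 0) →
        ι (InjHom? H e′ φ) + ι (lookup φ v ≟ y) * (ι (lookup φ u ≟ x) * ι (InjHom? H e φ)) ≤ ι (InjHom? H e φ)
      go (inj₂ (_ , q)) = ≤-trans (≤-reflexive (cong (_+ ι (lookup φ v ≟ y) * (ι (lookup φ u ≟ x) * ι (InjHom? H e φ))) q)) rest≤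
      go (inj₁ ((inj , hom) , q)) = ≤-trans (+-mono-≤ (≤-reflexive q) (ι*≤ (lookup φ v ≟ y) {k = 0} (λ b → ι*≤ (lookup φ u ≟ x) (λ c → contradiction (trans (sym (hom u v a)) (trans (cong₂ e′ c b) e′xy)) λ ()))))
        (≤-reflexive (sym (ι-yes (InjHom? H e φ) (inj , λ i j r → ∧-elimˡ (hom i j r)))))

  module Gained {m t} (F : Graph m) (f : Fin t → Fin m) (p r : ℕ) (p≥1 : 1 ≤ p) (r≥1 : 1 ≤ r)
    (deg≤ : ∀ z → p * r * deg (neg e′) z ≤ suc p * n) where
    H : Graph (m + t)
    H = hairy F t f
    M : ℕ
    M = suc p * n
    open ≤-Reasoning

    kf : Vec (Fin n) m → Fin t → Fin n → Fin t → Fin n → ℕ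
    kf u s y′ s′ z = if does (s′ ≟ s) then ι (z ≟ y′) else ⟦ neg e′ (lookup u (f s′)) z ⟧

    Z₁ : Vec (Fin n) m → Vec (Fin n) t → ℕ
    Z₁ u w = ∑F (λ a → ∑F (λ b → ι (¬? (a ≟ b)) * (ι (lookup u a ≟ x) * ι (lookup u b ≟ y)) * ι (Hom? H (neg e′) (u Vec.++ w))))

    -- Here hair s runs from x′ to y′. The other hairs must follow `neg e′`, but the edges of the
    -- core are left unconstrained, which turns the count over the hair ends into a product.
    Zs : Fin n → Fin n → Vec (Fin n) m → Vec (Fin n) t → ℕ
    Zs x′ y′ u w = ∑F (λ s → ι (lookup u (f s) ≟ x′) * ∏F (λ s′ → kf u s y′ s′ (lookup w s′)))

    Z₁-lower : ∀ u w a b → a ≢ b → lookup u a ≡ x → lookup u b ≡ y → Hom H (neg e′) (u Vec.++ w) → 1 ≤ Z₁ u w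
    Z₁-lower u w a b a≢b p q hom = ≤-trans (≤-reflexive (sym (cong₂ _*_ (cong₂ _*_ (ι-yes (¬? (a ≟ b)) a≢b) (cong₂ _*_ (ι-yes (lookup u a ≟ x) p) (ι-yes (lookup u b ≟ y) q))) (ι-yes (Hom? H (neg e′) (u Vec.++ w)) hom))))
      (≤-trans (∑F-≥ (λ b → ι (¬? (a ≟ b)) * (ι (lookup u a ≟ x) * ι (lookup u b ≟ y)) * ι (Hom? H (neg e′) (u Vec.++ w))) b)
        (∑F-≥ (λ a → ∑F (λ b → ι (¬? (a ≟ b)) * (ι (lookup u a ≟ x) * ι (lookup u b ≟ y)) * ι (Hom? H (neg e′) (u Vec.++ w)))) a))

    Zs-lower : ∀ x′ y′ u w s → lookup u (f s) ≡ x′ → lookup w s ≡ y′ → Hom H (neg e′) (u Vec.++ w) → 1 ≤ Zs x′ y′ u w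
    Zs-lower x′ y′ u w s p q hom = ≤-trans (*-mono-≤ (≤-reflexive (sym (ι-yes (lookup u (f s) ≟ x′) p))) (∏F-pos (λ s′ → kf u s y′ s′ (lookup w s′)) each))
      (∑F-≥ (λ s → ι (lookup u (f s) ≟ x′) * ∏F (λ s′ → kf u s y′ s′ (lookup w s′))) s)
      where
      each : ∀ s′ → 1 ≤ kf u s y′ s′ (lookup w s′)
      each s′ with s′ ≟ s
      ... | yes refl = ≤-reflexive (sym (ι-yes (lookup w s ≟ y′) q))
      ... | no _ = ≤-reflexive (sym (cong ⟦_⟧ (proj₂ (hairy-hom⇒ F f (neg e′) u w hom) s′)))

    -- A copy that did not exist before the deletion uses the pair xy, either for an edge of the
    -- core or for a hair in one of two orientations.
    gain-pt : ∀ u w → ι (InjHom? H (neg e′) (u Vec.++ w)) ≤ ι (InjHom? H (neg e) (u Vec.++ w)) + (Z₁ u w + (Zs x y u w + Zs y x u w))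
    gain-pt u w = ι≤ (InjHom? H (neg e′) (u Vec.++ w)) λ { (inj , hom) → go inj hom (InjHom? H (neg e) (u Vec.++ w)) }
      where
      Zall = Z₁ u w + (Zs x y u w + Zs y x u w)
      viaZ : 1 ≤ Zall → 1 ≤ ι (InjHom? H (neg e) (u Vec.++ w)) + Zall
      viaZ h = ≤-trans h (m≤n+m Zall (ι (InjHom? H (neg e) (u Vec.++ w))))
      go : Inj (u Vec.++ w) → Hom H (neg e′) (u Vec.++ w) → Dec (Inj (u Vec.++ w) × Hom H (neg e) (u Vec.++ w)) → 1 ≤ ι (InjHom? H (neg e) (u Vec.++ w)) + Zall
      go inj hom (yes q) = ≤-trans (≤-reflexive (sym (ι-yes (InjHom? H (neg e) (u Vec.++ w)) q))) (m≤m+n _ Zall)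
      go inj hom (no q) = viaZ (search (any? (λ a → any? (λ b → (adj F a b Bool.≟ true) ×-dec ¬? (neg e (lookup u a) (lookup u b) Bool.≟ true))))
          (any? (λ s → ¬? (neg e (lookup u (f s)) (lookup w s) Bool.≟ true))))
        where
        homs = hairy-hom⇒ F f (neg e′) u w hom
        search : Dec (∃ λ a → ∃ λ b → adj F a b ≡ true × neg e (lookup u a) (lookup u b) ≢ true) → Dec (∃ λ s → neg e (lookup u (f s)) (lookup w s) ≢ true) → 1 ≤ Zall
        search (yes (a , b , ab , ne)) _ with new-pair (lookup u a) (lookup u b) (proj₁ homs a b ab) ne
        ... | inj₁ (p , q) = ≤-trans (Z₁-lower u w a b (λ { refl → contradiction (trans (sym ab) (adjIrr F a)) λ () }) p q hom) (m≤m+n (Z₁ u w) _)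
        ... | inj₂ (p , q) = ≤-trans (Z₁-lower u w b a (λ { refl → contradiction (trans (sym ab) (adjIrr F a)) λ () }) q p hom) (m≤m+n (Z₁ u w) _)
        search (no _) (yes (s , ne)) with new-pair (lookup u (f s)) (lookup w s) (proj₂ homs s) ne
        ... | inj₁ (p , q) = ≤-trans (Zs-lower x y u w s p q hom) (≤-trans (m≤m+n (Zs x y u w) _) (m≤n+m _ (Z₁ u w)))
        ... | inj₂ (p , q) = ≤-trans (Zs-lower y x u w s p q hom) (≤-trans (m≤n+m (Zs y x u w) (Zs x y u w)) (m≤n+m _ (Z₁ u w)))
        search (no na) (no ns) = contradiction (inj , hairy-hom⇐ F f (neg e) (neg-sym e-sym) u w
          (λ a b ab → decidable-stable (neg e (lookup u a) (lookup u b) Bool.≟ true) (λ ne → na (a , b , ab , ne)))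
          (λ s → decidable-stable (neg e (lookup u (f s)) (lookup w s) Bool.≟ true) (λ ne → ns (s , ne)))) q

    hairs≤ : ∀ u → (p * r) ^ t * hairs F f (neg e′) u ≤ M ^ t
    hairs≤ u = begin
      (p * r) ^ t * hairs F f (neg e′) u ≡⟨ trans (cong (_* hairs F f (neg e′) u) (sym (∏F-const t (p * r)))) (sym (∏F-* (λ _ → p * r) (λ s → deg (neg e′) (lookup u (f s))))) ⟩
      ∏F (λ s → p * r * deg (neg e′) (lookup u (f s))) ≤⟨ ∏F-mono (λ s → deg≤ (lookup u (f s))) ⟩
      ∏F {t} (λ _ → M) ≡⟨ ∏F-const t M ⟩
      M ^ t ∎

    -- Two core vertices are prescribed, which saves n²; every hair keeps at most M/(pr) choices.
    Z₁-bound : n * n * ((p * r) ^ t * ∑V (λ u → ∑V (λ w → Z₁ u w))) ≤ m * m * (n ^ m * M ^ t)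
    Z₁-bound = begin
      n * n * ((p * r) ^ t * ∑V (λ u → ∑V (λ w → Z₁ u w))) ≡⟨ cong (λ z → n * n * ((p * r) ^ t * z)) (trans (∑V-cong (λ u → trans (∑VF-swap _) (∑F-cong (λ a → ∑VF-swap _)))) (trans (∑VF-swap _) (∑F-cong (λ a → ∑VF-swap _)))) ⟩
      n * n * ((p * r) ^ t * ∑F (λ a → ∑F (λ b → T a b))) ≡⟨ trans (sym (*-assoc (n * n) ((p * r) ^ t) _)) (trans (sym (∑F-*ˡ (n * n * (p * r) ^ t) _)) (∑F-cong (λ a → sym (∑F-*ˡ (n * n * (p * r) ^ t) _)))) ⟩
      ∑F (λ a → ∑F (λ b → n * n * (p * r) ^ t * T a b)) ≤⟨ ∑F-≤const (m * (n ^ m * M ^ t)) (λ a → ∑F-≤const (n ^ m * M ^ t) (λ b → each a b)) ⟩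
      m * (m * (n ^ m * M ^ t)) ≡⟨ *-assoc m m _ ⟨
      m * m * (n ^ m * M ^ t) ∎
      where
      W : Fin m → Fin m → Vec (Fin n) m → ℕ
      W a b u = ι (¬? (a ≟ b)) * (ι (lookup u a ≟ x) * ι (lookup u b ≟ y))
      T : Fin m → Fin m → ℕ
      T a b = ∑V (λ u → ∑V (λ w → W a b u * ι (Hom? H (neg e′) (u Vec.++ w))))
      l : ∀ a b c d → a * b * (c * d) ≡ a * (c * (b * d))
      l = solve-∀
      count : ∀ a b → n * n * ∑V (W a b) ≤ n ^ m
      count a b = go (a ≟ b)
        where
        go : Dec (a ≡ b) → n * n * ∑V (W a b) ≤ n ^ m
        go (yes q) = ≤-trans (≤-reflexive (trans (cong (n * n *_) (trans (∑V-cong (λ u → cong (_* (ι (lookup u a ≟ x) * ι (lookup u b ≟ y))) (ι-no (¬? (a ≟ b)) (λ z → z q)))) (∑V-0 m n))) (*-zeroʳ (n * n)))) z≤n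
        go (no q) = ≤-trans (mulˡ (n * n) (∑V-mono (λ u → ι*≤ (¬? (a ≟ b)) (λ _ → ≤-refl))))
          (≤-reflexive (trans (*-assoc n n _) (trans (pair-sum (λ z z′ → ι (z ≟ x) * ι (z′ ≟ y)) a b q)
            (trans (cong (n ^ m *_) (trans (∑F-cong (λ z → ∑F-*ˡ (ι (z ≟ x)) _)) (trans (∑F-δ x (λ _ → ∑F (λ z′ → ι (z′ ≟ y)))) (∑F-ι y)))) (*-identityʳ (n ^ m))))))
      each : ∀ a b → n * n * (p * r) ^ t * T a b ≤ n ^ m * M ^ t
      each a b = begin
        n * n * (p * r) ^ t * T a b ≡⟨ cong (n * n * (p * r) ^ t *_) (∑V-cong (λ u → trans (∑V-*ˡ (W a b u) _) (cong (W a b u *_) (hair-sum F f (neg e′) (neg-sym e′-sym) u)))) ⟩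
        n * n * (p * r) ^ t * ∑V (λ u → W a b u * (ι (Hom? F (neg e′) u) * hairs F f (neg e′) u)) ≤⟨ mulˡ (n * n * (p * r) ^ t) (∑V-mono (λ u → mulˡ (W a b u) (ι*≤ (Hom? F (neg e′) u) (λ _ → ≤-refl)))) ⟩
        n * n * (p * r) ^ t * ∑V (λ u → W a b u * hairs F f (neg e′) u) ≡⟨ trans (*-assoc (n * n) ((p * r) ^ t) _) (cong (n * n *_) (sym (∑V-*ˡ ((p * r) ^ t) _))) ⟩
        n * n * ∑V (λ u → (p * r) ^ t * (W a b u * hairs F f (neg e′) u)) ≤⟨ mulˡ (n * n) (∑V-mono (λ u → ≤-trans (≤-reflexive (l₂ ((p * r) ^ t) (W a b u) (hairs F f (neg e′) u))) (mulˡ (W a b u) (hairs≤ u)))) ⟩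
        n * n * ∑V (λ u → W a b u * M ^ t) ≡⟨ trans (cong (n * n *_) (∑V-*ʳ (M ^ t) (W a b))) (sym (*-assoc (n * n) _ (M ^ t))) ⟩
        n * n * ∑V (W a b) * M ^ t ≤⟨ mulʳ (M ^ t) (count a b) ⟩
        n ^ m * M ^ t ∎
        where l₂ : ∀ a b c → a * (b * c) ≡ b * (a * c)
              l₂ = solve-∀

    -- One factor n is saved at the stem of the hair on the new pair, the other at its end, which
    -- has one choice in place of about n/r. The sum over the hairs brings in the factor t.
    Zs-bound : ∀ x′ y′ → n * n * ((p * r) ^ t * ∑V (λ u → ∑V (λ w → Zs x′ y′ u w))) ≤ t * (p * r * (n ^ m * M ^ t))
    Zs-bound x′ y′ = begin
      n * n * ((p * r) ^ t * ∑V (λ u → ∑V (λ w → Zs x′ y′ u w))) ≡⟨ cong (λ z → n * n * ((p * r) ^ t * z)) (trans (∑V-cong (λ u → ∑VF-swap _)) (∑VF-swap _)) ⟩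
      n * n * ((p * r) ^ t * ∑F T) ≡⟨ trans (sym (*-assoc (n * n) ((p * r) ^ t) _)) (sym (∑F-*ˡ (n * n * (p * r) ^ t) T)) ⟩
      ∑F (λ s → n * n * (p * r) ^ t * T s) ≤⟨ ∑F-≤const (p * r * (n ^ m * M ^ t)) each ⟩
      t * (p * r * (n ^ m * M ^ t)) ∎
      where
      T : Fin t → ℕ
      T s = ∑V (λ u → ∑V (λ w → ι (lookup u (f s) ≟ x′) * ∏F (λ s′ → kf u s y′ s′ (lookup w s′))))
      cf : Fin t → Vec (Fin n) m → Fin t → ℕ
      cf s u s′ = ∑F (kf u s y′ s′)
      cf-s : ∀ s u → cf s u s ≡ 1
      cf-s s u = trans (∑F-cong (λ z → trans (cong (if_then ι (z ≟ y′) else ⟦ neg e′ (lookup u (f s)) z ⟧) (dec-true (s ≟ s) refl)) (sym (*-identityʳ _)))) (∑F-δ y′ (λ _ → 1))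
      cf-≢ : ∀ s u s′ → s′ ≢ s → cf s u s′ ≡ deg (neg e′) (lookup u (f s′))
      cf-≢ s u s′ q = ∑F-cong (λ z → cong (if_then ι (z ≟ y′) else ⟦ neg e′ (lookup u (f s′)) z ⟧) (dec-false (s′ ≟ s) q))
      prod : ∀ s u → n * ((p * r) ^ t * ∏F (cf s u)) ≤ p * r * M ^ t
      prod s u = ≤-trans (≤-reflexive (cong (n *_) (trans (cong (_* ∏F (cf s u)) (sym (∏F-const t (p * r)))) (sym (∏F-* (λ _ → p * r) (cf s u))))))
        (∏F-special (λ s′ → p * r * cf s u s′) s n (p * r) M (λ s′ q → ≤-trans (mulˡ (p * r) (≤-reflexive (cf-≢ s u s′ q))) (deg≤ (lookup u (f s′))))
          (≤-trans (≤-reflexive (trans (cong (λ z → n * (p * r * z)) (cf-s s u)) (l₃ n (p * r)))) (mulˡ (p * r) (m≤m+n n (p * n)))))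
        where l₃ : ∀ n q → n * (q * 1) ≡ q * n
              l₃ = solve-∀
      each : ∀ s → n * n * (p * r) ^ t * T s ≤ p * r * (n ^ m * M ^ t)
      each s = begin
        n * n * (p * r) ^ t * T s ≡⟨ cong (n * n * (p * r) ^ t *_) (∑V-cong (λ u → trans (∑V-*ˡ (ι (lookup u (f s) ≟ x′)) _) (cong (ι (lookup u (f s) ≟ x′) *_) (∑V-∏ (kf u s y′))))) ⟩
        n * n * (p * r) ^ t * ∑V (λ u → ι (lookup u (f s) ≟ x′) * ∏F (cf s u)) ≡⟨ trans (l₄ n ((p * r) ^ t) _) (cong (n *_) (sym (∑V-*ˡ (n * (p * r) ^ t) _))) ⟩
        n * ∑V (λ u → n * (p * r) ^ t * (ι (lookup u (f s) ≟ x′) * ∏F (cf s u))) ≤⟨ mulˡ n (∑V-mono (λ u → ≤-trans (≤-reflexive (l₅ n ((p * r) ^ t) (ι (lookup u (f s) ≟ x′)) (∏F (cf s u)))) (mulˡ (ι (lookup u (f s) ≟ x′)) (prod s u)))) ⟩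
        n * ∑V (λ u → ι (lookup u (f s) ≟ x′) * (p * r * M ^ t)) ≡⟨ trans (cong (n *_) (∑V-*ʳ (p * r * M ^ t) _)) (trans (sym (*-assoc n _ (p * r * M ^ t))) (cong (_* (p * r * M ^ t)) (collision (λ _ → x′) (f s) (λ _ _ → refl)))) ⟩
        n ^ m * (p * r * M ^ t) ≡⟨ *-left-comm (n ^ m) (p * r) (M ^ t) ⟩
        p * r * (n ^ m * M ^ t) ∎
        where
        l₄ : ∀ n q s → n * n * q * s ≡ n * (n * q * s)
        l₄ = solve-∀
        l₅ : ∀ n q i c → n * q * (i * c) ≡ i * (n * (q * c))
        l₅ = solve-∀

    gained : n * n * ((p * r) ^ t * #injhom H (neg e′)) ≤ n * n * ((p * r) ^ t * #injhom H (neg e)) + (m * m + 2 * (t * (p * r))) * (n ^ m * M ^ t)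
    gained = begin
      n * n * (R * #injhom H (neg e′)) ≤⟨ mulˡ (n * n) (mulˡ R sum) ⟩
      n * n * (R * (#injhom H (neg e) + (z₁ + (z₂ + z₃)))) ≡⟨ l (n * n) R (#injhom H (neg e)) z₁ z₂ z₃ ⟩
      n * n * (R * #injhom H (neg e)) + (n * n * (R * z₁) + (n * n * (R * z₂) + n * n * (R * z₃))) ≤⟨ +-monoʳ-≤ (n * n * (R * #injhom H (neg e))) (+-mono-≤ Z₁-bound (+-mono-≤ (Zs-bound x y) (Zs-bound y x))) ⟩
      n * n * (R * #injhom H (neg e)) + (m * m * N + (t * (p * r * N) + t * (p * r * N))) ≡⟨ cong (n * n * (R * #injhom H (neg e)) +_) (l₂ (m * m) t (p * r) N) ⟩
      n * n * (R * #injhom H (neg e)) + (m * m + 2 * (t * (p * r))) * N ∎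
      where
      R N z₁ z₂ z₃ : ℕ
      R = (p * r) ^ t
      N = n ^ m * M ^ t
      z₁ = ∑V (λ u → ∑V (λ w → Z₁ u w))
      z₂ = ∑V (λ u → ∑V (λ w → Zs x y u w))
      z₃ = ∑V (λ u → ∑V (λ w → Zs y x u w))
      l : ∀ nn R i a b c → nn * (R * (i + (a + (b + c)))) ≡ nn * (R * i) + (nn * (R * a) + (nn * (R * b) + nn * (R * c)))
      l = solve-∀
      l₂ : ∀ mm t q N → mm * N + (t * (q * N) + t * (q * N)) ≡ (mm + 2 * (t * q)) * N
      l₂ = solve-∀
      sum : #injhom H (neg e′) ≤ #injhom H (neg e) + (z₁ + (z₂ + z₃))
      sum = begin
        #injhom H (neg e′) ≡⟨ ∑V-++ {m} {t} _ ⟩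
        ∑V (λ u → ∑V (λ w → ι (InjHom? H (neg e′) (u Vec.++ w)))) ≤⟨ ∑V-mono (λ u → ∑V-mono (λ w → gain-pt u w)) ⟩
        ∑V (λ u → ∑V (λ w → ι (InjHom? H (neg e) (u Vec.++ w)) + (Z₁ u w + (Zs x y u w + Zs y x u w)))) ≡⟨ ∑V-cong (λ u → trans (∑V-+ _ _) (cong (∑V (λ w → ι (InjHom? H (neg e) (u Vec.++ w))) +_) (trans (∑V-+ _ _) (cong (∑V (Z₁ u) +_) (∑V-+ _ _))))) ⟩
        ∑V (λ u → ∑V (λ w → ι (InjHom? H (neg e) (u Vec.++ w))) + (∑V (Z₁ u) + (∑V (Zs x y u) + ∑V (Zs y x u)))) ≡⟨ trans (∑V-+ _ _) (cong₂ _+_ (sym (∑V-++ {m} {t} _)) (trans (∑V-+ _ _) (cong (z₁ +_) (∑V-+ _ _)))) ⟩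
        #injhom H (neg e) + (z₁ + (z₂ + z₃)) ∎

module _ {m₁ m₂} {F₁ : Graph m₁} {F₂ : Graph m₂} (r₁ r₂ : ℕ) (pr : Pair F₁ F₂) where
  open Pair pr

  -- Deleting xy cannot improve a minimiser. After division by powers of n, the lost copies of H₁
  -- contribute (10/9)^t₁, and the created copies of H₂ at most (1 + 1/p)^t₂ times a factor linear
  -- in t₂; the final `+ 1` takes up non-injective maps. For many hairs this contradicts
  -- `deletion-growth`.
  deletion-bound : ∀ {n} (e : Rel n) → Symm e → Minimal (pairObj r₁ r₂ pr) e → 1 ≤ n → 1 ≤ r₁ → 1 ≤ r₂ →
    ∀ u v → u ≢ v → adj F₁ u v ≡ true → ∀ x y (x≢y : x ≢ y) (exy : e x y ≡ true) → ∀ p c → 1 ≤ p →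
    (∀ z → p * r₁ * deg (neg e) z + p * r₁ ≤ suc p * n) →
    (∀ φ → (10 * n) ^ t₁ ≤ (9 * r₂) ^ t₁ * hairs F₁ f₁ e φ) →
    n ^ m₁ ≤ c * ∑V (λ φ → ι (Hom? F₁ e ((φ [ u ]≔ x) [ v ]≔ y))) →
    2 * ((m₂ + t₂) * (m₂ + t₂)) ≤ n → 2 * c * (r₂ ^ a₁ * ((m₁ + t₁) * (m₁ + t₁))) ≤ n →
    p ^ t₂ * 10 ^ t₁ ≤ 9 ^ t₁ * suc p ^ t₂ * (2 * c * r₁ ^ m₂ * (m₂ * m₂ + 2 * (t₂ * (p * r₁))) + 1)
  deletion-bound {n} e e-sym min n≥1 r₁≥1 r₂≥1 u v u≢v uv x y x≢y exy p c p≥1 deg≤ hair≥ copies n≥ n≥′ = step-i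
    where
    open ≤-Reasoning
    open Deletion e e-sym x y x≢y exy
    h₁ h₂ N₁ N₂ α β A B q g gN hh W R3 G I₁ I₁′ I₂ I₂′ T9 T10 : ℕ
    h₁ = m₁ + t₁
    h₂ = m₂ + t₂
    N₁ = n ^ h₁
    N₂ = n ^ h₂
    α = r₂ ^ a₁
    β = r₁ ^ a₂
    A = α * #inj h₂ n
    B = β * #inj h₁ n
    q = (p * r₁) ^ t₂
    g = m₂ * m₂ + 2 * (t₂ * (p * r₁))
    gN = g * (n ^ m₂ * (suc p * n) ^ t₂)
    hh = h₁ * h₁
    T9 = 9 ^ t₁
    T10 = 10 ^ t₁
    H₁ = hairy F₁ t₁ f₁
    H₂ = hairy F₂ t₂ f₂
    U V : Fin (m₁ + t₁)
    U = u ↑ˡ t₁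
    V = v ↑ˡ t₁
    U≢V : U ≢ V
    U≢V eq = u≢v (↑ˡ-injective t₁ u v eq)
    UV : adj H₁ U V ≡ true
    UV = trans (cong₂ (hairyAdj F₁ f₁) (splitAt-↑ˡ m₁ u t₁) (splitAt-↑ˡ m₁ v t₁)) uv
    W = ∑V (λ φ → ι (InjHom? H₁ e ((φ [ U ]≔ x) [ V ]≔ y)))
    R3 = ∑V (λ φ → ι (Hom? H₁ e ((φ [ U ]≔ x) [ V ]≔ y)))
    G = ∑V (λ φ → ι (Hom? F₁ e ((φ [ u ]≔ x) [ v ]≔ y)))
    I₁ = #injhom H₁ e
    I₁′ = #injhom H₁ e′
    I₂ = #injhom H₂ (neg e)
    I₂′ = #injhom H₂ (neg e′)
    pos : ∀ k → NonZero (n ^ k)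
    pos k = m^n≢0 n k ⦃ >-nonZero n≥1 ⦄
    step-a : n * R3 ≤ n * W + hh * N₁
    step-a = hom≤injhom+ H₁ e _ _ (fixing-2 U V x y U≢V x≢y)
    step-b : n * n * I₁′ + W ≤ n * n * I₁
    step-b = lost H₁ U V U≢V UV
    step-c : n * n * (q * I₂′) ≤ n * n * (q * I₂) + gN
    step-c = Gained.gained F₂ f₂ p r₁ p≥1 r₁≥1 (λ z → ≤-trans (mulˡ (p * r₁) (deg′ z)) (≤-trans (≤-reflexive (trans (*-distribˡ-+ (p * r₁) (deg (neg e) z) 1) (cong (p * r₁ * deg (neg e) z +_) (*-identityʳ (p * r₁))))) (deg≤ z)))
    step-d : A * I₁ + B * I₂ ≤ A * I₁′ + B * I₂′
    step-d = min e′ e′-sym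
    qAW≤ : q * (A * W) ≤ B * gN
    qAW≤ = linear 0 (+-mono-≤ (mulˡ (n * n * q) step-d) (+-mono-≤ (mulˡ (A * q) step-b) (mulˡ B step-c))) (l (n * n) q A B W I₁ I₁′ I₂ I₂′ gN)
      where l : ∀ nn q A B W I J K L g → B * g + (nn * q * (A * I + B * K) + (A * q * (nn * J + W) + B * (nn * (q * L))))
              ≡ q * (A * W) + (nn * q * (A * J + B * L) + (A * q * (nn * I) + B * (nn * (q * K) + g))) + 0
            l = solve-∀
    step-f : q * (α * N₂) * (n * R3) ≤ 2 * n * (β * N₁) * gN + 2 * q * (α * N₂) * (hh * N₁)
    step-f = begin
      q * (α * N₂) * (n * R3) ≤⟨ mulʳ (n * R3) (mulˡ q (mulˡ α (#inj-large h₂ n n≥ n≥1))) ⟩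
      q * (α * (2 * #inj h₂ n)) * (n * R3) ≡⟨ l₁ q α (#inj h₂ n) (n * R3) ⟩
      2 * q * A * (n * R3) ≤⟨ mulˡ (2 * q * A) step-a ⟩
      2 * q * A * (n * W + hh * N₁) ≡⟨ l₂ q A n W (hh * N₁) ⟩
      2 * n * (q * (A * W)) + 2 * q * A * (hh * N₁) ≤⟨ +-mono-≤ (mulˡ (2 * n) qAW≤) (mulʳ (hh * N₁) (mulˡ (2 * q) (mulˡ α (#inj≤ h₂ n)))) ⟩
      2 * n * (B * gN) + 2 * q * (α * N₂) * (hh * N₁) ≤⟨ +-monoˡ-≤ (2 * q * (α * N₂) * (hh * N₁)) (≤-trans (mulˡ (2 * n) (mulʳ gN (mulˡ β (#inj≤ h₁ n)))) (≤-reflexive (sym (*-assoc (2 * n) (β * N₁) gN)))) ⟩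
      2 * n * (β * N₁) * gN + 2 * q * (α * N₂) * (hh * N₁) ∎
      where
      l₁ : ∀ q a i z → q * (a * (2 * i)) * z ≡ 2 * q * (a * i) * z
      l₁ = solve-∀
      l₂ : ∀ q A n W z → 2 * q * A * (n * W + z) ≡ 2 * n * (q * (A * W)) + 2 * q * A * z
      l₂ = solve-∀
    R3-sum : R3 ≡ ∑V (λ φ → ι (Hom? F₁ e ((φ [ u ]≔ x) [ v ]≔ y)) * hairs F₁ f₁ e ((φ [ u ]≔ x) [ v ]≔ y))
    R3-sum = trans (∑V-++ {m₁} {t₁} _) (∑V-cong (λ φ → trans (∑V-cong (λ w → cong (λ z → ι (Hom? H₁ e z)) (trans (cong (_[ V ]≔ y) ([]≔-++-↑ˡ φ w u)) ([]≔-++-↑ˡ (φ [ u ]≔ x) w v)))) (hair-sum F₁ f₁ e e-sym ((φ [ u ]≔ x) [ v ]≔ y))))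
    step-g : T10 * N₁ ≤ c * T9 * (α * R3)
    step-g = begin
      T10 * N₁ ≡⟨ trans (cong (T10 *_) (^-distribˡ-+-* n m₁ t₁)) (l₁ T10 (n ^ m₁) (n ^ t₁)) ⟩
      n ^ m₁ * (T10 * n ^ t₁) ≡⟨ cong (n ^ m₁ *_) (^-distrib-* t₁ 10 n) ⟨
      n ^ m₁ * (10 * n) ^ t₁ ≤⟨ mulʳ ((10 * n) ^ t₁) copies ⟩
      c * G * (10 * n) ^ t₁ ≡⟨ trans (*-assoc c G _) (cong (c *_) (sym (∑V-*ʳ ((10 * n) ^ t₁) _))) ⟩
      c * ∑V (λ φ → ι (Hom? F₁ e ((φ [ u ]≔ x) [ v ]≔ y)) * (10 * n) ^ t₁) ≤⟨ mulˡ c (∑V-mono (λ φ → mulˡ (ι (Hom? F₁ e ((φ [ u ]≔ x) [ v ]≔ y))) (hair≥ ((φ [ u ]≔ x) [ v ]≔ y)))) ⟩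
      c * ∑V (λ φ → ι (Hom? F₁ e ((φ [ u ]≔ x) [ v ]≔ y)) * ((9 * r₂) ^ t₁ * hairs F₁ f₁ e ((φ [ u ]≔ x) [ v ]≔ y))) ≡⟨ cong (c *_) (trans (∑V-cong (λ φ → l₁ (ι (Hom? F₁ e ((φ [ u ]≔ x) [ v ]≔ y))) ((9 * r₂) ^ t₁) (hairs F₁ f₁ e ((φ [ u ]≔ x) [ v ]≔ y)))) (trans (∑V-*ˡ ((9 * r₂) ^ t₁) _) (cong ((9 * r₂) ^ t₁ *_) (sym R3-sum)))) ⟩
      c * ((9 * r₂) ^ t₁ * R3) ≡⟨ cong (λ z → c * (z * R3)) (^-distrib-* t₁ 9 r₂) ⟩
      c * (T9 * r₂ ^ t₁ * R3) ≤⟨ mulˡ c (mulʳ R3 (mulˡ T9 (^-monoʳ-≤ r₂ ⦃ >-nonZero r₂≥1 ⦄ t₁≤a₁))) ⟩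
      c * (T9 * α * R3) ≡⟨ l₂ c T9 α R3 ⟩
      c * T9 * (α * R3) ∎
      where
      l₁ : ∀ a b c → a * (b * c) ≡ b * (a * c)
      l₁ = solve-∀
      l₂ : ∀ a b c d → a * (b * c * d) ≡ a * b * (c * d)
      l₂ = solve-∀
    step-h : q * N₂ * T10 ≤ 2 * c * T9 * β * gN + q * T9 * N₂
    step-h = *-cancelˡ-≤ (n * N₁) ⦃ m*n≢0 n N₁ ⦃ >-nonZero n≥1 ⦄ ⦃ pos h₁ ⦄ ⦄ (begin
      n * N₁ * (q * N₂ * T10) ≡⟨ l₁ n N₁ q N₂ T10 ⟩
      q * N₂ * n * (T10 * N₁) ≤⟨ mulˡ (q * N₂ * n) step-g ⟩
      q * N₂ * n * (c * T9 * (α * R3)) ≡⟨ l₂ q N₂ n c T9 α R3 ⟩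
      c * T9 * (q * (α * N₂) * (n * R3)) ≤⟨ mulˡ (c * T9) step-f ⟩
      c * T9 * (2 * n * (β * N₁) * gN + 2 * q * (α * N₂) * (hh * N₁)) ≡⟨ l₃ c T9 n β N₁ gN q α N₂ hh ⟩
      n * N₁ * (2 * c * T9 * β * gN) + 2 * c * (α * hh) * (q * T9 * N₂ * N₁) ≤⟨ +-monoʳ-≤ (n * N₁ * (2 * c * T9 * β * gN)) (mulʳ (q * T9 * N₂ * N₁) n≥′) ⟩
      n * N₁ * (2 * c * T9 * β * gN) + n * (q * T9 * N₂ * N₁) ≡⟨ l₄ n N₁ (2 * c * T9 * β * gN) (q * T9 * N₂) ⟩
      n * N₁ * (2 * c * T9 * β * gN + q * T9 * N₂) ∎)
      where
      l₁ : ∀ n N q M T → n * N * (q * M * T) ≡ q * M * n * (T * N)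
      l₁ = solve-∀
      l₂ : ∀ q M n c T a R → q * M * n * (c * T * (a * R)) ≡ c * T * (q * (a * M) * (n * R))
      l₂ = solve-∀
      l₃ : ∀ c T n b N g q a M h → c * T * (2 * n * (b * N) * g + 2 * q * (a * M) * (h * N)) ≡ n * N * (2 * c * T * b * g) + 2 * c * (a * h) * (q * T * M * N)
      l₃ = solve-∀
      l₄ : ∀ n N a b → n * N * a + n * (b * N) ≡ n * N * (a + b)
      l₄ = solve-∀
    gN≡ : gN ≡ g * suc p ^ t₂ * N₂
    gN≡ = trans (cong (λ z → g * (n ^ m₂ * z)) (^-distrib-* t₂ (suc p) n)) (trans (l g (n ^ m₂) (suc p ^ t₂) (n ^ t₂)) (cong (g * suc p ^ t₂ *_) (sym (^-distribˡ-+-* n m₂ t₂))))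
      where l : ∀ a b c d → a * (b * (c * d)) ≡ a * c * (b * d)
            l = solve-∀
    q≡ : q ≡ p ^ t₂ * r₁ ^ t₂
    q≡ = ^-distrib-* t₂ p r₁
    β≤ : β ≤ r₁ ^ m₂ * r₁ ^ t₂
    β≤ = ≤-trans (^-monoʳ-≤ r₁ ⦃ >-nonZero r₁≥1 ⦄ a₂≤) (≤-reflexive (^-distribˡ-+-* r₁ m₂ t₂))
    P Sp Rt Rm : ℕ
    P = p ^ t₂
    Sp = suc p ^ t₂
    Rt = r₁ ^ t₂
    Rm = r₁ ^ m₂
    step-i : P * T10 ≤ T9 * Sp * (2 * c * Rm * g + 1)
    step-i = *-cancelˡ-≤ (Rt * N₂) ⦃ m*n≢0 Rt N₂ ⦃ m^n≢0 r₁ t₂ ⦃ >-nonZero r₁≥1 ⦄ ⦄ ⦃ pos h₂ ⦄ ⦄ (begin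
      Rt * N₂ * (P * T10) ≡⟨ l₁ Rt N₂ P T10 ⟩
      P * Rt * N₂ * T10 ≡⟨ cong (λ z → z * N₂ * T10) q≡ ⟨
      q * N₂ * T10 ≤⟨ step-h ⟩
      2 * c * T9 * β * gN + q * T9 * N₂ ≡⟨ cong₂ (λ a b → 2 * c * T9 * β * a + b * T9 * N₂) gN≡ q≡ ⟩
      2 * c * T9 * β * (g * Sp * N₂) + P * Rt * T9 * N₂ ≤⟨ +-mono-≤ (mulʳ (g * Sp * N₂) (mulˡ (2 * c * T9) β≤)) (mulʳ N₂ (mulʳ T9 (mulʳ Rt (^-monoˡ-≤ t₂ (n≤1+n p))))) ⟩
      2 * c * T9 * (Rm * Rt) * (g * Sp * N₂) + Sp * Rt * T9 * N₂ ≡⟨ l₂ c T9 Rm Rt g Sp N₂ ⟩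
      Rt * N₂ * (T9 * Sp * (2 * c * Rm * g + 1)) ∎)
      where
      l₁ : ∀ a b c d → a * b * (c * d) ≡ c * a * b * d
      l₁ = solve-∀
      l₂ : ∀ c T m t g S N → 2 * c * T * (m * t) * (g * S * N) + S * t * T * N ≡ t * N * (T * S * (2 * c * m * g + 1))
      l₂ = solve-∀

-- (10/9)^t₁ outgrows (1 + 1/p)^t₂ when t₂ ≤ Q(m₁ + t₁) and p = 40Q, because (1 + 1/p)^Q ≤ 21/20 and (10/9)(20/21) ≥ 19/18.
deletion-growth : ∀ Q m₁ a b → 1 ≤ Q → ∃ λ t₀ → ∀ t₁ t₂ → t₀ ≤ t₁ → t₂ ≤ Q * (m₁ + t₁) →
  9 ^ t₁ * suc (40 * Q) ^ t₂ * (a + b * t₂) < (40 * Q) ^ t₂ * 10 ^ t₁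
deletion-growth Q m₁ a b Q≥1 = proj₁ gr , main
  where
  open ≤-Reasoning
  p : ℕ
  p = 40 * Q
  p≥1 : 1 ≤ p
  p≥1 = *-mono-≤ {1} {40} (s≤s z≤n) Q≥1
  a′ b′ : ℕ
  a′ = 21 ^ m₁ * (a + b * (Q * m₁))
  b′ = 21 ^ m₁ * (b * Q)
  gr = exp>linear 18 a′ b′ (s≤s z≤n)
  per-Q : 20 * suc p ^ Q ≤ 21 * p ^ Q
  per-Q = *-cancelˡ-≤ (2 * (Q * 1)) ⦃ >-nonZero (*-mono-≤ {1} {2} (s≤s z≤n) (*-mono-≤ Q≥1 (≤-refl {1}))) ⦄ (begin
    2 * (Q * 1) * (20 * suc p ^ Q) ≡⟨ l₁ Q (suc p ^ Q) ⟩
    suc p ^ Q * p ≡⟨ cong (λ z → z ^ Q * p) (+-comm 1 p) ⟩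
    (p + 1) ^ Q * p ≤⟨ bernoulli-upper p 1 Q (≤-trans (≤-reflexive (cong (2 *_) (*-identityʳ Q))) (mulʳ Q (m≤m+n 2 38))) ⟩
    p ^ Q * (p + 2 * (Q * 1)) ≡⟨ l₂ Q (p ^ Q) ⟩
    2 * (Q * 1) * (21 * p ^ Q) ∎)
    where
    l₁ : ∀ Q s → 2 * (Q * 1) * (20 * s) ≡ s * (40 * Q)
    l₁ = solve-∀
    l₂ : ∀ Q s → s * (40 * Q + 2 * (Q * 1)) ≡ 2 * (Q * 1) * (21 * s)
    l₂ = solve-∀
  main : ∀ t₁ t₂ → proj₁ gr ≤ t₁ → t₂ ≤ Q * (m₁ + t₁) → 9 ^ t₁ * suc p ^ t₂ * (a + b * t₂) < p ^ t₂ * 10 ^ t₁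
  main t₁ t₂ t≥ t₂≤ = ≰⇒> λ h → <⇒≱ (proj₂ gr t₁ t≥) (contra h)
    where
    v i : ℕ
    v = m₁ + t₁
    i = Q * v ∸ t₂
    t₂+i : t₂ + i ≡ Q * v
    t₂+i = m+[n∸m]≡n t₂≤
    slow : 20 ^ v * suc p ^ t₂ ≤ 21 ^ v * p ^ t₂
    slow = *-cancelʳ-≤ _ _ (p ^ i) ⦃ m^n≢0 p i ⦃ >-nonZero p≥1 ⦄ ⦄ (begin
      20 ^ v * suc p ^ t₂ * p ^ i ≤⟨ mulˡ (20 ^ v * suc p ^ t₂) (^-monoˡ-≤ i (n≤1+n p)) ⟩
      20 ^ v * suc p ^ t₂ * suc p ^ i ≡⟨ pw 20 (suc p) ⟩
      (20 * suc p ^ Q) ^ v ≤⟨ ^-monoˡ-≤ v per-Q ⟩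
      (21 * p ^ Q) ^ v ≡⟨ pw 21 p ⟨
      21 ^ v * p ^ t₂ * p ^ i ∎)
      where
      pw : ∀ k z → k ^ v * z ^ t₂ * z ^ i ≡ (k * z ^ Q) ^ v
      pw k z = trans (*-assoc (k ^ v) _ _) (trans (cong (k ^ v *_) (trans (sym (^-distribˡ-+-* z t₂ i)) (trans (cong (z ^_) t₂+i) (sym (^-*-assoc z Q v))))) (sym (^-distrib-* v k (z ^ Q))))
    contra : p ^ t₂ * 10 ^ t₁ ≤ 9 ^ t₁ * suc p ^ t₂ * (a + b * t₂) → 19 ^ t₁ ≤ 18 ^ t₁ * (a′ + b′ * t₁)
    contra h = ≤-trans (bigs (9 ^ t₁) (10 ^ t₁) (20 ^ t₁) (21 ^ t₁) (18 ^ t₁) (19 ^ t₁) (20 ^ m₁) (21 ^ m₁) (p ^ t₂) (suc p ^ t₂) (a + b * t₂) (a + b * (Q * m₁) + b * Q * t₁)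
        (^-pos 9 t₁ (s≤s z≤n)) (^-pos 21 t₁ (s≤s z≤n)) (^-pos 20 m₁ (s≤s z≤n)) (^-pos p t₂ p≥1) h
        (subst₂ (λ y z → y * suc p ^ t₂ ≤ z * p ^ t₂) (^-distribˡ-+-* 20 m₁ t₁) (^-distribˡ-+-* 21 m₁ t₁) slow)
        -- 9 · 21 · 19 = 3591 and 10 · 20 · 18 = 3600.
        (subst₂ _≤_ (trans (^-distrib-* t₁ (9 * 21) 19) (cong (_* 19 ^ t₁) (^-distrib-* t₁ 9 21))) (trans (^-distrib-* t₁ (10 * 20) 18) (cong (_* 18 ^ t₁) (^-distrib-* t₁ 10 20))) (^-monoˡ-≤ t₁ (m≤m+n 3591 9)))
        (≤-trans (+-monoʳ-≤ a (mulˡ b t₂≤)) (≤-reflexive (l a b Q m₁ t₁))))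
        (≤-reflexive (l₂ (18 ^ t₁) (21 ^ m₁) (a + b * (Q * m₁)) (b * Q) t₁))
      where
      l : ∀ a b Q m t → a + b * (Q * (m + t)) ≡ a + b * (Q * m) + b * Q * t
      l = solve-∀
      l₂ : ∀ e s a b t → e * (s * (a + b * t)) ≡ e * (s * a + s * b * t)
      l₂ = solve-∀
      bigs : ∀ n9 n10 n20 n21 n18 n19 m20 m21 P S L L′ → 1 ≤ n9 → 1 ≤ n21 → 1 ≤ m20 → 1 ≤ P →
        P * n10 ≤ n9 * S * L → m20 * n20 * S ≤ m21 * n21 * P → n9 * n21 * n19 ≤ n10 * n20 * n18 → L ≤ L′ → n19 ≤ n18 * (m21 * L′)
      bigs n9 n10 n20 n21 n18 n19 m20 m21 P S L L′ n9≥1 n21≥1 m20≥1 P≥1 h h₂ h₃ L≤ =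
        *-cancelˡ-≤ (P * (n9 * n21)) ⦃ >-nonZero (*-mono-≤ P≥1 (*-mono-≤ n9≥1 n21≥1)) ⦄ (begin
          P * (n9 * n21) * n19 ≡⟨ *-identityˡ _ ⟨
          1 * (P * (n9 * n21) * n19) ≤⟨ mulʳ (P * (n9 * n21) * n19) m20≥1 ⟩
          m20 * (P * (n9 * n21) * n19) ≡⟨ l₃ m20 P (n9 * n21) n19 ⟩
          m20 * P * (n9 * n21 * n19) ≤⟨ mulˡ (m20 * P) h₃ ⟩
          m20 * P * (n10 * n20 * n18) ≡⟨ l₄ m20 P n10 n20 n18 ⟩
          P * n10 * (m20 * n20 * n18) ≤⟨ mulʳ (m20 * n20 * n18) h ⟩
          n9 * S * L * (m20 * n20 * n18) ≡⟨ l₅ n9 S L m20 n20 n18 ⟩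
          n9 * L * n18 * (m20 * n20 * S) ≤⟨ mulˡ (n9 * L * n18) h₂ ⟩
          n9 * L * n18 * (m21 * n21 * P) ≤⟨ mulʳ (m21 * n21 * P) (mulʳ n18 (mulˡ n9 L≤)) ⟩
          n9 * L′ * n18 * (m21 * n21 * P) ≡⟨ l₆ n9 L′ n18 m21 n21 P ⟩
          P * (n9 * n21) * (n18 * (m21 * L′)) ∎)
        where
        l₃ : ∀ a b c d → a * (b * c * d) ≡ a * b * (c * d)
        l₃ = solve-∀
        l₄ : ∀ m P a b c → m * P * (a * b * c) ≡ P * a * (m * b * c)
        l₄ = solve-∀
        l₅ : ∀ n S L m a b → n * S * L * (m * a * b) ≡ n * L * b * (m * a * S)
        l₅ = solve-∀
        l₆ : ∀ n L b m c P → n * L * b * (m * c * P) ≡ P * (n * c) * (b * (m * L))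
        l₆ = solve-∀

-- Minimisers close to a Turán relation are partite

Partite : ∀ {n} → Rel n → ℕ → Set
Partite {n} e r = Σ (Fin n → Fin r) λ part → ∀ x y → x ≢ y → e x y ≡ true → part x ≢ part y

Fin⇒≥1 : ∀ {m} → Fin m → 1 ≤ m
Fin⇒≥1 {suc m} _ = s≤s z≤n

module NearPartite {m₁ m₂} (F₁ : Graph m₁) (F₂ : Graph m₂) (ρ₁ ρ₂ Q : ℕ) (Q≥1 : 1 ≤ Q) (cr₁ : Critical F₁ ρ₁) (cr₂ : Critical F₂ ρ₂)
  (rr : suc (2 + ρ₁ + (2 + ρ₂)) ≤ (2 + ρ₁) * (2 + ρ₂)) where

  m₂≥1 : 1 ≤ m₂
  m₂≥1 = Fin⇒≥1 (Critical.u cr₂)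

  r r₂ p K₁ : ℕ
  r = 2 + ρ₁
  r₂ = 2 + ρ₂
  p = 40 * Q
  -- Twice as strict as p, so that after the deletion of an edge, which adds at most one to a degree
  -- of the complement, the bound still holds with p; see `deg-p`.
  K₁ = 2 * p

  40≤p : 40 ≤ p
  40≤p = ≤-trans (≤-reflexive (sym (*-identityʳ 40))) (mulˡ 40 Q≥1)

  40≤K₁ : 40 ≤ K₁
  40≤K₁ = ≤-trans 40≤p (m≤m+n p _)

  K₁≥1 : 1 ≤ K₁
  K₁≥1 = ≤-trans (m≤m+n 1 39) 40≤K₁

  module HA = HairArith K₁ m₂ r K₁≥1 m₂≥1 (s≤s z≤n)

  τ δ₀ d₁ d₂ d₃ : ℕ
  τ = HA.τ + (2 * (r * r) + 2 * (32 * r))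
  d₁ = 2 * (m₂ * m₂ * (2 * (r * r)) ^ m₂)
  d₂ = 2 * (m₁ * m₁ * (2 * (32 * r)) ^ m₁)
  d₃ = 2 * (m₁ * m₁ * (4 * r) ^ m₁)
  δ₀ = τ * τ + (d₁ + (d₂ + d₃))

  τ≥1 : 1 ≤ τ
  τ≥1 = ≤-trans HA.τ≥1 (m≤m+n HA.τ (2 * (r * r) + 2 * (32 * r)))

  c₁ c₂ c₃ C₀ : ℕ
  c₁ = 2 * (2 * (r * r)) ^ m₂
  c₂ = 2 * (2 * (32 * r)) ^ m₁
  c₃ = 2 * (4 * r) ^ m₁
  C₀ = 2 * c₃ * r ^ m₂

  growth = deletion-growth Q m₁ (C₀ * (m₂ * m₂) + 1) (C₀ * (2 * (p * r))) Q≥1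

  Few : Pred F₁ F₂
  Few pr e = FewGood r c₁ HA.b (swapPair pr) (neg e) × FewGood r₂ c₂ 9 pr e

  few-ev : Ev F₁ F₂ r r₂ Q Few
  few-ev = ev-× {P = λ pr e → FewGood r c₁ HA.b (swapPair pr) (neg e)} {R = λ pr e → FewGood r₂ c₂ 9 pr e}
    (ev-swap {P = λ pr e → FewGood r c₁ HA.b pr e} (Coarse.few-good-ev F₂ F₁ ρ₂ ρ₁ Q cr₂ c₁ HA.b HA.b≥1))
    (Coarse.few-good-ev F₁ F₂ ρ₁ ρ₂ Q cr₁ c₂ 9 (s≤s z≤n))

  near⇒partite : ∀ δ → δ₀ ≤ δ → Ev F₁ F₂ r r₂ Q (λ pr e → NearTuran e r δ → Partite e r)
  near⇒partite δ δ≥ = ev-map {P = Few} {R = λ pr e → NearTuran e r δ → Partite e r} (proj₁ growth) main few-ev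
    where
    main : ∀ pr → proj₁ growth ≤ Pair.t₁ pr → proj₁ growth ≤ Pair.t₂ pr → Comparable Q pr →
      ∃ λ n₀ → ∀ {n} (e : Rel n) → n₀ ≤ n → 1 ≤ n → Symm e → Minimal (pairObj r r₂ pr) e → Few pr e → NearTuran e r δ → Partite e r
    main pr t≥ _ cmp = n₀ , partite
      where
      open Pair pr
      k₁ k₂ k₃ n₀ : ℕ
      k₁ = 2 * ((m₂ + t₂) * (m₂ + t₂))
      k₂ = 2 * c₃ * (r₂ ^ a₁ * ((m₁ + t₁) * (m₁ + t₁)))
      k₃ = 2 * (p * r)
      n₀ = k₁ + (k₂ + k₃)
      partite : ∀ {n} (e : Rel n) → n₀ ≤ n → 1 ≤ n → Symm e → Minimal (pairObj r r₂ pr) e → Few pr e → NearTuran e r δ → Partite e r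
      partite {n} e n≥ n≥1 e-sym min (few₂ , few₁) nt = lab , proper
        where
        open Critical cr₁ using (u; v; u≢v; edge)
        ττ≤δ : τ * τ ≤ δ
        ττ≤δ = ≤-trans (m≤m+n (τ * τ) (d₁ + (d₂ + d₃))) δ≥
        nbrs : Fin n → Fin r → Fin n → Bool
        nbrs = Local.nbrIn e e-sym n≥1 ρ₁ δ τ τ≥1 ττ≤δ nt e
        module Cl = Claims F₁ F₂ ρ₁ ρ₂ K₁ τ δ cr₁ m₂≥1 K₁≥1 (≤-trans (m≤m+n 12 28) 40≤K₁) (≤-trans (m≤m+n 32 8) 40≤K₁) rr
          τ≥1 (m≤m+n HA.τ _) (≤-trans (m≤m+n (2 * (r * r)) _) (m≤n+m _ HA.τ)) (≤-trans (m≤n+m (2 * (32 * r)) (2 * (r * r))) (m≤n+m _ HA.τ))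
          ττ≤δ (≤-trans (≤-trans (m≤m+n d₁ _) (m≤n+m _ (τ * τ))) δ≥)
          (≤-trans (≤-trans (≤-trans (m≤m+n d₂ d₃) (m≤n+m _ d₁)) (m≤n+m _ (τ * τ))) δ≥) (≤-trans (≤-trans (≤-trans (m≤n+m d₃ d₂) (m≤n+m _ d₁)) (m≤n+m _ (τ * τ))) δ≥)
          e e-sym n≥1 nt
        deg₂≤ : ∀ x → K₁ * r * deg (neg e) x ≤ suc K₁ * n
        deg₂≤ = Cl.deg₂-bound f₂ few₂
        homes : ∀ x → ∃ λ i → 32 * r * card (nbrs x i) < n
        homes = Cl.home deg₂≤ f₁ few₁
        -- The final classes are the home classes. The partition given by stability may misplace
        -- single vertices.
        lab : Fin n → Fin r
        lab x = proj₁ (homes x)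
        deg-p : ∀ z → p * r * deg (neg e) z + p * r ≤ suc p * n
        deg-p z = *-cancelˡ-≤ 2 (linear 0 (+-mono-≤ (deg₂≤ z) (≤-trans (≤-trans (m≤n+m k₃ k₂) (m≤n+m _ k₁)) n≥)) (l p r n (deg (neg e) z)))
          where l : ∀ p r n d → 2 * (suc p * n) + (2 * p * r * d + 2 * (p * r)) ≡ 2 * (p * r * d + p * r) + (suc (2 * p) * n + n) + 0
                l = solve-∀
        proper : ∀ x y → x ≢ y → e x y ≡ true → lab x ≢ lab y
        proper x y x≢y exy same = <⇒≱ (proj₂ growth t₁ t₂ t≥ (≤-trans (m≤n+m t₂ m₂) (Comparable.v₂≤ cmp)))
            (≤-trans bound (≤-reflexive (cong (9 ^ t₁ * suc p ^ t₂ *_) (l C₀ (m₂ * m₂) t₂ (p * r)))))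
          where
          module In = Cl.Inside deg₂≤ x y (lab x) (proj₂ (homes x)) (subst (λ i → 32 * r * card (nbrs y i) < n) (sym same) (proj₂ (homes y))) exy
          bound : p ^ t₂ * 10 ^ t₁ ≤ 9 ^ t₁ * suc p ^ t₂ * (2 * c₃ * r ^ m₂ * (m₂ * m₂ + 2 * (t₂ * (p * r))) + 1)
          bound = deletion-bound r r₂ pr e e-sym min n≥1 (s≤s z≤n) (s≤s z≤n) u v u≢v edge x y x≢y exy p c₃ (≤-trans (m≤m+n 1 39) 40≤p) deg-p
            (Cl.good-hairs deg₂≤ f₁) In.many-copies (≤-trans (m≤m+n k₁ _) n≥) (≤-trans (≤-trans (m≤m+n k₂ k₃) (m≤n+m _ k₁)) n≥)
          l : ∀ c m t q → c * (m + 2 * (t * q)) + 1 ≡ c * m + 1 + c * (2 * q) * t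
          l = solve-∀

-- Injections and strict inequalities between sums over vectors

_≟V_ : ∀ {h n} (φ ψ : Vec (Fin n) h) → Dec (φ ≡ ψ)
_≟V_ = ≡-dec _≟_

∑V-δ : ∀ {h n} (ψ : Vec (Fin n) h) → ∑V (λ φ → ι (φ ≟V ψ)) ≡ 1
∑V-δ {n = n} [] = trans (∑V-nil _) (ι-yes (_≟V_ {n = n} [] []) refl)
∑V-δ {suc h} {n} (y ∷ ψ) = begin
  ∑V (λ φ → ι (φ ≟V (y ∷ ψ))) ≡⟨ ∑V-suc _ ⟩
  ∑V (λ φ → ∑F (λ x → ι ((x ∷ φ) ≟V (y ∷ ψ)))) ≡⟨ ∑V-cong (λ φ → trans (∑F-cong (λ x → trans (ι-cong ((x ∷ φ) ≟V (y ∷ ψ)) ((x ≟ y) ×-dec (φ ≟V ψ)) (λ { refl → refl , refl }) (λ { (refl , refl) → refl })) (⟦∧⟧ (does (x ≟ y)) _))) (∑F-δ y (λ _ → ι (φ ≟V ψ)))) ⟩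
  ∑V (λ φ → ι (φ ≟V ψ)) ≡⟨ ∑V-δ ψ ⟩
  1 ∎
  where open ≡-Reasoning

-- On P the indicator of ψ = Φ φ is dominated by that of φ = Ψ ψ, and either indicator sums to 1
-- over its free vector. The left inverse is needed on P only.
∑V-inj : ∀ {h n} {P R : Vec (Fin n) h → Set} (P? : ∀ φ → Dec (P φ)) (R? : ∀ φ → Dec (R φ)) (Φ Ψ : Vec (Fin n) h → Vec (Fin n) h) →
  (∀ φ → P φ → R (Φ φ)) → (∀ φ → P φ → Ψ (Φ φ) ≡ φ) → ∑V (λ φ → ι (P? φ)) ≤ ∑V (λ φ → ι (R? φ))
∑V-inj {h} {n} P? R? Φ Ψ to inv = begin
  ∑V (λ φ → ι (P? φ)) ≡⟨ ∑V-cong (λ φ → trans (∑V-*ˡ (ι (P? φ)) _) (trans (cong (ι (P? φ) *_) (∑V-δ (Φ φ))) (*-identityʳ _))) ⟨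
  ∑V (λ φ → ∑V (λ ψ → ι (P? φ) * ι (ψ ≟V Φ φ))) ≤⟨ ∑V-mono (λ φ → ∑V-mono (λ ψ → pt φ ψ)) ⟩
  ∑V (λ φ → ∑V (λ ψ → ι (R? ψ) * ι (φ ≟V Ψ ψ))) ≡⟨ ∑V-swap _ ⟩
  ∑V (λ ψ → ∑V (λ φ → ι (R? ψ) * ι (φ ≟V Ψ ψ))) ≡⟨ ∑V-cong (λ ψ → trans (∑V-*ˡ (ι (R? ψ)) _) (trans (cong (ι (R? ψ) *_) (∑V-δ (Ψ ψ))) (*-identityʳ _))) ⟩
  ∑V (λ ψ → ι (R? ψ)) ∎
  where
  open ≤-Reasoning
  pt : ∀ φ ψ → ι (P? φ) * ι (ψ ≟V Φ φ) ≤ ι (R? ψ) * ι (φ ≟V Ψ ψ)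
  pt φ ψ = ι*≤ (P? φ) λ p → ι≤ (ψ ≟V Φ φ) λ { refl → *-mono-≤ (≤-reflexive (sym (ι-yes (R? (Φ φ)) (to φ p)))) (≤-reflexive (sym (ι-yes (φ ≟V Ψ (Φ φ)) (sym (inv φ p))))) }

∑V-strict : ∀ {h n} {f k : Vec (Fin n) h → ℕ} → (∀ φ → f φ ≤ k φ) → ∀ φ* → f φ* < k φ* → ∑V f < ∑V k
∑V-strict {f = f} {k} le φ* lt = ≤-trans (≤-reflexive (trans (+-comm 1 (∑V f)) (cong (∑V f +_) (sym (∑V-δ φ*))))) (≤-trans (≤-reflexive (sym (∑V-+ _ _))) (∑V-mono pt))
  where
  pt : ∀ φ → f φ + ι (φ ≟V φ*) ≤ k φ
  pt φ with ι-cases (φ ≟V φ*)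
  ... | inj₁ (refl , q) = ≤-trans (≤-reflexive (trans (cong (f φ +_) q) (+-comm (f φ) 1))) lt
  ... | inj₂ (_ , q) = ≤-trans (≤-reflexive (trans (cong (f φ +_) q) (+-identityʳ (f φ)))) (le φ)


-- Injections between vertex sets

card-pos : ∀ {n} (S : Fin n → Bool) → 1 ≤ card S → ∃ λ z → S z ≡ true
card-pos {n} S h with any? (λ z → S z Bool.≟ true)
... | yes p = p
... | no q = contradiction (≤-trans h (≤-reflexive (trans (∑F-cong (λ z → cong ⟦_⟧ (Bool.¬-not (λ p → q (z , p))))) (∑F-0 n)))) λ ()

_∖_ : ∀ {n} → (Fin n → Bool) → Fin n → Fin n → Bool
(S ∖ z) y = S y ∧ not (does (y ≟ z))

card-∖ : ∀ {n} (S : Fin n → Bool) z → S z ≡ true → card (S ∖ z) + 1 ≡ card S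
card-∖ S z p = trans (cong (card (S ∖ z) +_) (sym (∑F-ι z))) (trans (sym (∑F-+ _ _)) (∑F-cong pt))
  where
  pt : ∀ y → ⟦ (S ∖ z) y ⟧ + ι (y ≟ z) ≡ ⟦ S y ⟧
  pt y with y ≟ z
  ... | yes refl = trans (cong (λ b → ⟦ b ⟧ + 1) (Bool.∧-zeroʳ (S z))) (cong ⟦_⟧ (sym p))
  ... | no _ = trans (+-identityʳ _) (cong ⟦_⟧ (Bool.∧-identityʳ (S y)))

record Embedding {n} (S T : Fin n → Bool) : Set where
  field
    f g : Fin n → Fin n
    into : ∀ z → S z ≡ true → T (f z) ≡ true
    inv : ∀ z → S z ≡ true → g (f z) ≡ z

embed : ∀ {n} k (S T : Fin n → Bool) → card S ≡ k → k ≤ card T → Embedding S T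
embed zero S T eq le = record { f = id ; g = id ; into = λ z p → ⊥-elim (none z p) ; inv = λ _ _ → refl }
  where none : ∀ z → S z ≡ true → ⊥
        none z p = contradiction (≤-trans (≤-reflexive (cong ⟦_⟧ (sym p))) (≤-trans (∑F-≥ (λ y → ⟦ S y ⟧) z) (≤-reflexive eq))) λ ()
embed {n} (suc k) S T eq le = record { f = f ; g = g ; into = into ; inv = inv }
  where
  z₀ y₀ : Fin n
  z₀ = proj₁ (card-pos S (≤-trans (s≤s z≤n) (≤-reflexive (sym eq))))
  y₀ = proj₁ (card-pos T (≤-trans (s≤s z≤n) le))
  Sz₀ : S z₀ ≡ true
  Sz₀ = proj₂ (card-pos S (≤-trans (s≤s z≤n) (≤-reflexive (sym eq))))
  Ty₀ : T y₀ ≡ true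
  Ty₀ = proj₂ (card-pos T (≤-trans (s≤s z≤n) le))
  IH : Embedding (S ∖ z₀) (T ∖ y₀)
  IH = embed k (S ∖ z₀) (T ∖ y₀) (suc-injective (trans (+-comm 1 _) (trans (card-∖ S z₀ Sz₀) eq))) (≤-pred (≤-trans le (≤-reflexive (trans (sym (card-∖ T y₀ Ty₀)) (+-comm _ 1)))))
  module IH = Embedding IH
  f g : Fin n → Fin n
  f z = if does (z ≟ z₀) then y₀ else IH.f z
  g y = if does (y ≟ y₀) then z₀ else IH.g y
  f-z₀ : ∀ {z} → z ≡ z₀ → f z ≡ y₀
  f-z₀ {z} p = cong (if_then y₀ else IH.f z) (dec-true (z ≟ z₀) p)
  f-≢ : ∀ {z} → z ≢ z₀ → f z ≡ IH.f z
  f-≢ {z} p = cong (if_then y₀ else IH.f z) (dec-false (z ≟ z₀) p)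
  S′ : ∀ z → S z ≡ true → z ≢ z₀ → (S ∖ z₀) z ≡ true
  S′ z p q = ∧-intro p (cong not (dec-false (z ≟ z₀) q))
  T-IH : ∀ z → S z ≡ true → z ≢ z₀ → T (IH.f z) ≡ true × IH.f z ≢ y₀
  T-IH z p q = ∧-elimˡ (IH.into z (S′ z p q)) , does-false (IH.f z ≟ y₀) (Bool.not-injective (∧-elimʳ {T (IH.f z)} (IH.into z (S′ z p q))))
  into : ∀ z → S z ≡ true → T (f z) ≡ true
  into z p = go (z ≟ z₀)
    where go : Dec (z ≡ z₀) → T (f z) ≡ true
          go (yes q) = trans (cong T (f-z₀ q)) Ty₀
          go (no q) = trans (cong T (f-≢ q)) (proj₁ (T-IH z p q))
  inv : ∀ z → S z ≡ true → g (f z) ≡ z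
  inv z p = go (z ≟ z₀)
    where go : Dec (z ≡ z₀) → g (f z) ≡ z
          go (yes q) = trans (cong g (f-z₀ q)) (trans (cong (if_then z₀ else IH.g y₀) (dec-true (y₀ ≟ y₀) refl)) (sym q))
          go (no q) = trans (cong g (f-≢ q)) (trans (cong (if_then z₀ else IH.g (IH.f z)) (dec-false (IH.f z ≟ y₀) (proj₂ (T-IH z p q)))) (IH.inv z (S′ z p q)))

-- Connected components as the sets that no edge-constant 2-colouring separates

all-colourings? : ∀ {h} {P : Vec Bool h → Set} → (∀ c → Dec (P c)) → Dec (∀ c → P c)
all-colourings? {zero} P? with P? []
... | yes p = yes λ { [] → p }
... | no q = no λ h → q (h [])
all-colourings? {suc h} P? with all-colourings? (λ c → P? (true ∷ c)) | all-colourings? (λ c → P? (false ∷ c))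
... | yes p | yes q = yes λ { (true ∷ c) → p c ; (false ∷ c) → q c }
... | no p | _ = no λ h → p (λ c → h (true ∷ c))
... | _ | no q = no λ h → q (λ c → h (false ∷ c))

module Components {h} (H : Graph h) where
  EdgeConst : Vec Bool h → Set
  EdgeConst c = ∀ a b → adj H a b ≡ true → lookup c a ≡ lookup c b

  Comp : Fin h → Fin h → Set
  Comp v w = ∀ c → EdgeConst c → lookup c v ≡ true → lookup c w ≡ true

  opaque
    comp? : ∀ v w → Dec (Comp v w)
    comp? v w = all-colourings? (λ c → all? (λ a → all? (λ b → (adj H a b Bool.≟ true) →-dec (lookup c a Bool.≟ lookup c b))) →-dec ((lookup c v Bool.≟ true) →-dec (lookup c w Bool.≟ true)))

  comp-refl : ∀ v → Comp v v
  comp-refl v c _ p = p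

  comp-edge : ∀ v {a b} → adj H a b ≡ true → Comp v a → Comp v b
  comp-edge v ab h c ec p = trans (sym (ec _ _ ab)) (h c ec p)

  -- Lying in the class of the image of v is a 2-colouring of H that is constant along edges, so it
  -- cannot separate v from a vertex of its component.
  comp-hom : ∀ {n r} (part : Fin n → Fin r) (φ : Vec (Fin n) h) → Hom H (sameRel part) φ → ∀ v w → Comp v w → part (lookup φ w) ≡ part (lookup φ v)
  comp-hom part φ hom v w cvw = does-true (part (lookup φ w) ≟ part (lookup φ v)) (trans (sym (at w)) (cvw c ec (trans (at v) (dec-true (part (lookup φ v) ≟ part (lookup φ v)) refl))))
    where
    c : Vec Bool h
    c = Vec.tabulate (λ w → does (part (lookup φ w) ≟ part (lookup φ v)))
    at : ∀ w → lookup c w ≡ does (part (lookup φ w) ≟ part (lookup φ v))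
    at w = lookup∘tabulate (λ w → does (part (lookup φ w) ≟ part (lookup φ v))) w
    ec : EdgeConst c
    ec a b ab = trans (at a) (trans (cong (λ z → does (z ≟ part (lookup φ v))) (does-true (part (lookup φ a) ≟ part (lookup φ b)) (hom a b ab))) (sym (at b)))

-- Moving a vertex between two cliques

record Pendant {h} (H : Graph h) : Set where
  field
    stem leaf : Fin h
    attached : adj H stem leaf ≡ true
    only : ∀ w → adj H leaf w ≡ true → w ≡ stem

  stem≢leaf : stem ≢ leaf
  stem≢leaf p = contradiction (trans (sym attached) (trans (cong (adj H stem) (sym p)) (adjIrr H stem))) λ ()

∑V-collide : ∀ {h n} (b : Fin h) (a : Vec (Fin n) h → Fin n) (k : Vec (Fin n) h → ℕ) →
  (∀ φ z → a (φ [ b ]≔ z) ≡ a φ) → (∀ φ z → k (φ [ b ]≔ z) ≡ k φ) →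
  n * ∑V (λ φ → ι (lookup φ b ≟ a φ) * k φ) ≡ ∑V k
∑V-collide b a k a-ind k-ind = trans (sym (∑V-update b (λ φ → ι (lookup φ b ≟ a φ) * k φ)))
  (∑V-cong (λ φ → trans (∑F-cong (λ z → cong₂ _*_ (cong₂ (λ p q → ι (p ≟ q)) (lookup∘update b φ z) (a-ind φ z)) (k-ind φ z))) (∑F-δ (a φ) (λ _ → k φ))))

-- The vertex x moves from its clique i to the clique j, which is smaller by at least two. Copies
-- that avoid x are unaffected. Copies through x are compared by an involution that exchanges j with
-- an equally large part of clique i without x; this settles all copies that avoid the remainder
-- `E′`. For the rest, maps with exactly one vertex at x are compared without injectivity, by
-- `Shift`. The strict gain is proportional to the size ε of `E′`, which may be 1. Non-injective
-- maps with x as root would have the same order n^(h-2), but those that also meet `E′` number only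
-- about ε n^(h-3).
module Unbalanced {h n r} (H : Graph h) (pend : Pendant H) (part : Fin n → Fin r) (x : Fin n) (j : Fin r) (i≢j : part x ≢ j)
  (gap : psize part j + 2 ≤ psize part (part x)) (n≥1 : 1 ≤ n) where
  open Pendant pend
  open Components H
  open ≤-Reasoning

  i : Fin r
  i = part x

  part′ : Fin n → Fin r
  part′ z = if does (z ≟ x) then j else part z

  part′-x : ∀ {z} → z ≡ x → part′ z ≡ j
  part′-x {z} p = cong (if_then j else part z) (dec-true (z ≟ x) p)

  part′-≢ : ∀ {z} → z ≢ x → part′ z ≡ part z
  part′-≢ {z} p = cong (if_then j else part z) (dec-false (z ≟ x) p)

  A B S : Fin n → Bool
  A z = does (part z ≟ i) ∧ not (does (z ≟ x))
  B z = does (part z ≟ j)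
  S z = B z ∨ does (z ≟ x)

  A-intro : ∀ z → part z ≡ i → z ≢ x → A z ≡ true
  A-intro z p q = ∧-intro (dec-true (part z ≟ i) p) (cong not (dec-false (z ≟ x) q))

  A-part : ∀ z → A z ≡ true → part z ≡ i
  A-part z p = does-true (part z ≟ i) (∧-elimˡ p)

  A-≢x : ∀ z → A z ≡ true → z ≢ x
  A-≢x z p = does-false (z ≟ x) (Bool.not-injective (∧-elimʳ {does (part z ≟ i)} p))

  B-part : ∀ z → B z ≡ true → part z ≡ j
  B-part z = does-true (part z ≟ j)

  ∑-x : ∑F (λ z → ι (z ≟ x)) ≡ 1
  ∑-x = ∑F-ι x

  card-A : card A + 1 ≡ psize part i
  card-A = card-∖ (λ z → does (part z ≟ i)) x (dec-true (part x ≟ i) refl)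

  card-S : card S ≡ card B + 1
  card-S = trans (∑F-cong pt) (trans (∑F-+ _ _) (cong (card B +_) ∑-x))
    where
    pt : ∀ z → ⟦ S z ⟧ ≡ ⟦ B z ⟧ + ι (z ≟ x)
    pt z with z ≟ x
    ... | yes refl = trans (cong (λ b → ⟦ b ∨ true ⟧) (dec-false (part x ≟ j) i≢j)) (cong (λ b → ⟦ b ⟧ + 1) (sym (dec-false (part x ≟ j) i≢j)))
    ... | no _ = trans (cong ⟦_⟧ (Bool.∨-identityʳ (B z))) (sym (+-identityʳ _))

  emb : Embedding S A
  emb = embed (card S) S A refl (≤-trans (≤-reflexive card-S) (+-cancelʳ-≤ 1 _ _ (≤-trans (≤-reflexive (+-assoc (card B) 1 1)) (≤-trans gap (≤-reflexive (sym card-A))))))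

  open Embedding emb

  B⇒S : ∀ z → B z ≡ true → S z ≡ true
  B⇒S z p = cong (_∨ does (z ≟ x)) p

  x∈S : S x ≡ true
  x∈S = trans (cong (B x ∨_) (dec-true (x ≟ x) refl)) (Bool.∨-zeroʳ (B x))

  -- `img` tests membership in the image of `B` under `f` by means of the left inverse. `E′` is what
  -- the image leaves of `A`; it contains `f x`, since x is embedded along with `B`.
  img E′ : Fin n → Bool
  img z = B (g z) ∧ does (f (g z) ≟ z)
  E′ z = A z ∧ not (img z)

  ε : ℕ
  ε = card E′

  img-f : ∀ z → B z ≡ true → img (f z) ≡ true
  img-f z p = ∧-intro (trans (cong B (inv z (B⇒S z p))) p) (dec-true (f (g (f z)) ≟ f z) (cong f (inv z (B⇒S z p))))

  ε≥1 : 1 ≤ ε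
  ε≥1 = ≤-trans (≤-reflexive (cong ⟦_⟧ (sym e₀))) (∑F-≥ (λ z → ⟦ E′ z ⟧) (f x))
    where
    e₀ : E′ (f x) ≡ true
    e₀ = ∧-intro (into x x∈S) (cong not (cong (_∧ does (f (g (f x)) ≟ f x)) (trans (cong B (inv x x∈S)) (dec-false (part x ≟ j) i≢j))))

  -- The involution that exchanges `B` with its image and fixes all else, in particular x and `E′`.
  -- Off `E′` it translates the new partition into the old one with the names i and j exchanged.
  s : Fin n → Fin n
  s z = if B z then f z else (if A z ∧ img z then g z else z)

  s-B : ∀ z → B z ≡ true → s z ≡ f z
  s-B z p = cong (if_then f z else (if A z ∧ img z then g z else z)) p

  s-A : ∀ z → B z ≡ false → (A z ∧ img z) ≡ true → s z ≡ g z
  s-A z p q = trans (cong (if_then f z else (if A z ∧ img z then g z else z)) p) (cong (if_then g z else z) q)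

  s-else : ∀ z → B z ≡ false → (A z ∧ img z) ≡ false → s z ≡ z
  s-else z p q = trans (cong (if_then f z else (if A z ∧ img z then g z else z)) p) (cong (if_then g z else z) q)

  A⇒¬B : ∀ z → A z ≡ true → B z ≡ false
  A⇒¬B z p = dec-false (part z ≟ j) (λ q → i≢j (trans (sym (A-part z p)) q))

  data Kind (z : Fin n) : Set where
    inB : B z ≡ true → Kind z
    inA : A z ≡ true → img z ≡ true → Kind z
    other : B z ≡ false → (A z ∧ img z) ≡ false → Kind z

  kind : ∀ z → Kind z
  kind z with B z in p | A z in q | img z in o
  ... | true | _ | _ = inB p
  ... | false | true | true = inA q o
  ... | false | true | false = other p (trans (cong (_∧ img z) q) o)
  ... | false | false | _ = other p (cong (_∧ img z) q)

  s-invol : ∀ z → s (s z) ≡ z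
  s-invol z = go (kind z)
    where
    go : Kind z → s (s z) ≡ z
    go (inB p) = trans (cong s (s-B z p)) (trans (s-A (f z) (A⇒¬B _ (into z (B⇒S z p))) (∧-intro (into z (B⇒S z p)) (img-f z p))) (inv z (B⇒S z p)))
    go (inA p q) = trans (cong s (s-A z (A⇒¬B z p) (∧-intro p q))) (trans (s-B (g z) (∧-elimˡ q)) (does-true (f (g z) ≟ z) (∧-elimʳ {B (g z)} q)))
    go (other p q) = trans (cong s (s-else z p q)) (s-else z p q)

  s-x : s x ≡ x
  s-x = s-else x (dec-false (part x ≟ j) i≢j) (cong (_∧ img x) (trans (cong (λ b → does (part x ≟ i) ∧ not b) (dec-true (x ≟ x) refl)) (Bool.∧-zeroʳ _)))

  s-inj : ∀ {y z} → s y ≡ s z → y ≡ z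
  s-inj {y} {z} p = trans (sym (s-invol y)) (trans (cong s p) (s-invol z))

  s-≢x : ∀ {z} → z ≢ x → s z ≢ x
  s-≢x q p = q (s-inj (trans p (sym s-x)))

  s-E : ∀ z → E′ z ≡ true → s z ≡ z
  s-E z p = s-else z (A⇒¬B z (∧-elimˡ p)) (trans (cong (A z ∧_) (Bool.not-injective (∧-elimʳ {A z} p))) (Bool.∧-zeroʳ (A z)))

  s-¬E : ∀ z → E′ z ≡ false → E′ (s z) ≡ false
  s-¬E z p = Bool.¬-not λ q → contradiction (trans (sym p) (trans (cong E′ (trans (sym (s-invol z)) (s-E (s z) q))) q)) λ ()

  sw : Fin r → Fin r
  sw c = if does (c ≟ j) then i else (if does (c ≟ i) then j else c)

  sw-j : sw j ≡ i
  sw-j = cong (if_then i else (if does (j ≟ i) then j else j)) (dec-true (j ≟ j) refl)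

  sw-i : sw i ≡ j
  sw-i = trans (cong (if_then i else (if does (i ≟ i) then j else i)) (dec-false (i ≟ j) i≢j)) (cong (if_then j else i) (dec-true (i ≟ i) refl))

  sw-else : ∀ {c} → c ≢ j → c ≢ i → sw c ≡ c
  sw-else {c} p q = trans (cong (if_then i else (if does (c ≟ i) then j else c)) (dec-false (c ≟ j) p)) (cong (if_then j else c) (dec-false (c ≟ i) q))

  part-s : ∀ z → z ≢ x → E′ z ≡ false → part (s z) ≡ sw (part z)
  part-s z z≢x nE = go (kind z)
    where
    go : Kind z → part (s z) ≡ sw (part z)
    go (inB p) = trans (cong part (s-B z p)) (trans (A-part _ (into z (B⇒S z p))) (sym (trans (cong sw (B-part z p)) sw-j)))
    go (inA p q) = trans (cong part (s-A z (A⇒¬B z p) (∧-intro p q))) (trans (B-part _ (∧-elimˡ q)) (sym (trans (cong sw (A-part z p)) sw-i)))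
    go (other p q) = trans (cong part (s-else z p q)) (sym (sw-else (does-false (part z ≟ j) p) not-i))
      where
      not-i : part z ≢ i
      not-i r = contradiction (trans (sym nE) (trans (cong₂ (λ a b → a ∧ not b) Az (trans (sym (cong (_∧ img z) Az)) q)) refl)) λ ()
        where Az : A z ≡ true
              Az = A-intro z r z≢x

  part-s₁ : ∀ z → E′ z ≡ false → part (s z) ≡ sw (part′ z)
  part-s₁ z nE = go (z ≟ x)
    where go : Dec (z ≡ x) → part (s z) ≡ sw (part′ z)
          go (yes p) = trans (cong part (trans (cong s p) s-x)) (sym (trans (cong sw (part′-x p)) sw-j))
          go (no p) = trans (part-s z p nE) (cong sw (sym (part′-≢ p)))

  part-s₂ : ∀ z → E′ z ≡ false → part′ (s z) ≡ sw (part z)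
  part-s₂ z nE = go (z ≟ x)
    where go : Dec (z ≡ x) → part′ (s z) ≡ sw (part z)
          go (yes p) = trans (part′-x (trans (cong s p) s-x)) (sym (trans (cong (sw ∘ part) p) sw-i))
          go (no p) = trans (part′-≢ (s-≢x p)) (part-s z p nE)

  V : Set
  V = Vec (Fin n) h

  hits? : (φ : V) → Dec (∃ λ v → lookup φ v ≡ x)
  hits? φ = any? (λ v → lookup φ v ≟ x)

  usesE? : (φ : V) → Dec (∃ λ w → E′ (lookup φ w) ≡ true)
  usesE? φ = any? (λ w → E′ (lookup φ w) Bool.≟ true)

  Root : Fin h → V → Set
  Root v φ = lookup φ v ≡ x × (∀ w → w ≢ v → lookup φ w ≢ x)

  root? : ∀ v φ → Dec (Root v φ)
  root? v φ = (lookup φ v ≟ x) ×-dec all? (λ w → ¬? (w ≟ v) →-dec ¬? (lookup φ w ≟ x))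

  same-at : ∀ {p : Fin n → Fin r} {y z} → p y ≡ p z → sameRel p y z ≡ true
  same-at {p} {y} {z} = dec-true (p y ≟ p z)

  at-same : ∀ {p : Fin n → Fin r} {y z} → sameRel p y z ≡ true → p y ≡ p z
  at-same {p} {y} {z} = does-true (p y ≟ p z)

  mapS : V → V
  mapS = Vec.map s

  mapS-at : ∀ φ w → lookup (mapS φ) w ≡ s (lookup φ w)
  mapS-at φ w = lookup-map w s φ

  mapS-invol : ∀ φ → mapS (mapS φ) ≡ φ
  mapS-invol φ = trans (sym (map-∘ s s φ)) (trans (map-cong s-invol φ) (map-id φ))

  noE-at : ∀ (φ : V) → ¬ (∃ λ w → E′ (lookup φ w) ≡ true) → ∀ w → E′ (lookup φ w) ≡ false
  noE-at φ q w = Bool.¬-not (λ p → q (w , p))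

  mapS-noE : ∀ φ → ¬ (∃ λ w → E′ (lookup φ w) ≡ true) → ¬ (∃ λ w → E′ (lookup (mapS φ) w) ≡ true)
  mapS-noE φ q (w , p) = contradiction (trans (sym p) (trans (cong E′ (mapS-at φ w)) (s-¬E _ (noE-at φ q w)))) λ ()

  hom-s₁ : ∀ φ → ¬ (∃ λ w → E′ (lookup φ w) ≡ true) → Hom H (sameRel part′) φ → Hom H (sameRel part) (mapS φ)
  hom-s₁ φ q hom a b ab = same-at {part} (trans (cong part (mapS-at φ a)) (trans (part-s₁ (lookup φ a) (noE-at φ q a)) (trans (cong sw (at-same {part′} {lookup φ a} {lookup φ b} (hom a b ab))) (sym (trans (cong part (mapS-at φ b)) (part-s₁ (lookup φ b) (noE-at φ q b)))))))

  hom-s₂ : ∀ φ → ¬ (∃ λ w → E′ (lookup φ w) ≡ true) → Hom H (sameRel part) φ → Hom H (sameRel part′) (mapS φ)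
  hom-s₂ φ q hom a b ab = same-at {part′} (trans (cong part′ (mapS-at φ a)) (trans (part-s₂ _ (noE-at φ q a)) (trans (cong sw (at-same {part} (hom a b ab))) (sym (trans (cong part′ (mapS-at φ b)) (part-s₂ _ (noE-at φ q b)))))))

  root-s : ∀ v φ → Root v φ → Root v (mapS φ)
  root-s v φ (p , q) = trans (mapS-at φ v) (trans (cong s p) s-x) , λ w w≢ r → s-≢x (q w w≢) (trans (sym (mapS-at φ w)) r)

  inj-s : ∀ φ → Inj φ → Inj (mapS φ)
  inj-s φ inj a b a≢b p = inj a b a≢b (s-inj (trans (sym (mapS-at φ a)) (trans p (mapS-at φ b))))

  g₁ g₂ : Rel n
  g₁ = sameRel part
  g₂ = sameRel part′

  miss thru thruE : Rel n → ℕ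
  miss k = ∑V (λ φ → ι (InjHom? H k φ ×-dec ¬? (hits? φ)))
  thru k = ∑V (λ φ → ι (InjHom? H k φ ×-dec (hits? φ ×-dec ¬? (usesE? φ))))
  thruE k = ∑V (λ φ → ι (InjHom? H k φ ×-dec (hits? φ ×-dec usesE? φ)))

  split3 : ∀ k → #injhom H k ≡ miss k + (thru k + thruE k)
  split3 k = trans (∑V-cong (λ φ → b (does (InjHom? H k φ)) (does (hits? φ)) (does (usesE? φ)))) (trans (∑V-+ _ _) (cong (miss k +_) (∑V-+ _ _)))
    where
    b : ∀ p q o → ⟦ p ⟧ ≡ ⟦ p ∧ not q ⟧ + (⟦ p ∧ (q ∧ not o) ⟧ + ⟦ p ∧ (q ∧ o) ⟧)
    b false q o = refl
    b true false o = refl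
    b true true false = refl
    b true true true = refl

  miss-eq : miss g₂ ≤ miss g₁
  miss-eq = ∑V-mono (λ φ → ι-mono (InjHom? H g₂ φ ×-dec ¬? (hits? φ)) (InjHom? H g₁ φ ×-dec ¬? (hits? φ)) λ { ((inj , hom) , q) →
    (inj , λ a b ab → same-at {part} (trans (sym (part′-≢ (λ p → q (a , p)))) (trans (at-same {part′} (hom a b ab)) (part′-≢ (λ p → q (b , p)))))) , q })

  thru-eq : thru g₂ ≤ thru g₁
  thru-eq = ∑V-inj (λ φ → InjHom? H g₂ φ ×-dec (hits? φ ×-dec ¬? (usesE? φ))) (λ φ → InjHom? H g₁ φ ×-dec (hits? φ ×-dec ¬? (usesE? φ))) mapS mapS
    (λ { φ ((inj , hom) , ((v , p) , q)) → (inj-s φ inj , hom-s₁ φ q hom) , ((v , trans (mapS-at φ v) (trans (cong s p) s-x)) , mapS-noE φ q) })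
    (λ φ _ → mapS-invol φ)

  rooted rootedE rootedN : Rel n → ℕ
  rooted k = ∑F (λ v → ∑V (λ φ → ι (root? v φ ×-dec Hom? H k φ)))
  rootedE k = ∑F (λ v → ∑V (λ φ → ι ((root? v φ ×-dec Hom? H k φ) ×-dec usesE? φ)))
  rootedN k = ∑F (λ v → ∑V (λ φ → ι ((root? v φ ×-dec Hom? H k φ) ×-dec ¬? (usesE? φ))))

  rooted-split : ∀ k → rooted k ≡ rootedE k + rootedN k
  rooted-split k = trans (∑F-cong (λ v → trans (∑V-cong (λ φ → b (does (root? v φ ×-dec Hom? H k φ)) (does (usesE? φ)))) (∑V-+ _ _))) (∑F-+ _ _)
    where b : ∀ p q → ⟦ p ⟧ ≡ ⟦ p ∧ q ⟧ + ⟦ p ∧ not q ⟧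
          b false q = refl
          b true q = sym (⟦⟧+not q)

  rootedN-eq : rootedN g₁ ≤ rootedN g₂
  rootedN-eq = ∑F-mono (λ v → ∑V-inj (λ φ → (root? v φ ×-dec Hom? H g₁ φ) ×-dec ¬? (usesE? φ)) (λ φ → (root? v φ ×-dec Hom? H g₂ φ) ×-dec ¬? (usesE? φ)) mapS mapS
    (λ { φ ((rt , hom) , q) → (root-s v φ rt , hom-s₂ φ q hom) , mapS-noE φ q }) (λ φ _ → mapS-invol φ))

  thruE≤rootedE : thruE g₂ ≤ rootedE g₂
  thruE≤rootedE = ≤-trans (∑V-mono pt) (≤-reflexive (∑VF-swap _))
    where
    pt : ∀ φ → ι (InjHom? H g₂ φ ×-dec (hits? φ ×-dec usesE? φ)) ≤ ∑F (λ v → ι ((root? v φ ×-dec Hom? H g₂ φ) ×-dec usesE? φ))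
    pt φ = ι≤ (InjHom? H g₂ φ ×-dec (hits? φ ×-dec usesE? φ)) λ { ((inj , hom) , ((v , p) , q)) →
      ≤-trans (≤-reflexive (sym (ι-yes ((root? v φ ×-dec Hom? H g₂ φ) ×-dec usesE? φ) (((p , λ w w≢ r → inj w v w≢ (trans r (sym p))) , hom) , q))))
        (∑F-≥ (λ v → ι ((root? v φ ×-dec Hom? H g₂ φ) ×-dec usesE? φ)) v) }

  NI : ℕ
  NI = ∑F (λ v → ∑V (λ φ → ι ((root? v φ ×-dec usesE? φ) ×-dec ¬? (Inj? φ))))

  -- An injective map has at most one root, so it is counted once on either side; the non-injective
  -- ones go into `NI`.
  rootedE≤thruE : rootedE g₁ ≤ thruE g₁ + NI
  rootedE≤thruE = ≤-trans (≤-reflexive (sym (∑VF-swap _))) (≤-trans (∑V-mono pt) (≤-reflexive (trans (∑V-+ _ _) (cong (thruE g₁ +_) (∑VF-swap _)))))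
    where
    R : Fin h → V → ℕ
    R v φ = ι ((root? v φ ×-dec Hom? H g₁ φ) ×-dec usesE? φ)
    N : V → ℕ
    N φ = ∑F (λ v → ι ((root? v φ ×-dec usesE? φ) ×-dec ¬? (Inj? φ)))
    pt : ∀ φ → ∑F (λ v → R v φ) ≤ ι (InjHom? H g₁ φ ×-dec (hits? φ ×-dec usesE? φ)) + N φ
    pt φ = go (Inj? φ) (hits? φ)
      where
      T = ι (InjHom? H g₁ φ ×-dec (hits? φ ×-dec usesE? φ))
      go : Dec (Inj φ) → Dec (∃ λ v → lookup φ v ≡ x) → ∑F (λ v → R v φ) ≤ T + N φ
      go (no ni) _ = ≤-trans (∑F-mono (λ v → ι-mono ((root? v φ ×-dec Hom? H g₁ φ) ×-dec usesE? φ) ((root? v φ ×-dec usesE? φ) ×-dec ¬? (Inj? φ)) λ { ((a , _) , b) → (a , b) , ni })) (m≤n+m (N φ) T)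
      go (yes inj) (no nh) = ≤-trans (≤-reflexive (trans (∑F-cong (λ v → ι-no ((root? v φ ×-dec Hom? H g₁ φ) ×-dec usesE? φ) (λ { (((p , _) , _) , _) → nh (v , p) }))) (∑F-0 h))) z≤n
      go (yes inj) (yes (v₁ , p₁)) = ≤-trans (≤-trans (∑F-mono (λ v → ≤-trans (ι≤ ((root? v φ ×-dec Hom? H g₁ φ) ×-dec usesE? φ) λ { (((p , _) , hom) , q) →
            *-mono-≤ (≤-reflexive (sym (ι-yes (v ≟ v₁) (uniq v p)))) (≤-reflexive (sym (ι-yes (InjHom? H g₁ φ ×-dec (hits? φ ×-dec usesE? φ)) ((inj , hom) , ((v , p) , q))))) }) ≤-refl))
          (≤-reflexive (∑F-δ v₁ (λ _ → T)))) (m≤m+n T (N φ))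
        where
        uniq : ∀ v → lookup φ v ≡ x → v ≡ v₁
        uniq v p with v ≟ v₁
        ... | yes q = q
        ... | no q = contradiction (trans p (sym p₁)) (inj v v₁ q)

  surplus : ℕ
  surplus = ∑V (λ φ → ι ((root? stem φ ×-dec Hom? H g₁ φ) ×-dec (E′ (lookup φ leaf) Bool.≟ true)))

  -- Send the component of the root from the small clique into the large one, missing E′.
  module Shift (v : Fin h) where
    to : Fin n → Fin n
    to z = if does (z ≟ x) then x else f z
    back : Fin n → Fin n
    back z = if does (z ≟ x) then x else g z
    to-x : ∀ {z} → z ≡ x → to z ≡ x
    to-x {z} p = cong (if_then x else f z) (dec-true (z ≟ x) p)
    to-≢ : ∀ {z} → z ≢ x → to z ≡ f z
    to-≢ {z} p = cong (if_then x else f z) (dec-false (z ≟ x) p)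
    back-x : ∀ {z} → z ≡ x → back z ≡ x
    back-x {z} p = cong (if_then x else g z) (dec-true (z ≟ x) p)
    back-≢ : ∀ {z} → z ≢ x → back z ≡ g z
    back-≢ {z} p = cong (if_then x else g z) (dec-false (z ≟ x) p)

    Φ Ψ : V → V
    Φ φ = Vec.tabulate (λ w → if does (comp? v w) then to (lookup φ w) else lookup φ w)
    Ψ φ = Vec.tabulate (λ w → if does (comp? v w) then back (lookup φ w) else lookup φ w)

    Φ-in : ∀ φ w → Comp v w → lookup (Φ φ) w ≡ to (lookup φ w)
    Φ-in φ w c = trans (lookup∘tabulate _ w) (cong (if_then to (lookup φ w) else lookup φ w) (dec-true (comp? v w) c))
    Φ-out : ∀ φ w → ¬ Comp v w → lookup (Φ φ) w ≡ lookup φ w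
    Φ-out φ w c = trans (lookup∘tabulate _ w) (cong (if_then to (lookup φ w) else lookup φ w) (dec-false (comp? v w) c))
    Ψ-in : ∀ φ w → Comp v w → lookup (Ψ φ) w ≡ back (lookup φ w)
    Ψ-in φ w c = trans (lookup∘tabulate _ w) (cong (if_then back (lookup φ w) else lookup φ w) (dec-true (comp? v w) c))
    Ψ-out : ∀ φ w → ¬ Comp v w → lookup (Ψ φ) w ≡ lookup φ w
    Ψ-out φ w c = trans (lookup∘tabulate _ w) (cong (if_then back (lookup φ w) else lookup φ w) (dec-false (comp? v w) c))

    module _ (φ : V) (rt : Root v φ) (hom : Hom H g₂ φ) where
      comp-B : ∀ w → Comp v w → lookup φ w ≢ x → B (lookup φ w) ≡ true
      comp-B w c q = dec-true (part (lookup φ w) ≟ j) (trans (sym (part′-≢ q)) (trans (comp-hom part′ φ hom v w c) (part′-x (proj₁ rt))))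

      comp-A : ∀ w → Comp v w → lookup φ w ≢ x → A (lookup (Φ φ) w) ≡ true
      comp-A w c q = trans (cong A (trans (Φ-in φ w c) (to-≢ q))) (into _ (B⇒S _ (comp-B w c q)))

      comp-i : ∀ w → Comp v w → part (lookup (Φ φ) w) ≡ i
      comp-i w c = go (lookup φ w ≟ x)
        where go : Dec (lookup φ w ≡ x) → part (lookup (Φ φ) w) ≡ i
              go (yes p) = cong part (trans (Φ-in φ w c) (to-x p))
              go (no p) = A-part _ (comp-A w c p)

      out-≢x : ∀ w → ¬ Comp v w → lookup φ w ≢ x
      out-≢x w c = proj₂ rt w (λ { refl → c (comp-refl v) })

      Φ-root : Root v (Φ φ)
      Φ-root = trans (Φ-in φ v (comp-refl v)) (to-x (proj₁ rt)) , λ w w≢v → go w w≢v (comp? v w)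
        where
        go : ∀ w → w ≢ v → Dec (Comp v w) → lookup (Φ φ) w ≢ x
        go w w≢v (yes c) = A-≢x _ (comp-A w c (proj₂ rt w w≢v))
        go w w≢v (no c) p = proj₂ rt w w≢v (trans (sym (Φ-out φ w c)) p)

      Φ-hom : Hom H g₁ (Φ φ)
      Φ-hom a b ab = go (comp? v a) (comp? v b)
        where
        go : Dec (Comp v a) → Dec (Comp v b) → g₁ (lookup (Φ φ) a) (lookup (Φ φ) b) ≡ true
        go (yes c) (yes d) = same-at {part} (trans (comp-i a c) (sym (comp-i b d)))
        go (yes c) (no d) = contradiction (comp-edge v ab c) d
        go (no c) (yes d) = contradiction (comp-edge v (trans (adjSym H b a) ab) d) c
        go (no c) (no d) = same-at {part} (trans (cong part (Φ-out φ a c)) (trans (sym (part′-≢ (out-≢x a c))) (trans (at-same {part′} (hom a b ab)) (trans (part′-≢ (out-≢x b d)) (cong part (sym (Φ-out φ b d)))))))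

      -- The leaf lies in the component of its stem and is moved from `B` by `f`, so it lands in the
      -- image of `B`. Maps with the stem at x and the leaf in `E′` are therefore missed by `Φ`;
      -- they form `surplus`.
      Φ-leaf : v ≡ stem → E′ (lookup (Φ φ) leaf) ≡ false
      Φ-leaf refl = trans (cong E′ (trans (Φ-in φ leaf c) (to-≢ q))) (trans (cong (λ b → A (f (lookup φ leaf)) ∧ not b) (img-f _ (comp-B leaf c q))) (Bool.∧-zeroʳ _))
        where
        c : Comp v leaf
        c = comp-edge v attached (comp-refl v)
        q : lookup φ leaf ≢ x
        q = proj₂ rt leaf (λ p → stem≢leaf (sym p))

      Φ-inv : Ψ (Φ φ) ≡ φ
      Φ-inv = ext-lookup (λ w → go w (comp? v w))
        where
        ext-lookup : ∀ {k} {φ ψ : Vec (Fin n) k} → (∀ w → lookup φ w ≡ lookup ψ w) → φ ≡ ψ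
        ext-lookup {φ = []} {[]} _ = refl
        ext-lookup {φ = _ ∷ _} {_ ∷ _} q = cong₂ _∷_ (q zero) (ext-lookup (q ∘ suc))
        go : ∀ w → Dec (Comp v w) → lookup (Ψ (Φ φ)) w ≡ lookup φ w
        go w (no c) = trans (Ψ-out (Φ φ) w c) (Φ-out φ w c)
        go w (yes c) = trans (Ψ-in (Φ φ) w c) (trans (cong back (Φ-in φ w c)) (go′ (lookup φ w ≟ x)))
          where
          go′ : Dec (lookup φ w ≡ x) → back (to (lookup φ w)) ≡ lookup φ w
          go′ (yes p) = trans (back-x (to-x p)) (sym p)
          go′ (no p) = trans (cong back (to-≢ p)) (trans (back-≢ (A-≢x _ (into _ (B⇒S _ (comp-B w c p))))) (inv _ (B⇒S _ (comp-B w c p))))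

  rooted-surplus : rooted g₂ + surplus ≤ rooted g₁
  rooted-surplus = begin
    rooted g₂ + surplus ≡⟨ cong (rooted g₂ +_) (∑F-δ stem sur) ⟨
    rooted g₂ + ∑F (λ v → ι (v ≟ stem) * sur v) ≡⟨ ∑F-+ _ _ ⟨
    ∑F (λ v → ∑V (λ φ → ι (root? v φ ×-dec Hom? H g₂ φ)) + ι (v ≟ stem) * sur v) ≤⟨ ∑F-mono each ⟩
    rooted g₁ ∎
    where
    sur : Fin h → ℕ
    sur v = ∑V (λ φ → ι ((root? v φ ×-dec Hom? H g₁ φ) ×-dec (E′ (lookup φ leaf) Bool.≟ true)))
    each : ∀ v → ∑V (λ φ → ι (root? v φ ×-dec Hom? H g₂ φ)) + ι (v ≟ stem) * sur v ≤ ∑V (λ φ → ι (root? v φ ×-dec Hom? H g₁ φ))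
    each v = go (v ≟ stem)
      where
      open Shift v
      go : Dec (v ≡ stem) → ∑V (λ φ → ι (root? v φ ×-dec Hom? H g₂ φ)) + ι (v ≟ stem) * sur v ≤ ∑V (λ φ → ι (root? v φ ×-dec Hom? H g₁ φ))
      go (no q) = ≤-trans (≤-reflexive (trans (cong (λ z → ∑V (λ φ → ι (root? v φ ×-dec Hom? H g₂ φ)) + z * sur v) (ι-no (v ≟ stem) q)) (+-identityʳ _)))
        (∑V-inj (λ φ → root? v φ ×-dec Hom? H g₂ φ) (λ φ → root? v φ ×-dec Hom? H g₁ φ) Φ Ψ (λ { φ (rt , hom) → Φ-root φ rt hom , Φ-hom φ rt hom }) (λ { φ (rt , hom) → Φ-inv φ rt hom }))
      go (yes q) = begin
        ∑V (λ φ → ι (root? v φ ×-dec Hom? H g₂ φ)) + ι (v ≟ stem) * sur v ≤⟨ +-mono-≤ (∑V-inj (λ φ → root? v φ ×-dec Hom? H g₂ φ) (λ φ → (root? v φ ×-dec Hom? H g₁ φ) ×-dec ¬? (E′ (lookup φ leaf) Bool.≟ true)) Φ Ψ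
              (λ { φ (rt , hom) → (Φ-root φ rt hom , Φ-hom φ rt hom) , λ p → contradiction (trans (sym p) (Φ-leaf φ rt hom q)) λ () }) (λ { φ (rt , hom) → Φ-inv φ rt hom }))
            (≤-trans (mulʳ (sur v) (⟦⟧≤1 (does (v ≟ stem)))) (≤-reflexive (*-identityˡ (sur v)))) ⟩
        ∑V (λ φ → ι ((root? v φ ×-dec Hom? H g₁ φ) ×-dec ¬? (E′ (lookup φ leaf) Bool.≟ true))) + sur v ≡⟨ ∑V-+ _ _ ⟨
        ∑V (λ φ → ι ((root? v φ ×-dec Hom? H g₁ φ) ×-dec ¬? (E′ (lookup φ leaf) Bool.≟ true)) + ι ((root? v φ ×-dec Hom? H g₁ φ) ×-dec (E′ (lookup φ leaf) Bool.≟ true))) ≡⟨ ∑V-cong (λ φ → b (does (root? v φ ×-dec Hom? H g₁ φ)) (does (E′ (lookup φ leaf) Bool.≟ true))) ⟩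
        ∑V (λ φ → ι (root? v φ ×-dec Hom? H g₁ φ)) ∎
        where b : ∀ p q → ⟦ p ∧ not q ⟧ + ⟦ p ∧ q ⟧ ≡ ⟦ p ⟧
              b false q = refl
              b true true = refl
              b true false = refl

  -- Put the stem on x, the leaf anywhere in `E′` and all other vertices anywhere in `A`: everything
  -- lies in one class, so each such map is a homomorphism. The factor n² comes from overwriting
  -- stem and leaf.
  surplus-large : ε * card A ^ h ≤ n * (n * surplus)
  surplus-large = begin
    ε * card A ^ h ≡⟨ cong (ε *_) (sym (trans (∑V-cong (λ φ → trans (ι-all-∏ (λ w → A (lookup φ w) Bool.≟ true)) (∏F-cong (λ w → sym (⟦⟧≡ι (A (lookup φ w))))))) (trans (∑V-∏ (λ _ z → ⟦ A z ⟧)) (∏F-const h (card A))))) ⟩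
    ε * ∑V (λ φ → ι (allA? φ)) ≡⟨ trans (*-comm ε _) (sym (∑V-*ʳ ε _)) ⟩
    ∑V (λ φ → ι (allA? φ) * ε) ≤⟨ ∑V-mono pt ⟩
    ∑V (λ φ → ∑F (λ z → ∑F (λ z′ → k ((φ [ stem ]≔ z) [ leaf ]≔ z′)))) ≡⟨ ∑V-update stem (λ φ → ∑F (λ z′ → k (φ [ leaf ]≔ z′))) ⟩
    n * ∑V (λ φ → ∑F (λ z′ → k (φ [ leaf ]≔ z′))) ≡⟨ cong (n *_) (∑V-update leaf k) ⟩
    n * (n * surplus) ∎
    where
    allA? : ∀ φ → Dec (∀ w → A (lookup φ w) ≡ true)
    allA? φ = all? (λ w → A (lookup φ w) Bool.≟ true)
    k : V → ℕ
    k φ = ι ((root? stem φ ×-dec Hom? H g₁ φ) ×-dec (E′ (lookup φ leaf) Bool.≟ true))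
    pt : ∀ φ → ι (allA? φ) * ε ≤ ∑F (λ z → ∑F (λ z′ → k ((φ [ stem ]≔ z) [ leaf ]≔ z′)))
    pt φ = ι*≤ (allA? φ) λ all → ≤-trans (∑F-mono (λ z′ → ⟦⟧≤k all z′)) (∑F-≥ (λ z → ∑F (λ z′ → k ((φ [ stem ]≔ z) [ leaf ]≔ z′))) x)
      where
      ⟦⟧≤k : (∀ w → A (lookup φ w) ≡ true) → ∀ z′ → ⟦ E′ z′ ⟧ ≤ k ((φ [ stem ]≔ x) [ leaf ]≔ z′)
      ⟦⟧≤k all z′ = ≤-trans (≤-reflexive (⟦⟧≡ι (E′ z′))) (ι-mono (E′ z′ Bool.≟ true) ((root? stem ψ ×-dec Hom? H g₁ ψ) ×-dec (E′ (lookup ψ leaf) Bool.≟ true)) λ q →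
          ((ψ-stem , λ w w≢ → A-≢x _ (ψ-A q w w≢)) , λ a b ab → same-at {part} (trans (ψ-i q a) (sym (ψ-i q b)))) , trans (cong E′ ψ-leaf) q)
        where
        ψ : V
        ψ = (φ [ stem ]≔ x) [ leaf ]≔ z′
        ψ-leaf : lookup ψ leaf ≡ z′
        ψ-leaf = lookup∘update leaf (φ [ stem ]≔ x) z′
        ψ-stem : lookup ψ stem ≡ x
        ψ-stem = trans (lookup∘update′ stem≢leaf (φ [ stem ]≔ x) z′) (lookup∘update stem φ x)
        ψ-A : E′ z′ ≡ true → ∀ w → w ≢ stem → A (lookup ψ w) ≡ true
        ψ-A q w w≢ with w ≟ leaf
        ... | yes refl = trans (cong A ψ-leaf) (∧-elimˡ q)
        ... | no w≢l = trans (cong A (trans (lookup∘update′ w≢l (φ [ stem ]≔ x) z′) (lookup∘update′ w≢ φ x))) (all w)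
        ψ-i : E′ z′ ≡ true → ∀ w → part (lookup ψ w) ≡ i
        ψ-i q w with w ≟ stem
        ... | yes refl = cong part ψ-stem
        ... | no w≢ = A-part _ (ψ-A q w w≢)

  -- Three independent constraints: v is at x, some w lies in `E′`, and some b collides with an a.
  -- Only the root takes the value x, so neither colliding vertex is v, and at least one of the two
  -- differs from w and can serve as b.
  NI-small : n * (n * (n * NI)) ≤ h * (h * (h * (h * (n ^ h * ε))))
  NI-small = begin
    n * (n * (n * NI)) ≤⟨ mulˡ n (mulˡ n (mulˡ n (∑F-mono (λ v → ∑V-mono (λ φ → pt v φ))))) ⟩
    n * (n * (n * ∑F (λ v → ∑V (λ φ → ∑F (λ w → ∑F (λ a → ∑F (λ b → term v w a b φ))))))) ≡⟨ cong (λ z → n * (n * (n * z))) (∑F-cong (λ v → trans (∑VF-swap _) (∑F-cong (λ w → trans (∑VF-swap _) (∑F-cong (λ a → ∑VF-swap _)))))) ⟩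
    n * (n * (n * ∑F (λ v → ∑F (λ w → ∑F (λ a → ∑F (λ b → ∑V (term v w a b))))))) ≡⟨ l n _ ⟩
    n * n * n * ∑F (λ v → ∑F (λ w → ∑F (λ a → ∑F (λ b → ∑V (term v w a b))))) ≡⟨ trans (sym (∑F-*ˡ (n * n * n) _)) (∑F-cong (λ v → trans (sym (∑F-*ˡ (n * n * n) _)) (∑F-cong (λ w → trans (sym (∑F-*ˡ (n * n * n) _)) (∑F-cong (λ a → sym (∑F-*ˡ (n * n * n) _))))))) ⟩
    ∑F (λ v → ∑F (λ w → ∑F (λ a → ∑F (λ b → n * n * n * ∑V (term v w a b))))) ≤⟨ ∑F-≤const _ (λ v → ∑F-≤const _ (λ w → ∑F-≤const _ (λ a → ∑F-≤const (n ^ h * ε) (λ b → each v w a b)))) ⟩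
    h * (h * (h * (h * (n ^ h * ε)))) ∎
    where
    l : ∀ n z → n * (n * (n * z)) ≡ n * n * n * z
    l = solve-∀
    ok? : ∀ (v w a b : Fin h) → Dec (v ≢ w × (a ≢ b × (b ≢ v × b ≢ w)))
    ok? v w a b = ¬? (v ≟ w) ×-dec (¬? (a ≟ b) ×-dec (¬? (b ≟ v) ×-dec ¬? (b ≟ w)))
    term : Fin h → Fin h → Fin h → Fin h → V → ℕ
    term v w a b φ = ι (ok? v w a b) * (ι (lookup φ b ≟ lookup φ a) * (ι (lookup φ v ≟ x) * ⟦ E′ (lookup φ w) ⟧))
    pt : ∀ v φ → ι ((root? v φ ×-dec usesE? φ) ×-dec ¬? (Inj? φ)) ≤ ∑F (λ w → ∑F (λ a → ∑F (λ b → term v w a b φ)))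
    pt v φ = ι≤ ((root? v φ ×-dec usesE? φ) ×-dec ¬? (Inj? φ)) λ { ((rt , (w , Ew)) , ni) → go rt w Ew ni }
      where
      sum = ∑F (λ w → ∑F (λ a → ∑F (λ b → term v w a b φ)))
      one : ∀ w a b → v ≢ w → a ≢ b → b ≢ v → b ≢ w → lookup φ b ≡ lookup φ a → lookup φ v ≡ x → E′ (lookup φ w) ≡ true → 1 ≤ sum
      one w a b p₁ p₂ p₃ p₄ q₁ q₂ q₃ = ≤-trans (≤-reflexive (sym (cong₂ _*_ (ι-yes (ok? v w a b) (p₁ , (p₂ , (p₃ , p₄)))) (cong₂ _*_ (ι-yes (lookup φ b ≟ lookup φ a) q₁) (cong₂ _*_ (ι-yes (lookup φ v ≟ x) q₂) (cong ⟦_⟧ q₃))))))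
        (≤-trans (∑F-≥ (λ b → term v w a b φ) b) (≤-trans (∑F-≥ (λ a → ∑F (λ b → term v w a b φ)) a) (∑F-≥ (λ w → ∑F (λ a → ∑F (λ b → term v w a b φ))) w)))
      go : Root v φ → ∀ w → E′ (lookup φ w) ≡ true → ¬ Inj φ → 1 ≤ sum
      go (p , q) w Ew ni with any? (λ a → any? (λ b → ¬? (a ≟ b) ×-dec (lookup φ a ≟ lookup φ b)))
      ... | no none = contradiction (λ a b a≢b eq → none (a , b , a≢b , eq)) ni
      ... | yes (a , b , a≢b , eq) = pick (b ≟ w)
        where
        v≢w : v ≢ w
        v≢w r = A-≢x _ (∧-elimˡ Ew) (trans (cong (lookup φ) (sym r)) p)
        b≢v : b ≢ v
        b≢v r = q a (λ a≡v → a≢b (trans a≡v (sym r))) (trans eq (trans (cong (lookup φ) r) p))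
        a≢v : a ≢ v
        a≢v r = q b (λ b≡v → a≢b (trans r (sym b≡v))) (trans (sym eq) (trans (cong (lookup φ) r) p))
        pick : Dec (b ≡ w) → 1 ≤ sum
        pick (no b≢w) = one w a b v≢w a≢b b≢v b≢w (sym eq) p Ew
        pick (yes b≡w) = one w b a v≢w (a≢b ∘ sym) a≢v (λ a≡w → a≢b (trans a≡w (sym b≡w))) eq p Ew
    each : ∀ v w a b → n * n * n * ∑V (term v w a b) ≤ n ^ h * ε
    each v w a b = go (ok? v w a b)
      where
      k : V → ℕ
      k φ = ι (lookup φ v ≟ x) * ⟦ E′ (lookup φ w) ⟧
      go : Dec (v ≢ w × (a ≢ b × (b ≢ v × b ≢ w))) → n * n * n * ∑V (term v w a b) ≤ n ^ h * ε
      go (no q) = ≤-trans (≤-reflexive (trans (cong (n * n * n *_) (trans (∑V-cong (λ φ → cong (_* (ι (lookup φ b ≟ lookup φ a) * k φ)) (ι-no (ok? v w a b) q))) (∑V-0 h n))) (*-zeroʳ (n * n * n)))) z≤n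
      go (yes (v≢w , (a≢b , (b≢v , b≢w)))) = begin
        n * n * n * ∑V (term v w a b) ≤⟨ mulˡ (n * n * n) (∑V-mono (λ φ → ι*≤ (ok? v w a b) (λ _ → ≤-refl))) ⟩
        n * n * n * ∑V (λ φ → ι (lookup φ b ≟ lookup φ a) * k φ) ≡⟨ l₂ n _ ⟩
        n * (n * (n * ∑V (λ φ → ι (lookup φ b ≟ lookup φ a) * k φ))) ≡⟨ cong (λ z → n * (n * z)) (∑V-collide b (λ φ → lookup φ a) k (λ φ z → lookup∘update′ a≢b φ z) (λ φ z → cong₂ (λ p q → ι (p ≟ x) * ⟦ E′ q ⟧) (lookup∘update′ (b≢v ∘ sym) φ z) (lookup∘update′ (b≢w ∘ sym) φ z))) ⟩
        n * (n * ∑V k) ≡⟨ pair-sum (λ z z′ → ι (z ≟ x) * ⟦ E′ z′ ⟧) v w v≢w ⟩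
        n ^ h * ∑F (λ z → ∑F (λ z′ → ι (z ≟ x) * ⟦ E′ z′ ⟧)) ≡⟨ cong (n ^ h *_) (trans (∑F-cong (λ z → ∑F-*ˡ (ι (z ≟ x)) _)) (∑F-δ x (λ _ → ε))) ⟩
        n ^ h * ε ∎
        where l₂ : ∀ n z → n * n * n * z ≡ n * (n * (n * z))
              l₂ = solve-∀

  -- The error `NI` is at most h⁴c^h / n times `surplus`: both bounds carry the factor ε, which
  -- cancels.
  fewer : ∀ c → n ≤ c * card A → h * (h * (h * (h * c ^ h))) < n → #injhom H g₂ < #injhom H g₁
  fewer c big n> = begin-strict
    #injhom H g₂ ≡⟨ split3 g₂ ⟩
    miss g₂ + (thru g₂ + thruE g₂) <⟨ +-mono-≤-< miss-eq (+-mono-≤-< thru-eq thruE-lt) ⟩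
    miss g₁ + (thru g₁ + thruE g₁) ≡⟨ split3 g₁ ⟨
    #injhom H g₁ ∎
    where
    hhhh : ℕ
    hhhh = h * (h * (h * (h * c ^ h)))
    nh≤ : n ^ h ≤ c ^ h * card A ^ h
    nh≤ = ≤-trans (^-monoˡ-≤ h big) (≤-reflexive (^-distrib-* h c (card A)))
    nNI≤ : n * NI ≤ hhhh * surplus
    nNI≤ = *-cancelˡ-≤ n ⦃ >-nonZero n≥1 ⦄ (*-cancelˡ-≤ n ⦃ >-nonZero n≥1 ⦄ (begin
      n * (n * (n * NI)) ≤⟨ NI-small ⟩
      h * (h * (h * (h * (n ^ h * ε)))) ≤⟨ mulˡ h (mulˡ h (mulˡ h (mulˡ h (mulʳ ε nh≤)))) ⟩
      h * (h * (h * (h * (c ^ h * card A ^ h * ε)))) ≡⟨ l₁ h (c ^ h) (card A ^ h) ε ⟩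
      hhhh * (ε * card A ^ h) ≤⟨ mulˡ hhhh surplus-large ⟩
      hhhh * (n * (n * surplus)) ≡⟨ l₂ hhhh n surplus ⟩
      n * (n * (hhhh * surplus)) ∎))
      where
      l₁ : ∀ h c a e → h * (h * (h * (h * (c * a * e)))) ≡ h * (h * (h * (h * c))) * (e * a)
      l₁ = solve-∀
      l₂ : ∀ k n s → k * (n * (n * s)) ≡ n * (n * (k * s))
      l₂ = solve-∀
    A≥1 : 1 ≤ card A
    A≥1 = 1≤*ʳ {c} (≤-trans n≥1 big)
    surplus≥1 : 1 ≤ surplus
    surplus≥1 = 1≤*ʳ {n} (1≤*ʳ {n} (≤-trans (*-mono-≤ ε≥1 (^-pos (card A) h A≥1)) surplus-large))
    NI<surplus : NI < surplus
    NI<surplus = *-cancelˡ-< n NI surplus (≤-<-trans nNI≤ (*-monoˡ-< surplus ⦃ >-nonZero surplus≥1 ⦄ n>))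
    thruE-lt : thruE g₂ < thruE g₁
    thruE-lt = +-cancelʳ-< (surplus + NI) (thruE g₂) (thruE g₁) (begin-strict
      thruE g₂ + (surplus + NI) ≤⟨ +-monoˡ-≤ (surplus + NI) thruE≤rootedE ⟩
      rootedE g₂ + (surplus + NI) <⟨ +-monoʳ-< (rootedE g₂) (+-monoʳ-< surplus NI<surplus) ⟩
      rootedE g₂ + (surplus + surplus) ≤⟨ linear 0 (+-mono-≤ rooted-surplus′ rootedN-eq) (l₃ (rootedE g₁) (rootedE g₂) (rootedN g₁) (rootedN g₂) surplus) ⟩
      rootedE g₁ + surplus ≤⟨ +-monoˡ-≤ surplus rootedE≤thruE ⟩
      thruE g₁ + NI + surplus ≡⟨ trans (+-assoc (thruE g₁) NI surplus) (cong (thruE g₁ +_) (+-comm NI surplus)) ⟩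
      thruE g₁ + (surplus + NI) ∎)
      where
      rooted-surplus′ : rootedE g₂ + rootedN g₂ + surplus ≤ rootedE g₁ + rootedN g₁
      rooted-surplus′ = subst₂ (λ p q → p + surplus ≤ q) (rooted-split g₂) (rooted-split g₁) rooted-surplus
      l₃ : ∀ e e′ n n′ s → e + s + (e′ + n′ + s + n) ≡ e′ + (s + s) + (e + n + n′) + 0
      l₃ = solve-∀

unbalanced-fewer : ∀ {h n r} (H : Graph h) → Pendant H → ∀ (part : Fin n → Fin r) x j → part x ≢ j →
  psize part j + 2 ≤ psize part (part x) → 1 ≤ n → ∀ c → n + c ≤ c * psize part (part x) → h * (h * (h * (h * c ^ h))) < n →
  ∃ λ (part′ : Fin n → Fin r) → #injhom H (sameRel part′) < #injhom H (sameRel part)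
unbalanced-fewer {n = n} H pend part x j i≢j gap n≥1 c big n> = Unbalanced.part′ H pend part x j i≢j gap n≥1 ,
  Unbalanced.fewer H pend part x j i≢j gap n≥1 c (+-cancelʳ-≤ c _ _ (≤-trans big (≤-reflexive (trans (cong (c *_) (sym (Unbalanced.card-A H pend part x j i≢j gap n≥1))) (l c _))))) n>
  where l : ∀ c a → c * (a + 1) ≡ c * a + c
        l = solve-∀

-- Partite minimisers are Turán

TuranRel : ∀ {n} → Rel n → ℕ → Set
TuranRel {n} e ρ = Σ (Fin n → Fin (suc ρ)) λ part →
  (∀ x y → x ≢ y → e x y ≡ true → part x ≢ part y) ×
  (∀ x y → x ≢ y → part x ≢ part y → e x y ≡ true) ×
  (∀ a → psize part a ≡ n / suc ρ ⊎ psize part a ≡ (n + ρ) / suc ρ)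

#injhom-cong≢ : ∀ {h n} (H : Graph h) {e e′ : Rel n} → (∀ x y → x ≢ y → e x y ≡ e′ x y) → #injhom H e ≡ #injhom H e′
#injhom-cong≢ {h} {n} H {e} {e′} eq = ∑V-cong (λ φ → ι-cong (InjHom? H e φ) (InjHom? H e′ φ) (to φ eq) (to φ (λ x y p → sym (eq x y p))))
  where
  to : ∀ φ {e e′ : Rel n} → (∀ x y → x ≢ y → e x y ≡ e′ x y) → Inj φ × Hom H e φ → Inj φ × Hom H e′ φ
  to φ q (inj , hom) = inj , λ i j a → trans (sym (q _ _ (inj i j (λ { refl → contradiction (trans (sym a) (adjIrr H i)) λ () })))) (hom i j a)

no-injhom : ∀ {h n r} (H : Graph h) (part : Fin n → Fin r) (e : Rel n) → (∀ x y → x ≢ y → e x y ≡ true → part x ≢ part y) →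
  ¬ Colourable H r → #injhom H e ≡ 0
no-injhom {h} {n} H part e proper nc = trans (∑V-cong (λ φ → ι-no (InjHom? H e φ) (λ { (inj , hom) → nc ((λ i → part (lookup φ i)) ,
    λ i j a → proper _ _ (inj i j (λ { refl → contradiction (trans (sym a) (adjIrr H i)) λ () })) (hom i j a)) }))) (∑V-0 h n)

turan-sizes : ∀ {n} ρ (part : Fin n → Fin (suc ρ)) → (∀ k l → psize part k ≤ psize part l + 1) →
  (∀ a → psize part a ≡ n / suc ρ ⊎ psize part a ≡ (n + ρ) / suc ρ) × (∀ a → suc n ≤ suc ρ * suc (psize part a))
turan-sizes {n} ρ part close = sizes , low
  where
  r = suc ρ
  psz = psize part
  δk : ∀ k → ∑F {r} (λ l → ι (l ≟ k)) ≡ 1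
  δk k = ∑F-ι k
  low : ∀ k → suc n ≤ r * suc (psz k)
  low k = ≤-trans (≤-reflexive (trans (+-comm 1 n) (trans (sym (cong₂ _+_ (psize-total part) (δk k))) (sym (∑F-+ _ _))))) (∑F-≤const (suc (psz k)) pt)
    where
    pt : ∀ l → psz l + ι (l ≟ k) ≤ suc (psz k)
    pt l with ι-cases (l ≟ k)
    ... | inj₁ (refl , q) = ≤-reflexive (trans (cong (psz l +_) q) (+-comm (psz l) 1))
    ... | inj₂ (_ , q) = ≤-trans (≤-reflexive (trans (cong (psz l +_) q) (+-identityʳ (psz l)))) (≤-trans (close l k) (≤-reflexive (+-comm (psz k) 1)))
  high : ∀ k → r * psz k + 1 ≤ n + r
  high k = ≤-trans (≤-reflexive (trans (cong₂ _+_ (sym (∑F-const r (psz k))) (sym (δk k))) (sym (∑F-+ _ _)))) (≤-trans (∑F-mono pt) (≤-reflexive (trans (∑F-+ _ _) (cong₂ _+_ (psize-total part) (∑F-1 r)))))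
    where
    pt : ∀ l → psz k + ι (l ≟ k) ≤ psz l + 1
    pt l with ι-cases (l ≟ k)
    ... | inj₁ (refl , q) = ≤-reflexive (cong (psz l +_) q)
    ... | inj₂ (_ , q) = ≤-trans (≤-reflexive (trans (cong (psz k +_) q) (+-identityʳ (psz k)))) (close k l)
  quotient : ∀ z s → s * r ≤ z → z < suc s * r → s ≡ z / r
  quotient z s lo hi = ≤-antisym (≤-trans (≤-reflexive (sym (m*n/n≡m s r))) (/-monoˡ-≤ r lo)) (≤-pred (m<n*o⇒m/o<n hi))
  sizes : ∀ a → psz a ≡ n / r ⊎ psz a ≡ (n + ρ) / r
  sizes a with psz a * r ≤? n
  ... | yes q = inj₁ (quotient n (psz a) q (≤-trans (low a) (≤-reflexive (*-comm r (suc (psz a))))))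
  ... | no q = inj₂ (quotient (n + ρ) (psz a) (+-cancelʳ-≤ 1 _ _ (≤-trans (≤-reflexive (cong (_+ 1) (*-comm (psz a) r))) (≤-trans (high a) (≤-reflexive (l n ρ)))))
      (≤-trans (+-monoˡ-≤ ρ (≰⇒> q)) (≤-trans (+-monoʳ-≤ (psz a * r) (n≤1+n ρ)) (≤-reflexive (+-comm (psz a * r) r)))))
    where l : ∀ n ρ → n + suc ρ ≡ n + ρ + 1
          l = solve-∀

module Exact {h₁ h₂ n} (H₁ : Graph h₁) (H₂ : Graph h₂) (α β ρ : ℕ) (β≥1 : 1 ≤ β) (pend : Pendant H₂) (nc : ¬ Colourable H₁ (suc ρ))
  (e : Rel n) (e-sym : Symm e) (min : Minimal (objective′ H₁ H₂ α β) e) (n≥1 : 1 ≤ n) (n≥h₁ : 2 * (h₁ * h₁) ≤ n) (n≥2r : 2 * suc ρ ≤ n)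
  (n> : h₂ * (h₂ * (h₂ * (h₂ * (2 * suc ρ) ^ h₂))) < n) (n>′ : h₂ * h₂ * (2 * suc ρ) ^ h₂ < n)
  (part : Fin n → Fin (suc ρ)) (proper : ∀ x y → x ≢ y → e x y ≡ true → part x ≢ part y) where
  open ≤-Reasoning
  open Pendant pend

  r : ℕ
  r = suc ρ

  psz : Fin r → ℕ
  psz = psize part

  Bc : ℕ
  Bc = β * #inj h₁ n

  Bc≥1 : 1 ≤ Bc
  Bc≥1 = *-mono-≤ β≥1 (1≤*ʳ {2} (≤-trans (^-pos n h₁ n≥1) (#inj-large h₁ n n≥h₁ n≥1)))

  neg≤same : ∀ (part″ : Fin n → Fin r) → #injhom H₂ (neg e) ≤ #injhom H₂ (sameRel part″)
  neg≤same part″ = *-cancelˡ-≤ Bc ⦃ >-nonZero Bc≥1 ⦄ (begin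
    Bc * #injhom H₂ (neg e) ≤⟨ m≤n+m _ (α * #inj h₂ n * #injhom H₁ e) ⟩
    objective′ H₁ H₂ α β e ≤⟨ min (multi part″) (neg-sym (sameRel-sym part″)) ⟩
    α * #inj h₂ n * #injhom H₁ (multi part″) + Bc * #injhom H₂ (neg (multi part″)) ≡⟨ cong₂ _+_ (trans (cong (α * #inj h₂ n *_) (no-injhom H₁ part″ (multi part″) (λ x y _ → multi-proper part″ x y) nc)) (*-zeroʳ (α * #inj h₂ n))) (cong (Bc *_) (#injhom-cong H₂ (λ x y → Bool.not-involutive (sameRel part″ x y)))) ⟩
    Bc * #injhom H₂ (sameRel part″) ∎)

  same⇒neg : ∀ φ → Inj φ × Hom H₂ (sameRel part) φ → Inj φ × Hom H₂ (neg e) φ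
  same⇒neg φ (inj , hom) = inj , λ a b ab → cong not (Bool.¬-not (λ q → proper _ _ (inj a b (λ { refl → contradiction (trans (sym ab) (adjIrr H₂ a)) λ () })) q (does-true (part (lookup φ a) ≟ part (lookup φ b)) (hom a b ab))))

  same≤neg : #injhom H₂ (sameRel part) ≤ #injhom H₂ (neg e)
  same≤neg = ∑V-mono (λ φ → ι-mono (InjHom? H₂ (sameRel part) φ) (InjHom? H₂ (neg e) φ) (same⇒neg φ))

  -- A class of at least average size makes the large clique linear in n, with the constant 2r that
  -- `unbalanced-fewer` takes.
  large-close : ∀ k l → n ≤ r * psz k → psz k ≤ psz l + 1
  large-close k l big with psz k ≤? psz l + 1
  ... | yes q = q
  ... | no q = ⊥-elim (<⇒≱ (proj₂ moved) (≤-trans same≤neg (neg≤same (proj₁ moved))))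
    where
    gap₀ : psz l + 2 ≤ psz k
    gap₀ = ≤-trans (≤-reflexive (+-suc (psz l) 1)) (≰⇒> q)
    x₀ : ∃ λ z → does (part z ≟ k) ≡ true
    x₀ = card-pos (λ z → does (part z ≟ k)) (≤-trans (≤-trans (s≤s z≤n) (m≤n+m 2 (psz l))) gap₀)
    x = proj₁ x₀
    x∈k : part x ≡ k
    x∈k = does-true (part x ≟ k) (proj₂ x₀)
    k≢l : part x ≢ l
    k≢l p = <⇒≱ (≤-trans (≤-reflexive (+-comm 1 (psz l))) (≤-trans (+-monoʳ-≤ (psz l) (s≤s {n = 1} z≤n)) gap₀)) (≤-reflexive (cong psz (trans (sym x∈k) p)))
    big′ : n + 2 * r ≤ 2 * r * psz (part x)
    big′ = ≤-trans (linear 0 (+-mono-≤ (mulˡ 2 big) n≥2r) (l₁ r (psz k) n)) (mulˡ (2 * r) (≤-reflexive (cong psz (sym x∈k))))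
      where l₁ : ∀ r p n → 2 * r * p + (2 * n + 2 * r) ≡ n + 2 * r + (2 * (r * p) + n) + 0
            l₁ = solve-∀
    moved : ∃ λ (part′ : Fin n → Fin r) → #injhom H₂ (sameRel part′) < #injhom H₂ (sameRel part)
    moved = unbalanced-fewer H₂ pend part x l k≢l (≤-trans gap₀ (≤-reflexive (cong psz (sym x∈k)))) n≥1 (2 * r) big′ n>

  -- A largest class i has at least average size, so it exceeds l by at most one. If k exceeded l by
  -- more, then k would be at least as large as i, and `large-close` would apply to k as well.
  close : ∀ k l → psz k ≤ psz l + 1
  close k l with psz k ≤? psz l + 1
  ... | yes q = q
  ... | no q = large-close k l (≤-trans i-big (mulˡ r (≤-trans (large-close i l i-big) (<⇒≤ (≰⇒> q)))))
    where
    i = proj₁ (max-val psz (s≤s {n = ρ} z≤n))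
    i-big : n ≤ r * psz i
    i-big = ≤-trans (≤-reflexive (sym (psize-total part))) (proj₂ (max-val psz (s≤s {n = ρ} z≤n)))

  -- If a pair xy between classes were a non-edge, the complement would contain all the cliques and
  -- this pair. With the stem on x, the leaf on y and the rest injectively in the class of x there
  -- is then a copy of H₂ that the cliques alone do not have, because the leaf has no further
  -- neighbour. The multipartite relation would be strictly better.
  complete : ∀ x y → x ≢ y → part x ≢ part y → e x y ≡ true
  complete x y x≢y diff with e x y Bool.≟ true
  ... | yes q = q
  ... | no q = ⊥-elim (<⇒≱ (∑V-strict (λ φ → ι-mono (InjHom? H₂ (sameRel part) φ) (InjHom? H₂ (neg e) φ) (same⇒neg φ)) ψ ψ-strict) (neg≤same part))
    where
    i = part x
    sub : Vec (Fin n) h₂ → Vec (Fin n) h₂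
    sub φ = (φ [ stem ]≔ x) [ leaf ]≔ y
    in? : ∀ φ → Dec (∀ w → part (lookup φ w) ≡ i)
    in? φ = all? (λ w → part (lookup φ w) ≟ i)
    in-sum : ∑V (λ φ → ι (in? φ)) ≡ psz i ^ h₂
    in-sum = trans (∑V-cong (λ φ → ι-all-∏ (λ w → part (lookup φ w) ≟ i))) (trans (∑V-∏ (λ _ z → ι (part z ≟ i))) (∏F-const h₂ (psz i)))
    big : n ≤ 2 * r * psz i
    big = linear 0 (+-mono-≤ (mulˡ 2 (<⇒≤ (proj₂ (turan-sizes ρ part close) i))) n≥2r) (l₁ r (psz i) n)
      where l₁ : ∀ r p n → 2 * r * p + (2 * n + 2 * r) ≡ n + (2 * (r * suc p) + n) + 0
            l₁ = solve-∀
    lt : ∑V (λ φ → ι (¬? (Inj? (sub φ)))) < ∑V (λ φ → ι (in? φ))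
    lt = *-cancelˡ-< n _ _ (begin-strict
      n * ∑V (λ φ → ι (¬? (Inj? (sub φ)))) ≤⟨ noninj-bound _ sub (fixing-2 stem leaf x y stem≢leaf x≢y) ⟩
      h₂ * h₂ * n ^ h₂ ≤⟨ mulˡ (h₂ * h₂) (≤-trans (^-monoˡ-≤ h₂ big) (≤-reflexive (^-distrib-* h₂ (2 * r) (psz i)))) ⟩
      h₂ * h₂ * ((2 * r) ^ h₂ * psz i ^ h₂) ≡⟨ *-assoc (h₂ * h₂) ((2 * r) ^ h₂) _ ⟨
      h₂ * h₂ * (2 * r) ^ h₂ * psz i ^ h₂ <⟨ *-monoˡ-< (psz i ^ h₂) ⦃ >-nonZero (^-pos (psz i) h₂ (1≤*ʳ {2 * r} (≤-trans n≥1 big))) ⦄ n>′ ⟩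
      n * psz i ^ h₂ ≡⟨ cong (n *_) in-sum ⟨
      n * ∑V (λ φ → ι (in? φ)) ∎)
    found : ∃ λ φ → ι (¬? (Inj? (sub φ))) < ι (in? φ)
    found = ∑V-<-∃ (λ φ → ι (¬? (Inj? (sub φ)))) (λ φ → ι (in? φ)) lt
    φ = proj₁ found
    ψ = sub φ
    φ-in : ∀ w → part (lookup φ w) ≡ i
    φ-in = ι-pos (in? φ) (≤-trans (s≤s z≤n) (proj₂ found))
    ψ-inj : Inj ψ
    ψ-inj = decidable-stable (Inj? ψ) (λ ni → <⇒≱ (≤-<-trans (≤-reflexive (sym (ι-yes (¬? (Inj? ψ)) ni))) (proj₂ found)) (⟦⟧≤1 (does (in? φ))))
    ψ-leaf : lookup ψ leaf ≡ y
    ψ-leaf = lookup∘update leaf (φ [ stem ]≔ x) y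
    ψ-stem : lookup ψ stem ≡ x
    ψ-stem = trans (lookup∘update′ stem≢leaf (φ [ stem ]≔ x) y) (lookup∘update stem φ x)
    ψ-i : ∀ w → w ≢ leaf → part (lookup ψ w) ≡ i
    ψ-i w w≢ = go (w ≟ stem)
      where go : Dec (w ≡ stem) → part (lookup ψ w) ≡ i
            go (yes p) = cong part (trans (cong (lookup ψ) p) ψ-stem)
            go (no w≢s) = trans (cong part (trans (lookup∘update′ w≢ (φ [ stem ]≔ x) y) (lookup∘update′ w≢s φ x))) (φ-in w)
    ψ-hom : Hom H₂ (neg e) ψ
    ψ-hom a b ab = go (a ≟ leaf) (b ≟ leaf)
      where
      ba : adj H₂ b a ≡ true
      ba = trans (adjSym H₂ b a) ab
      nxy : neg e x y ≡ true
      nxy = cong not (Bool.¬-not q)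
      go : Dec (a ≡ leaf) → Dec (b ≡ leaf) → neg e (lookup ψ a) (lookup ψ b) ≡ true
      go (yes p) _ = trans (cong₂ (neg e) (trans (cong (lookup ψ) p) ψ-leaf) (trans (cong (lookup ψ) (only b (trans (cong (λ z → adj H₂ z b) (sym p)) ab))) ψ-stem)) (trans (neg-sym e-sym y x) nxy)
      go (no _) (yes p) = trans (cong₂ (neg e) (trans (cong (lookup ψ) (only a (trans (cong (λ z → adj H₂ z a) (sym p)) ba))) ψ-stem) (trans (cong (lookup ψ) p) ψ-leaf)) nxy
      go (no p) (no p′) = cong not (Bool.¬-not (λ o → proper _ _ (ψ-inj a b (λ { refl → contradiction (trans (sym ab) (adjIrr H₂ a)) λ () })) o (trans (ψ-i a p) (sym (ψ-i b p′)))))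
    ψ-strict : ι (InjHom? H₂ (sameRel part) ψ) < ι (InjHom? H₂ (neg e) ψ)
    ψ-strict = subst₂ _<_ (sym (ι-no (InjHom? H₂ (sameRel part) ψ) (λ { (_ , hom) → diff (trans (cong part (sym ψ-stem)) (trans (does-true (part (lookup ψ stem) ≟ part (lookup ψ leaf)) (hom stem leaf attached)) (cong part ψ-leaf))) })))
      (sym (ι-yes (InjHom? H₂ (neg e) ψ) (ψ-inj , ψ-hom))) (s≤s z≤n)

  turan : TuranRel e ρ
  turan = part , proper , complete , proj₁ (turan-sizes ρ part close)

-- Clearing denominators

objective-≤ : ∀ a b i k i′ k′ d d′ →
  ℕtoℚ a ℚ.* frac i (suc d) ℚ.+ ℕtoℚ b ℚ.* frac k (suc d′) ℚ.≤ ℕtoℚ a ℚ.* frac i′ (suc d) ℚ.+ ℕtoℚ b ℚ.* frac k′ (suc d′) →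
  a * i * suc d′ + b * k * suc d ≤ a * i′ * suc d′ + b * k′ * suc d
objective-≤ a b i k i′ k′ d d′ h = ℤ.drop‿+≤+ (subst₂ ℤ._≤_ (num i k) (num i′ k′) (cancel (ℚᵘ.≤-respˡ-≃ (val i k) (ℚᵘ.≤-respʳ-≃ (val i′ k′) (ℚ.toℚᵘ-mono-≤ h)))))
  where
  un : ℕ → ℕ → ℚᵘ.ℚᵘ
  un i k = mkℚᵘ (ℤ.+ a) 0 ℚᵘ.* mkℚᵘ (ℤ.+ i) d ℚᵘ.+ mkℚᵘ (ℤ.+ b) 0 ℚᵘ.* mkℚᵘ (ℤ.+ k) d′
  val : ∀ i k → toℚᵘ (ℕtoℚ a ℚ.* frac i (suc d) ℚ.+ ℕtoℚ b ℚ.* frac k (suc d′)) ℚᵘ.≃ un i k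
  val i k = ℚᵘ.≃-trans (ℚ.toℚᵘ-homo-+ (ℕtoℚ a ℚ.* frac i (suc d)) (ℕtoℚ b ℚ.* frac k (suc d′)))
    (ℚᵘ.+-cong (ℚᵘ.≃-trans (ℚ.toℚᵘ-homo-* (ℕtoℚ a) (frac i (suc d))) (ℚᵘ.*-cong (ℚ.toℚᵘ-fromℚᵘ (mkℚᵘ (ℤ.+ a) 0)) (ℚ.toℚᵘ-fromℚᵘ (mkℚᵘ (ℤ.+ i) d))))
               (ℚᵘ.≃-trans (ℚ.toℚᵘ-homo-* (ℕtoℚ b) (frac k (suc d′))) (ℚᵘ.*-cong (ℚ.toℚᵘ-fromℚᵘ (mkℚᵘ (ℤ.+ b) 0)) (ℚ.toℚᵘ-fromℚᵘ (mkℚᵘ (ℤ.+ k) d′)))))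
  cancel : un i k ℚᵘ.≤ un i′ k′ → ℚᵘ.↥ (un i k) ℤ.≤ ℚᵘ.↥ (un i′ k′)
  cancel (*≤* q) = ℤ.*-cancelʳ-≤-pos (ℚᵘ.↥ (un i k)) (ℚᵘ.↥ (un i′ k′)) (ℚᵘ.↧ (un i k)) q
  num : ∀ i k → ℚᵘ.↥ (un i k) ≡ ℤ.+ (a * i * suc d′ + b * k * suc d)
  num i k = trans (cong₂ ℤ._+_
    (trans (cong₂ ℤ._*_ (sym (ℤ.pos-* a i)) (cong (λ z → ℤ.+ suc z) (+-identityʳ d′))) (sym (ℤ.pos-* (a * i) (suc d′))))
    (trans (cong₂ ℤ._*_ (sym (ℤ.pos-* b k)) (cong (λ z → ℤ.+ suc z) (+-identityʳ d))) (sym (ℤ.pos-* (b * k) (suc d)))))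
    (sym (ℤ.pos-+ (a * i * suc d′) (b * k * suc d)))

-- A positive rational is at least the reciprocal of its denominator, which therefore serves as Q.
ratio-≤ : ∀ (q : ℚ) → 0ℚ ℚ.< q → ∃ λ Q → 1 ≤ Q × (∀ M N → q ℚ.* ℕtoℚ M ℚ.≤ ℕtoℚ N → M ≤ Q * N)
ratio-≤ q@(mkℚ (ℤ.+ zero) d c) 0<q = ⊥-elim (ℤ.Positive.pos (ℚ.positive 0<q))
ratio-≤ q@(mkℚ ℤ.-[1+ _ ] d c) 0<q = ⊥-elim (ℤ.Positive.pos (ℚ.positive 0<q))
ratio-≤ q@(mkℚ (ℤ.+ suc k) d c) 0<q = suc d , s≤s z≤n , bound
  where
  bound : ∀ M N → q ℚ.* ℕtoℚ M ℚ.≤ ℕtoℚ N → M ≤ suc d * N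
  bound M N h with ℚᵘ.≤-respˡ-≃ (ℚᵘ.≃-trans (ℚ.toℚᵘ-homo-* q (ℕtoℚ M)) (ℚᵘ.*-congˡ {mkℚᵘ (ℤ.+ suc k) d} (ℚ.toℚᵘ-fromℚᵘ (mkℚᵘ (ℤ.+ M) 0)))) (ℚᵘ.≤-respʳ-≃ (ℚ.toℚᵘ-fromℚᵘ (mkℚᵘ (ℤ.+ N) 0)) (ℚ.toℚᵘ-mono-≤ h))
  ... | *≤* le = ≤-trans (m≤m+n M (k * M)) (ℤ.drop‿+≤+ (subst₂ ℤ._≤_ (trans (ℤ.*-identityʳ _) (sym (ℤ.pos-* (suc k) M))) (trans (sym (ℤ.pos-* N (suc (d * 1)))) (cong ℤ.+_ (trans (cong (λ z → N * suc z) (*-identityʳ d)) (*-comm N (suc d))))) le))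

-- Counting by enumeration

countB-∑ : ∀ {A : Set} (p : A → Bool) (xs : List A) → countB p xs ≡ ∑ xs (λ x → ⟦ p x ⟧)
countB-∑ p [] = refl
countB-∑ p (x ∷ xs) = cong₂ _+_ (b (p x)) (countB-∑ p xs)
  where b : ∀ c → (if c then 1 else 0) ≡ ⟦ c ⟧
        b true = refl
        b false = refl

countB-F : ∀ {n} (p : Fin n → Bool) → countB p (allFin n) ≡ ∑F (λ x → ⟦ p x ⟧)
countB-F {n} p = trans (countB-∑ p (allFin n)) (sym (∑F-list _))

opaque
  unfolding ∑V
  -- The enumerated functions and the lookups of vectors agree only pointwise; hence `k` is required
  -- to respect pointwise equality.
  ∑-allMaps : ∀ {h n} (k : (Fin h → Fin n) → ℕ) → (∀ {f g} → (∀ i → f i ≡ g i) → k f ≡ k g) → ∑ (allMaps h n) k ≡ ∑V (λ φ → k (lookup φ))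
  ∑-allMaps {zero} k k-ext = cong (_+ 0) (k-ext (λ ()))
  ∑-allMaps {suc h} {n} k k-ext = trans (∑-concatMap (allMaps h n) _ k)
    (trans (∑-cong (allMaps h n) (λ f → ∑-map (allFin n) (λ x → consF x f) k))
    (trans (∑-allMaps (λ f → ∑ (allFin n) (λ x → k (consF x f))) (λ eq → ∑-cong (allFin n) (λ x → k-ext (λ { zero → refl ; (suc i) → eq i }))))
    (trans (∑-cong (vecs h n) (λ φ → ∑-cong (allFin n) (λ x → k-ext {g = lookup (x ∷ φ)} (λ { zero → refl ; (suc i) → refl }))))
    (sym (trans (∑V-suc (λ φ → k (lookup φ))) (∑-cong (vecs h n) (λ φ → ∑F-list (λ x → k (lookup (x ∷ φ))))))))))

all-tabulate⇒ : ∀ {n} {A : Set} (p : A → Bool) (f : Fin n → A) → all p (tabulate f) ≡ true → ∀ i → p (f i) ≡ true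
all-tabulate⇒ p f h zero = ∧-elimˡ h
all-tabulate⇒ p f h (suc i) = all-tabulate⇒ p (f ∘ suc) (∧-elimʳ {p (f zero)} h) i

all-tabulate⇐ : ∀ {n} {A : Set} (p : A → Bool) (f : Fin n → A) → (∀ i → p (f i) ≡ true) → all p (tabulate f) ≡ true
all-tabulate⇐ {zero} p f h = refl
all-tabulate⇐ {suc n} p f h = ∧-intro (h zero) (all-tabulate⇐ p (f ∘ suc) (h ∘ suc))

any-tabulate⇐ : ∀ {n} {A : Set} (p : A → Bool) (f : Fin n → A) i → p (f i) ≡ true → any p (tabulate f) ≡ true
any-tabulate⇐ p f zero h = cong (_∨ any p (tabulate (f ∘ suc))) h
any-tabulate⇐ p f (suc i) h = trans (cong (p (f zero) ∨_) (any-tabulate⇐ p (f ∘ suc) i h)) (Bool.∨-zeroʳ (p (f zero)))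

isInjective⇒ : ∀ {h n} (f : Fin h → Fin n) → isInjective f ≡ true → ∀ i j → i ≢ j → f i ≢ f j
isInjective⇒ f p i j i≢j eq = contradiction (trans (sym (all-tabulate⇒ _ id (all-tabulate⇒ _ id p i) j)) (cong₂ (λ a b → a ∨ not b) (dec-false (i ≟ j) i≢j) (dec-true (f i ≟ f j) eq))) λ ()

isInjective⇐ : ∀ {h n} (f : Fin h → Fin n) → (∀ i j → i ≢ j → f i ≢ f j) → isInjective f ≡ true
isInjective⇐ f inj = all-tabulate⇐ _ id (λ i → all-tabulate⇐ _ id (λ j → go i j (i ≟ j)))
  where
  go : ∀ i j → Dec (i ≡ j) → ((i == j) ∨ not (f i == f j)) ≡ true
  go i j (yes p) = cong (_∨ not (f i == f j)) (dec-true (i ≟ j) p)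
  go i j (no p) = trans (cong (λ b → (i == j) ∨ not b) (dec-false (f i ≟ f j) (inj i j p))) (Bool.∨-zeroʳ (i == j))

isHom⇒ : ∀ {h n} (H : Graph h) (G : Graph n) f → isHom H G f ≡ true → ∀ i j → adj H i j ≡ true → adj G (f i) (f j) ≡ true
isHom⇒ H G f p i j a = trans (cong (λ b → not b ∨ adj G (f i) (f j)) (sym a)) (all-tabulate⇒ _ id (all-tabulate⇒ _ id p i) j)

isHom⇐ : ∀ {h n} (H : Graph h) (G : Graph n) f → (∀ i j → adj H i j ≡ true → adj G (f i) (f j) ≡ true) → isHom H G f ≡ true
isHom⇐ H G f hom = all-tabulate⇐ _ id (λ i → all-tabulate⇐ _ id (λ j → go i j (adj H i j) refl))
  where
  go : ∀ i j b → adj H i j ≡ b → (not (adj H i j) ∨ adj G (f i) (f j)) ≡ true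
  go i j true a = trans (cong (λ b → not b ∨ adj G (f i) (f j)) a) (hom i j a)
  go i j false a = cong (λ b → not b ∨ adj G (f i) (f j)) a

⟦⟧-iff : ∀ {a b} → (a ≡ true → b ≡ true) → (b ≡ true → a ≡ true) → ⟦ a ⟧ ≡ ⟦ b ⟧
⟦⟧-iff f g = ≤-antisym (⟦⟧-mono f) (⟦⟧-mono g)

#inj-count : ∀ h n → countB isInjective (allMaps h n) ≡ #inj h n
#inj-count h n = trans (countB-∑ isInjective (allMaps h n)) (trans (∑-allMaps (λ f → ⟦ isInjective f ⟧)
    (λ {f} {g} eq → ⟦⟧-iff (λ p → isInjective⇐ g (carry f g eq (isInjective⇒ f p))) (λ p → isInjective⇐ f (carry g f (sym ∘ eq) (isInjective⇒ g p)))))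
  (∑V-cong (λ φ → ⟦⟧-iff (λ p → dec-true (Inj? φ) (isInjective⇒ (lookup φ) p)) (λ p → isInjective⇐ (lookup φ) (does-true (Inj? φ) p)))))
  where
  carry : ∀ (f g : Fin h → Fin n) → (∀ i → f i ≡ g i) → (∀ i j → i ≢ j → f i ≢ f j) → ∀ i j → i ≢ j → g i ≢ g j
  carry f g eq inj i j p q = inj i j p (trans (eq i) (trans q (sym (eq j))))

#injhom-count : ∀ {h n} (H : Graph h) (G : Graph n) → countB (λ f → isInjective f ∧ isHom H G f) (allMaps h n) ≡ #injhom H (adj G)
#injhom-count {h} {n} H G = trans (countB-∑ _ (allMaps h n)) (trans (∑-allMaps (λ f → ⟦ isInjective f ∧ isHom H G f ⟧)
    (λ {f} {g} eq → ⟦⟧-iff (λ p → back g (carry f g eq (fwd f p))) (λ p → back f (carry g f (sym ∘ eq) (fwd g p)))))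
  (∑V-cong (λ φ → ⟦⟧-iff (λ p → dec-true (InjHom? H (adj G) φ) (fwd (lookup φ) p)) (λ p → back (lookup φ) (does-true (InjHom? H (adj G) φ) p)))))
  where
  Q : (Fin h → Fin n) → Set
  Q f = (∀ i j → i ≢ j → f i ≢ f j) × (∀ i j → adj H i j ≡ true → adj G (f i) (f j) ≡ true)
  fwd : ∀ f → (isInjective f ∧ isHom H G f) ≡ true → Q f
  fwd f p = isInjective⇒ f (∧-elimˡ p) , isHom⇒ H G f (∧-elimʳ {isInjective f} p)
  back : ∀ f → Q f → (isInjective f ∧ isHom H G f) ≡ true
  back f (a , b) = ∧-intro (isInjective⇐ f a) (isHom⇐ H G f b)
  carry : ∀ (f g : Fin h → Fin n) → (∀ i → f i ≡ g i) → Q f → Q g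
  carry f g eq (inj , hom) = (λ i j p q → inj i j p (trans (eq i) (trans q (sym (eq j))))) , λ i j a → trans (sym (cong₂ (adj G) (eq i) (eq j))) (hom i j a)

-- Components of a hairy graph

∑F-split : ∀ m {t} (g : Fin (m + t) → ℕ) → ∑F g ≡ ∑F (λ i → g (i ↑ˡ t)) + ∑F (λ s → g (m ↑ʳ s))
∑F-split zero g = sym (cong (_+ ∑F g) (∑F-zero _))
∑F-split (suc m) {t} g = trans (∑F-suc g) (trans (cong (g zero +_) (∑F-split m (g ∘ suc))) (trans (sym (+-assoc (g zero) _ _)) (cong (_+ ∑F (λ s → g (suc m ↑ʳ s))) (sym (∑F-suc (λ i → g (i ↑ˡ t)))))))

reach-refl : ∀ {n} (G : Graph n) k i → reach G k i i ≡ true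
reach-refl G zero i = ==-refl i
reach-refl G (suc k) i = cong (_∨ any (λ l → reach G k i l ∧ adj G l i) (allFin _)) (reach-refl G k i)

adj⇒connected : ∀ {n} (G : Graph n) i j → adj G i j ≡ true → connected G i j ≡ true
adj⇒connected {suc n} G i j a = trans (cong (reach G n i j ∨_) (any-tabulate⇐ (λ l → reach G n i l ∧ adj G l j) id i (∧-intro (reach-refl G n i) a))) (Bool.∨-zeroʳ (reach G n i j))

hairy-attached : ∀ {m t} (F : Graph m) (f : Fin t → Fin m) s → adj (hairy F t f) (f s ↑ˡ t) (m ↑ʳ s) ≡ true
hairy-attached {m} {t} F f s = trans (cong₂ (hairyAdj F f) (splitAt-↑ˡ m (f s) t) (splitAt-↑ʳ m t s)) (==-refl (f s))

-- The end of a hair has a larger index than all vertices of F and is adjacent to one of them, so it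
-- is never the least vertex of its component. This makes the exponents of the objective at least t.
components-hairy : ∀ {m t} (F : Graph m) (f : Fin t → Fin m) → components (hairy F t f) ≤ m
components-hairy {m} {t} F f = ≤-trans (≤-reflexive (trans (countB-F root) (∑F-split m _)))
  (≤-trans (+-mono-≤ (∑F-≤const 1 (λ i → ⟦⟧≤1 (root (i ↑ˡ t)))) (∑F-≤const 0 (λ s → ≤-reflexive (cong (⟦_⟧ ∘ not) (not-root s)))))
    (≤-reflexive (trans (cong₂ _+_ (*-identityʳ m) (*-zeroʳ t)) (+-identityʳ m))))
  where
  H = hairy F t f
  lower : Fin (m + t) → Fin (m + t) → Bool
  lower i j = (toℕ j <ᵇ toℕ i) ∧ connected H i j
  root : Fin (m + t) → Bool
  root i = not (any (lower i) (allFin (m + t)))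
  less : ∀ s → toℕ (f s ↑ˡ t) < toℕ (m ↑ʳ s)
  less s = subst₂ _<_ (sym (toℕ-↑ˡ (f s) t)) (sym (toℕ-↑ʳ m s)) (≤-trans (toℕ<n (f s)) (m≤m+n m (toℕ s)))
  not-root : ∀ s → any (lower (m ↑ʳ s)) (allFin (m + t)) ≡ true
  not-root s = any-tabulate⇐ (lower (m ↑ʳ s)) id (f s ↑ˡ t) (∧-intro (dec-true (toℕ (f s ↑ˡ t) <? toℕ (m ↑ʳ s)) (less s)) (adj⇒connected H (m ↑ʳ s) (f s ↑ˡ t) (trans (adjSym H _ _) (hairy-attached F f s))))

-- Chromatic numbers

colour-mono : ∀ {n c d} (G : Graph n) → c ≤ d → Colourable G c → Colourable G d
colour-mono G c≤d (col , proper) = (λ i → inject≤ (col i) c≤d) , λ i j a eq → proper i j a (inject≤-injective c≤d c≤d (col i) (col j) eq)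

-- A graph that is not bipartite has c ≥ 3, hence the form 3 + ρ; without the critical edge at most
-- 2 + ρ colours are needed.
critical : ∀ {m} (F : Graph m) → ¬ Bipartite F → HasCriticalEdge F → ∃ λ ρ → Critical F ρ × IsChromatic F (3 + ρ)
critical F nb (u , v , edge , zero , d , (col , _) , _) = ⊥-elim (nb (colour-mono F z≤n col))
critical F nb (u , v , edge , suc zero , d , (col , _) , _) = ⊥-elim (nb (colour-mono F (s≤s z≤n) col))
critical F nb (u , v , edge , suc (suc zero) , d , (col , _) , _) = ⊥-elim (nb col)
critical F nb (u , v , edge , suc (suc (suc ρ)) , d , ch , (colD , _) , d<c) = ρ , record
    { u = u ; v = v ; edge = edge ; col = proj₁ col ; col-proper = proper ; uncolourable = proj₂ ch (2 + ρ) (n<1+n (2 + ρ)) } , ch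
  where
  col : Colourable (deleteEdge F u v) (2 + ρ)
  col = colour-mono (deleteEdge F u v) (≤-pred d<c) colD
  proper : ∀ i j → adj F i j ≡ true → ¬ (i ≡ u × j ≡ v) → ¬ (i ≡ v × j ≡ u) → proj₁ col i ≢ proj₁ col j
  proper i j a p q = proj₂ col i j (∧-intro a (cong not (cong₂ _∨_ (both p) (both q))))
    where
    both : ∀ {y z} → ¬ (i ≡ y × j ≡ z) → ((i == y) ∧ (j == z)) ≡ false
    both {y} {z} n with i ≟ y | j ≟ z
    ... | yes b | yes c = contradiction (b , c) n
    ... | yes _ | no _ = refl
    ... | no _ | _ = refl

hairy-colourable : ∀ {m t ρ} (F : Graph m) (f : Fin t → Fin m) → Colourable F (3 + ρ) → Colourable (hairy F t f) (3 + ρ)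
hairy-colourable {m} {t} {ρ} F f (col , proper) = (λ i → c (splitAt m i)) , λ i j → ok (splitAt m i) (splitAt m j)
  where
  flip : Fin (3 + ρ) → Fin (3 + ρ)
  flip zero = suc zero
  flip (suc _) = zero
  flip-≢ : ∀ a → a ≢ flip a
  flip-≢ zero ()
  flip-≢ (suc _) ()
  c : Fin m ⊎ Fin t → Fin (3 + ρ)
  c (inj₁ a) = col a
  c (inj₂ s) = flip (col (f s))
  ok : ∀ y z → hairyAdj F f y z ≡ true → c y ≢ c z
  ok (inj₁ a) (inj₁ b) p = proper a b p
  ok (inj₁ a) (inj₂ s) p eq = flip-≢ (col (f s)) (trans (cong col (does-true (f s ≟ a) p)) eq)
  ok (inj₂ s) (inj₁ a) p eq = flip-≢ (col (f s)) (trans (cong col (does-true (f s ≟ a) p)) (sym eq))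

hairy-chromatic : ∀ {m t ρ c} (F : Graph m) (f : Fin t → Fin m) → IsChromatic F (3 + ρ) → IsChromatic (hairy F t f) c → c ≡ 3 + ρ
hairy-chromatic {ρ = ρ} {c} F f (colF , minF) (colH , minH) = ≤-antisym
  (≮⇒≥ (λ lt → minH (3 + ρ) lt (hairy-colourable F f colF)))
  (≮⇒≥ (λ lt → hairy-uncolourable F f (minF c lt) colH))

pendant-hairy : ∀ {m t} (F : Graph m) (f : Fin t → Fin m) → 1 ≤ t → Pendant (hairy F t f)
pendant-hairy {m} {suc t} F f _ = record { stem = f zero ↑ˡ suc t ; leaf = m ↑ʳ zero ; attached = hairy-attached F f zero ; only = only }
  where
  only : ∀ w → adj (hairy F (suc t) f) (m ↑ʳ zero) w ≡ true → w ≡ f zero ↑ˡ suc t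
  only w p with splitAt m w in eq
  ... | inj₁ a = sym (trans (cong (_↑ˡ suc t) (does-true (f zero ≟ a) (trans (cong (λ z → hairyAdj F f z (inj₁ a)) (sym (splitAt-↑ʳ m (suc t) zero))) p))) (splitAt⁻¹-↑ˡ eq))
  ... | inj₂ s = contradiction (trans (sym p) (cong (λ z → hairyAdj F f z (inj₂ s)) (splitAt-↑ʳ m (suc t) zero))) λ ()

-- Large minimisers are Turán on one of the two sides

exact-ev : ∀ {m₁ m₂} (F₁ : Graph m₁) (F₂ : Graph m₂) ρ₁ r₂ Q → Critical F₁ ρ₁ →
  Ev F₁ F₂ (2 + ρ₁) r₂ Q (λ p e → Partite e (2 + ρ₁) → TuranRel e (1 + ρ₁))
exact-ev {m₁} {m₂} F₁ F₂ ρ₁ r₂ Q cr = 1 , λ p _ t₂≥1 _ →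
  let open Pair p
      h₁ = m₁ + t₁
      h₂ = m₂ + t₂
      k₁ = 2 * (h₁ * h₁)
      k₂ = 2 * (2 + ρ₁)
      k₃ = h₂ * (h₂ * (h₂ * (h₂ * (2 * (2 + ρ₁)) ^ h₂)))
      k₄ = h₂ * h₂ * (2 * (2 + ρ₁)) ^ h₂
  in suc (k₁ + (k₂ + (k₃ + k₄))) , λ n n≥ e e-sym min (part , proper) →
    Exact.turan (hairy F₁ t₁ f₁) (hairy F₂ t₂ f₂) (r₂ ^ a₁) ((2 + ρ₁) ^ a₂) (1 + ρ₁) (^-pos (2 + ρ₁) a₂ (s≤s z≤n)) (pendant-hairy F₂ f₂ t₂≥1)
      (hairy-uncolourable F₁ f₁ (Critical.uncolourable cr)) e e-sym min (≤-trans (s≤s z≤n) n≥)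
      (≤-trans (m≤m+n k₁ _) (<⇒≤ n≥)) (≤-trans (≤-trans (m≤m+n k₂ _) (m≤n+m _ k₁)) (<⇒≤ n≥))
      (≤-trans (s≤s (≤-trans (m≤m+n k₃ k₄) (≤-trans (m≤n+m _ k₂) (m≤n+m _ k₁)))) n≥)
      (≤-trans (s≤s (≤-trans (m≤n+m k₄ k₃) (≤-trans (m≤n+m _ k₂) (m≤n+m _ k₁)))) n≥)
      part proper

turan-ev : ∀ {m₁ m₂} (F₁ : Graph m₁) (F₂ : Graph m₂) ρ₁ ρ₂ Q → 1 ≤ Q → Critical F₁ ρ₁ → Critical F₂ ρ₂ →
  suc (2 + ρ₁ + (2 + ρ₂)) ≤ (2 + ρ₁) * (2 + ρ₂) →
  Ev F₁ F₂ (2 + ρ₁) (2 + ρ₂) Q (λ p e → TuranRel e (1 + ρ₁) ⊎ TuranRel (neg e) (1 + ρ₂))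
turan-ev F₁ F₂ ρ₁ ρ₂ Q Q≥1 cr₁ cr₂ rr = ev-map′ {P = λ p e → A₀ p e × (A₁ p e × A₂ p e)} {R = λ p e → TuranRel e (1 + ρ₁) ⊎ TuranRel (neg e) (1 + ρ₂)}
    (λ { p e _ _ (near , ((np₁ , ex₁) , (np₂ , ex₂))) → conclude p e near np₁ ex₁ np₂ ex₂ })
    (ev-× {P = A₀} {R = λ p e → A₁ p e × A₂ p e} (coarse F₁ F₂ ρ₁ ρ₂ Q cr₁ cr₂ rr δ) (ev-× {P = A₁} {R = A₂} one two))
  where
  rr′ : suc (2 + ρ₂ + (2 + ρ₁)) ≤ (2 + ρ₂) * (2 + ρ₁)
  rr′ = ≤-trans (≤-reflexive (cong suc (+-comm (2 + ρ₂) (2 + ρ₁)))) (≤-trans rr (≤-reflexive (*-comm (2 + ρ₁) (2 + ρ₂))))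
  δ₁ δ₂ δ : ℕ
  δ₁ = NearPartite.δ₀ F₁ F₂ ρ₁ ρ₂ Q Q≥1 cr₁ cr₂ rr
  δ₂ = NearPartite.δ₀ F₂ F₁ ρ₂ ρ₁ Q Q≥1 cr₂ cr₁ rr′
  -- A single closeness for `coarse` that is strict enough whichever side turns out to be close to a
  -- Turán relation.
  δ = δ₁ + δ₂
  A₀ A₁ A₂ : Pred F₁ F₂
  A₀ p e = NearTuran e (2 + ρ₁) δ ⊎ NearTuran (neg e) (2 + ρ₂) δ
  A₁ p e = (NearTuran e (2 + ρ₁) δ → Partite e (2 + ρ₁)) × (Partite e (2 + ρ₁) → TuranRel e (1 + ρ₁))
  A₂ p e = (NearTuran (neg e) (2 + ρ₂) δ → Partite (neg e) (2 + ρ₂)) × (Partite (neg e) (2 + ρ₂) → TuranRel (neg e) (1 + ρ₂))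
  one : Ev F₁ F₂ (2 + ρ₁) (2 + ρ₂) Q A₁
  one = ev-× {P = λ p e → NearTuran e (2 + ρ₁) δ → Partite e (2 + ρ₁)} {R = λ p e → Partite e (2 + ρ₁) → TuranRel e (1 + ρ₁)}
    (NearPartite.near⇒partite F₁ F₂ ρ₁ ρ₂ Q Q≥1 cr₁ cr₂ rr δ (m≤m+n δ₁ δ₂)) (exact-ev F₁ F₂ ρ₁ (2 + ρ₂) Q cr₁)
  two : Ev F₁ F₂ (2 + ρ₁) (2 + ρ₂) Q A₂
  two = ev-swap {P = λ p e → (NearTuran e (2 + ρ₂) δ → Partite e (2 + ρ₂)) × (Partite e (2 + ρ₂) → TuranRel e (1 + ρ₂))}
    (ev-× {P = λ p e → NearTuran e (2 + ρ₂) δ → Partite e (2 + ρ₂)} {R = λ p e → Partite e (2 + ρ₂) → TuranRel e (1 + ρ₂)}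
      (NearPartite.near⇒partite F₂ F₁ ρ₂ ρ₁ Q Q≥1 cr₂ cr₁ rr′ δ (m≤n+m δ₂ δ₁)) (exact-ev F₂ F₁ ρ₂ (2 + ρ₁) Q cr₂))
  conclude : ∀ p {n} (e : Rel n) → A₀ p e → (NearTuran e (2 + ρ₁) δ → Partite e (2 + ρ₁)) → (Partite e (2 + ρ₁) → TuranRel e (1 + ρ₁)) →
    (NearTuran (neg e) (2 + ρ₂) δ → Partite (neg e) (2 + ρ₂)) → (Partite (neg e) (2 + ρ₂) → TuranRel (neg e) (1 + ρ₂)) → TuranRel e (1 + ρ₁) ⊎ TuranRel (neg e) (1 + ρ₂)
  conclude p e (inj₁ nt) np₁ ex₁ _ _ = inj₁ (ex₁ (np₁ nt))
  conclude p e (inj₂ nt) _ _ np₂ ex₂ = inj₂ (ex₂ (np₂ nt))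

-- Back to graphs

fromRel : ∀ {n} (e : Rel n) → Symm e → Graph n
fromRel e e-sym = record
  { adj = λ i j → e i j ∧ not (i == j)
  ; adjSym = λ i j → cong₂ (λ a b → a ∧ not b) (e-sym i j) (==-sym i j)
  ; adjIrr = λ i → trans (cong (λ b → e i i ∧ not b) (==-refl i)) (Bool.∧-zeroʳ (e i i)) }

fromRel-≢ : ∀ {n} (e : Rel n) (s : Symm e) x y → x ≢ y → adj (fromRel e s) x y ≡ e x y
fromRel-≢ e s x y p = trans (cong (λ b → e x y ∧ not b) (dec-false (x ≟ y) p)) (Bool.∧-identityʳ (e x y))

complement-≢ : ∀ {n} (G : Graph n) x y → x ≢ y → adj (complement G) x y ≡ neg (adj G) x y
complement-≢ G x y p = trans (cong (λ b → not (adj G x y) ∧ not b) (dec-false (x ≟ y) p)) (Bool.∧-identityʳ (not (adj G x y)))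

module _ {h₁ h₂ n} (H₁ : Graph h₁) (H₂ : Graph h₂) (c₁ c₂ : ℕ) (P₁≥1 : 1 ≤ #inj h₁ n) (P₂≥1 : 1 ≤ #inj h₂ n) where
  private
    a b d₁ d₂ : ℕ
    a = (c₂ ∸ 1) ^ (h₁ ∸ components H₁)
    b = (c₁ ∸ 1) ^ (h₂ ∸ components H₂)
    d₁ = #inj h₁ n ∸ 1
    d₂ = #inj h₂ n ∸ 1
    e₁ : #inj h₁ n ≡ suc d₁
    e₁ = sym (m+[n∸m]≡n P₁≥1)
    e₂ : #inj h₂ n ≡ suc d₂
    e₂ = sym (m+[n∸m]≡n P₂≥1)

  objective-value : ∀ (G : Graph n) → objective H₁ H₂ c₁ c₂ G ≡
    ℕtoℚ a ℚ.* frac (#injhom H₁ (adj G)) (suc d₁) ℚ.+ ℕtoℚ b ℚ.* frac (#injhom H₂ (neg (adj G))) (suc d₂)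
  objective-value G = cong₂ ℚ._+_ (cong (ℕtoℚ a ℚ.*_) (cong₂ frac (#injhom-count H₁ G) (trans (#inj-count h₁ n) e₁)))
    (cong (ℕtoℚ b ℚ.*_) (cong₂ frac (trans (#injhom-count H₂ (complement G)) (#injhom-cong≢ H₂ (complement-≢ G))) (trans (#inj-count h₂ n) e₂)))

  -- A competing relation is made a graph by removing its diagonal, which no injective homomorphism
  -- of a loopless graph sees. Multiplying by both numbers of injections clears the denominators.
  minimal-rel : ∀ (G : Graph n) → (∀ G′ → objective H₁ H₂ c₁ c₂ G ℚ.≤ objective H₁ H₂ c₁ c₂ G′) → Minimal (objective′ H₁ H₂ a b) (adj G)
  minimal-rel G min e′ s′ = ≤-trans (≤-reflexive (shape (#injhom H₁ (adj G)) (#injhom H₂ (neg (adj G)))))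
    (≤-trans (objective-≤ a b (#injhom H₁ (adj G)) (#injhom H₂ (neg (adj G))) (#injhom H₁ (adj G′)) (#injhom H₂ (neg (adj G′))) d₁ d₂ (subst₂ ℚ._≤_ (objective-value G) (objective-value G′) (min G′)))
    (≤-reflexive (trans (sym (shape (#injhom H₁ (adj G′)) (#injhom H₂ (neg (adj G′))))) (cong₂ (λ p q → a * #inj h₂ n * p + b * #inj h₁ n * q)
      (#injhom-cong≢ H₁ (fromRel-≢ e′ s′)) (#injhom-cong≢ H₂ (λ x y p → cong not (fromRel-≢ e′ s′ x y p)))))))
    where
    G′ = fromRel e′ s′
    l : ∀ a p i → a * p * i ≡ a * i * p
    l = solve-∀
    shape : ∀ i k → a * #inj h₂ n * i + b * #inj h₁ n * k ≡ a * i * suc d₂ + b * k * suc d₁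
    shape i k = cong₂ _+_ (trans (l a (#inj h₂ n) i) (cong (a * i *_) e₂)) (trans (l b (#inj h₁ n) k) (cong (b * k *_) e₁))

turan-graph : ∀ {n} (G : Graph n) (e : Rel n) ρ → (∀ x y → x ≢ y → adj G x y ≡ e x y) → TuranRel e ρ → IsTuran (suc ρ) G
turan-graph G e ρ eq (part , proper , complete , sizes) = part , (λ i j a → proper i j (i≢j a) (trans (sym (eq i j (i≢j a))) a)) ,
    (λ i j p q → trans (eq i j p) (complete i j p q)) , λ a → subst (λ z → z ≡ _ ⊎ z ≡ _) (sym (countB-F (λ i → part i == a))) (sizes a)
  where
  i≢j : ∀ {i j} → adj G i j ≡ true → i ≢ j
  i≢j a refl = contradiction (trans (sym a) (adjIrr G _)) λ ()

module _ {m₁ m₂} (F₁ : Graph m₁) (F₂ : Graph m₂) (ρ₁ ρ₂ Q : ℕ) (cr₁ : Critical F₁ ρ₁) (cr₂ : Critical F₂ ρ₂)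
  (ch₁ : IsChromatic F₁ (3 + ρ₁)) (ch₂ : IsChromatic F₂ (3 + ρ₂))
  (ev : Ev F₁ F₂ (2 + ρ₁) (2 + ρ₂) Q (λ p e → TuranRel e (1 + ρ₁) ⊎ TuranRel (neg e) (1 + ρ₂))) where

  bonbon : ∀ t₁ t₂ → proj₁ ev ≤ t₁ → proj₁ ev ≤ t₂ → ∀ (f₁ : Fin t₁ → Fin m₁) (f₂ : Fin t₂ → Fin m₂) →
    (m₁ + t₁) ⊔ (m₂ + t₂) ≤ Q * ((m₁ + t₁) ⊓ (m₂ + t₂)) → IsBonbonPair (hairy F₁ t₁ f₁) (hairy F₂ t₂ f₂)
  bonbon t₁ t₂ t₁≥ t₂≥ f₁ f₂ max≤ = edge F₁ f₁ cr₁ , edge F₂ f₂ cr₂ , λ c₁ c₂ ich₁ ich₂ →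
      subst₂ Conclusion (sym (hairy-chromatic F₁ f₁ ch₁ ich₁)) (sym (hairy-chromatic F₂ f₂ ch₂ ich₂)) conclusion
    where
    h₁ h₂ : ℕ
    h₁ = m₁ + t₁
    h₂ = m₂ + t₂
    H₁ = hairy F₁ t₁ f₁
    H₂ = hairy F₂ t₂ f₂
    edge : ∀ {m t ρ} (F : Graph m) (f : Fin t → Fin m) → Critical F ρ → HasEdge (hairy F t f)
    edge {m} {t} F f cr = Critical.u cr ↑ˡ t , Critical.v cr ↑ˡ t , trans (cong₂ (hairyAdj F f) (splitAt-↑ˡ m _ t) (splitAt-↑ˡ m _ t)) (Critical.edge cr)
    Conclusion : ℕ → ℕ → Set
    Conclusion c₁ c₂ = Σ ℕ λ n₀ → ∀ n → n₀ ≤ n → ∀ (G : Graph n) → (∀ G′ → objective H₁ H₂ c₁ c₂ G ℚ.≤ objective H₁ H₂ c₁ c₂ G′) →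
      IsTuran (c₁ ∸ 1) G ⊎ IsTuran (c₂ ∸ 1) (complement G)
    exponent : ∀ {m t} (F : Graph m) (f : Fin t → Fin m) → t ≤ m + t ∸ components (hairy F t f)
    exponent {m} {t} F f = ≤-trans (≤-reflexive (sym (m+n∸m≡n m t))) (∸-monoʳ-≤ (m + t) (components-hairy F f))
    p : Pair F₁ F₂
    p = record { t₁ = t₁ ; t₂ = t₂ ; f₁ = f₁ ; f₂ = f₂ ; a₁ = h₁ ∸ components H₁ ; a₂ = h₂ ∸ components H₂
               ; t₁≤a₁ = exponent F₁ f₁ ; a₁≤ = m∸n≤m h₁ (components H₁) ; t₂≤a₂ = exponent F₂ f₂ ; a₂≤ = m∸n≤m h₂ (components H₂) }
    cmp : Comparable Q p
    cmp = comparable (≤-trans (m≤n⊔m h₁ h₂) (≤-trans max≤ (mulˡ Q (m⊓n≤m h₁ h₂)))) (≤-trans (m≤m⊔n h₁ h₂) (≤-trans max≤ (mulˡ Q (m⊓n≤n h₁ h₂))))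
    n₁ : ℕ
    n₁ = proj₁ (proj₂ ev p t₁≥ t₂≥ cmp)
    conclusion : Conclusion (3 + ρ₁) (3 + ρ₂)
    conclusion = suc (n₁ + (2 * (h₁ * h₁) + 2 * (h₂ * h₂))) , λ n n≥ G min →
      let n≥1 = ≤-trans (s≤s z≤n) n≥
          P₁≥1 = 1≤*ʳ {2} (≤-trans (^-pos n h₁ n≥1) (#inj-large h₁ n (≤-trans (≤-trans (m≤m+n (2 * (h₁ * h₁)) _) (m≤n+m _ n₁)) (<⇒≤ n≥)) n≥1))
          P₂≥1 = 1≤*ʳ {2} (≤-trans (^-pos n h₂ n≥1) (#inj-large h₂ n (≤-trans (≤-trans (m≤n+m (2 * (h₂ * h₂)) (2 * (h₁ * h₁))) (m≤n+m _ n₁)) (<⇒≤ n≥)) n≥1))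
      in convert G (proj₂ (proj₂ ev p t₁≥ t₂≥ cmp) n (≤-trans (m≤m+n n₁ _) (<⇒≤ n≥)) (adj G) (adjSym G) (minimal-rel H₁ H₂ (3 + ρ₁) (3 + ρ₂) P₁≥1 P₂≥1 G min))
      where
      convert : ∀ {n} (G : Graph n) → TuranRel (adj G) (1 + ρ₁) ⊎ TuranRel (neg (adj G)) (1 + ρ₂) → IsTuran (2 + ρ₁) G ⊎ IsTuran (2 + ρ₂) (complement G)
      convert G (inj₁ tr) = inj₁ (turan-graph G (adj G) (1 + ρ₁) (λ _ _ _ → refl) tr)
      convert G (inj₂ tr) = inj₂ (turan-graph (complement G) (neg (adj G)) (1 + ρ₂) (complement-≢ G) tr)

-- The conclusion is (1 + ρ₁)(1 + ρ₂) ≥ 2, which fails only for two 3-chromatic graphs; this is the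
-- case that the bound 7 excludes.
rr-bound : ∀ ρ₁ ρ₂ → 7 ≤ 3 + ρ₁ + (3 + ρ₂) → suc (2 + ρ₁ + (2 + ρ₂)) ≤ (2 + ρ₁) * (2 + ρ₂)
rr-bound ρ₁ ρ₂ seven = linear (ρ₁ * ρ₂) seven (l ρ₁ ρ₂)
  where l : ∀ a b → (2 + a) * (2 + b) + 7 ≡ suc (2 + a + (2 + b)) + (3 + a + (3 + b)) + a * b
        l = solve-∀

bonbon-threshold : ∀ {m₁ m₂} (F₁ : Graph m₁) (F₂ : Graph m₂) →
  (∃ λ ρ → Critical F₁ ρ × IsChromatic F₁ (3 + ρ)) → (∃ λ ρ → Critical F₂ ρ × IsChromatic F₂ (3 + ρ)) →
  (∀ c₁ c₂ → IsChromatic F₁ c₁ → IsChromatic F₂ c₂ → 7 ≤ c₁ + c₂) → ∀ Q → 1 ≤ Q →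
  ∃ λ t₀ → ∀ t₁ t₂ → t₀ ≤ t₁ → t₀ ≤ t₂ → ∀ (f₁ : Fin t₁ → Fin m₁) (f₂ : Fin t₂ → Fin m₂) →
  (m₁ + t₁) ⊔ (m₂ + t₂) ≤ Q * ((m₁ + t₁) ⊓ (m₂ + t₂)) → IsBonbonPair (hairy F₁ t₁ f₁) (hairy F₂ t₂ f₂)
bonbon-threshold F₁ F₂ (ρ₁ , cr₁ , ch₁) (ρ₂ , cr₂ , ch₂) seven Q Q≥1 = proj₁ ev , bonbon F₁ F₂ ρ₁ ρ₂ Q cr₁ cr₂ ch₁ ch₂ ev
  where
  ev : Ev F₁ F₂ (2 + ρ₁) (2 + ρ₂) Q (λ p e → TuranRel e (1 + ρ₁) ⊎ TuranRel (neg e) (1 + ρ₂))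
  ev = turan-ev F₁ F₂ ρ₁ ρ₂ Q Q≥1 cr₁ cr₂ (rr-bound ρ₁ ρ₂ (seven (3 + ρ₁) (3 + ρ₂) ch₁ ch₂))

theorem1p2 : (q : ℚ) → 0ℚ ℚ.< q → q ℚ.≤ 1ℚ →
    ∀ {m₁ m₂} (F₁ : Graph m₁) (F₂ : Graph m₂) →
    ¬ Bipartite F₁ → ¬ Bipartite F₂ →
    HasCriticalEdge F₁ → HasCriticalEdge F₂ →
    (∀ c₁ c₂ → IsChromatic F₁ c₁ → IsChromatic F₂ c₂ → 7 ≤ c₁ + c₂) →
    Σ ℕ λ t₀ → ∀ t₁ t₂ → t₀ ≤ t₁ → t₀ ≤ t₂ →
    ∀ (f₁ : Fin t₁ → Fin m₁) (f₂ : Fin t₂ → Fin m₂) →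
    q ℚ.* ℕtoℚ ((m₁ + t₁) ⊔ (m₂ + t₂)) ℚ.≤ ℕtoℚ ((m₁ + t₁) ⊓ (m₂ + t₂)) →
    IsBonbonPair (hairy F₁ t₁ f₁) (hairy F₂ t₂ f₂)
theorem1p2 q 0<q q≤1 F₁ F₂ nb₁ nb₂ hc₁ hc₂ seven =
  proj₁ threshold , λ t₁ t₂ t₁≥ t₂≥ f₁ f₂ q≤ → proj₂ threshold t₁ t₂ t₁≥ t₂≥ f₁ f₂ (proj₂ (proj₂ (ratio-≤ q 0<q)) _ _ q≤)
  where
  threshold = bonbon-threshold F₁ F₂ (critical F₁ nb₁ hc₁) (critical F₂ nb₂ hc₂) seven (proj₁ (ratio-≤ q 0<q)) (proj₁ (proj₂ (ratio-≤ q 0<q)))
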